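{- Let $\mathrm{val}(w)$ denote the smallest integer $k$ for which there exists an on-line chain partitioning algorithm that partitions every poset of width $w$ into at most $k$ chains. Then $\mathrm{val}(w) \le w^{O(\log\log w)}$; that is, there is an on-line algorithm that partitions posets of width $w$ into at most $w^{O(\log\log w)}$ chains.
   Context: An on-line chain partitioning algorithm receives the elements $x_1,\dots,x_n$ of a finite poset $(P,\le)$ one at a time and, when $x_i$ is received, irrevocably assigns it to a chain; the chain to which $x_i$ is assigned may depend only on the subposet induced by $\{x_1,\dots,x_i\}$ and on the chains to which $x_1,\dots,x_{i-1}$ were assigned. The resulting sets must be chains (sets of pairwise comparable elements) partitioning $P$. The width of a poset is the maximum size of an antichain. The asymptotic notation refers to $w\to\infty$. -}

module Defs where

open import Data.Bool.Base using (Bool; T)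
open import Data.Fin.Base using (Fin; suc)
open import Data.Fin.Properties using (suc-injective)
open import Data.Fin.Subset using (Subset; _∈_; ∣_∣)
open import Data.List.Base using (length; deduplicate)
open import Data.Nat.Base using (ℕ; zero; suc; _≤_)
open import Data.Nat.Properties using (_≟_)
open import Data.Product.Base using (∃-syntax; _×_)
open import Data.Sum.Base using (_⊎_)
open import Data.Vec.Base using (Vec; []; _∷_; lookup; toList)
open import Level using (0ℓ)
open import Relation.Binary.PropositionalEquality using (_≡_; cong; isEquivalence)
open import Relation.Binary.Structures using (IsPartialOrder)
open import Relation.Unary using (Pred)

-- A finite poset together with a presentation order x₁,…,xₙ of its elements.
-- Elements are indexed newest first: x_n is `zero`, x_{n-1} is `suc zero`, and so on.
-- The order is Boolean-valued so that an algorithm can inspect it.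
record FinPoset (n : ℕ) : Set where
  field
    leq : Fin n → Fin n → Bool

  _⊑_ : Fin n → Fin n → Set
  x ⊑ y = T (leq x y)

  field
    isPartialOrder : IsPartialOrder _≡_ _⊑_

-- The subposet induced by all elements except the newest one.
earlier : ∀ {n} → FinPoset (suc n) → FinPoset n
earlier P = record
  { leq = λ x y → leq (suc x) (suc y)
  ; isPartialOrder = record
    { isPreorder = record
      { isEquivalence = isEquivalence
      ; reflexive     = λ x≡y → O.reflexive (cong suc x≡y)
      ; trans         = O.trans
      }
    ; antisym = λ x⊑y y⊑x → suc-injective (O.antisym x⊑y y⊑x)
    }
  }
  where
  open FinPoset P
  module O = IsPartialOrder isPartialOrder

module _ {n} (P : FinPoset n) where
  open FinPoset P

  IsChain : Pred (Pred (Fin n) 0ℓ) 0ℓ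
  IsChain S = ∀ x y → S x → S y → x ⊑ y ⊎ y ⊑ x

  IsAntichain : Pred (Subset n) 0ℓ
  IsAntichain S = ∀ x y → x ∈ S → y ∈ S → x ⊑ y → x ≡ y

  HasWidth : Pred ℕ 0ℓ
  HasWidth w = (∃[ S ] (IsAntichain S × ∣ S ∣ ≡ w))
             × (∀ S → IsAntichain S → ∣ S ∣ ≤ w)

-- An on-line rule names (by a natural number) the class of the newest element, given
-- the poset presented so far and the names of the classes of the earlier elements.
OnlineRule : Set
OnlineRule = ∀ {n} → FinPoset (suc n) → Vec ℕ n → ℕ

run : OnlineRule → ∀ {n} → FinPoset n → Vec ℕ n
run r {zero}  P = []
run r {suc n} P = r P classes ∷ classes
  where classes = run r (earlier P)

record OnlineChainPartitioning : Set where
  field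
    rule   : OnlineRule
    chains : ∀ {n} (P : FinPoset n) (a : ℕ) →
             IsChain P (λ x → lookup (run rule P) x ≡ a)

  chainCount : ∀ {n} → FinPoset n → ℕ
  chainCount P = length (deduplicate _≟_ (toList (run rule P)))

open OnlineChainPartitioning public using (chainCount)

PartitionsInto : ℕ → ℕ → OnlineChainPartitioning → Set
PartitionsInto w k A = ∀ {n} (P : FinPoset n) → HasWidth P w → chainCount A P ≤ k

-- A relation, since there is no evident constructive function computing val(w) = k.
IsVal : ℕ → ℕ → Set
IsVal w k = (∃[ A ] PartitionsInto w k A)
          × (∀ j → (∃[ A ] PartitionsInto w j A) → k ≤ j)

module Submission where

open import Data.Bool.Base using (Bool; true; false; T; not; if_then_else_) renaming (_∧_ to _&&_; _∨_ to _||_)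
open import Data.Bool.Properties using (T?; T-∧)
open import Data.Empty using (⊥; ⊥-elim)
open import Data.Fin.Base as Fin using (Fin; zero; suc; toℕ; fromℕ<)
import Data.Fin.Properties as Fin
open import Data.Fin.Permutation as Perm using (Permutation′; permutation; _⟨$⟩ʳ_; _⟨$⟩ˡ_; _∘ₚ_; inverseˡ; inverseʳ; flip; transpose)
open import Data.Fin.Subset as Sub using (Subset; inside; outside; ∣_∣)
import Data.Fin.Subset.Properties as Sub
open import Data.List.Base as List using (List; []; _∷_; _++_; map; length; filter; allFin; deduplicate; tabulate)
open import Data.List.Properties using (filter-≐; length-map; length-tabulate; map-∘; map-cong; length-++)
open import Data.List.Membership.Propositional using (_∈_; _∉_; find; lose)
open import Data.List.Membership.Propositional.Properties
  using (∈-filter⁺; ∈-filter⁻; ∈-map⁺; ∈-map⁻; ∈-++⁺ˡ; ∈-++⁺ʳ; ∈-++⁻; ∈-allFin; ∈-deduplicate⁻; ∈-tabulate⁺; ∈-tabulate⁻; ∈-lookup)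
open import Data.List.Relation.Unary.All as All using (All; []; _∷_)
import Data.List.Relation.Unary.All.Properties as All
open import Data.List.Relation.Unary.AllPairs as AllPairs using (AllPairs; []; _∷_)
import Data.List.Relation.Unary.AllPairs.Properties as AllPairs
open import Data.List.Relation.Unary.Any as Any using (Any; here; there)
import Data.List.Relation.Unary.Any.Properties as Any
open import Data.List.Relation.Unary.Unique.Propositional using (Unique)
import Data.List.Relation.Unary.Unique.Propositional.Properties as Unique
open import Data.Maybe.Base using (Maybe; just; nothing)
open import Data.Nat.Base using (zero; suc; _+_; _<_; z≤n; s≤s; _∸_; ⌊_/2⌋; pred; NonZero; >-nonZero)
open import Data.Nat using (ℕ; _≤_; _≥_; _*_; _^_)
import Data.Nat.Properties as ℕ
open import Data.List.Relation.Unary.Unique.DecPropositional.Properties ℕ._≟_ using (deduplicate-!)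
open import Data.Nat.Tactic.RingSolver using (solve-∀)
open import Data.Nat.ListAction using (sum)
open import Data.Nat.Logarithm using (⌊log₂_⌋; ⌊log₂⌋-mono-≤; ⌊log₂⌊n/2⌋⌋≡⌊log₂n⌋∸1; ⌊log₂[2^n]⌋≡n)
open import Data.Product using (Σ; ∃; ∃-syntax; Σ-syntax; _×_; _,_; proj₁; proj₂)
open import Data.Product.Properties using (≡-dec)
open import Data.Sum.Base using (_⊎_; inj₁; inj₂; [_,_]′)
open import Data.Unit.Base using (⊤; tt)
open import Data.Vec.Base as Vec using (Vec; []; _∷_)
import Data.Vec.Properties as Vec
open import Data.Vec.Relation.Binary.Pointwise.Inductive using (Pointwise; []; _∷_)
open import Function.Base using (_∘_; id; case_of_)
open import Level using (0ℓ)
open import Relation.Binary.Definitions using (DecidableEquality; tri<; tri≈; tri>)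
open import Relation.Binary.Structures using (IsPartialOrder)
open import Relation.Binary.PropositionalEquality
  using (_≡_; _≢_; refl; sym; trans; cong; cong₂; subst; subst₂; module ≡-Reasoning)
open import Relation.Nullary using (¬_; Dec; yes; no; does; contradiction)
open import Relation.Nullary.Decidable using (_×-dec_; _⊎-dec_; _→-dec_; ¬?; map′; decidable-stable)
open import Relation.Unary using (Pred; Decidable)
open import Defs

-- Pigeonhole principles and greedy extraction

private variable
  A B : Set

filter-split : {P : A → Set} (P? : ∀ x → Dec (P x)) (xs : List A) →
  length xs ≡ length (filter P? xs) + length (filter (λ x → ¬? (P? x)) xs)
filter-split P? [] = refl
filter-split P? (x ∷ xs) with P? x
... | yes _ = cong suc (filter-split P? xs)
... | no  _ = trans (cong suc (filter-split P? xs)) (sym (ℕ.+-suc _ _))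

fiber : ∀ {k} (f : A → Fin k) → Fin k → List A → List A
fiber f y = filter (λ x → f x Fin.≟ y)

private
  ∑ : ∀ {k} → (Fin k → ℕ) → ℕ
  ∑ g = sum (tabulate g)

  ∑-zero : ∀ k → ∑ {k} (λ _ → 0) ≡ 0
  ∑-zero zero = refl
  ∑-zero (suc k) = ∑-zero k

  ∑-cong : ∀ {k} {g h : Fin k → ℕ} → (∀ j → g j ≡ h j) → ∑ g ≡ ∑ h
  ∑-cong {zero} e = refl
  ∑-cong {suc k} e = cong₂ _+_ (e zero) (∑-cong (e ∘ suc))

  ∑-suc : ∀ {k} (g h : Fin k → ℕ) i → h i ≡ suc (g i) → (∀ j → j ≢ i → h j ≡ g j) → suc (∑ g) ≡ ∑ h
  ∑-suc g h zero p q = cong₂ _+_ (sym p) (∑-cong (λ j → sym (q (suc j) (λ ()))))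
  ∑-suc g h (suc i) p q = trans (sym (ℕ.+-suc _ _))
    (cong₂ _+_ (sym (q zero (λ ()))) (∑-suc (g ∘ suc) (h ∘ suc) i p (λ j ne → q (suc j) (ne ∘ Fin.suc-injective))))

  ∑-bound : ∀ {k} (g : Fin k → ℕ) n → (∀ y → g y ≤ n) → ∑ g ≤ k * n
  ∑-bound {zero} g n s = z≤n
  ∑-bound {suc k} g n s = ℕ.+-mono-≤ (s zero) (∑-bound (g ∘ suc) n (s ∘ suc))

∑-fibers : ∀ {k} (f : A → Fin k) xs → length xs ≡ ∑ (λ y → length (fiber f y xs))
∑-fibers {k = k} f [] = sym (∑-zero k)
∑-fibers f (x ∷ xs) = trans (cong suc (∑-fibers f xs)) (∑-suc _ _ (f x) hit miss)
  where
  hit : length (fiber f (f x) (x ∷ xs)) ≡ suc (length (fiber f (f x) xs))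
  hit with f x Fin.≟ f x
  ... | yes _ = refl
  ... | no ne = ⊥-elim (ne refl)
  miss : ∀ y → y ≢ f x → length (fiber f y (x ∷ xs)) ≡ length (fiber f y xs)
  miss y ne with f x Fin.≟ y
  ... | yes e = ⊥-elim (ne (sym e))
  ... | no _ = refl

large-fiber : ∀ {k} (f : A → Fin k) n xs → suc n * suc k ≤ length xs →
  ∃[ y ] suc n ≤ length (fiber f y xs)
large-fiber {k = k} f n xs le with Fin.any? (λ y → suc n ℕ.≤? length (fiber f y xs))
... | yes r = r
... | no ¬r = ⊥-elim (ℕ.<-irrefl refl (begin-strict
    length xs    ≡⟨ ∑-fibers f xs ⟩
    ∑ (λ y → length (fiber f y xs)) ≤⟨ ∑-bound (λ y → length (fiber f y xs)) n (λ y → ℕ.≤-pred (ℕ.≰⇒> (λ l → ¬r (y , l)))) ⟩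
    k * n        ≡⟨ ℕ.*-comm k n ⟩
    n * k        ≤⟨ ℕ.*-monoʳ-≤ n (ℕ.n≤1+n k) ⟩
    n * suc k    <⟨ ℕ.m<n+m _ (s≤s z≤n) ⟩
    suc n * suc k ≤⟨ le ⟩
    length xs    ∎))
  where open ℕ.≤-Reasoning

opaque
  large-fiber′ : ∀ {k} (f : A → Fin k) n xs → 1 ≤ n → n * suc k ≤ length xs → ∃[ y ] n ≤ length (fiber f y xs)
  large-fiber′ f (suc n) xs _ = large-fiber f n xs

InjOn : (A → B) → List A → Set
InjOn f xs = ∀ {x y} → x ∈ xs → y ∈ xs → f x ≡ f y → x ≡ y

remove-∈ : {x : A} {xs : List A} → x ∈ xs →
  ∃[ ys ] length xs ≡ suc (length ys) × (∀ {y} → y ≢ x → y ∈ xs → y ∈ ys)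
remove-∈ {xs = _ ∷ xs} (here refl) = xs , refl , λ { ne (here e) → ⊥-elim (ne e) ; ne (there m) → m }
remove-∈ {xs = z ∷ xs} (there m) with ys , e , h ← remove-∈ m =
  z ∷ ys , cong suc e , λ { ne (here e) → here e ; ne (there m) → there (h ne m) }

inj-length : (f : A → B) {xs : List A} (ys : List B) → Unique xs → InjOn f xs →
  (∀ {x} → x ∈ xs → f x ∈ ys) → length xs ≤ length ys
inj-length f {[]} ys u i h = z≤n
inj-length f {x ∷ xs} ys (px ∷ u) i h with zs , e , k ← remove-∈ (h (here refl)) =
  subst (suc (length xs) ≤_) (sym e) (s≤s (inj-length f zs u (λ a b → i (there a) (there b))
    (λ m → k (λ q → All.lookup px m (sym (i (there m) (here refl) q))) (h (there m)))))

inj-Fin : ∀ {k} (f : A → Fin k) {xs : List A} → Unique xs → InjOn f xs → length xs ≤ k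
inj-Fin {k = k} f u i = subst (_ ≤_) (length-tabulate id) (inj-length f (allFin k) u i (λ _ → ∈-allFin _))

Unique-allFin : ∀ n → Unique (allFin n)
Unique-allFin n = Unique.allFin⁺ n

unique-constant : {x : A} (xs : List A) → Unique xs → All (x ≡_) xs → length xs ≤ 1
unique-constant [] u a = z≤n
unique-constant (_ ∷ []) u a = s≤s z≤n
unique-constant (_ ∷ _ ∷ _) ((ne ∷ _) ∷ _) (refl ∷ refl ∷ _) = ⊥-elim (ne refl)

Unique-map : {f : A → B} {xs : List A} → InjOn f xs → Unique xs → Unique (map f xs)
Unique-map {xs = []} i [] = []
Unique-map {xs = x ∷ xs} i (px ∷ u) =
  All.map⁺ (All.tabulate λ m e → All.lookup px m (i (here refl) (there m) e)) ∷ Unique-map (λ a b → i (there a) (there b)) u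

AllPairs⇒Unique : {R : A → A → Set} {xs : List A} → (∀ {x} → ¬ R x x) → AllPairs R xs → Unique xs
AllPairs⇒Unique irr = AllPairs.map (λ { r refl → irr r })

split-AllPairs : {R : A → A → Set} → ∀ n k (xs : List A) → n + suc k ≤ length xs → AllPairs R xs →
  ∃[ front ] ∃[ x ] ∃[ back ] length front ≡ n × k ≤ length back × All (λ y → R y x) front ×
    AllPairs R front × AllPairs R (x ∷ back) × (∀ {y} → y ∈ front → y ∈ xs) × (∀ {y} → y ∈ (x ∷ back) → y ∈ xs)
split-AllPairs zero k (x ∷ xs) (s≤s l) ps = [] , x , xs , refl , l , [] , [] , ps , (λ ()) , id
split-AllPairs (suc n) k (y ∷ xs) (s≤s l) (p ∷ ps) with f , x , b , e , l′ , a , pf , pb , sf , sb ← split-AllPairs n k xs l ps =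
  y ∷ f , x , b , cong suc e , l′ , All.lookup p (sb (here refl)) ∷ a , All.tabulate (λ m → All.lookup p (sf m)) ∷ pf , pb ,
  (λ { (here e) → here e ; (there m) → there (sf m) }) , there ∘ sb

AllPairs-lookup : {R : A → A → Set} {xs : List A} → AllPairs R xs →
  ∀ {x y} → x ∈ xs → y ∈ xs → x ≡ y ⊎ R x y ⊎ R y x
AllPairs-lookup (p ∷ ps) (here refl) (here refl) = inj₁ refl
AllPairs-lookup (p ∷ ps) (here refl) (there m) = inj₂ (inj₁ (All.lookup p m))
AllPairs-lookup (p ∷ ps) (there m) (here refl) = inj₂ (inj₂ (All.lookup p m))
AllPairs-lookup (p ∷ ps) (there m) (there m′) = AllPairs-lookup ps m m′

tabulate-AllPairs : {R : A → A → Set} (xs : List A) → Unique xs →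
  (∀ {x y} → x ∈ xs → y ∈ xs → x ≢ y → R x y) → AllPairs R xs
tabulate-AllPairs [] u h = []
tabulate-AllPairs (x ∷ xs) (px ∷ u) h =
  All.tabulate (λ m → h (here refl) (there m) (All.lookup px m)) ∷ tabulate-AllPairs xs u (λ a b → h (there a) (there b))

module _ (_⊑_ : A → A → Set) (_⊑?_ : ∀ x y → Dec (x ⊑ y))
  (⊑-refl : ∀ {x} → x ⊑ x) (⊑-trans : ∀ {x y z} → x ⊑ y → y ⊑ z → x ⊑ z) (⊑-total : ∀ x y → x ⊑ y ⊎ y ⊑ x) where

  least : ∀ x xs → ∃[ m ] m ∈ (x ∷ xs) × All (m ⊑_) (x ∷ xs)
  least x [] = x , here refl , ⊑-refl ∷ []
  least x (y ∷ ys) with m , m∈ , am ← least y ys with ⊑-total x m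
  ... | inj₁ x⊑m = x , here refl , ⊑-refl ∷ All.map (⊑-trans x⊑m) am
  ... | inj₂ m⊑x = m , there m∈ , m⊑x ∷ am

  -- Repeatedly pick a least element and discard everything that is bad for it.
  greedy-extract : (_≟_ : DecidableEquality A) (Bad : A → A → Set) (Bad? : ∀ x y → Dec (Bad x y)) (k : ℕ) (xs : List A) →
    (∀ {x} ys → x ∈ xs → Unique ys → (∀ {y} → y ∈ ys → y ∈ xs × x ⊑ y × Bad x y) → length ys ≤ k) →
    ∀ n → Unique xs → n * suc k ≤ length xs →
    ∃[ ys ] length ys ≡ n × (∀ {y} → y ∈ ys → y ∈ xs) × AllPairs (λ x y → x ≢ y × x ⊑ y × ¬ Bad x y) ys
  greedy-extract _≟_ Bad Bad? k xs deg zero u le = [] , refl , (λ ()) , []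
  greedy-extract _≟_ Bad Bad? k (x₀ ∷ xs₀) deg (suc n) u le
    with m , m∈ , am ← least x₀ xs₀ = 
    m ∷ ys , cong suc len , (λ { (here refl) → m∈ ; (there y∈) → proj₁ (keep⁻ (sub y∈)) }) ,
    All.tabulate (λ y∈ → let (a , b , c) = keep⁻ (sub y∈) in b , All.lookup am a , c) ∷ pairs
    where
    xs = x₀ ∷ xs₀
    Q : A → Set
    Q y = m ≡ y ⊎ Bad m y
    Q? : ∀ y → Dec (Q y)
    Q? y = (m ≟ y) ⊎-dec Bad? m y
    xs′ = filter (λ y → ¬? (Q? y)) xs
    keep⁻ : ∀ {y} → y ∈ xs′ → y ∈ xs × m ≢ y × ¬ Bad m y
    keep⁻ y∈ = let (a , b) = ∈-filter⁻ (λ y → ¬? (Q? y)) {xs = xs} y∈ in a , b ∘ inj₁ , b ∘ inj₂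
    dropped = filter Q? xs
    dropped-small : length dropped ≤ suc k
    dropped-small = subst (_≤ suc k) (sym (filter-split (m ≟_) dropped))
      (ℕ.+-mono-≤ (unique-constant _ (Unique.filter⁺ (m ≟_) ud) (All.tabulate (proj₂ ∘ ∈-filter⁻ (m ≟_) {xs = dropped})))
        (deg _ m∈ (Unique.filter⁺ (λ y → ¬? (m ≟ y)) ud) λ y∈ → 
          let (a , b) = ∈-filter⁻ (λ y → ¬? (m ≟ y)) {xs = dropped} y∈ ; (c , d) = ∈-filter⁻ Q? {xs = xs} a in
          c , All.lookup am c , [ (λ e → ⊥-elim (b e)) , id ]′ d))
      where ud = Unique.filter⁺ Q? u
    big : n * suc k ≤ length xs′
    big = ℕ.+-cancelˡ-≤ (suc k) _ _ (ℕ.≤-trans le (ℕ.≤-trans (ℕ.≤-reflexive (filter-split Q? xs)) (ℕ.+-monoˡ-≤ _ dropped-small)))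
    rec = greedy-extract _≟_ Bad Bad? k xs′
      (λ zs x∈ uz h → deg zs (proj₁ (keep⁻ x∈)) uz (λ z∈ → proj₁ (keep⁻ (proj₁ (h z∈))) , proj₂ (h z∈))) n (Unique.filter⁺ (λ y → ¬? (Q? y)) u) big
    ys = proj₁ rec
    len = proj₁ (proj₂ rec)
    sub = proj₁ (proj₂ (proj₂ rec))
    pairs = proj₂ (proj₂ (proj₂ rec))

  opaque
    greedy : (_≟_ : DecidableEquality A) (Bad : A → A → Set) (Bad? : ∀ x y → Dec (Bad x y)) (k : ℕ) (xs : List A) →
      (∀ {x} ys → x ∈ xs → Unique ys → (∀ {y} → y ∈ ys → y ∈ xs × x ⊑ y × Bad x y) → length ys ≤ k) →
      ∀ n → Unique xs → n * suc k ≤ length xs →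
      ∃[ ys ] length ys ≡ n × (∀ {y} → y ∈ ys → y ∈ xs) × AllPairs (λ x y → x ≢ y × x ⊑ y × ¬ Bad x y) ys
    greedy = greedy-extract

iterate : (A → A) → ℕ → A → A
iterate f zero x = x
iterate f (suc n) x = f (iterate f n x)

iterate-preserves : {V : A → Set} {f : A → A} → (∀ {x} → V x → V (f x)) → ∀ n {x} → V x → V (iterate f n x)
iterate-preserves h zero v = v
iterate-preserves {V = V} h (suc n) v = h (iterate-preserves {V = V} h n v)

perm-injective : ∀ {n} (π : Permutation′ n) {x y} → π ⟨$⟩ʳ x ≡ π ⟨$⟩ʳ y → x ≡ y
perm-injective π e = trans (sym (inverseˡ π)) (trans (cong (π ⟨$⟩ˡ_) e) (inverseˡ π))

-- A set mapped into itself by a permutation of a finite set is also mapped into itself by the inverse.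
perm-closed : ∀ {n} (π : Permutation′ n) {V : Fin n → Set} →
  (∀ {x} → V x → V (π ⟨$⟩ʳ x)) → ∀ {x} → V x → V (π ⟨$⟩ˡ x)
perm-closed {n} π {V} h {x} v
  with i , j , i<j , e ← Fin.pigeonhole (ℕ.n<1+n n) (λ k → iterate (π ⟨$⟩ʳ_) (toℕ k) x)
  = subst V (period (toℕ j ∸ suc (toℕ i)) (toℕ i) (trans e (cong (λ k → iterate (π ⟨$⟩ʳ_) k x) (sym (ℕ.m∸n+n≡m i<j)))))
      (iterate-preserves {V = V} h (toℕ j ∸ suc (toℕ i)) v)
  where
  period : ∀ d i → iterate (π ⟨$⟩ʳ_) i x ≡ iterate (π ⟨$⟩ʳ_) (d + suc i) x → iterate (π ⟨$⟩ʳ_) d x ≡ π ⟨$⟩ˡ x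
  period d zero e = trans (sym (inverseˡ π)) (cong (π ⟨$⟩ˡ_) (sym (trans e (cong (λ k → iterate (π ⟨$⟩ʳ_) k x) (ℕ.+-comm d 1)))))
  period d (suc i) e = period d i (perm-injective π (trans e (cong (λ k → iterate (π ⟨$⟩ʳ_) k x) (ℕ.+-suc d (suc i)))))

oldest : ∀ {m} {Q : Fin m → Set} → (∀ c → Dec (Q c)) → ∃ Q → ∃[ b ] Q b × (∀ c → Q c → c Fin.≤ b)
oldest {suc m} {Q} Q? (c , q) with Fin.any? (Q? ∘ suc)
... | yes r with b , qb , h ← oldest (Q? ∘ suc) r = suc b , qb , λ { zero _ → z≤n ; (suc c) q → s≤s (h c q) }
... | no ¬r with c | q
...   | zero  | q = zero , q , λ { zero _ → z≤n ; (suc c) q → ⊥-elim (¬r (c , q)) }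
...   | suc c | q = ⊥-elim (¬r (c , q))

does⁻ : ∀ {P : Set} (d : Dec P) → T (does d) → P
does⁻ (yes p) _ = p

does⁺ : ∀ {P : Set} (d : Dec P) → P → T (does d)
does⁺ (yes _) _ = tt
does⁺ (no n) p = n p

-- Systems of levels linked by unions of perfect matchings

-- Levels are numbered newest first.  The last two fields say that a relation between two levels
-- factors through any level b that was present before everything on one side of it.
record LevelSystem (w m : ℕ) : Set₁ where
  infix 4 _≼_ _≼?_
  field
    _≼_       : Fin m → Fin m → Set
    _≼?_      : ∀ a b → Dec (a ≼ b)
    ≼-refl    : ∀ {a} → a ≼ a
    ≼-trans   : ∀ {a b c} → a ≼ b → b ≼ c → a ≼ c
    ≼-antisym : ∀ {a b} → a ≼ b → b ≼ a → a ≡ b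
    ≼-total   : ∀ a b → a ≼ b ⊎ b ≼ a
    Le        : Fin m → Fin w → Fin m → Fin w → Set
    Le?       : ∀ a x b y → Dec (Le a x b y)
    Le⇒≼      : ∀ {a x b y} → Le a x b y → a ≼ b
    Le-refl   : ∀ {a x} → Le a x a x
    Le-eq     : ∀ {a x y} → Le a x a y → x ≡ y
    Le-trans  : ∀ {a x b y c z} → Le a x b y → Le b y c z → Le a x c z
    matching  : ∀ {a x b y} → Le a x b y → ∃[ π ] (∀ z → Le a z b (π ⟨$⟩ʳ z)) × π ⟨$⟩ʳ x ≡ y
    thread    : Fin m → Permutation′ w
    thread-Le : ∀ {a b} → a ≼ b → ∀ i → Le a (thread a ⟨$⟩ʳ i) b (thread b ⟨$⟩ʳ i)
    factorʳ   : ∀ {a b e x y} → a ≼ b → b ≼ e → (∀ c → b ≼ c → c ≼ e → c Fin.≤ b) →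
                Le a x e y → ∃[ z ] Le a x b z × Le b z e y
    factorˡ   : ∀ {a b e x y} → a ≼ b → b ≼ e → (∀ c → a ≼ c → c ≼ b → c Fin.≤ b) →
                Le a x e y → ∃[ z ] Le a x b z × Le b z e y

  thread-up : ∀ {a b} → a ≼ b → ∀ x → Le a x b (thread b ⟨$⟩ʳ (thread a ⟨$⟩ˡ x))
  thread-up {a} {b} l x = subst (λ v → Le a v b (thread b ⟨$⟩ʳ (thread a ⟨$⟩ˡ x))) (inverseʳ (thread a)) (thread-Le l _)

  thread-down : ∀ {a b} → a ≼ b → ∀ y → Le a (thread a ⟨$⟩ʳ (thread b ⟨$⟩ˡ y)) b y
  thread-down {a} {b} l y = subst (λ v → Le a (thread a ⟨$⟩ʳ (thread b ⟨$⟩ˡ y)) b v) (inverseʳ (thread b)) (thread-Le l _)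

opposite : ∀ {w m} → LevelSystem w m → LevelSystem w m
opposite S = record
  { _≼_ = λ a b → b ≼ a ; _≼?_ = λ a b → b ≼? a ; ≼-refl = ≼-refl ; ≼-trans = λ p q → ≼-trans q p
  ; ≼-antisym = λ p q → ≼-antisym q p ; ≼-total = λ a b → ≼-total b a
  ; Le = λ a x b y → Le b y a x ; Le? = λ a x b y → Le? b y a x ; Le⇒≼ = Le⇒≼ ; Le-refl = Le-refl
  ; Le-eq = sym ∘ Le-eq ; Le-trans = λ p q → Le-trans q p
  ; matching = λ l → let (π , h , e) = matching l in
      flip π , (λ z → subst (λ v → Le _ (π ⟨$⟩ˡ z) _ v) (inverseʳ π) (h (π ⟨$⟩ˡ z)))
             , trans (cong (π ⟨$⟩ˡ_) (sym e)) (inverseˡ π)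
  ; thread = thread ; thread-Le = λ p i → thread-Le p i
  ; factorʳ = λ p q h l → let (z , l₁ , l₂) = factorˡ q p (λ c u v → h c v u) l in z , l₂ , l₁
  ; factorˡ = λ p q h l → let (z , l₁ , l₂) = factorʳ q p (λ c u v → h c v u) l in z , l₂ , l₁
  }
  where open LevelSystem S

-- A connected component of the relation between two levels.
record Node {w m} (S : LevelSystem w m) : Set₁ where
  open LevelSystem S
  field
    lo hi : Fin m
    lo≼hi : lo ≼ hi
    hi⋠lo : ¬ hi ≼ lo
    X Y : Fin w → Set
    X? : ∀ x → Dec (X x)
    Y? : ∀ y → Dec (Y y)
    closedʳ : ∀ {x y} → X x → Le lo x hi y → Y y
    closedˡ : ∀ {x y} → Y y → Le lo x hi y → X x
    connected : (U V : Fin w → Set) → (∀ x → Dec (U x)) → (∀ y → Dec (V y)) →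
      (∀ {x y} → X x → Le lo x hi y → (U x → V y) × (V y → U x)) → ∀ {x x′} → X x → X x′ → U x → U x′
    inhabited : ∃ X

  thread-closedʳ : ∀ {i} → X (thread lo ⟨$⟩ʳ i) → Y (thread hi ⟨$⟩ʳ i)
  thread-closedʳ h = closedʳ h (thread-Le lo≼hi _)

  thread-closedˡ : ∀ {i} → Y (thread hi ⟨$⟩ʳ i) → X (thread lo ⟨$⟩ʳ i)
  thread-closedˡ h = closedˡ h (thread-Le lo≼hi _)

oppositeNode : ∀ {w m} {S : LevelSystem w m} → Node S → Node (opposite S)
oppositeNode {S = S} N = record
  { lo = hi ; hi = lo ; lo≼hi = lo≼hi ; hi⋠lo = hi⋠lo ; X = Y ; Y = X ; X? = Y? ; Y? = X? ; closedʳ = closedˡ ; closedˡ = closedʳ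
  ; connected = λ U V U? V? h {y} {y′} Yy Yy′ u →
      let f = connected V U V? U? (λ Xx l → let (p , q) = h (closedʳ Xx l) l in q , p)
                (closedˡ Yy (thread-down lo≼hi y)) (closedˡ Yy′ (thread-down lo≼hi y′)) (proj₁ (h Yy (thread-down lo≼hi y)) u)
      in proj₂ (h Yy′ (thread-down lo≼hi y′)) f
  ; inhabited = let (x , Xx) = inhabited in
      thread hi ⟨$⟩ʳ (thread lo ⟨$⟩ˡ x) , thread-closedʳ (subst X (sym (inverseʳ (thread lo))) Xx)
  }
  where open LevelSystem S ; open Node N

module _ {w m} (S : LevelSystem w m) where
  open LevelSystem S

  at : Fin m → Fin w → Fin w
  at a i = thread a ⟨$⟩ʳ i

  module Switching (D : Fin m → Fin w → Set) (D? : ∀ a x → Dec (D a x))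
    (down : ∀ {a x b y} → Le a x b y → D b y → D a x) (N : Node S) where
    open Node N

    Switches : Fin w → Set
    Switches i = X (at lo i) × D lo (at lo i) × ¬ D hi (at hi i)

    Switches? : ∀ i → Dec (Switches i)
    Switches? i = X? _ ×-dec D? _ _ ×-dec ¬? (D? _ _)

    -- If no thread leaves D inside N then D splits N into two unions of matchings, which connectedness forbids.
    switch-lo : ∀ {x x′} → X x → X x′ → D lo x → ¬ D lo x′ → ∃ Switches
    switch-lo {x} {x′} Xx Xx′ d nd with Fin.any? Switches?
    ... | yes r = r
    ... | no none = ⊥-elim (nd (connected (D lo) (D hi) (D? lo) (D? hi) (λ Xz l → up Xz l , down l) Xx Xx′ d))
      where
      stays : ∀ i → X (at lo i) → D lo (at lo i) → D hi (at hi i)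
      stays i p q = decidable-stable (D? _ _) (λ r → none (i , p , q , r))
      up : ∀ {z y} → X z → Le lo z hi y → D lo z → D hi y
      up {z} {y} Xz l dz with π , h , e ← matching l =
        subst (D hi) (trans (inverseʳ (thread hi)) e) (stays _ (proj₁ back) (proj₂ back))
        where
        V : Fin w → Set
        V v = X v × D lo v
        g = flip (thread lo) ∘ₚ thread hi ∘ₚ flip π
        edge : ∀ v → Le lo (π ⟨$⟩ˡ v) hi v
        edge v = subst (Le lo _ hi) (inverseʳ π) (h _)
        fwd : ∀ {v} → V v → V (g ⟨$⟩ʳ v)
        fwd {v} (p , q) =
          let e′ = inverseʳ (thread lo) {v}
              p′ = subst X (sym e′) p
              q′ = stays _ p′ (subst (D lo) (sym e′) q)
          in closedˡ (thread-closedʳ p′) (edge _) , down (edge _) q′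
        back : V (g ⟨$⟩ˡ z)
        back = perm-closed g {V} fwd (Xz , dz)

    switch-hi : ∀ {y y′} → Y y → Y y′ → D hi y → ¬ D hi y′ → ∃ Switches
    switch-hi {y} {y′} Yy Yy′ d nd with D? lo (at lo (thread hi ⟨$⟩ˡ y′))
    ... | yes q = _ , thread-closedˡ (subst Y (sym (inverseʳ (thread hi))) Yy′) , q ,
                  λ r → nd (subst (D hi) (inverseʳ (thread hi)) r)
    ... | no nq = switch-lo (thread-closedˡ (subst Y (sym (inverseʳ (thread hi))) Yy))
                    (thread-closedˡ (subst Y (sym (inverseʳ (thread hi))) Yy′))
                    (down (thread-Le lo≼hi _) (subst (D hi) (sym (inverseʳ (thread hi))) d)) nq

-- A list of nodes any two of which are disjoint wherever their level intervals overlap.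
record NodeFamily {w m} (S : LevelSystem w m) (Nd : Set) : Set₁ where
  field
    _≟ᴺ_  : DecidableEquality Nd
    node  : Nd → Node S
    nodes : List Nd
    separated : ∀ {M N} → M ∈ nodes → N ∈ nodes → ∀ i →
      Node.X (node M) (at S (Node.lo (node M)) i) → Node.X (node N) (at S (Node.lo (node N)) i) →
      M ≡ N ⊎ LevelSystem._≼_ S (Node.hi (node M)) (Node.lo (node N)) ⊎ LevelSystem._≼_ S (Node.hi (node N)) (Node.lo (node M))

oppositeFamily : ∀ {w m} {S : LevelSystem w m} {Nd} → NodeFamily S Nd → NodeFamily (opposite S) Nd
oppositeFamily F = record
  { _≟ᴺ_ = _≟ᴺ_ ; node = oppositeNode ∘ node ; nodes = nodes
  ; separated = λ {M} {N} M∈ N∈ i p q → case separated M∈ N∈ i (Node.thread-closedˡ (node M) p) (Node.thread-closedˡ (node N) q) of λ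
      { (inj₁ e) → inj₁ e ; (inj₂ (inj₁ l)) → inj₂ (inj₂ l) ; (inj₂ (inj₂ l)) → inj₂ (inj₁ l) }
  }
  where open NodeFamily F

module Relations {w m} {S : LevelSystem w m} {Nd} (F : NodeFamily S Nd) where
  open LevelSystem S
  open NodeFamily F public
  private module N (n : Nd) = Node (node n)
  open N public

  -- M ⇝ N : some element of the top of M lies below some element of the bottom of N.
  -- M ⊲ N : every element of the top of M lies below some element of the bottom of N.
  _⇝_ _⊲_ E : Nd → Nd → Set
  M ⇝ N = ∃[ y ] ∃[ x ] Y M y × X N x × Le (hi M) y (lo N) x
  M ⊲ N = ∀ y → Y M y → ∃[ x ] X N x × Le (hi M) y (lo N) x
  E M N = M ⇝ N × ¬ M ⊲ N

  _⇝?_ : ∀ M N → Dec (M ⇝ N)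
  M ⇝? N = Fin.any? λ y → Fin.any? λ x → Y? M y ×-dec X? N x ×-dec Le? _ _ _ _

  _⊲?_ : ∀ M N → Dec (M ⊲ N)
  M ⊲? N = Fin.all? λ y → Y? M y →-dec Fin.any? λ x → X? N x ×-dec Le? _ _ _ _

  E? : ∀ M N → Dec (E M N)
  E? M N = M ⇝? N ×-dec ¬? (M ⊲? N)

  ⇝⇒≼ : ∀ {M N} → M ⇝ N → hi M ≼ lo N
  ⇝⇒≼ (_ , _ , _ , _ , l) = Le⇒≼ l

  top : ∀ M → ∃ (Y M)
  top M = let (x , Xx) = inhabited M in _ , thread-closedʳ M (subst (X M) (sym (inverseʳ (thread (lo M)))) Xx)

  ⊲⇒⇝ : ∀ {M N} → M ⊲ N → M ⇝ N
  ⊲⇒⇝ {M} h = let (y , Yy) = top M ; (x , Xx , l) = h y Yy in y , x , Yy , Xx , l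

  ⊲⇒≼ : ∀ {M N} → M ⊲ N → hi M ≼ lo N
  ⊲⇒≼ = ⇝⇒≼ ∘ ⊲⇒⇝

  upward : ∀ M {x} → X M x → ∃[ y ] Y M y × Le (lo M) x (hi M) y
  upward M {x} Xx = let l = thread-up (lo≼hi M) x in
    _ , closedʳ M Xx l , l

  ⊲-⇝-trans : ∀ {L M N} → L ⇝ M → M ⊲ N → L ⇝ N
  ⊲-⇝-trans {L} {M} (y , x , Yy , Xx , l) h =
    let (y′ , Yy′ , l′) = upward M Xx ; (z , Xz , l″) = h y′ Yy′ in y , z , Yy , Xz , Le-trans l (Le-trans l′ l″)

  ⊲-trans : ∀ {L M N} → L ⊲ M → M ⊲ N → L ⊲ N
  ⊲-trans {L} {M} g h y Yy = 
    let (x , Xx , l) = g y Yy ; (y′ , Yy′ , l′) = upward M Xx ; (z , Xz , l″) = h y′ Yy′ in z , Xz , Le-trans l (Le-trans l′ l″)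

  -- If L ⊲ M and M reaches N but L is not entirely below N, then M is not entirely below N either.
  E-trans : ∀ {L M N} → L ⊲ M → M ⇝ N → ¬ L ⊲ N → E M N
  E-trans h r n = r , n ∘ ⊲-trans h

  thr : Nd → Fin w
  thr M = thread (lo M) ⟨$⟩ˡ proj₁ (inhabited M)

  thr-X : ∀ M → X M (at S (lo M) (thr M))
  thr-X M = subst (X M) (sym (inverseʳ (thread (lo M)))) (proj₂ (inhabited M))

  thread⇒⇝ : ∀ {M N} i → X M (at S (lo M) i) → X N (at S (lo N) i) → hi M ≼ lo N → M ⇝ N
  thread⇒⇝ {M} i p q l = _ , _ , thread-closedʳ M p , q , thread-Le l i

  opaque
    comparable : ∀ {M N} → M ∈ nodes → N ∈ nodes → thr M ≡ thr N → M ≡ N ⊎ M ⇝ N ⊎ N ⇝ M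
    comparable {M} {N} M∈ N∈ e with separated M∈ N∈ (thr M) (thr-X M) q
      where
      q : X N (at S (lo N) (thr M))
      q = subst (X N ∘ at S (lo N)) (sym e) (thr-X N)
    ... | inj₁ r = inj₁ r
    ... | inj₂ (inj₁ l) = inj₂ (inj₁ (thread⇒⇝ {M} {N} (thr M) (thr-X M) (subst (X N ∘ at S (lo N)) (sym e) (thr-X N)) l))
    ... | inj₂ (inj₂ l) = inj₂ (inj₂ (thread⇒⇝ {N} {M} (thr M) (subst (X N ∘ at S (lo N)) (sym e) (thr-X N)) (thr-X M) l))

  module _ (D : Fin m → Fin w → Set) (D? : ∀ a x → Dec (D a x))
    (down : ∀ {a x b y} → Le a x b y → D b y → D a x) where
    private module Sw (n : Nd) = Switching S D D? down (node n)

    opaque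
      few-cut : ∀ xs → Unique xs → (∀ {N} → N ∈ xs → N ∈ nodes × ∃[ y ] ∃[ y′ ] Y N y × Y N y′ × D (hi N) y × ¬ D (hi N) y′) →
        length xs ≤ w
      few-cut xs u h = inj-Fin pick u inj
        where
        pick : Nd → Fin w
        pick N with Fin.any? (Sw.Switches? N)
        ... | yes (i , _) = i
        ... | no _ = thr N
        pick-switches : ∀ {N} → N ∈ xs → Sw.Switches N (pick N)
        pick-switches {N} N∈ with Fin.any? (Sw.Switches? N)
        ... | yes (i , s) = s
        ... | no ¬s = let (_ , y , y′ , a , b , c , d) = h N∈ in ⊥-elim (¬s (Sw.switch-hi N a b c d))
        inj : InjOn pick xs
        inj {M} {N} M∈ N∈ e with pick-switches M∈ | pick-switches N∈
        ... | (a , b , c) | s with subst (Sw.Switches N) (sym e) s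
        ... | (a′ , b′ , c′) with separated (proj₁ (h M∈)) (proj₁ (h N∈)) (pick M) a a′
        ... | inj₁ r = r
        ... | inj₂ (inj₁ l) = ⊥-elim (c (down (thread-Le l (pick M)) b′))
        ... | inj₂ (inj₂ l) = ⊥-elim (c′ (down (thread-Le l (pick M)) b))

  opaque
    few-below : ∀ f xs → Unique xs → (∀ {N} → N ∈ xs → N ∈ nodes × E N f) → length xs ≤ w
    few-below f xs u h = few-cut D D? (λ { l (x , Xx , l′) → x , Xx , Le-trans l l′ }) xs u λ {N} N∈ →
      let (n∈ , (y , x , Yy , Xx , l) , n⊲) = h N∈ in case escape N n⊲ of λ { (y′ , Yy′ , nd) → n∈ , y , y′ , Yy , Yy′ , (x , Xx , l) , nd }
      where
      D : Fin m → Fin w → Set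
      D a z = ∃[ x ] X f x × Le a z (lo f) x
      D? : ∀ a z → Dec (D a z)
      D? a z = Fin.any? λ x → X? f x ×-dec Le? _ _ _ _
      escape : ∀ N → ¬ N ⊲ f → ∃[ y ] Y N y × ¬ D (hi N) y
      escape N n with Fin.any? (λ y → Y? N y ×-dec ¬? (D? (hi N) y))
      ... | yes r = r
      ... | no r = ⊥-elim (n λ y Yy → decidable-stable (D? _ _) λ nd → r (y , Yy , nd))

-- First-fit colourings of the conflict graph E use polynomially many colours

module FirstFit {w m} {S : LevelSystem w m} {Nd} (F : NodeFamily S Nd) (0<w : 1 ≤ w) where
  open LevelSystem S
  open Relations F

  W : ℕ
  W = suc w

  -- Powers of W, opaque because their normal forms are huge.
  opaque
    P^ : ℕ → ℕ
    P^ k = W ^ k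

    P^-def : ∀ k → P^ k ≡ W ^ k
    P^-def k = refl

    P^1 : P^ 1 ≡ W
    P^1 = ℕ.*-identityʳ W

    pow : ∀ k → P^ k * W ≤ P^ (suc k)
    pow k = ℕ.≤-reflexive (ℕ.*-comm (W ^ k) W)

    pow² : ∀ k → P^ k * W * W ≤ P^ (2 + k)
    pow² k = ℕ.≤-trans (ℕ.*-monoˡ-≤ W (pow k)) (pow (suc k))

    pos : ∀ k → 1 ≤ P^ k
    pos k = ℕ.m^n>0 W k

    pow+pow : ∀ k → P^ k + P^ k ≤ P^ (suc k)
    pow+pow k = ℕ.≤-trans (ℕ.≤-reflexive (cong (P^ k +_) (sym (ℕ.+-identityʳ _)))) (ℕ.*-monoˡ-≤ (P^ k) (s≤s 0<w))

    W≤pow : ∀ k → W ≤ P^ (suc k)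
    W≤pow k = ℕ.≤-trans (ℕ.≤-reflexive (sym (ℕ.*-identityʳ W))) (ℕ.^-monoʳ-≤ W {1} {suc k} (s≤s z≤n))

  predecessor : ∀ {n} → 1 ≤ n → ∃[ k ] n ≡ suc k
  predecessor (s≤s {n = n} _) = n , refl

  opaque
    below-few : ∀ {A : Set} (π : A → Nd) f (ys : List A) → Unique ys → InjOn π ys →
      (∀ {y} → y ∈ ys → π y ∈ nodes × E (π y) f) → length ys ≤ w
    below-few π f ys u i h = subst (_≤ w) (length-map π ys) (few-below f (map π ys) (Unique-map i u) λ N∈ →
      case ∈-map⁻ π N∈ of λ { (y , y∈ , refl) → h y∈ })

  private
    chain₀ : ∀ {A : Set} (_≟_ : DecidableEquality A) (π : A → Nd) xs → Unique xs → InjOn π xs → (∀ {x} → x ∈ xs → π x ∈ nodes) →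
      ∀ n → 1 ≤ n → n * W * W ≤ length xs →
      ∃[ ys ] length ys ≡ n × (∀ {y} → y ∈ ys → y ∈ xs) × AllPairs (λ x y → x ≢ y × π y ⊲ π x) ys
    chain₀ {A} _≟_ π xs u inj sub n 1≤n le = ys , len , in-xs ∘ sub′ , go ys ps refine
      where
      fib = large-fiber′ (thr ∘ π) (n * W) xs (ℕ.*-mono-≤ 1≤n (s≤s z≤n)) le
      i = proj₁ fib
      in-xs : ∀ {x} → x ∈ fiber (thr ∘ π) i xs → x ∈ xs
      in-xs = proj₁ ∘ ∈-filter⁻ (λ x → thr (π x) Fin.≟ i) {xs = xs}
      in-fiber : ∀ {x} → x ∈ fiber (thr ∘ π) i xs → thr (π x) ≡ i
      in-fiber = proj₂ ∘ ∈-filter⁻ (λ x → thr (π x) Fin.≟ i) {xs = xs}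
      gr = greedy (λ x y → lo (π y) ≼ lo (π x)) (λ x y → lo (π y) ≼? lo (π x))
        ≼-refl (λ p q → ≼-trans q p) (λ x y → ≼-total (lo (π y)) (lo (π x))) _≟_
        (λ x y → E (π y) (π x)) (λ x y → E? (π y) (π x)) w (fiber (thr ∘ π) i xs)
        (λ {x} ys x∈ uy h → below-few π (π x) ys uy (λ a b → inj (in-xs (proj₁ (h a))) (in-xs (proj₁ (h b))))
           (λ y∈ → sub (in-xs (proj₁ (h y∈))) , proj₂ (proj₂ (h y∈))))
        n (Unique.filter⁺ (λ x → thr (π x) Fin.≟ i) u) (proj₂ fib)
      ys = proj₁ gr
      len = proj₁ (proj₂ gr)
      sub′ = proj₁ (proj₂ (proj₂ gr))
      ps = proj₂ (proj₂ (proj₂ gr))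
      refine : ∀ {x y} → x ∈ ys → y ∈ ys → x ≢ y × lo (π y) ≼ lo (π x) × ¬ E (π y) (π x) → x ≢ y × π y ⊲ π x
      refine {x} {y} x∈ y∈ (ne , l , ¬e) = ne , decidable-stable (π y ⊲? π x) λ n → ¬e (reach , n)
        where
        reach : π y ⇝ π x
        reach = case comparable (sub (in-xs (sub′ x∈))) (sub (in-xs (sub′ y∈))) (trans (in-fiber (sub′ x∈)) (sym (in-fiber (sub′ y∈)))) of λ
          { (inj₁ e) → ⊥-elim (ne (inj (in-xs (sub′ x∈)) (in-xs (sub′ y∈)) e))
          ; (inj₂ (inj₁ r)) → ⊥-elim (hi⋠lo (π x) (≼-trans (⇝⇒≼ {π x} {π y} r) l))
          ; (inj₂ (inj₂ r)) → r }
      go : ∀ {R Q : A → A → Set} zs → AllPairs R zs → (∀ {x y} → x ∈ zs → y ∈ zs → R x y → Q x y) → AllPairs Q zs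
      go [] [] h = []
      go (z ∷ zs) (p ∷ ps) h = All.tabulate (λ m → h (here refl) (there m) (All.lookup p m)) ∷ go zs ps (λ a b → h (there a) (there b))

  opaque
    chain : ∀ {A : Set} (_≟_ : DecidableEquality A) (π : A → Nd) xs → Unique xs → InjOn π xs → (∀ {x} → x ∈ xs → π x ∈ nodes) →
      ∀ n → 1 ≤ n → n * W * W ≤ length xs →
      ∃[ ys ] length ys ≡ n × (∀ {y} → y ∈ ys → y ∈ xs) × AllPairs (λ x y → x ≢ y × π y ⊲ π x) ys
    chain = chain₀

  Pair = Nd × Nd
  _≟ᴾ_ : DecidableEquality Pair
  _≟ᴾ_ = ≡-dec _≟ᴺ_ _≟ᴺ_

  opaque
    chain-either : ∀ {A : Set} {π : A → Nd} {ys} → AllPairs (λ x y → x ≢ y × π y ⊲ π x) ys →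
      ∀ {x y} → x ∈ ys → y ∈ ys → x ≡ y ⊎ π x ⊲ π y ⊎ π y ⊲ π x
    chain-either ps x∈ y∈ with AllPairs-lookup ps x∈ y∈
    ... | inj₁ e = inj₁ e
    ... | inj₂ (inj₁ (_ , l)) = inj₂ (inj₂ l)
    ... | inj₂ (inj₂ (_ , l)) = inj₂ (inj₁ l)

  -- A chain below level B cannot have too many conflicts with nodes above B: pairs (i , f) that are increasing
  -- in both coordinates all factor through the oldest level b between the middle i and the middle f.
  crossing : ∀ B (ps : List Pair) → Unique ps → InjOn proj₁ ps →
    (∀ {i f} → (i , f) ∈ ps → i ∈ nodes × f ∈ nodes × E i f × hi i ≼ B × B ≼ lo f) →
    (∀ {p q} → p ∈ ps → q ∈ ps → p ≡ q ⊎ proj₁ p ⊲ proj₁ q ⊎ proj₁ q ⊲ proj₁ p) →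
    ¬ P^ 8 ≤ length ps
  crossing B ps u inj ok cmp le =
    contra ts (ℕ.≤-trans (pow+pow 3) (ℕ.≤-reflexive (sym lt))) pt (sq ∘ sr ∘ st) (chain-either pr) st
    where
    forward : ∀ {p q} → p ∈ ps → q ∈ ps → p ≢ q → lo (proj₁ p) ≼ lo (proj₁ q) → proj₁ p ⊲ proj₁ q
    forward {p} {q} p∈ q∈ ne l with cmp p∈ q∈
    ... | inj₁ e = ⊥-elim (ne e)
    ... | inj₂ (inj₁ r) = r
    ... | inj₂ (inj₂ r) = ⊥-elim (hi⋠lo (proj₁ q) (≼-trans (⊲⇒≼ {proj₁ q} {proj₁ p} r) l))
    conflict : ∀ {p q} → p ∈ ps → q ∈ ps → lo (proj₁ p) ≼ lo (proj₁ q) → proj₂ q ⊲ proj₂ p → E (proj₁ q) (proj₂ p)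
    conflict {p} {q} p∈ q∈ l s with p ≟ᴾ q
    ... | yes refl = proj₁ (proj₂ (proj₂ (ok p∈)))
    ... | no ne = E-trans {proj₁ p} {proj₁ q} {proj₂ p} (forward p∈ q∈ ne l)
      (⊲-⇝-trans {proj₁ q} {proj₂ q} {proj₂ p} (proj₁ (proj₁ (proj₂ (proj₂ (ok q∈))))) s) (proj₂ (proj₁ (proj₂ (proj₂ (ok p∈)))))
    distinct = greedy (λ _ _ → ⊤) (λ _ _ → yes tt) tt (λ _ _ → tt) (λ _ _ → inj₁ tt) _≟ᴾ_
      (λ p q → proj₂ q ≡ proj₂ p) (λ p q → proj₂ q ≟ᴺ proj₂ p) w ps
      (λ {p} ys p∈ uy h → below-few proj₁ (proj₂ p) ys uy (λ a b → inj (proj₁ (h a)) (proj₁ (h b)))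
        (λ {q} q∈ → let (a , _ , e) = h q∈ ; (b , _ , c , _) = ok a in b , subst (E (proj₁ q)) e c))
      (P^ 7) u (ℕ.≤-trans (pow 7) le)
    qs = proj₁ distinct
    sq = proj₁ (proj₂ (proj₂ distinct))
    pq = proj₂ (proj₂ (proj₂ distinct))
    chain₂ = chain _≟ᴾ_ proj₂ qs (AllPairs⇒Unique (λ h → proj₁ h refl) pq)
      (λ a b e → case AllPairs-lookup pq a b of λ
        { (inj₁ r) → r ; (inj₂ (inj₁ (_ , _ , n))) → ⊥-elim (n (sym e)) ; (inj₂ (inj₂ (_ , _ , n))) → ⊥-elim (n e) })
      (λ q∈ → proj₁ (proj₂ (ok (sq q∈)))) (P^ 5) (pos 5) (ℕ.≤-trans (pow² 5) (ℕ.≤-reflexive (sym (proj₁ (proj₂ distinct)))))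
    rs = proj₁ chain₂
    sr = proj₁ (proj₂ (proj₂ chain₂))
    pr = proj₂ (proj₂ (proj₂ chain₂))
    monotone = greedy (λ p q → lo (proj₁ p) ≼ lo (proj₁ q)) (λ p q → lo (proj₁ p) ≼? lo (proj₁ q))
      ≼-refl ≼-trans (λ p q → ≼-total _ _) _≟ᴾ_
      (λ p q → proj₂ q ⊲ proj₂ p) (λ p q → proj₂ q ⊲? proj₂ p) w rs
      (λ {p} ys p∈ uy h → below-few proj₁ (proj₂ p) ys uy (λ a b → inj (sq (sr (proj₁ (h a)))) (sq (sr (proj₁ (h b)))))
        (λ {q} q∈ → let (a , l , s) = h q∈ in proj₁ (ok (sq (sr a))) , conflict (sq (sr p∈)) (sq (sr a)) l s))
      (P^ 4) (AllPairs⇒Unique (λ h → proj₁ h refl) pr) (ℕ.≤-trans (pow 4) (ℕ.≤-reflexive (sym (proj₁ (proj₂ chain₂)))))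
    ts = proj₁ monotone
    lt = proj₁ (proj₂ monotone)
    st = proj₁ (proj₂ (proj₂ monotone))
    pt = proj₂ (proj₂ (proj₂ monotone))
    Via : Fin m → Pair → Fin w → Set
    Via b (i , f) z = ∃[ y ] ∃[ x ] Y i y × X f x × Le (hi i) y b z × Le b z (lo f) x
    Via? : ∀ b p z → Dec (Via b p z)
    Via? b (i , f) z = Fin.any? λ y → Fin.any? λ x → Y? i y ×-dec X? f x ×-dec Le? _ _ _ _ ×-dec Le? _ _ _ _
    through : ∀ b (us : List Pair) → P^ 3 ≤ length us → (∀ {p} → p ∈ us → p ∈ ps) →
      AllPairs (λ p q → p ≢ q × lo (proj₁ p) ≼ lo (proj₁ q)) us →
      (∀ {p} → p ∈ us → ∃ (Via b p)) → ⊥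
    through b us len sub pu via = go (fiber pick z us) (proj₂ fib) (proj₁ ∘ ∈-filter⁻ P? {xs = us}) same (AllPairs.filter⁺ P? pu)
      where
      pick : Pair → Fin w
      pick p with Fin.any? (Via? b p)
      ... | yes (z , _) = z
      ... | no _ = thr (proj₁ p)
      fib = large-fiber′ pick (P^ 2) us (pos 2) (ℕ.≤-trans (pow 2) len)
      z = proj₁ fib
      P? = λ p → pick p Fin.≟ z
      picked : ∀ {p} → ∃ (Via b p) → Via b p (pick p)
      picked {p} e with Fin.any? (Via? b p)
      ... | yes (z , v) = v
      ... | no n = ⊥-elim (n e)
      same : ∀ {p} → p ∈ fiber pick z us → Via b p z
      same {p} p∈ = let (a , e) = ∈-filter⁻ P? {xs = us} p∈ in subst (Via b p) e (picked {p} (via a))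
      go : ∀ vs → P^ 2 ≤ length vs → (∀ {p} → p ∈ vs → p ∈ us) → (∀ {p} → p ∈ vs → Via b p z) →
        AllPairs (λ p q → p ≢ q × lo (proj₁ p) ≼ lo (proj₁ q)) vs → ⊥
      go [] l _ _ _ = case ℕ.≤-trans (pos 2) l of λ ()
      go (p ∷ vs) l s v (h ∷ pv) = ℕ.<-irrefl refl (ℕ.<-≤-trans (ℕ.n<1+n w) (ℕ.≤-trans (ℕ.≤-pred big′) few))
        where
        big′ : suc W ≤ suc (length vs)
        big′ = ℕ.≤-trans (ℕ.≤-trans (ℕ.+-monoˡ-≤ W (s≤s {0} z≤n)) (ℕ.≤-trans (ℕ.≤-reflexive (cong₂ _+_ (sym P^1) (sym P^1))) (pow+pow 1))) l
        few : length vs ≤ w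
        few = below-few proj₁ (proj₂ p) vs (AllPairs⇒Unique (λ h → proj₁ h refl) pv)
          (λ a c → inj (sub (s (there a))) (sub (s (there c))))
          λ {q} q∈ → let (ne , lo≼) = All.lookup h q∈ ; p∈ = sub (s (here refl)) ; q∈′ = sub (s (there q∈))
                         (y , _ , Yy , _ , l₁ , _) = v (there q∈) ; (_ , x , _ , Xx , _ , l₂) = v (here refl) in
            proj₁ (ok q∈′) , E-trans {proj₁ p} {proj₁ q} {proj₂ p} (forward p∈ q∈′ ne lo≼) (y , x , Yy , Xx , Le-trans l₁ l₂)
              (proj₂ (proj₁ (proj₂ (proj₂ (ok p∈)))))
    contra : ∀ {rs : List Pair} ts → P^ 3 + P^ 3 ≤ length ts →
      AllPairs (λ p q → p ≢ q × lo (proj₁ p) ≼ lo (proj₁ q) × ¬ proj₂ q ⊲ proj₂ p) ts → (∀ {p} → p ∈ ts → p ∈ ps) →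
      (∀ {p q} → p ∈ rs → q ∈ rs → p ≡ q ⊎ proj₂ p ⊲ proj₂ q ⊎ proj₂ q ⊲ proj₂ p) → (∀ {p} → p ∈ ts → p ∈ rs) → ⊥
    contra ts len pt sub cmp₂ sub₂ 
      with k , e ← predecessor (pos 3)
      with front , p@(i , f) , back , lf , lb , fp , pf , pb ∷ pbs , sf , sb ← split-AllPairs (suc k) k ts (subst (λ n → n + n ≤ length ts) e len) pt
      with b , (i≼b , b≼f) , old ← oldest (λ c → (hi i ≼? c) ×-dec (c ≼? lo f)) (hi i , ≼-refl ,
        let (_ , _ , _ , a , c) = ok (sub (sb (here refl))) in ≼-trans a c)
      with ≼-total b B
    ... | inj₁ b≼B = through b front (ℕ.≤-reflexive (trans e (sym lf))) (sub ∘ sf) (AllPairs.map (λ (a , c , _) → a , c) pf) λ {q} q∈ →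
      let (ne , l , n) = All.lookup fp q∈ ; q∈′ = sub (sf q∈) ; p∈ = sub (sb (here refl))
          (_ , _ , ((y , x , Yy , Xx , r) , _) , qB , Bq) = ok q∈′
          fq = ascend (sub₂ (sf q∈)) (sub₂ (sb (here refl))) ne n
          (z , r₁ , r₂) = factorʳ (≼-trans (≼-trans (⊲⇒≼ {proj₁ q} {i} (forward q∈′ p∈ ne l)) (lo≼hi i)) i≼b) (≼-trans b≼B Bq)
            (λ c u v → old c (≼-trans i≼b u , ≼-trans v fq)) r
      in z , y , x , Yy , Xx , r₁ , r₂
      where
      ascend : ∀ {p q} → p ∈ _ → q ∈ _ → p ≢ q → ¬ proj₂ q ⊲ proj₂ p → lo (proj₂ p) ≼ lo (proj₂ q)
      ascend {p} {q} p∈ q∈ ne n with cmp₂ p∈ q∈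
      ... | inj₁ e = ⊥-elim (ne e)
      ... | inj₂ (inj₁ r) = ≼-trans (lo≼hi (proj₂ p)) (⊲⇒≼ {proj₂ p} {proj₂ q} r)
      ... | inj₂ (inj₂ r) = ⊥-elim (n r)
    ... | inj₂ B≼b = through b (p ∷ back) (subst (_≤ suc (length back)) (sym e) (s≤s lb)) (sub ∘ sb) (AllPairs.map (λ (a , c , _) → a , c) (pb ∷ pbs)) λ {q} q∈ →
      let p∈ = sub (sb (here refl)) ; q∈′ = sub (sb q∈)
          (_ , _ , ((y , x , Yy , Xx , r) , _) , qB , Bq) = ok q∈′
          (iq , fq) = above q∈
          (z , r₁ , r₂) = factorˡ (≼-trans qB B≼b) (≼-trans b≼f fq)
            (λ c u v → old c (≼-trans iq u , ≼-trans v b≼f)) r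
      in z , y , x , Yy , Xx , r₁ , r₂
      where
      above : ∀ {q} → q ∈ (p ∷ back) → hi i ≼ hi (proj₁ q) × lo f ≼ lo (proj₂ q)
      above (here refl) = ≼-refl , ≼-refl
      above {q} (there q∈) with All.lookup pb q∈
      ... | ne , l , n = ≼-trans (⊲⇒≼ {i} {proj₁ q} (forward (sub (sb (here refl))) (sub (sb (there q∈))) ne l)) (lo≼hi (proj₁ q)) , up
        where
        up : lo f ≼ lo (proj₂ q)
        up with cmp₂ (sub₂ (sb (here refl))) (sub₂ (sb (there q∈)))
        ... | inj₁ e = ⊥-elim (ne e)
        ... | inj₂ (inj₁ r) = ≼-trans (lo≼hi f) (⊲⇒≼ {f} {proj₂ q} r)
        ... | inj₂ (inj₂ r) = ⊥-elim (n r)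

opaque
  φ-limit : ℕ → ℕ
  φ-limit w = suc w ^ 5 * suc w ^ 12

  φ-limit-def : ∀ w → φ-limit w ≡ suc w ^ 5 * suc w ^ 12
  φ-limit-def w = refl

module FirstFitBound {w m} {S : LevelSystem w m} {Nd} (F : NodeFamily S Nd) (0<w : 1 ≤ w)
  (colour : Nd → ℕ)
  (grundy : ∀ {N} → N ∈ NodeFamily.nodes F → ∀ k → k < colour N →
    ∃[ M ] M ∈ NodeFamily.nodes F × (Relations.E F N M ⊎ Relations.E F M N) × colour M ≡ k) where
  open LevelSystem S
  open Relations F
  open FirstFit F 0<w

  private
    drop : ℕ
    drop = P^ 12

  private
    descend₀ : ∀ {v} → v ∈ nodes → drop ≤ colour v → ∃[ v′ ] ∃[ e ] v′ ∈ nodes × e ∈ nodes × E v e × E v v′ ×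
      colour v ≤ drop + colour v′ × (∀ {f} → f ∈ nodes → E v′ f → ¬ lo e ≼ lo f)
    descend₀ {v} v∈ le = extract ys ys-long ys-pairs ys-up
      where
      k : Fin drop → ℕ
      k j = colour v ∸ suc (toℕ j)
      k< : ∀ j → k j < colour v
      k< j = ℕ.∸-monoʳ-< {m = colour v} {n = suc (toℕ j)} {o = 0} (s≤s z≤n) (ℕ.≤-trans (Fin.toℕ<n j) le)
      g : Fin drop → Nd
      g j = proj₁ (grundy v∈ (k j) (k< j))
      g∈ : ∀ j → g j ∈ nodes
      g∈ j = proj₁ (proj₂ (grundy v∈ (k j) (k< j)))
      adj : ∀ j → E v (g j) ⊎ E (g j) v
      adj j = proj₁ (proj₂ (proj₂ (grundy v∈ (k j) (k< j))))
      col : ∀ j → colour (g j) ≡ k j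
      col j = proj₂ (proj₂ (proj₂ (grundy v∈ (k j) (k< j))))
      g-inj : ∀ {i j} → g i ≡ g j → i ≡ j
      g-inj {i} {j} e = Fin.toℕ-injective (ℕ.suc-injective (ℕ.∸-cancelˡ-≡
        (ℕ.≤-trans (Fin.toℕ<n i) le) (ℕ.≤-trans (Fin.toℕ<n j) le) (trans (sym (col i)) (trans (cong colour e) (col j)))))
      js = allFin drop
      up? = λ j → E? v (g j)
      uppers = filter up? js
      lowers = filter (λ j → ¬? (up? j)) js
      few : length lowers ≤ w
      few = below-few g v lowers (Unique.filter⁺ (λ j → ¬? (up? j)) (Unique-allFin drop)) (λ _ _ → g-inj)
        λ {j} j∈ → g∈ j , [ (λ h → ⊥-elim (proj₂ (∈-filter⁻ (λ j → ¬? (up? j)) {xs = js} j∈) h)) , id ]′ (adj j)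
      many : P^ 9 * W * W ≤ length uppers
      many = ℕ.≤-trans (pow² 9) (ℕ.+-cancelʳ-≤ (P^ 11) _ _ (ℕ.≤-trans (pow+pow 11)
        (ℕ.≤-trans (ℕ.≤-reflexive (trans (sym (length-tabulate id)) (filter-split up? js)))
          (ℕ.+-monoʳ-≤ (length uppers) (ℕ.≤-trans few (ℕ.≤-trans (ℕ.n≤1+n w) (W≤pow 10)))))))
      chn = chain Fin._≟_ g uppers (Unique.filter⁺ up? (Unique-allFin drop)) (λ _ _ → g-inj) (λ _ → g∈ _) (P^ 9) (pos 9) many
      ys = proj₁ chn
      ys-long : P^ 8 + P^ 8 ≤ length ys
      ys-long = ℕ.≤-trans (pow+pow 8) (ℕ.≤-reflexive (sym (proj₁ (proj₂ chn))))
      ys-up : ∀ {j} → j ∈ ys → E v (g j)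
      ys-up j∈ = proj₂ (∈-filter⁻ up? {xs = js} (proj₁ (proj₂ (proj₂ chn)) j∈))
      ys-pairs = proj₂ (proj₂ (proj₂ chn))
      Result = ∃[ v′ ] ∃[ e ] v′ ∈ nodes × e ∈ nodes × E v e × E v v′ ×
        colour v ≤ drop + colour v′ × (∀ {f} → f ∈ nodes → E v′ f → ¬ lo e ≼ lo f)
      extract : ∀ ys → P^ 8 + P^ 8 ≤ length ys → AllPairs (λ x y → x ≢ y × g y ⊲ g x) ys → (∀ {j} → j ∈ ys → E v (g j)) → Result
      extract [] l _ _ = case ℕ.≤-trans (pos 8) (ℕ.≤-trans (ℕ.m≤m+n _ _) l) of λ ()
      extract (e ∷ ys) l (he ∷ ps) up with Any.any? inner? ys
        where
        inner? : ∀ j → Dec (All (λ f → E (g j) f → ¬ lo (g e) ≼ lo f) nodes)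
        inner? j = All.all? (λ f → E? (g j) f →-dec ¬? (lo (g e) ≼? lo f)) nodes
      ... | yes found = let (j , j∈ , h) = find found in
        g j , g e , g∈ j , g∈ e , up (here refl) , up (there j∈) ,
        ℕ.≤-trans (ℕ.m≤n+m∸n (colour v) (suc (toℕ j))) (ℕ.+-mono-≤ (Fin.toℕ<n j) (ℕ.≤-reflexive (sym (col j)))) ,
        All.lookup h
      ... | no none = ⊥-elim (crossing (lo (g e)) pairs pairs-unique pairs-inj ok cmp long)
        where
        escape : ∀ j → j ∈ ys → ∃[ f ] f ∈ nodes × E (g j) f × lo (g e) ≼ lo f
        escape j j∈ with Any.any? (λ f → E? (g j) f ×-dec (lo (g e) ≼? lo f)) nodes
        ... | yes q = let (f , f∈ , a , b) = find q in f , f∈ , a , b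
        ... | no nq = ⊥-elim (none (lose j∈ (All.tabulate λ f∈ a b → nq (lose f∈ (a , b)))))
        pick : Fin drop → Nd
        pick j with Any.any? (j Fin.≟_) ys
        ... | yes j∈ = proj₁ (escape j j∈)
        ... | no _ = v
        pick-ok : ∀ {j} → j ∈ ys → pick j ∈ nodes × E (g j) (pick j) × lo (g e) ≼ lo (pick j)
        pick-ok {j} j∈ with Any.any? (j Fin.≟_) ys
        ... | yes j∈ = proj₂ (escape j j∈)
        ... | no n = ⊥-elim (n j∈)
        pairs = map (λ j → g j , pick j) ys
        uys : Unique ys
        uys = AllPairs⇒Unique (λ h → proj₁ h refl) ps
        pairs-unique : Unique pairs
        pairs-unique = Unique-map (λ _ _ q → g-inj (cong proj₁ q)) uys
        pairs-inj : InjOn proj₁ pairs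
        pairs-inj a b q with ∈-map⁻ _ a | ∈-map⁻ _ b
        ... | j , _ , refl | j′ , _ , refl with refl ← g-inj q = refl
        ok : ∀ {i f} → (i , f) ∈ pairs → i ∈ nodes × f ∈ nodes × E i f × hi i ≼ lo (g e) × lo (g e) ≼ lo f
        ok a with ∈-map⁻ _ a
        ... | j , j∈ , refl = let (p , q , r) = pick-ok j∈ in g∈ j , p , q , ⊲⇒≼ {g j} {g e} (proj₂ (All.lookup he j∈)) , r
        cmp : ∀ {p q} → p ∈ pairs → q ∈ pairs → p ≡ q ⊎ proj₁ p ⊲ proj₁ q ⊎ proj₁ q ⊲ proj₁ p
        cmp a b with ∈-map⁻ _ a | ∈-map⁻ _ b
        ... | j , j∈ , refl | j′ , j∈′ , refl with chain-either {π = g} ps j∈ j∈′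
        ...   | inj₁ refl = inj₁ refl
        ...   | inj₂ r = inj₂ r
        long : P^ 8 ≤ length pairs
        long = subst (P^ 8 ≤_) (sym (length-map _ ys)) (ℕ.≤-pred (ℕ.≤-trans (ℕ.+-monoˡ-≤ (P^ 8) (pos 8)) l))

  opaque
    descend : ∀ {v} → v ∈ nodes → drop ≤ colour v → ∃[ v′ ] ∃[ e ] v′ ∈ nodes × e ∈ nodes × E v e × E v v′ ×
      colour v ≤ drop + colour v′ × (∀ {f} → f ∈ nodes → E v′ f → ¬ lo e ≼ lo f)
    descend = descend₀

  Nested : Pair → Pair → Set
  Nested (v , e) (v′ , e′) = hi v ≼ lo v′ × ¬ lo e ≼ lo e′

  private
    ≼-of-⋡ : ∀ {a b} → ¬ a ≼ b → b ≼ a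
    ≼-of-⋡ {a} {b} n = [ (λ l → ⊥-elim (n l)) , id ]′ (≼-total a b)

  nested : ∀ n {v} (P : Nd → Set) → (∀ {e f} → P e → ¬ lo e ≼ lo f → P f) →
    v ∈ nodes → n * drop ≤ colour v → (∀ {f} → f ∈ nodes → E v f → P f) →
    ∃[ ps ] length ps ≡ n × AllPairs Nested ps ×
      (∀ {u e} → (u , e) ∈ ps → u ∈ nodes × e ∈ nodes × E u e × P e × (u ≡ v ⊎ hi v ≼ lo u))
  nested zero P mono v∈ le h = [] , refl , [] , λ ()
  nested (suc n) {v} P mono v∈ le h
    with v′ , e , v′∈ , e∈ , Eve , Evv′ , c , inner ← descend v∈ (ℕ.≤-trans (ℕ.m≤m+n drop _) le)
    with ps , len , pairs , ok ← nested n (λ f → ¬ lo e ≼ lo f) (λ p q r → p (≼-trans r (≼-of-⋡ q)))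
      v′∈ (ℕ.+-cancelˡ-≤ drop _ _ (ℕ.≤-trans le c)) inner
    = (v , e) ∷ ps , cong suc len , All.tabulate (λ {q} q∈ → let (_ , _ , _ , a , b) = ok q∈ in above b , a) ∷ pairs ,
      λ { (here refl) → v∈ , e∈ , Eve , h e∈ Eve , inj₁ refl
        ; (there q∈) → let (a , b , c , d , f) = ok q∈ in a , b , c , mono (h e∈ Eve) d , inj₂ (above f) }
    where
    above : ∀ {u} → u ≡ v′ ⊎ hi v′ ≼ lo u → hi v ≼ lo u
    above (inj₁ refl) = ⇝⇒≼ {v} {v′} (proj₁ Evv′)
    above (inj₂ l) = ≼-trans (⇝⇒≼ {v} {v′} (proj₁ Evv′)) (≼-trans (lo≼hi v′) l)

  colour-bound : ∀ {v} → v ∈ nodes → colour v < P^ 5 * P^ 12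
  colour-bound {v} v∈ with suc (colour v) ℕ.≤? P^ 5 * P^ 12
  ... | yes l = l
  ... | no n = ⊥-elim (go (nested (P^ 5) (λ _ → ⊤) (λ _ _ → tt) v∈ (ℕ.≤-pred (ℕ.≰⇒> n)) (λ _ _ → tt)))
    where
    go : ¬ (∃[ ps ] length ps ≡ P^ 5 × AllPairs Nested ps ×
      (∀ {u e} → (u , e) ∈ ps → u ∈ nodes × e ∈ nodes × E u e × ⊤ × (u ≡ v ⊎ hi v ≼ lo u)))
    go (ps , len , pairs , ok) = ℕ.<-irrefl refl (ℕ.≤-trans (ℕ.≤-reflexive (trans (sym P^1) (sym (proj₁ (proj₂ chain₂))))) few)
      where
      irr : ∀ {p} → ¬ Nested p p
      irr (_ , n) = n ≼-refl
      inj₁ⁿ : InjOn proj₁ ps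
      inj₁ⁿ a b e = case AllPairs-lookup pairs a b of λ
        { (inj₁ r) → r
        ; (inj₂ (inj₁ (l , _))) → ⊥-elim (hi⋠lo _ (subst (λ u → hi u ≼ lo _) e l))
        ; (inj₂ (inj₂ (l , _))) → ⊥-elim (hi⋠lo _ (subst (λ u → hi _ ≼ lo u) e l)) }
      chain₁ = chain _≟ᴾ_ proj₁ ps (AllPairs⇒Unique irr pairs) inj₁ⁿ (proj₁ ∘ ok) (P^ 3) (pos 3) (ℕ.≤-trans (pow² 3) (ℕ.≤-reflexive (sym len)))
      qs = proj₁ chain₁
      sq = proj₁ (proj₂ (proj₂ chain₁))
      inj₂ⁿ : InjOn proj₂ qs
      inj₂ⁿ a b e = case AllPairs-lookup pairs (sq a) (sq b) of λ
        { (inj₁ r) → r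
        ; (inj₂ (inj₁ (_ , n))) → ⊥-elim (n (subst (λ u → lo _ ≼ lo u) e ≼-refl))
        ; (inj₂ (inj₂ (_ , n))) → ⊥-elim (n (subst (λ u → lo _ ≼ lo u) (sym e) ≼-refl)) }
      chain₂ = chain _≟ᴾ_ proj₂ qs (AllPairs⇒Unique (λ h → proj₁ h refl) (proj₂ (proj₂ (proj₂ chain₁)))) inj₂ⁿ
        (λ q∈ → proj₁ (proj₂ (ok (sq q∈)))) (P^ 1) (pos 1) (ℕ.≤-trans (pow² 1) (ℕ.≤-reflexive (sym (proj₁ (proj₂ chain₁)))))
      rs = proj₁ chain₂
      sr = proj₁ (proj₂ (proj₂ chain₂))
      few : length rs ≤ w
      few = bound rs (proj₂ (proj₂ (proj₂ chain₂))) id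
        where
        bound : ∀ ts → AllPairs (λ p q → p ≢ q × proj₂ q ⊲ proj₂ p) ts → (∀ {p} → p ∈ ts → p ∈ rs) → length ts ≤ w
        bound [] _ _ = z≤n
        bound (p@(u , e) ∷ ts) (h ∷ pt) sub = below-few proj₁ e (p ∷ ts) (AllPairs⇒Unique (λ h → proj₁ h refl) (h ∷ pt))
          (λ a b → inj₁ⁿ (sq (sr (sub a))) (sq (sr (sub b)))) λ
          { (here refl) → let (a , _ , c , _) = ok p∈ in a , c
          ; {q} (there q∈) → let (a , _ , c , _) = ok (sq (sr (sub (there q∈)))) in a , conflict q∈ }
          where
          p∈ = sq (sr (sub (here refl)))
          conflict : ∀ {q} → q ∈ ts → E (proj₁ q) e
          conflict {q@(u′ , e′)} q∈ = case AllPairs-lookup pairs p∈ q∈′ of λ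
            { (inj₁ r) → ⊥-elim (ne r)
            ; (inj₂ (inj₂ (_ , n))) → ⊥-elim (n (≼-trans (lo≼hi e′) (⊲⇒≼ {e′} {e} s)))
            ; (inj₂ (inj₁ (l , _))) → E-trans {u} {u′} {e} (below l)
                (⊲-⇝-trans {u′} {e′} {e} (proj₁ (proj₁ (proj₂ (proj₂ (ok q∈′))))) s) (proj₂ (proj₁ (proj₂ (proj₂ (ok p∈))))) }
            where
            q∈′ = sq (sr (sub (there q∈)))
            ne = proj₁ (All.lookup h q∈)
            s = proj₂ (All.lookup h q∈)
            below : hi u ≼ lo u′ → u ⊲ u′
            below l = case chain-either {π = proj₁} (proj₂ (proj₂ (proj₂ chain₁))) (sr (sub (here refl))) (sr (sub (there q∈))) of λ
              { (inj₁ r) → ⊥-elim (ne r)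
              ; (inj₂ (inj₁ r)) → r
              ; (inj₂ (inj₂ r)) → ⊥-elim (hi⋠lo u (≼-trans l (≼-trans (lo≼hi u′) (⊲⇒≼ {u′} {u} r)))) }

  opaque
    unfolding φ-limit

    colour-limit : ∀ {v} → v ∈ nodes → colour v < φ-limit w
    colour-limit {v} v∈ = subst₂ (λ a b → colour v < a * b) (P^-def 5) (P^-def 12) (colour-bound v∈)

-- Growing systems: levels inserted one at a time between adjacent levels

record Link (w : ℕ) : Set where
  field
    edge? : Fin w → Fin w → Bool
    main : Permutation′ w
    main-edge : ∀ x → T (edge? x (main ⟨$⟩ʳ x))
    extend : ∀ {x z} → T (edge? x z) → ∃[ π ] (∀ v → T (edge? v (π ⟨$⟩ʳ v))) × π ⟨$⟩ʳ x ≡ z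

  Edge : Fin w → Fin w → Set
  Edge x z = T (edge? x z)

  Edge? : ∀ x z → Dec (Edge x z)
  Edge? x z = T? (edge? x z)

open Link public using (Edge; main; main-edge; extend; Edge?)

data Sys (w : ℕ) : ℕ → Set
below : ∀ {w m} → Sys w m → Fin m → Fin m → Set
Below : ∀ {w m} → Sys w m → Fin m → Fin w → Fin m → Fin w → Set

-- In `base` the levels are the top (zero) and the bottom (one), completely related.
-- `pt` is the element for whose sake the new level was inserted.
data Sys w where
  base : Sys w 2
  ins : ∀ {m} (S : Sys w m) (p s : Fin m) (p≼s : below S p s) (p≢s : p ≢ s) (adj : ∀ c → below S c p ⊎ below S s c)
    (L U : Link w) (refines : ∀ {x z y} → Edge L x z → Edge U z y → Below S p x s y) (pt : Fin w) → Sys w (suc m)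

below base zero zero = ⊤
below base zero (suc zero) = ⊥
below base (suc zero) b = ⊤
below (ins S p s _ _ _ _ _ _ _) zero zero = ⊤
below (ins S p s _ _ _ _ _ _ _) zero (suc b) = below S s b
below (ins S p s _ _ _ _ _ _ _) (suc a) zero = below S a p
below (ins S p s _ _ _ _ _ _ _) (suc a) (suc b) = below S a b

Below base zero x zero y = x ≡ y
Below base zero x (suc zero) y = ⊥
Below base (suc zero) x zero y = ⊤
Below base (suc zero) x (suc zero) y = x ≡ y
Below (ins S p s _ _ _ L U _ _) zero x zero y = x ≡ y
Below (ins S p s _ _ _ L U _ _) zero z (suc b) y = ∃[ x ] Edge U z x × Below S s x b y
Below (ins S p s _ _ _ L U _ _) (suc a) x zero z = ∃[ y ] Below S a x p y × Edge L y z
Below (ins S p s _ _ _ L U _ _) (suc a) x (suc b) y = Below S a x b y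

module _ {w : ℕ} where

  below? : ∀ {m} (S : Sys w m) a b → Dec (below S a b)
  below? base zero zero = yes tt
  below? base zero (suc zero) = no id
  below? base (suc zero) b = yes tt
  below? (ins S p s _ _ _ _ _ _ _) zero zero = yes tt
  below? (ins S p s _ _ _ _ _ _ _) zero (suc b) = below? S s b
  below? (ins S p s _ _ _ _ _ _ _) (suc a) zero = below? S a p
  below? (ins S p s _ _ _ _ _ _ _) (suc a) (suc b) = below? S a b

  Below? : ∀ {m} (S : Sys w m) a x b y → Dec (Below S a x b y)
  Below? base zero x zero y = x Fin.≟ y
  Below? base zero x (suc zero) y = no id
  Below? base (suc zero) x zero y = yes tt
  Below? base (suc zero) x (suc zero) y = x Fin.≟ y
  Below? (ins S p s _ _ _ L U _ _) zero x zero y = x Fin.≟ y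
  Below? (ins S p s _ _ _ L U _ _) zero z (suc b) y = Fin.any? λ x → Edge? U z x ×-dec Below? S s x b y
  Below? (ins S p s _ _ _ L U _ _) (suc a) x zero z = Fin.any? λ y → Below? S a x p y ×-dec Edge? L y z
  Below? (ins S p s _ _ _ L U _ _) (suc a) x (suc b) y = Below? S a x b y

  below-refl : ∀ {m} (S : Sys w m) a → below S a a
  below-refl base zero = tt
  below-refl base (suc zero) = tt
  below-refl (ins _ _ _ _ _ _ _ _ _ _) zero = tt
  below-refl (ins S _ _ _ _ _ _ _ _ _) (suc a) = below-refl S a

  below-trans : ∀ {m} (S : Sys w m) a b c → below S a b → below S b c → below S a c
  below-antisym : ∀ {m} (S : Sys w m) a b → below S a b → below S b a → a ≡ b

  below-trans base zero zero c _ q = q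
  below-trans base zero (suc zero) c () q
  below-trans base (suc zero) b c _ _ = tt
  below-trans (ins _ _ _ _ _ _ _ _ _ _) zero zero c p q = q
  below-trans (ins _ _ _ _ _ _ _ _ _ _) zero (suc b) zero _ _ = tt
  below-trans (ins S _ s _ _ _ _ _ _ _) zero (suc b) (suc c) p q = below-trans S s b c p q
  below-trans (ins _ _ _ _ _ _ _ _ _ _) (suc a) zero zero p q = p
  below-trans (ins S p s p≼s _ _ _ _ _ _) (suc a) zero (suc c) l r = below-trans S a p c l (below-trans S p s c p≼s r)
  below-trans (ins S p _ _ _ _ _ _ _ _) (suc a) (suc b) zero l r = below-trans S a b p l r
  below-trans (ins S _ _ _ _ _ _ _ _ _) (suc a) (suc b) (suc c) l r = below-trans S a b c l r

  below-antisym base zero zero _ _ = refl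
  below-antisym base (suc zero) (suc zero) _ _ = refl
  below-antisym base (suc zero) zero _ ()
  below-antisym base zero (suc zero) ()
  below-antisym (ins _ _ _ _ _ _ _ _ _ _) zero zero _ _ = refl
  below-antisym (ins S p s p≼s p≢s _ _ _ _ _) zero (suc b) l r = ⊥-elim (p≢s (below-antisym S p s p≼s (below-trans S s b p l r)))
  below-antisym (ins S p s p≼s p≢s _ _ _ _ _) (suc a) zero l r = ⊥-elim (p≢s (below-antisym S p s p≼s (below-trans S s a p r l)))
  below-antisym (ins S _ _ _ _ _ _ _ _ _) (suc a) (suc b) l r = cong suc (below-antisym S a b l r)

  s⋠p : ∀ {m} (S : Sys w m) {p s} → below S p s → p ≢ s → ¬ below S s p
  s⋠p S l ne r = ne (below-antisym S _ _ l r)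

  below-total : ∀ {m} (S : Sys w m) a b → below S a b ⊎ below S b a
  below-total base zero zero = inj₁ tt
  below-total base zero (suc zero) = inj₂ tt
  below-total base (suc zero) b = inj₁ tt
  below-total (ins _ _ _ _ _ _ _ _ _ _) zero zero = inj₁ tt
  below-total (ins S p s _ _ adj _ _ _ _) zero (suc b) = [ inj₂ , inj₁ ]′ (adj b)
  below-total (ins S p s _ _ adj _ _ _ _) (suc a) zero = adj a
  below-total (ins S _ _ _ _ _ _ _ _ _) (suc a) (suc b) = below-total S a b

  Below⇒below : ∀ {m} (S : Sys w m) a x b y → Below S a x b y → below S a b
  Below⇒below base zero x zero y _ = tt
  Below⇒below base (suc zero) x b y _ = tt
  Below⇒below base zero x (suc zero) y ()
  Below⇒below (ins _ _ _ _ _ _ _ _ _ _) zero x zero y _ = tt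
  Below⇒below (ins S p s _ _ _ _ _ _ _) zero x (suc b) y (v , _ , l) = Below⇒below S s v b y l
  Below⇒below (ins S p s _ _ _ _ _ _ _) (suc a) x zero y (v , l , _) = Below⇒below S a x p v l
  Below⇒below (ins S _ _ _ _ _ _ _ _ _) (suc a) x (suc b) y l = Below⇒below S a x b y l

  Below-refl : ∀ {m} (S : Sys w m) a x → Below S a x a x
  Below-refl base zero x = refl
  Below-refl base (suc zero) x = refl
  Below-refl (ins _ _ _ _ _ _ _ _ _ _) zero x = refl
  Below-refl (ins S _ _ _ _ _ _ _ _ _) (suc a) x = Below-refl S a x

  Below-eq : ∀ {m} (S : Sys w m) a x y → Below S a x a y → x ≡ y
  Below-eq base zero x y e = e
  Below-eq base (suc zero) x y e = e
  Below-eq (ins _ _ _ _ _ _ _ _ _ _) zero x y e = e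
  Below-eq (ins S _ _ _ _ _ _ _ _ _) (suc a) x y l = Below-eq S a x y l

  Below-trans : ∀ {m} (S : Sys w m) a x b y c z → Below S a x b y → Below S b y c z → Below S a x c z
  Below-trans base zero x zero y c z refl q = q
  Below-trans base zero x (suc zero) y c z () q
  Below-trans base (suc zero) x zero y zero z p refl = tt
  Below-trans base (suc zero) x zero y (suc zero) z p ()
  Below-trans base (suc zero) x (suc zero) y c z refl q = q
  Below-trans (ins _ _ _ _ _ _ _ _ _ _) zero x zero y c z refl q = q
  Below-trans (ins S p s p≼s p≢s _ _ _ _ _) zero x (suc b) y zero z (u , _ , l) (v , r , _) =
    ⊥-elim (s⋠p S p≼s p≢s (below-trans S s b p (Below⇒below S s u b y l) (Below⇒below S b y p v r)))
  Below-trans (ins S _ s _ _ _ _ _ _ _) zero x (suc b) y (suc c) z (u , e , l) r = u , e , Below-trans S s u b y c z l r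
  Below-trans (ins _ _ _ _ _ _ _ _ _ _) (suc a) x zero y zero z l refl = l
  Below-trans (ins S p s _ _ _ _ _ ref _) (suc a) x zero y (suc c) z (u , l , e) (v , f , r) =
    Below-trans S a x p u c z l (Below-trans S p u s v c z (ref e f) r)
  Below-trans (ins S p _ _ _ _ _ _ _ _) (suc a) x (suc b) y zero z l (v , r , e) = v , Below-trans S a x b y p v l r , e
  Below-trans (ins S _ _ _ _ _ _ _ _ _) (suc a) x (suc b) y (suc c) z l r = Below-trans S a x b y c z l r

  Below-matching : ∀ {m} (S : Sys w m) a x b y → Below S a x b y → ∃[ π ] (∀ z → Below S a z b (π ⟨$⟩ʳ z)) × π ⟨$⟩ʳ x ≡ y
  Below-matching base zero x zero y e = Perm.id , (λ z → refl) , e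
  Below-matching base zero x (suc zero) y ()
  Below-matching base (suc zero) x zero y _ = transpose x y , (λ _ → tt) , transpose-to x y
    where
    transpose-to : ∀ (x y : Fin w) → transpose x y ⟨$⟩ʳ x ≡ y
    transpose-to x y with x Fin.≟ x
    ... | yes _ = refl
    ... | no n = ⊥-elim (n refl)
  Below-matching base (suc zero) x (suc zero) y e = Perm.id , (λ z → refl) , e
  Below-matching (ins _ _ _ _ _ _ _ _ _ _) zero x zero y e = Perm.id , (λ z → refl) , e
  Below-matching (ins S _ s _ _ _ _ U _ _) zero x (suc b) y (u , e , l)
    with π , h , q ← extend U e | ρ , k , r ← Below-matching S s u b y l =
    π ∘ₚ ρ , (λ z → π ⟨$⟩ʳ z , h z , k _) , trans (cong (ρ ⟨$⟩ʳ_) q) r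
  Below-matching (ins S p _ _ _ _ L _ _ _) (suc a) x zero y (u , l , e)
    with π , h , q ← extend L e | ρ , k , r ← Below-matching S a x p u l =
    ρ ∘ₚ π , (λ z → ρ ⟨$⟩ʳ z , k z , h _) , trans (cong (π ⟨$⟩ʳ_) r) q
  Below-matching (ins S _ _ _ _ _ _ _ _ _) (suc a) x (suc b) y l = Below-matching S a x b y l

  -- Threads above the new level are relabelled so that they continue through the two main matchings.
  threads : ∀ {m} → Sys w m → Fin m → Permutation′ w
  threads base a = Perm.id
  threads (ins S p s _ _ _ L U _ _) zero = threads S p ∘ₚ main L
  threads (ins S p s _ _ _ L U _ _) (suc a) with below? S a p
  ... | yes _ = threads S a
  ... | no _ = threads S p ∘ₚ main L ∘ₚ main U ∘ₚ flip (threads S s) ∘ₚ threads S a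

  rethread : ∀ {m} (S : Sys w m) {a b} (π ρ : Permutation′ w) → (∀ i → Below S a (π ⟨$⟩ʳ i) b (ρ ⟨$⟩ʳ i)) →
    ∀ v → Below S a v b (ρ ⟨$⟩ʳ (π ⟨$⟩ˡ v))
  rethread S {a} {b} π ρ h v = subst (λ u → Below S a u b (ρ ⟨$⟩ʳ (π ⟨$⟩ˡ v))) (inverseʳ π) (h (π ⟨$⟩ˡ v))

  threads-Below : ∀ {m} (S : Sys w m) a b → below S a b → ∀ i → Below S a (threads S a ⟨$⟩ʳ i) b (threads S b ⟨$⟩ʳ i)
  threads-Below base zero zero _ i = refl
  threads-Below base (suc zero) zero _ i = tt
  threads-Below base zero (suc zero) ()
  threads-Below base (suc zero) (suc zero) _ i = refl
  threads-Below (ins _ _ _ _ _ _ _ _ _ _) zero zero _ i = refl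
  threads-Below (ins S p s p≼s p≢s _ L U _ _) zero (suc b) l i with below? S b p
  ... | yes r = ⊥-elim (s⋠p S p≼s p≢s (below-trans S s b p l r))
  ... | no _ = _ , main-edge U _ , rethread S (threads S s) (threads S b) (threads-Below S s b l) _
  threads-Below (ins S p s _ _ _ L U _ _) (suc a) zero l i with below? S a p
  ... | yes r = _ , threads-Below S a p l i , main-edge L _
  ... | no n = ⊥-elim (n l)
  threads-Below (ins S p s p≼s _ adj L U ref _) (suc a) (suc b) l i with below? S a p | below? S b p
  ... | yes r | yes _ = threads-Below S a b l i
  ... | no n | yes r = ⊥-elim (n (below-trans S a b p l r))
  ... | no _ | no _ = threads-Below S a b l _
  ... | yes r | no n = Below-trans S a _ p _ b _ (threads-Below S a p r i)
      (Below-trans S p _ s _ b _ (ref (main-edge L _) (main-edge U _))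
        (rethread S (threads S s) (threads S b) (threads-Below S s b ([ (λ q → ⊥-elim (n q)) , id ]′ (adj b))) _))

  Below-factorʳ : ∀ {m} (S : Sys w m) a b e x y → below S a b → below S b e → (∀ c → below S b c → below S c e → c Fin.≤ b) →
    Below S a x e y → ∃[ z ] Below S a x b z × Below S b z e y
  Below-factorʳ S a zero e x y p q h l with h e q (below-refl S e)
  Below-factorʳ S a zero zero x y p q h l | z≤n = y , l , Below-refl S zero y
  Below-factorʳ base (suc zero) (suc zero) e x y p q h l = x , refl , l
  Below-factorʳ (ins S p s p≼s p≢s _ _ _ _ _) zero (suc b) zero x y l r h _ = ⊥-elim (s⋠p S p≼s p≢s (below-trans S s b p l r))
  Below-factorʳ (ins S p s _ _ _ _ _ _ _) zero (suc b) (suc e) x y l r h (u , f , k)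
    with z , k₁ , k₂ ← Below-factorʳ S s b e u y l r (λ c u v → ℕ.≤-pred (h (suc c) u v)) k = z , (u , f , k₁) , k₂
  Below-factorʳ (ins S p s _ _ _ _ _ _ _) (suc a) (suc b) zero x y l r h (u , k , f)
    with z , k₁ , k₂ ← Below-factorʳ S a b p x u l r (λ c u v → ℕ.≤-pred (h (suc c) u v)) k = z , k₁ , u , k₂ , f
  Below-factorʳ (ins S _ _ _ _ _ _ _ _ _) (suc a) (suc b) (suc e) x y l r h k =
    Below-factorʳ S a b e x y l r (λ c u v → ℕ.≤-pred (h (suc c) u v)) k

  Below-factorˡ : ∀ {m} (S : Sys w m) a b e x y → below S a b → below S b e → (∀ c → below S a c → below S c b → c Fin.≤ b) →
    Below S a x e y → ∃[ z ] Below S a x b z × Below S b z e y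
  Below-factorˡ S a zero e x y p q h l with h a (below-refl S a) p
  Below-factorˡ S zero zero e x y p q h l | z≤n = x , Below-refl S zero x , l
  Below-factorˡ base (suc zero) (suc zero) e x y p q h l = x , refl , l
  Below-factorˡ (ins S p s p≼s p≢s _ _ _ _ _) zero (suc b) zero x y l r h _ = ⊥-elim (s⋠p S p≼s p≢s (below-trans S s b p l r))
  Below-factorˡ (ins S p s _ _ _ _ _ _ _) zero (suc b) (suc e) x y l r h (u , f , k)
    with z , k₁ , k₂ ← Below-factorˡ S s b e u y l r (λ c u v → ℕ.≤-pred (h (suc c) u v)) k = z , (u , f , k₁) , k₂
  Below-factorˡ (ins S p s _ _ _ _ _ _ _) (suc a) (suc b) zero x y l r h (u , k , f)
    with z , k₁ , k₂ ← Below-factorˡ S a b p x u l r (λ c u v → ℕ.≤-pred (h (suc c) u v)) k = z , k₁ , u , k₂ , f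
  Below-factorˡ (ins S _ _ _ _ _ _ _ _ _) (suc a) (suc b) (suc e) x y l r h k =
    Below-factorˡ S a b e x y l r (λ c u v → ℕ.≤-pred (h (suc c) u v)) k

  levelSystem : ∀ {m} → Sys w m → LevelSystem w m
  levelSystem S = record
    { _≼_ = below S ; _≼?_ = below? S ; ≼-refl = λ {a} → below-refl S a
    ; ≼-trans = λ {a} {b} {c} → below-trans S a b c ; ≼-antisym = λ {a} {b} → below-antisym S a b ; ≼-total = below-total S
    ; Le = Below S ; Le? = Below? S ; Le⇒≼ = λ {a} {x} {b} {y} → Below⇒below S a x b y
    ; Le-refl = λ {a} {x} → Below-refl S a x ; Le-eq = λ {a} {x} {y} → Below-eq S a x y
    ; Le-trans = λ {a} {x} {b} {y} {c} {z} → Below-trans S a x b y c z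
    ; matching = λ {a} {x} {b} {y} → Below-matching S a x b y
    ; thread = threads S ; thread-Le = λ {a} {b} → threads-Below S a b
    ; factorʳ = λ {a} {b} {e} {x} {y} → Below-factorʳ S a b e x y ; factorˡ = λ {a} {b} {e} {x} {y} → Below-factorˡ S a b e x y }

-- Components of the relation between two levels

module Components {w m : ℕ} (S : Sys w m) (a b : Fin m) where

  Closed : Subset w → Set
  Closed U = ∀ x x′ y → Below S a x b y → Below S a x′ b y → x Sub.∈ U → x′ Sub.∈ U

  Conn : Fin w → Fin w → Set
  Conn x x′ = ∀ U → Closed U → x Sub.∈ U → x′ Sub.∈ U

  Closed? : ∀ U → Dec (Closed U)
  Closed? U = Fin.all? λ x → Fin.all? λ x′ → Fin.all? λ y →
    Below? S a x b y →-dec Below? S a x′ b y →-dec (x Sub.∈? U) →-dec (x′ Sub.∈? U)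

  opaque
    Conn? : ∀ x x′ → Dec (Conn x x′)
    Conn? x x′ = map′ (λ n U c u → decidable-stable (x′ Sub.∈? U) (λ v → n (U , c , u , v))) (λ h (U , c , u , v) → v (h U c u))
      (¬? (Sub.anySubset? λ U → Closed? U ×-dec (x Sub.∈? U) ×-dec ¬? (x′ Sub.∈? U)))

  conn-refl : ∀ {x} → Conn x x
  conn-refl U c u = u

  conn-trans : ∀ {x y z} → Conn x y → Conn y z → Conn x z
  conn-trans f g U c u = g U c (f U c u)

  conn-step : ∀ {x x′ y} → Below S a x b y → Below S a x′ b y → Conn x x′
  conn-step l l′ U c u = c _ _ _ l l′ u

  conn-sym : ∀ {x y} → Conn x y → Conn y x
  conn-sym {x} {y} f U c u with x Sub.∈? U
  ... | yes v = v
  ... | no v = ⊥-elim (Sub.x∈∁p⇒x∉p (f (Sub.∁ U) co (Sub.x∉p⇒x∈∁p v)) u)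
    where
    co : Closed (Sub.∁ U)
    co x x′ y l l′ h = Sub.x∉p⇒x∈∁p λ k → Sub.x∈∁p⇒x∉p h (c x′ x y l′ l k)

  conn-elim : {P : Fin w → Set} → (∀ x → Dec (P x)) →
    (∀ {x x′ y} → Below S a x b y → Below S a x′ b y → P x → P x′) → ∀ {x x′} → Conn x x′ → P x → P x′
  conn-elim {P} P? h f p = out (f U (λ x x′ y l l′ u → into (h l l′ (out u))) (into p))
    where
    U : Subset w
    U = Vec.tabulate (λ x → does (P? x))
    into : ∀ {x} → P x → x Sub.∈ U
    into {x} p = Vec.lookup⇒[]= x U (trans (Vec.lookup∘tabulate _ x) (does-true (P? x) p))
      where
      does-true : ∀ {Q : Set} (d : Dec Q) → Q → does d ≡ true
      does-true (yes _) _ = refl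
      does-true (no n) q = ⊥-elim (n q)
    out : ∀ {x} → x Sub.∈ U → P x
    out {x} u with P? x | trans (sym (Vec.lookup∘tabulate (λ x → does (P? x)) x)) (Vec.[]=⇒lookup u)
    ... | yes p | _ = p
    ... | no _ | ()

  opaque
    members : Fin w → List (Fin w)
    members x = filter (Conn? x) (allFin w)

    ∈-members : ∀ {x x′} → Conn x x′ → x′ ∈ members x
    ∈-members {x} f = ∈-filter⁺ (Conn? x) (∈-allFin _) f

    members-∈ : ∀ {x x′} → x′ ∈ members x → Conn x x′
    members-∈ {x} h = proj₂ (∈-filter⁻ (Conn? x) {xs = allFin w} h)

    members-cong : ∀ {x x′} → Conn x x′ → members x ≡ members x′
    members-cong {x} {x′} f = filter-≐ (Conn? x) (Conn? x′) (conn-trans (conn-sym f) , conn-trans f) (allFin w)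

    members-unique : ∀ x → Unique (members x)
    members-unique x = Unique.filter⁺ (Conn? x) (Unique-allFin w)

  csize : Fin w → ℕ
  csize x = length (members x)

  csize-cong : ∀ {x x′} → Conn x x′ → csize x ≡ csize x′
  csize-cong f = cong length (members-cong f)

  headOr : Fin w → List (Fin w) → Fin w
  headOr d [] = d
  headOr d (x ∷ _) = x

  -- The canonical element of the component of x.
  rep : Fin w → Fin w
  rep x = headOr x (members x)

  rep-conn : ∀ x → Conn x (rep x)
  rep-conn x = go (members x) members-∈
    where
    go : ∀ ys → (∀ {y} → y ∈ ys → Conn x y) → Conn x (headOr x ys)
    go [] h = conn-refl
    go (y ∷ ys) h = h (here refl)

  rep-cong : ∀ {x x′} → Conn x x′ → rep x ≡ rep x′
  rep-cong {x} {x′} f = go (members x) (members x′) (members-cong f) (∈-members conn-refl)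
    where
    go : ∀ ys zs → ys ≡ zs → x ∈ ys → headOr x ys ≡ headOr x′ zs
    go (y ∷ ys) _ refl _ = refl

open Components public using (Conn; Conn?; csize; rep)

opaque
  unfolding Components.members Components.Conn?

  csize-ins : ∀ {w m} {S : Sys w m} {p s p≼s p≢s adj L U} {ref : ∀ {x z y} → Edge L x z → Edge U z y → Below S p x s y} {pt} a b x →
    csize (ins S p s p≼s p≢s adj L U ref pt) (suc a) (suc b) x ≡ csize S a b x
  csize-ins a b x = refl

record Name {w m : ℕ} (S : Sys w m) : Set where
  constructor name
  field
    lo hi : Fin m
    root : Fin w
    .ordered : below S lo hi × lo ≢ hi

_≟ᴺᵃ_ : ∀ {w m} {S : Sys w m} → DecidableEquality (Name S)
name a b x _ ≟ᴺᵃ name a′ b′ x′ _ with a Fin.≟ a′ | b Fin.≟ b′ | x Fin.≟ x′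
... | yes refl | yes refl | yes refl = yes refl
... | no n | _ | _ = no λ { refl → n refl }
... | _ | no n | _ = no λ { refl → n refl }
... | _ | _ | no n = no λ { refl → n refl }

module Names {w m : ℕ} (S : Sys w m) where
  open LevelSystem (levelSystem S) public

  module _ (N : Name S) where
    open Name N

    lo-hi : lo ≼ hi
    lo-hi = recompute N
      where
      recompute : (N : Name S) → Name.lo N ≼ Name.hi N
      recompute (name a b _ o) with a ≼? b
      ... | yes l = l
      ... | no n = ⊥-elim-irr (n (proj₁ o))
        where
        ⊥-elim-irr : ∀ {A : Set} → .⊥ → A
        ⊥-elim-irr ()

    lo≢hi : lo ≢ hi
    lo≢hi = recompute N
      where
      recompute : (N : Name S) → Name.lo N ≢ Name.hi N
      recompute (name a b _ o) e = ⊥-elim-irr (proj₂ o e)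
        where
        ⊥-elim-irr : ∀ {A : Set} → .⊥ → A
        ⊥-elim-irr ()

    Bottom : Fin w → Set
    Bottom = Conn S lo hi root

    Top : Fin w → Set
    Top y = ∃[ x ] Bottom x × Below S lo x hi y

    Trace : Fin m → Fin w → Set
    Trace ℓ z = ∃[ x ] Bottom x × Below S lo x ℓ z

    size : ℕ
    size = csize S lo hi root

    node : Node (levelSystem S)
    node = record
      { lo = lo ; hi = hi ; lo≼hi = lo-hi ; hi⋠lo = λ l → lo≢hi (≼-antisym lo-hi l)
      ; X = Bottom ; Y = Top ; X? = Conn? S lo hi root ; Y? = λ y → Fin.any? λ x → Conn? S lo hi root x ×-dec Below? S lo x hi y
      ; closedʳ = λ {x} Xx l → x , Xx , l
      ; closedˡ = λ { (x , Xx , l) l′ → C.conn-trans Xx (C.conn-step l l′) }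
      ; connected = λ U V U? V? h Xx Xx′ u → proj₂ (C.conn-elim {P = λ v → Bottom v × U v} (λ v → Conn? S lo hi root v ×-dec U? v)
          (λ { l l′ (Xv , Uv) → let Xv′ = C.conn-trans Xv (C.conn-step l l′) in Xv′ , proj₂ (h Xv′ l′) (proj₁ (h Xv l) Uv) })
          (C.conn-trans (C.conn-sym Xx) Xx′) (Xx , u))
      ; inhabited = root , C.conn-refl }
      where module C = Components S lo hi

    trace-up : ∀ {a u b v} → Below S a u b v → Trace a u → Trace b v
    trace-up l (x , Xx , k) = x , Xx , Le-trans k l

    trace-down : ∀ {a u b v} → lo ≼ a → b ≼ hi → Below S a u b v → Trace b v → Trace a u
    trace-down {a} {u} {b} {v} lo≼a b≼hi l (x , Xx , k) = 
      _ , Node.closedˡ node (Node.closedʳ node Xx (Le-trans k (thread-up b≼hi v))) (Le-trans (thread-down lo≼a u) (Le-trans l (thread-up b≼hi v)))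
        , thread-down lo≼a u

    Contains : Fin m → Fin m → Fin w → Set
    Contains p s x = lo ≼ p × s ≼ hi × Trace p x

  Adjacent : Fin m → Fin m → Set
  Adjacent p s = p ≼ s × p ≢ s × (∀ c → c ≼ p ⊎ s ≼ c)

  successor : ∀ a c → a ≼ c → a ≢ c → ∃[ b ] Adjacent a b
  successor a c l ne = go above (∈-filter⁺ Q? (∈-allFin c) (l , ne)) (λ h → proj₂ (∈-filter⁻ Q? {xs = allFin m} h)) (λ q → ∈-filter⁺ Q? (∈-allFin _) q)
    where
    Q? = λ c → (a ≼? c) ×-dec ¬? (a Fin.≟ c)
    above = filter Q? (allFin m)
    go : ∀ xs → c ∈ xs → (∀ {x} → x ∈ xs → a ≼ x × a ≢ x) → (∀ {x} → a ≼ x × a ≢ x → x ∈ xs) → ∃[ b ] Adjacent a b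
    go (x ∷ xs) _ h k with b , b∈ , bl ← least _≼_ _≼?_ ≼-refl ≼-trans ≼-total x xs =
      b , proj₁ (h b∈) , proj₂ (h b∈) , λ d → side d (≼-total d a)
      where
      side : ∀ d → d ≼ a ⊎ a ≼ d → d ≼ a ⊎ b ≼ d
      side d (inj₁ l) = inj₁ l
      side d (inj₂ l) with a Fin.≟ d
      ... | yes refl = inj₁ ≼-refl
      ... | no n = inj₂ (All.lookup bl (k (l , n)))

-- The forest of instances: nodes in which the component shrank while its parent was still large

module Step {w′ m : ℕ} (r : ℕ) (S : Sys (suc w′) m) (p s : Fin m) (p≼s : below S p s) (p≢s : p ≢ s)
  (adj : ∀ c → below S c p ⊎ below S s c) (L U : Link (suc w′))
  (refines : ∀ {x z y} → Edge L x z → Edge U z y → Below S p x s y) (pt : Fin (suc w′))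
  (old : Fin m → Fin (suc w′) → Name S) where
  private
    w : ℕ
    w = suc w′


  S⁺ : Sys w (suc m)
  S⁺ = ins S p s p≼s p≢s adj L U refines pt

  wk : Name S → Name S⁺
  wk (name a b x o) = name (suc a) (suc b) x (proj₁ o , λ e → proj₂ o (Fin.suc-injective e))

  lowerName upperName : Fin w → Name S⁺
  lowerName x = name (suc p) zero (rep S⁺ (suc p) zero x) (below-refl S p , λ ())
  upperName z = name zero (suc s) (rep S⁺ zero (suc s) z) (below-refl S s , λ ())

  down : Fin w → Fin w
  down z = main L ⟨$⟩ˡ z

  Big : Name S → Set
  Big N = r < Names.size S N

  Freshˡ Freshʰ : Fin w → Set
  Freshˡ x = Big (old p x) × csize S⁺ (suc p) zero x < Names.size S (old p x)
  Freshʰ z = Big (old p (down z)) × csize S⁺ zero (suc s) z < Names.size S (old p (down z))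

  Freshˡ? : ∀ x → Dec (Freshˡ x)
  Freshˡ? x = (_ ℕ.<? _) ×-dec (_ ℕ.<? _)

  Freshʰ? : ∀ x → Dec (Freshʰ x)
  Freshʰ? x = (_ ℕ.<? _) ×-dec (_ ℕ.<? _)

  curˡ curʰ : Fin w → Name S⁺
  curˡ x with Freshˡ? x
  ... | yes _ = lowerName x
  ... | no _ = wk (old p x)
  curʰ z with Freshʰ? z
  ... | yes _ = upperName z
  ... | no _ = wk (old p (down z))

  cur⁺ : Fin (suc m) → Fin w → Name S⁺
  cur⁺ zero z = curʰ z
  cur⁺ (suc g) x with g Fin.≟ p
  ... | yes _ = curˡ x
  ... | no _ = wk (old g x)

current : ∀ {w′ m} (r : ℕ) (S : Sys (suc w′) m) → Fin m → Fin (suc w′) → Name S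
current r base _ _ = name (suc zero) zero zero (tt , λ ())
current r (ins S p s p≼s p≢s adj L U ref pt) = Step.cur⁺ r S p s p≼s p≢s adj L U ref pt (current r S)

InForest : ∀ {w′ m} (r : ℕ) (S : Sys (suc w′) m) → Name S → Set
InForest r base N = N ≡ current r base zero zero
InForest r (ins S p s p≼s p≢s adj L U ref pt) N =
  (∃[ M ] InForest r S M × N ≡ wk M) ⊎ (∃[ x ] Freshˡ x × N ≡ lowerName x) ⊎ (∃[ z ] Freshʰ z × N ≡ upperName z)
  where open Step r S p s p≼s p≢s adj L U ref pt (current r S)

record ForestInvariant {w′ m : ℕ} (r : ℕ) (S : Sys (suc w′) m) (cur : Fin m → Fin (suc w′) → Name S) (In : Name S → Set) : Set where
  open Names S
  field
    cur-in : ∀ {p s} → Adjacent p s → ∀ x → In (cur p x)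
    cur-contains : ∀ {p s} → Adjacent p s → ∀ x → Contains (cur p x) p s x
    cur-least : ∀ {p s} → Adjacent p s → ∀ {x N} → In N → Contains N p s x → size (cur p x) ≤ size N
    unique : ∀ {p s} → Adjacent p s → ∀ {x M N} → In M → In N → Contains M p s x → Contains N p s x → size M ≡ size N → M ≡ N
    cur-big : ∀ {p s} → Adjacent p s → ∀ x → r < size (cur p x) → csize S p s x ≡ size (cur p x)
    cur-cong : ∀ {p s} → Adjacent p s → ∀ {x x′} → Conn S p s x x′ → cur p x ≡ cur p x′

module StepProof {w′ m : ℕ} (r : ℕ) (S : Sys (suc w′) m) (p s : Fin m) (p≼s : below S p s) (p≢s : p ≢ s)
  (adj : ∀ c → below S c p ⊎ below S s c) (L U : Link (suc w′))
  (refines : ∀ {x z y} → Edge L x z → Edge U z y → Below S p x s y) (pt : Fin (suc w′))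
  (old : Fin m → Fin (suc w′) → Name S) (In : Name S → Set) (inv : ForestInvariant r S old In) where
  private
    w : ℕ
    w = suc w′

  open Step r S p s p≼s p≢s adj L U refines pt old
  private
    module O = Names S
    module N = Names S⁺
    module Cˡ = Components S⁺ (suc p) zero
    module Cʰ = Components S⁺ zero (suc s)
    module C = Components S p s
  open ForestInvariant inv

  In⁺ : Name S⁺ → Set
  In⁺ N = (∃[ M ] In M × N ≡ wk M) ⊎ (∃[ x ] Freshˡ x × N ≡ lowerName x) ⊎ (∃[ z ] Freshʰ z × N ≡ upperName z)

  gap : O.Adjacent p s
  gap = p≼s , p≢s , adj

  up-edge : ∀ z → Edge U z (main U ⟨$⟩ʳ z)
  up-edge = main-edge U

  down-edge : ∀ z → Edge L (down z) z
  down-edge z = subst (Edge L (down z)) (inverseʳ (main L)) (main-edge L (down z))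

  conn-lower : ∀ {x x′} → Cˡ.Conn x x′ → C.Conn x x′
  conn-lower {x} {x′} f = Cˡ.conn-elim {P = C.Conn x} (C.Conn? x)
    (λ { {u} {u′} {z} (v , l , e) (v′ , l′ , e′) h →
      let ll = edge {u} {v} l e ; ll′ = edge {u′} {v′} l′ e′ in C.conn-trans h (C.conn-step ll ll′) }) f C.conn-refl
    where
    edge : ∀ {u v z} → Below S p u p v → Edge L v z → Below S p u s (main U ⟨$⟩ʳ z)
    edge {u} {v} {z} l e with refl ← Below-eq S p u v l = refines e (up-edge z)

  conn-upper : ∀ {z z′} → Cʰ.Conn z z′ → C.Conn (down z) (down z′)
  conn-upper {z} {z′} f = Cʰ.conn-elim {P = λ u → C.Conn (down z) (down u)} (λ u → C.Conn? (down z) (down u))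
    (λ { {u} {u′} {y} (v , e , l) (v′ , e′ , l′) h → C.conn-trans h (C.conn-step (edge {u} {v} e l) (edge {u′} {v′} e′ l′)) }) f C.conn-refl
    where
    edge : ∀ {u v y} → Edge U u v → Below S s v s y → Below S p (down u) s y
    edge {u} {v} {y} e l with refl ← Below-eq S s v y l = refines (down-edge u) e

  csize-lower : ∀ x → Cˡ.csize x ≤ C.csize x
  csize-lower x = inj-length id (C.members x) (Cˡ.members-unique x) (λ _ _ → id)
    (λ h → C.∈-members (conn-lower (Cˡ.members-∈ h)))

  csize-upper : ∀ z → Cʰ.csize z ≤ C.csize (down z)
  csize-upper z = inj-length down (C.members (down z)) (Cʰ.members-unique z) (λ _ _ → perm-injective (flip (main L)))
    (λ h → C.∈-members (conn-upper (Cʰ.members-∈ h)))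

  size-lowerName : ∀ x → N.size (lowerName x) ≡ Cˡ.csize x
  size-lowerName x = sym (Cˡ.csize-cong (Cˡ.rep-conn x))

  size-upperName : ∀ z → N.size (upperName z) ≡ Cʰ.csize z
  size-upperName z = sym (Cʰ.csize-cong (Cʰ.rep-conn z))

  fresh-lower-cong : ∀ {x x′} → Cˡ.Conn x x′ → Freshˡ x → Freshˡ x′
  fresh-lower-cong f (b , l) = subst Big (cur-cong gap (conn-lower f)) b ,
    subst₂ _<_ (Cˡ.csize-cong f) (cong O.size (cur-cong gap (conn-lower f))) l

  fresh-upper-cong : ∀ {x x′} → Cʰ.Conn x x′ → Freshʰ x → Freshʰ x′
  fresh-upper-cong f (b , l) = subst Big (cur-cong gap (conn-upper f)) b ,
    subst₂ _<_ (Cʰ.csize-cong f) (cong O.size (cur-cong gap (conn-upper f))) l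

  -- The gap elements on either side of the new level lie in the same old nodes as their parent.
  data Side : Fin (suc m) → Fin (suc m) → Set where
    lower : Side (suc p) zero
    upper : Side zero (suc s)
    other : ∀ {a b} → a ≢ p → O.Adjacent a b → Side (suc a) (suc b)

  side : ∀ {a b} → N.Adjacent a b → Side a b
  side {zero} {zero} (_ , n , _) = ⊥-elim (n refl)
  side {suc a} {zero} (l , _ , h) with h (suc p)
  ... | inj₁ r = subst (λ q → Side (suc q) zero) (O.≼-antisym r l) lower
  ... | inj₂ r = ⊥-elim (s⋠p S p≼s p≢s r)
  side {zero} {suc b} (l , _ , h) with h (suc s)
  ... | inj₁ r = ⊥-elim (s⋠p S p≼s p≢s r)
  ... | inj₂ r = subst (λ q → Side zero (suc q)) (O.≼-antisym l r) upper
  side {suc a} {suc b} (l , n , h) = other not-p (l , n ∘ cong suc , λ c → h (suc c))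
    where
    not-p : a ≢ p
    not-p refl with h zero
    ... | inj₁ r = s⋠p S p≼s p≢s r
    ... | inj₂ r = n (cong suc (O.≼-antisym l r))

  wk-lower : ∀ N x → N.Contains (wk N) (suc p) zero x → O.Contains N p s x
  wk-lower (name _ _ _ _) x h = h

  wk-lower⁻¹ : ∀ N x → O.Contains N p s x → N.Contains (wk N) (suc p) zero x
  wk-lower⁻¹ (name _ _ _ _) x h = h

  wk-upper : ∀ N z → N.Contains (wk N) zero (suc s) z → O.Contains N p s (down z)
  wk-upper N@(name _ _ _ _) z (l , h , (x , Xx , (y , k , e))) = l , h ,
    O.trace-down N l h (refines (down-edge z) (up-edge z)) (O.trace-up N (refines e (up-edge z)) (x , Xx , k))

  wk-upper⁻¹ : ∀ N z → O.Contains N p s (down z) → N.Contains (wk N) zero (suc s) z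
  wk-upper⁻¹ (name _ _ _ _) z (l , h , (x , Xx , k)) = l , h , (x , Xx , (_ , k , down-edge z))

  csize-old : ∀ a b x → csize S⁺ (suc a) (suc b) x ≡ csize S a b x
  csize-old = csize-ins {S = S} {p} {s} {p≼s} {p≢s} {adj} {L} {U} {refines} {pt}

  size-wk : ∀ N → N.size (wk N) ≡ O.size N
  size-wk (name a b x _) = csize-old a b x

  lower-contains : ∀ x → N.Contains (lowerName x) (suc p) zero x
  lower-contains x = O.≼-refl , tt , x , Cˡ.conn-sym (Cˡ.rep-conn x) , Below-refl S p x

  upper-contains : ∀ z → N.Contains (upperName z) zero (suc s) z
  upper-contains z = tt , O.≼-refl , z , Cʰ.conn-sym (Cʰ.rep-conn z) , refl

  contains-lower : ∀ {x x′} → N.Contains (lowerName x′) (suc p) zero x → Cˡ.Conn x′ x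
  contains-lower {x} {x′} (_ , _ , (v , Xv , l)) with refl ← Below-eq S p v x l = Cˡ.conn-trans (Cˡ.rep-conn x′) Xv

  contains-upper : ∀ {x x′} → N.Contains (upperName x′) zero (suc s) x → Cʰ.Conn x′ x
  contains-upper {x} {x′} (_ , _ , (v , Xv , refl)) = Cʰ.conn-trans (Cʰ.rep-conn x′) Xv

  lower-eq : ∀ {x x′} → Cˡ.Conn x x′ → lowerName x ≡ lowerName x′
  lower-eq f = cong (λ v → name (suc p) zero v (below-refl S p , λ ())) (Cˡ.rep-cong f)

  upper-eq : ∀ {x x′} → Cʰ.Conn x x′ → upperName x ≡ upperName x′
  upper-eq f = cong (λ v → name zero (suc s) v (below-refl S s , λ ())) (Cʰ.rep-cong f)

  -- A node of the new forest over a new gap element is old or the fresh one.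
  locateˡ : ∀ {x N} → In⁺ N → N.Contains N (suc p) zero x →
    (∃[ M ] In M × N ≡ wk M × O.Contains M p s x) ⊎ (Freshˡ x × N ≡ lowerName x)
  locateˡ {x} (inj₁ (M , i , refl)) c = inj₁ (M , i , refl , wk-lower M x c)
  locateˡ (inj₂ (inj₁ (x′ , f , refl))) c = inj₂ (fresh-lower-cong (contains-lower c) f , lower-eq (contains-lower c))
  locateˡ (inj₂ (inj₂ (z , f , refl))) (l , _ , _) = ⊥-elim (s⋠p S p≼s p≢s l)

  locateʰ : ∀ {x N} → In⁺ N → N.Contains N zero (suc s) x →
    (∃[ M ] In M × N ≡ wk M × O.Contains M p s (down x)) ⊎ (Freshʰ x × N ≡ upperName x)
  locateʰ {x} (inj₁ (M , i , refl)) c = inj₁ (M , i , refl , wk-upper M x c)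
  locateʰ (inj₂ (inj₂ (x′ , f , refl))) c = inj₂ (fresh-upper-cong (contains-upper c) f , upper-eq (contains-upper c))
  locateʰ (inj₂ (inj₁ (z , f , refl))) (_ , l , _) = ⊥-elim (s⋠p S p≼s p≢s l)

  locate : ∀ {a b x N} → O.Adjacent a b → In⁺ N → N.Contains N (suc a) (suc b) x → ∃[ M ] In M × N ≡ wk M × O.Contains M a b x
  locate g (inj₁ (M@(name _ _ _ _) , i , refl)) c = M , i , refl , c
  locate {a} {b} (l , n , _) (inj₂ (inj₁ (x , f , refl))) (h , k , _) = ⊥-elim (n (O.≼-antisym l (O.≼-trans k h)))
  locate {a} {b} (l , n , _) (inj₂ (inj₂ (x , f , refl))) (h , k , _) = ⊥-elim (n (O.≼-antisym l (O.≼-trans k h)))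

  step-invariant : ForestInvariant r S⁺ cur⁺ In⁺
  step-invariant = record
    { cur-in = λ g x → in′ (side g) x ; cur-contains = λ g x → contains′ (side g) x
    ; cur-least = λ g i c → least′ (side g) i c ; unique = λ g i j c d e → unique′ (side g) i j c d e
    ; cur-big = λ g x b → big′ (side g) x b ; cur-cong = λ g f → cong′ (side g) f }
    where
    in′ : ∀ {a b} → Side a b → ∀ x → In⁺ (cur⁺ a x)
    in′ lower x with p Fin.≟ p
    ... | no n = ⊥-elim (n refl)
    ... | yes _ with Freshˡ? x
    ...   | yes f = inj₂ (inj₁ (x , f , refl))
    ...   | no _ = inj₁ (_ , cur-in gap x , refl)
    in′ upper z with Freshʰ? z
    ... | yes f = inj₂ (inj₂ (z , f , refl))
    ... | no _ = inj₁ (_ , cur-in gap _ , refl)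
    in′ (other {a} n g) x with a Fin.≟ p
    ... | yes e = ⊥-elim (n e)
    ... | no _ = inj₁ (_ , cur-in g x , refl)

    contains′ : ∀ {a b} → Side a b → ∀ x → N.Contains (cur⁺ a x) a b x
    contains′ lower x with p Fin.≟ p
    ... | no n = ⊥-elim (n refl)
    ... | yes _ with Freshˡ? x
    ...   | yes f = lower-contains x
    ...   | no _ = wk-lower⁻¹ (old p x) x (cur-contains gap x)
    contains′ upper z with Freshʰ? z
    ... | yes f = upper-contains z
    ... | no _ = wk-upper⁻¹ (old p (down z)) z (cur-contains gap (down z))
    contains′ (other {a} n g) x with a Fin.≟ p
    ... | yes e = ⊥-elim (n e)
    ... | no _ with old a x | cur-contains g x
    ...   | name _ _ _ _ | c = c

    least′ : ∀ {a b} → Side a b → ∀ {x N} → In⁺ N → N.Contains N a b x → N.size (cur⁺ a x) ≤ N.size N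
    least′ lower {x} i c with p Fin.≟ p
    ... | no n = ⊥-elim (n refl)
    ... | yes _ with Freshˡ? x | locateˡ i c
    ...   | no f | inj₂ (f′ , _) = ⊥-elim (f f′)
    ...   | yes f | inj₂ (_ , refl) = ℕ.≤-refl
    ...   | no f | inj₁ (M , j , refl , d) = subst₂ _≤_ (sym (size-wk (old p x))) (sym (size-wk M)) (cur-least gap j d)
    ...   | yes (_ , l) | inj₁ (M , j , refl , d) =
      subst₂ _≤_ (sym (size-lowerName x)) (sym (size-wk M)) (ℕ.≤-trans (ℕ.<⇒≤ l) (cur-least gap j d))
    least′ upper {x} i c with Freshʰ? x | locateʰ i c
    ... | no f | inj₂ (f′ , _) = ⊥-elim (f f′)
    ... | yes f | inj₂ (_ , refl) = ℕ.≤-refl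
    ... | no f | inj₁ (M , j , refl , d) = subst₂ _≤_ (sym (size-wk (old p (down x)))) (sym (size-wk M)) (cur-least gap j d)
    ... | yes (_ , l) | inj₁ (M , j , refl , d) =
      subst₂ _≤_ (sym (size-upperName x)) (sym (size-wk M)) (ℕ.≤-trans (ℕ.<⇒≤ l) (cur-least gap j d))
    least′ (other {a} n g) {x} i c with a Fin.≟ p
    ... | yes e = ⊥-elim (n e)
    ... | no _ with M , j , refl , d ← locate g i c = subst₂ _≤_ (sym (size-wk (old a x))) (sym (size-wk M)) (cur-least g j d)

    unique′ : ∀ {a b} → Side a b → ∀ {x M N} → In⁺ M → In⁺ N → N.Contains M a b x → N.Contains N a b x → N.size M ≡ N.size N → M ≡ N
    unique′ lower {x} i j c d e with locateˡ i c | locateˡ j d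
    ... | inj₁ (M , i′ , refl , c′) | inj₁ (N , j′ , refl , d′) =
      cong wk (unique gap i′ j′ c′ d′ (trans (sym (size-wk M)) (trans e (size-wk N))))
    ... | inj₂ (_ , refl) | inj₂ (_ , refl) = refl
    ... | inj₁ (M , i′ , refl , c′) | inj₂ ((_ , l) , refl) = ⊥-elim (ℕ.<-irrefl (sym (trans (sym (size-wk M)) (trans e (size-lowerName x))))
      (ℕ.<-≤-trans l (cur-least gap i′ c′)))
    ... | inj₂ ((_ , l) , refl) | inj₁ (M , i′ , refl , c′) = ⊥-elim (ℕ.<-irrefl (sym (trans (sym (size-wk M)) (trans (sym e) (size-lowerName x))))
      (ℕ.<-≤-trans l (cur-least gap i′ c′)))
    unique′ upper {x} i j c d e with locateʰ i c | locateʰ j d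
    ... | inj₁ (M , i′ , refl , c′) | inj₁ (N , j′ , refl , d′) =
      cong wk (unique gap i′ j′ c′ d′ (trans (sym (size-wk M)) (trans e (size-wk N))))
    ... | inj₂ (_ , refl) | inj₂ (_ , refl) = refl
    ... | inj₁ (M , i′ , refl , c′) | inj₂ ((_ , l) , refl) = ⊥-elim (ℕ.<-irrefl (sym (trans (sym (size-wk M)) (trans e (size-upperName x))))
      (ℕ.<-≤-trans l (cur-least gap i′ c′)))
    ... | inj₂ ((_ , l) , refl) | inj₁ (M , i′ , refl , c′) = ⊥-elim (ℕ.<-irrefl (sym (trans (sym (size-wk M)) (trans (sym e) (size-upperName x))))
      (ℕ.<-≤-trans l (cur-least gap i′ c′)))
    unique′ (other n g) i j c d e with locate g i c | locate g j d
    ... | M , i′ , refl , c′ | N , j′ , refl , d′ = cong wk (unique g i′ j′ c′ d′ (trans (sym (size-wk M)) (trans e (size-wk N))))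

    big′ : ∀ {a b} → Side a b → ∀ x → r < N.size (cur⁺ a x) → csize S⁺ a b x ≡ N.size (cur⁺ a x)
    big′ lower x b with p Fin.≟ p
    ... | no n = ⊥-elim (n refl)
    ... | yes _ with Freshˡ? x
    ...   | yes f = sym (size-lowerName x)
    ...   | no f = trans (ℕ.≤-antisym (ℕ.≤-trans (csize-lower x) (ℕ.≤-reflexive (cur-big gap x b′)))
               (ℕ.≮⇒≥ (λ l → f (b′ , l)))) (sym (size-wk (old p x)))
      where b′ = subst (r <_) (size-wk (old p x)) b
    big′ upper x b with Freshʰ? x
    ... | yes f = sym (size-upperName x)
    ... | no f = trans (ℕ.≤-antisym (ℕ.≤-trans (csize-upper x) (ℕ.≤-reflexive (cur-big gap (down x) b′)))
               (ℕ.≮⇒≥ (λ l → f (b′ , l)))) (sym (size-wk (old p (down x))))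
      where b′ = subst (r <_) (size-wk (old p (down x))) b
    big′ (other {a} n g) x b with a Fin.≟ p
    ... | yes e = ⊥-elim (n e)
    ... | no _ = trans (csize-old _ _ x) (trans (cur-big g x (subst (r <_) (size-wk (old a x)) b)) (sym (size-wk (old a x))))

    cong′ : ∀ {a b} → Side a b → ∀ {x x′} → Conn S⁺ a b x x′ → cur⁺ a x ≡ cur⁺ a x′
    cong′ lower {x} {x′} f with p Fin.≟ p
    ... | no n = ⊥-elim (n refl)
    ... | yes _ with Freshˡ? x | Freshˡ? x′
    ...   | yes _ | yes _ = lower-eq f
    ...   | no _ | no _ = cong wk (cur-cong gap (conn-lower f))
    ...   | yes q | no n = ⊥-elim (n (fresh-lower-cong f q))
    ...   | no n | yes q = ⊥-elim (n (fresh-lower-cong (Cˡ.conn-sym f) q))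
    cong′ upper {x} {x′} f with Freshʰ? x | Freshʰ? x′
    ... | yes _ | yes _ = upper-eq f
    ... | no _ | no _ = cong wk (cur-cong gap (conn-upper f))
    ... | yes q | no n = ⊥-elim (n (fresh-upper-cong f q))
    ... | no n | yes q = ⊥-elim (n (fresh-upper-cong (Cʰ.conn-sym f) q))
    cong′ (other {a} n g) f with a Fin.≟ p
    ... | yes e = ⊥-elim (n e)
    ... | no _ = cong wk (cur-cong g f)

forest-invariant : ∀ {w′ m} (r : ℕ) (S : Sys (suc w′) m) → ForestInvariant r S (current r S) (InForest r S)
forest-invariant {w′} r base = record
  { cur-in = λ _ _ → refl ; cur-contains = λ { {p} {s} _ x → contains p s x } ; cur-least = λ { _ refl _ → ℕ.≤-refl }
  ; unique = λ { _ refl refl _ _ _ → refl } ; cur-big = λ { {p} {s} g x _ → big p s g x } ; cur-cong = λ _ _ → refl }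
  where
  open Names {suc w′} base
  module C = Components {suc w′} base (suc zero) zero
  all-conn : ∀ {x y} → C.Conn x y
  all-conn {x} {y} = C.conn-step {y = x} tt tt
  contains : ∀ p s x → Contains (current r base p x) p s x
  contains zero s x = tt , bottom s , x , all-conn , tt
    where
    bottom : ∀ s → s ≼ zero
    bottom zero = tt
    bottom (suc zero) = tt
  contains (suc zero) s x = tt , bottom s , x , all-conn , refl
    where
    bottom : ∀ s → s ≼ zero
    bottom zero = tt
    bottom (suc zero) = tt
  big : ∀ p s → Adjacent p s → ∀ x → csize base p s x ≡ size (current r base p x)
  big zero zero (_ , n , _) x = ⊥-elim (n refl)
  big zero (suc zero) (() , _) x
  big (suc zero) zero _ x = C.csize-cong all-conn
  big (suc zero) (suc zero) (_ , n , _) x = ⊥-elim (n refl)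
forest-invariant r (ins S p s p≼s p≢s adj L U ref pt) =
  StepProof.step-invariant r S p s p≼s p≢s adj L U ref pt (current r S) (InForest r S) (forest-invariant r S)

-- Distinct instances of equal size that share a thread occupy disjoint level intervals.
module _ {w′ m} (r : ℕ) (S : Sys (suc w′) m) where
  open Names S
  open Name

  private
    coincide : ∀ {M N} → lo M ≼ lo N → ¬ hi M ≼ lo N → InForest r S M → InForest r S N → size M ≡ size N →
      ∀ i → Bottom M (at (levelSystem S) (lo M) i) → Bottom N (at (levelSystem S) (lo N) i) → M ≡ N
    coincide {M} {N} l n M∈ N∈ e i p q with b , g@(_ , _ , h) ← successor (lo N) (hi N) (lo-hi N) (lo≢hi N) =
      ForestInvariant.unique (forest-invariant r S) g M∈ N∈
        (l , [ (λ k → ⊥-elim (n k)) , id ]′ (h (hi M)) , _ , p , thread-Le l i)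
        (≼-refl , [ (λ k → ⊥-elim (lo≢hi N (≼-antisym (lo-hi N) k))) , id ]′ (h (hi N)) , _ , q , Le-refl) e

  instances-separated : ∀ {M N} → InForest r S M → InForest r S N → size M ≡ size N →
    ∀ i → Bottom M (at (levelSystem S) (lo M) i) → Bottom N (at (levelSystem S) (lo N) i) →
    M ≡ N ⊎ hi M ≼ lo N ⊎ hi N ≼ lo M
  instances-separated {M} {N} M∈ N∈ e i p q with hi M ≼? lo N | hi N ≼? lo M
  ... | yes l | _ = inj₂ (inj₁ l)
  ... | no _ | yes l = inj₂ (inj₂ l)
  ... | no n₁ | no n₂ = inj₁ ([ (λ l → coincide l n₁ M∈ N∈ e i p q) , (λ l → sym (coincide l n₂ N∈ M∈ (sym e) i q p)) ]′ (≼-total (lo M) (lo N)))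

-- Online algorithms on explicitly presented strict orders

-- A presentation lists, newest element first, the comparisons with all earlier elements:
-- (new < old , old < new).
Row Presentation : Set
Row = List (Bool × Bool)
Presentation = List Row

entry : Row → ℕ → Bool × Bool
entry [] _ = false , false
entry (b ∷ _) zero = b
entry (_ ∷ r) (suc n) = entry r n

less : (D : Presentation) → Fin (length D) → Fin (length D) → Bool
less (r ∷ D) zero zero = false
less (r ∷ D) zero (suc j) = proj₁ (entry r (toℕ j))
less (r ∷ D) (suc i) zero = proj₂ (entry r (toℕ i))
less (r ∷ D) (suc i) (suc j) = less D i j

Less : (D : Presentation) → Fin (length D) → Fin (length D) → Set
Less D i j = T (less D i j)

less-irrefl : ∀ D i → ¬ Less D i i
less-irrefl (r ∷ D) (suc i) l = less-irrefl D i l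

Transitive : Presentation → Set
Transitive D = ∀ i j k → Less D i j → Less D j k → Less D i k

Incomparable : (D : Presentation) → Fin (length D) → Fin (length D) → Set
Incomparable D i j = i ≢ j × ¬ Less D i j × ¬ Less D j i

WidthAtMost : ℕ → Presentation → Set
WidthAtMost w D = ∀ xs → AllPairs (Incomparable D) xs → length xs ≤ w

colours : (Row → Presentation → ℕ) → (D : Presentation) → Fin (length D) → ℕ
colours col (r ∷ D) zero = col r D
colours col (r ∷ D) (suc i) = colours col D i

record Algorithm (w k : ℕ) : Set where
  field
    col : Row → Presentation → ℕ
    bounded : ∀ D → Transitive D → WidthAtMost w D → ∀ i → colours col D i < k
    proper : ∀ D → Transitive D → WidthAtMost w D → ∀ i j → colours col D i ≡ colours col D j → i ≡ j ⊎ Less D i j ⊎ Less D j i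

module _ {X : Set} (rel : X → X → Bool) where

  row : X → List X → Row
  row x = map (λ y → rel x y , rel y x)

  present : List X → Presentation
  present [] = []
  present (x ∷ xs) = row x xs ∷ present xs

  elem : ∀ xs → Fin (length (present xs)) → X
  elem (x ∷ xs) zero = x
  elem (x ∷ xs) (suc i) = elem xs i

  elem-∈ : ∀ xs i → elem xs i ∈ xs
  elem-∈ (x ∷ xs) zero = here refl
  elem-∈ (x ∷ xs) (suc i) = there (elem-∈ xs i)

  entry-row : ∀ x xs i → entry (row x xs) (toℕ i) ≡ (rel x (elem xs i) , rel (elem xs i) x)
  entry-row x (y ∷ xs) zero = refl
  entry-row x (y ∷ xs) (suc i) = entry-row x xs i

  less-present : ∀ xs i j → i ≢ j → less (present xs) i j ≡ rel (elem xs i) (elem xs j)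
  less-present (x ∷ xs) zero zero n = ⊥-elim (n refl)
  less-present (x ∷ xs) zero (suc j) n = cong proj₁ (entry-row x xs j)
  less-present (x ∷ xs) (suc i) zero n = cong proj₂ (entry-row x xs i)
  less-present (x ∷ xs) (suc i) (suc j) n = less-present xs i j (n ∘ cong suc)

  less⇒rel : ∀ xs i j → Less (present xs) i j → T (rel (elem xs i) (elem xs j))
  less⇒rel xs i j l = subst T (less-present xs i j λ { refl → less-irrefl (present xs) i l }) l

  rel⇒less : ∀ xs i j → i ≢ j → T (rel (elem xs i) (elem xs j)) → Less (present xs) i j
  rel⇒less xs i j n = subst T (sym (less-present xs i j n))

  elem-injective : ∀ xs → Unique xs → ∀ i j → elem xs i ≡ elem xs j → i ≡ j
  elem-injective (x ∷ xs) u zero zero e = refl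
  elem-injective (x ∷ xs) (p ∷ u) zero (suc j) e = ⊥-elim (All.lookup p (elem-∈ xs j) e)
  elem-injective (x ∷ xs) (p ∷ u) (suc i) zero e = ⊥-elim (All.lookup p (elem-∈ xs i) (sym e))
  elem-injective (x ∷ xs) (p ∷ u) (suc i) (suc j) e = cong suc (elem-injective xs u i j e)

  present-transitive : ∀ xs → (∀ {x y z} → x ∈ xs → y ∈ xs → z ∈ xs → T (rel x y) → T (rel y z) → T (rel x z)) →
    (∀ {x} → x ∈ xs → ¬ T (rel x x)) → Transitive (present xs)
  present-transitive xs tr irr i j k l l′ = rel⇒less xs i k
    (λ { refl → irr (elem-∈ xs i) r }) r
    where r = tr (elem-∈ xs i) (elem-∈ xs j) (elem-∈ xs k) (less⇒rel xs i j l) (less⇒rel xs j k l′)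

  present-width : ∀ w xs → Unique xs →
    (∀ ys → Unique ys → (∀ {y} → y ∈ ys → y ∈ xs) → (∀ {x y} → x ∈ ys → y ∈ ys → x ≢ y → ¬ T (rel x y)) → length ys ≤ w) →
    WidthAtMost w (present xs)
  present-width w xs u h is ps = subst (_≤ w) (length-map (elem xs) is)
    (h (map (elem xs) is) (Unique-map (λ _ _ → elem-injective xs u _ _) (AllPairs⇒Unique (λ (n , _) → n refl) ps))
      (λ y∈ → case ∈-map⁻ (elem xs) y∈ of λ { (i , _ , refl) → elem-∈ xs i })
      λ x∈ y∈ n → case (∈-map⁻ (elem xs) x∈ , ∈-map⁻ (elem xs) y∈) of λ { ((i , i∈ , refl) , (j , j∈ , refl)) → apart i∈ j∈ n })
    where
    apart : ∀ {i j} → i ∈ is → j ∈ is → elem xs i ≢ elem xs j → ¬ T (rel (elem xs i) (elem xs j))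
    apart {i} {j} i∈ j∈ n r = case AllPairs-lookup ps i∈ j∈ of λ
      { (inj₁ refl) → n refl
      ; (inj₂ (inj₁ (_ , a , _))) → a (rel⇒less xs i j (λ { refl → n refl }) r)
      ; (inj₂ (inj₂ (_ , _ , b))) → b (rel⇒less xs i j (λ { refl → n refl }) r) }

module _ {X Y : Set} (rel : X → X → Bool) (rel′ : Y → Y → Bool) (f : X → Y) (h : ∀ x y → rel′ (f x) (f y) ≡ rel x y) where

  row-map : ∀ x xs → row rel′ (f x) (map f xs) ≡ row rel x xs
  row-map x [] = refl
  row-map x (y ∷ xs) = cong₂ _∷_ (cong₂ _,_ (h x y) (h y x)) (row-map x xs)

  present-map : ∀ xs → present rel′ (map f xs) ≡ present rel xs
  present-map [] = refl
  present-map (x ∷ xs) = cong₂ _∷_ (row-map x xs) (present-map xs)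

-- Running one copy of an algorithm for every key, each on the entries with that key.
module Keyed {w k : ℕ} (alg : Algorithm w k) {E K X : Set} (_≟ᴷ_ : DecidableEquality K)
  (key : E → K) (val : E → X) (stored : E → ℕ) (rel : X → X → Bool) where
  open Algorithm alg

  select : K → List E → List X
  select κ es = map val (filter (λ e → key e ≟ᴷ κ) es)

  nextColour : K → X → List E → ℕ
  nextColour κ x es = col (row rel x (select κ es)) (present rel (select κ es))

  Consistent : List E → Set
  Consistent [] = ⊤
  Consistent (e ∷ es) = stored e ≡ nextColour (key e) (val e) es × Consistent es

  position : ∀ es → Consistent es → ∀ {e} → e ∈ es →
    ∃[ i ] elem rel (select (key e) es) i ≡ val e × colours col (present rel (select (key e) es)) i ≡ stored e
  position (e ∷ es) (s , c) (here refl) with key e ≟ᴷ key e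
  ... | yes _ = zero , refl , sym s
  ... | no n = ⊥-elim (n refl)
  position (e′ ∷ es) (s , c) {e} (there e∈) with key e′ ≟ᴷ key e | position es c e∈
  ... | yes _ | i , p , q = suc i , p , q
  ... | no _ | r = r

  ∈-select : ∀ {κ es x} → x ∈ select κ es → ∃[ e ] e ∈ es × key e ≡ κ × x ≡ val e
  ∈-select {κ} {es} h = let (e , e∈ , q) = ∈-map⁻ val h ; (a , b) = ∈-filter⁻ (λ e → key e ≟ᴷ κ) {xs = es} e∈ in e , a , b , q

  module _ (es : List E) (c : Consistent es) (κ : K)
    (tr : Transitive (present rel (select κ es))) (wd : WidthAtMost w (present rel (select κ es))) where

    keyed-bounded : ∀ {e} → e ∈ es → key e ≡ κ → stored e < k
    keyed-bounded e∈ refl with i , _ , q ← position es c e∈ = subst (_< k) q (bounded (present rel (select κ es)) tr wd i)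

    keyed-proper : ∀ {e e′} → e ∈ es → e′ ∈ es → key e ≡ κ → key e′ ≡ κ → stored e ≡ stored e′ →
      val e ≡ val e′ ⊎ T (rel (val e) (val e′)) ⊎ T (rel (val e′) (val e))
    keyed-proper {e} {e′} e∈ e∈′ refl q s = case position es c e∈ of λ (i , p , a) →
      case subst (λ κ → ∃[ i ] elem rel (select κ es) i ≡ val e′ × colours col (present rel (select κ es)) i ≡ stored e′) q (position es c e∈′) of λ (j , p′ , a′) →
      case proper (present rel (select κ es)) tr wd i j (trans a (trans s (sym a′))) of λ
        { (inj₁ refl) → inj₁ (trans (sym p) p′)
        ; (inj₂ (inj₁ l)) → inj₂ (inj₁ (subst₂ (λ x y → T (rel x y)) p p′ (less⇒rel rel (select κ es) i j l)))
        ; (inj₂ (inj₂ l)) → inj₂ (inj₂ (subst₂ (λ x y → T (rel x y)) p′ p (less⇒rel rel (select κ es) j i l))) }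

module KeyedMap {w k : ℕ} (alg : Algorithm w k) {E K X E′ K′ X′ : Set}
  (_≟ᴷ_ : DecidableEquality K) (_≟ᴷ′_ : DecidableEquality K′)
  (key : E → K) (val : E → X) (stored : E → ℕ) (rel : X → X → Bool)
  (key′ : E′ → K′) (val′ : E′ → X′) (stored′ : E′ → ℕ) (rel′ : X′ → X′ → Bool)
  (g : E → E′) (h : K → K′) (f : X → X′) (h-inj : ∀ {a b} → h a ≡ h b → a ≡ b)
  (key-g : ∀ e → key′ (g e) ≡ h (key e)) (val-g : ∀ e → val′ (g e) ≡ f (val e)) (stored-g : ∀ e → stored′ (g e) ≡ stored e)
  (rel-f : ∀ x y → rel′ (f x) (f y) ≡ rel x y) where
  private
    module M = Keyed alg _≟ᴷ_ key val stored rel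
    module M′ = Keyed alg _≟ᴷ′_ key′ val′ stored′ rel′

  select-map : ∀ κ es → M′.select (h κ) (map g es) ≡ map f (M.select κ es)
  select-map κ [] = refl
  select-map κ (e ∷ es) with key e ≟ᴷ κ | key′ (g e) ≟ᴷ′ h κ
  ... | yes _ | yes _ = cong₂ _∷_ (val-g e) (select-map κ es)
  ... | no _ | no _ = select-map κ es
  ... | yes refl | no n = ⊥-elim (n (key-g e))
  ... | no n | yes q = ⊥-elim (n (h-inj (trans (sym (key-g e)) q)))

  nextColour-map : ∀ κ x es → M′.nextColour (h κ) (f x) (map g es) ≡ M.nextColour κ x es
  nextColour-map κ x es rewrite select-map κ es | row-map rel rel′ f rel-f x (M.select κ es) | present-map rel rel′ f rel-f (M.select κ es) = refl

  consistent-map : ∀ es → M.Consistent es → M′.Consistent (map g es)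
  consistent-map [] _ = tt
  consistent-map (e ∷ es) (s , c) = trans (stored-g e) (trans s (trans (sym (nextColour-map (key e) (val e) es))
    (cong₂ (λ κ x → M′.nextColour κ x (map g es)) (sym (key-g e)) (sym (val-g e))))) , consistent-map es c

-- Zones of a large instance: the levels between consecutive splitting levels

record Origin (w m : ℕ) : Set where
  constructor origin
  field
    lev : Fin m
    idx : Fin w
    col : ℕ
open Origin public

lift-origin : ∀ {w m} → Origin w m → Origin w (suc m)
lift-origin (origin a x c) = origin (suc a) x c

module _ {w m} (LS : LevelSystem w m) where
  open LevelSystem LS

  Adj : Fin m → Fin m → Set
  Adj a b = a ≼ b × a ≢ b × (∀ c → c ≼ a ⊎ b ≼ c)

-- `cur a x` is the instance at element x of the lower end a of a gap and `org a x` the origin of the thread ending there.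
-- `item t z` records the instance and the thread to which (t , z) was appended, and the previous end of that thread.
-- `Split I ℓ c` says that level ℓ split the live gap of I and got colour c.
record ZoneData (w m : ℕ) (N : Set) : Set₁ where
  field
    cur : Fin m → Fin w → N
    Big : N → Set
    org : Fin m → Fin w → Origin w m
    item : Fin m → Fin w → Maybe (N × Origin w m × Fin m × Fin w)
    Split : N → Fin m → ℕ → Set
    On : N → Fin m → Fin w → Set
    Start : N → Fin m → Set

record Zones {w m} (LS : LevelSystem w m) {N : Set} (Z : ZoneData w m N) : Set where
  open LevelSystem LS
  open ZoneData Z

  Coloured : N → Origin w m → Set
  Coloured I o = (Start I (lev o) × col o ≡ 0) ⊎ Split I (lev o) (col o)

  field
    start-below : ∀ {I o a x} → Start I o → On I a x → o ≼ a
    live : ∀ {a b} → Adj LS a b → ∀ x → Big (cur a x) → let I = cur a x ; o = org a x in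
      Le (lev o) (idx o) a x × On I (lev o) (idx o) × Coloured I o × (∀ ℓ c → Split I ℓ c → ℓ ≼ lev o ⊎ b ≼ ℓ)
    attached : ∀ {t z I o p x} → item t z ≡ just (I , o , p , x) →
      Le (lev o) (idx o) p x × Le p x t z × On I (lev o) (idx o) × Coloured I o × (∀ ℓ c → Split I ℓ c → lev o ≼ ℓ → lev o ≢ ℓ → t ≼ ℓ)
    below-live : ∀ {a b} → Adj LS a b → ∀ x → Big (cur a x) → ∀ {t z o p v} → item t z ≡ just (cur a x , o , p , v) →
      lev o ≡ lev (org a x) → t ≼ a × (idx o ≡ idx (org a x) → Le t z a x)
    disjoint : ∀ {a b a′ b′} → Adj LS a b → Adj LS a′ b′ → ∀ {x x′} → Big (cur a x) → cur a x ≡ cur a′ x′ → a ≢ a′ → a ≼ a′ →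
      b ≼ lev (org a′ x′)
    injective : ∀ {a b} → Adj LS a b → ∀ {x x′} → Big (cur a x) → cur a x ≡ cur a x′ → idx (org a x) ≡ idx (org a x′) → x ≡ x′
    chained : ∀ {t z t′ z′ I o o′ p x p′ x′} → item t z ≡ just (I , o , p , x) → item t′ z′ ≡ just (I , o′ , p′ , x′) →
      lev o ≡ lev o′ → idx o ≡ idx o′ → (t ≡ t′ × z ≡ z′) ⊎ Le t z p′ x′ ⊎ Le t′ z′ p x

module ZoneStep {w m} (LS : LevelSystem w m) (LS⁺ : LevelSystem w (suc m)) {N N⁺ : Set} (Z : ZoneData w m N) (Z⁺ : ZoneData w (suc m) N⁺) where
  open LevelSystem LS
  open LevelSystem LS⁺ using () renaming (_≼_ to _≼⁺_; Le to Le⁺; Le-trans to Le⁺-trans; ≼-refl to ≼⁺-refl; Le-refl to Le⁺-refl; ≼-antisym to ≼⁺-antisym)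
  open ZoneData Z
  open ZoneData Z⁺ using () renaming (cur to cur⁺; Big to Big⁺; org to org⁺; item to item⁺; Split to Split⁺; On to On⁺; Start to Start⁺)

  module _
    (e f : Fin m) (gap : Adj LS e f)
    (suc-≼ : ∀ {a b} → a ≼ b → suc a ≼⁺ suc b) (suc-≼⁻ : ∀ {a b} → suc a ≼⁺ suc b → a ≼ b)
    (≼-new : ∀ {a} → a ≼ e → suc a ≼⁺ zero) (≼-new⁻ : ∀ {a} → suc a ≼⁺ zero → a ≼ e)
    (new-≼ : ∀ {b} → f ≼ b → zero ≼⁺ suc b) (new-≼⁻ : ∀ {b} → zero ≼⁺ suc b → f ≼ b)
    (suc-Le : ∀ {a x b y} → Le a x b y → Le⁺ (suc a) x (suc b) y)
    (μ : Permutation′ w) (new-edge : ∀ z → Le⁺ (suc e) (μ ⟨$⟩ˡ z) zero z)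
    (wk : N → N⁺) (wk-inj : ∀ {I J} → wk I ≡ wk J → I ≡ J)
    (Fresh Freshᵒ : Fin w → Set) (Fresh? : ∀ z → Dec (Fresh z)) (Freshᵒ? : ∀ z → Dec (Freshᵒ z))
    (big? : ∀ I → Dec (Big I))
    (inst : Fin w → N) (inst-cur : ∀ z → inst z ≡ cur e (μ ⟨$⟩ˡ z))
    (fresh-const : ∀ {z z′} → Big (inst z) → inst z ≡ inst z′ → Fresh z → Fresh z′)
    (new newᵒ : Fin w → N⁺) (new-wk : ∀ {x I} → new x ≢ wk I) (newᵒ-wk : ∀ {x I} → newᵒ x ≢ wk I) (new-newᵒ : ∀ {x z} → new x ≢ newᵒ z)
    (cur-near : ∀ x → (Fresh (μ ⟨$⟩ʳ x) × cur⁺ (suc e) x ≡ new x) ⊎ (¬ Fresh (μ ⟨$⟩ʳ x) × cur⁺ (suc e) x ≡ wk (cur e x)))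
    (cur-far : ∀ z → (Freshᵒ z × cur⁺ zero z ≡ newᵒ z) ⊎ (¬ Freshᵒ z × cur⁺ zero z ≡ wk (inst z)))
    (cur-other : ∀ {a} x → a ≢ e → cur⁺ (suc a) x ≡ wk (cur a x))
    (big-wk : ∀ {I} → Big⁺ (wk I) → Big I)
    (c : Fin w → ℕ)
    (org-near : ∀ x → (Fresh (μ ⟨$⟩ʳ x) × org⁺ (suc e) x ≡ origin (suc e) x 0) ⊎ (¬ Fresh (μ ⟨$⟩ʳ x) × org⁺ (suc e) x ≡ lift-origin (org e x)))
    (org-far : ∀ z → (Freshᵒ z × org⁺ zero z ≡ origin zero z 0)
      ⊎ (¬ Freshᵒ z × Fresh z × org⁺ zero z ≡ lift-origin (org e (μ ⟨$⟩ˡ z)))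
      ⊎ (¬ Freshᵒ z × ¬ Fresh z × org⁺ zero z ≡ origin zero z (c z)))
    (org-other : ∀ {a} x → a ≢ e → org⁺ (suc a) x ≡ lift-origin (org a x))
    (item-old : ∀ {t z J j} → item⁺ (suc t) z ≡ just (J , j) →
      ∃[ I ] ∃[ o ] ∃[ p ] ∃[ x ] item t z ≡ just (I , o , p , x) × J ≡ wk I × j ≡ (lift-origin o , suc p , x))
    (item-new : ∀ {z J j} → item⁺ zero z ≡ just (J , j) →
      Big (inst z) × Fresh z × J ≡ wk (inst z) × j ≡ (lift-origin (org e (μ ⟨$⟩ˡ z)) , suc e , (μ ⟨$⟩ˡ z)))
    (split-wk : ∀ {I ℓ c} → Split I ℓ c → Split⁺ (wk I) (suc ℓ) c)
    (split-old : ∀ {J ℓ c} → Split⁺ J (suc ℓ) c → ∃[ I ] J ≡ wk I × Split I ℓ c)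
    (split-new : ∀ {J c} → Split⁺ J zero c → ∃[ z ] J ≡ wk (inst z) × Big (inst z) × ¬ Fresh z × ¬ Freshᵒ z)
    (split-here : ∀ {z} → Big (inst z) → ¬ Fresh z → ¬ Freshᵒ z → Split⁺ (wk (inst z)) zero (c z))
    (on-wk : ∀ {I a x} → On I a x → On⁺ (wk I) (suc a) x)
    (on-near : ∀ {x} → Fresh (μ ⟨$⟩ʳ x) → On⁺ (new x) (suc e) x)
    (on-far : ∀ {z} → Freshᵒ z → On⁺ (newᵒ z) zero z)
    (on-new : ∀ {z} → On⁺ (wk (inst z)) zero z)
    (start-wk : ∀ {I a} → Start I a → Start⁺ (wk I) (suc a))
    (start-near : ∀ {x} → Start⁺ (new x) (suc e)) (start-far : ∀ {z} → Start⁺ (newᵒ z) zero)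
    (start-below⁺ : ∀ {I o a x} → Start⁺ I o → On⁺ I a x → o ≼⁺ a)
    (zones : Zones LS Z) where

    open Zones zones

    private
      f⋠e : ¬ f ≼ e
      f⋠e l = proj₁ (proj₂ gap) (≼-antisym (proj₁ gap) l)

      data Side : Fin (suc m) → Fin (suc m) → Set where
        near : Side (suc e) zero
        far : Side zero (suc f)
        other : ∀ {a b} → a ≢ e → Adj LS a b → Side (suc a) (suc b)

      side : ∀ {a b} → Adj LS⁺ a b → Side a b
      side {zero} {zero} (_ , n , _) = ⊥-elim (n refl)
      side {suc a} {zero} (l , _ , h) with h (suc e)
      ... | inj₁ r = subst (λ q → Side (suc q) zero) (≼-antisym (suc-≼⁻ r) (≼-new⁻ l)) near
      ... | inj₂ r = ⊥-elim (f⋠e (new-≼⁻ r))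
      side {zero} {suc b} (l , _ , h) with h (suc f)
      ... | inj₁ r = ⊥-elim (f⋠e (≼-new⁻ r))
      ... | inj₂ r = subst (λ q → Side zero (suc q)) (≼-antisym (new-≼⁻ l) (suc-≼⁻ r)) far
      side {suc a} {suc b} (l , n , h) = other not-e (suc-≼⁻ l , n ∘ cong suc , λ c → [ inj₁ ∘ suc-≼⁻ , inj₂ ∘ suc-≼⁻ ]′ (h (suc c)))
        where
        not-e : a ≢ e
        not-e refl with h zero
        ... | inj₁ r = f⋠e (new-≼⁻ r)
        ... | inj₂ r = n (cong suc (≼-antisym (suc-≼⁻ l) (≼-new⁻ r)))

      -- The live thread through (e , x) for elements of the parent gap.
      Coloured⁺ : N⁺ → Origin w (suc m) → Set
      Coloured⁺ I o = (Start⁺ I (lev o) × col o ≡ 0) ⊎ Split⁺ I (lev o) (col o)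

      coloured-wk : ∀ I o → Coloured I o → Coloured⁺ (wk I) (lift-origin o)
      coloured-wk I o (inj₁ (s , e)) = inj₁ (start-wk s , e)
      coloured-wk I o (inj₂ s) = inj₂ (split-wk s)

      no-split : ∀ {J ℓ c} → (∀ {I} → J ≢ wk I) → ¬ Split⁺ J ℓ c
      no-split {ℓ = zero} n s = n (proj₁ (proj₂ (split-new s)))
      no-split {ℓ = suc ℓ} n s = n (proj₁ (proj₂ (split-old s)))

      no-item : ∀ {t z J o p x} → (∀ {I} → J ≢ wk I) → ¬ item⁺ t z ≡ just (J , o , p , x)
      no-item {zero} n q = n (proj₁ (proj₂ (proj₂ (item-new q))))
      no-item {suc t} n q = n (proj₁ (proj₂ (proj₂ (proj₂ (proj₂ (proj₂ (item-old q)))))))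

      down : Fin w → Fin w
      down z = μ ⟨$⟩ˡ z

      Live⁺ : Fin (suc m) → Fin (suc m) → Fin w → N⁺ → Origin w (suc m) → Set
      Live⁺ a b x I o = Le⁺ (lev o) (idx o) a x × On⁺ I (lev o) (idx o) × Coloured⁺ I o × (∀ ℓ c → Split⁺ I ℓ c → ℓ ≼⁺ lev o ⊎ b ≼⁺ ℓ)

      split-zone : ∀ {I o b b⁺} → (∀ ℓ c → Split I ℓ c → ℓ ≼ o ⊎ b ≼ ℓ) → (∀ {ℓ} → b ≼ ℓ → b⁺ ≼⁺ suc ℓ) →
        (∀ {c} → Split⁺ (wk I) zero c → zero ≼⁺ suc o ⊎ b⁺ ≼⁺ zero) → ∀ ℓ c → Split⁺ (wk I) ℓ c → ℓ ≼⁺ suc o ⊎ b⁺ ≼⁺ ℓ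
      split-zone h k z zero c s = z s
      split-zone h k z (suc ℓ) c s with _ , q , s′ ← split-old s with refl ← wk-inj q = [ inj₁ ∘ suc-≼ , inj₂ ∘ k ]′ (h ℓ c s′)

      live⁺ : ∀ {a b} → Side a b → ∀ x → Big⁺ (cur⁺ a x) → Live⁺ a b x (cur⁺ a x) (org⁺ a x)
      live⁺ near x b with cur-near x | org-near x
      ... | inj₁ (fr , q) | inj₂ (n , _) = ⊥-elim (n fr)
      ... | inj₂ (n , q) | inj₁ (fr , _) = ⊥-elim (n fr)
      ... | inj₁ (fr , q) | inj₁ (_ , r) rewrite q | r = Le⁺-refl , on-near fr , inj₁ (start-near , refl) , λ ℓ c s → ⊥-elim (no-split new-wk s)
      ... | inj₂ (n , q) | inj₂ (_ , r) rewrite q | r =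
        let (l , o , k , h) = live gap x (big-wk b) in suc-Le l , on-wk o , coloured-wk (cur e x) (org e x) k , split-zone h new-≼ (λ _ → inj₂ ≼⁺-refl)
      live⁺ far z b with cur-far z | org-far z
      ... | inj₁ (fr , q) | inj₂ (inj₁ (n , _)) = ⊥-elim (n fr)
      ... | inj₁ (fr , q) | inj₂ (inj₂ (n , _)) = ⊥-elim (n fr)
      ... | inj₂ (n , q) | inj₁ (fr , _) = ⊥-elim (n fr)
      ... | inj₁ (fr , q) | inj₁ (_ , r) rewrite q | r = Le⁺-refl , on-far fr , inj₁ (start-far , refl) , λ ℓ c s → ⊥-elim (no-split newᵒ-wk s)
      ... | inj₂ (n , q) | inj₂ (inj₁ (_ , fr , r)) rewrite q | r | inst-cur z =
        let b′ = big-wk b ; (l , o , k , h) = live gap (down z) b′ in Le⁺-trans (suc-Le l) (new-edge z) , on-wk o , coloured-wk (cur e (down z)) (org e (down z)) k ,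
        split-zone h suc-≼ (λ s → ⊥-elim (clash b′ s))
        where
        clash : ∀ {c} → Big (cur e (down z)) → ¬ Split⁺ (wk (cur e (down z))) zero c
        clash b′ s with z′ , q′ , b″ , n′ , _ ← split-new s =
          n′ (fresh-const (subst Big (sym (inst-cur z)) b′) (trans (inst-cur z) (wk-inj q′)) fr)
      ... | inj₂ (n , q) | inj₂ (inj₂ (_ , n′ , r)) rewrite q | r =
        Le⁺-refl , on-new , inj₂ (split-here (big-wk b) n′ n) , zone
        where
        I = inst z
        b′ : Big (cur e (down z))
        b′ = subst Big (inst-cur z) (big-wk b)
        zone : ∀ ℓ c → Split⁺ (wk I) ℓ c → ℓ ≼⁺ zero ⊎ suc f ≼⁺ ℓ
        zone zero c s = inj₁ ≼⁺-refl
        zone (suc ℓ) c s with _ , q , s′ ← split-old s with refl ← wk-inj q =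
          let (l , _ , _ , h) = live gap (down z) b′ in
          [ (λ k → inj₁ (≼-new (≼-trans k (Le⇒≼ l)))) , inj₂ ∘ suc-≼ ]′ (h ℓ c (subst (λ I → Split I ℓ c) (inst-cur z) s′))
      live⁺ (other {a} {b} n g) x bg rewrite cur-other x n | org-other x n =
        let bg′ = big-wk bg ; (l , o , k , h) = live g x bg′ in suc-Le l , on-wk o , coloured-wk (cur a x) (org a x) k , split-zone h suc-≼ (apart bg′)
        where
        apart : ∀ {c} → Big (cur a x) → Split⁺ (wk (cur a x)) zero c → zero ≼⁺ suc (lev (org a x)) ⊎ suc b ≼⁺ zero
        apart bg′ s with z , q , b″ , _ ← split-new s with proj₂ (proj₂ g) e | proj₂ (proj₂ gap) a
        ... | inj₂ l | _ = inj₂ (≼-new l)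
        ... | inj₁ l | _ = inj₁ (new-≼ (disjoint gap g (subst Big (inst-cur z) b″) (sym (trans (wk-inj q) (inst-cur z))) (λ { refl → n refl }) l))

      attached⁺ : ∀ {t z I o p x} → item⁺ t z ≡ just (I , o , p , x) →
        Le⁺ (lev o) (idx o) p x × Le⁺ p x t z × On⁺ I (lev o) (idx o) × Coloured⁺ I o × (∀ ℓ c → Split⁺ I ℓ c → lev o ≼⁺ ℓ → lev o ≢ ℓ → t ≼⁺ ℓ)
      attached⁺ {zero} {z} q with b , fr , refl , refl ← item-new q =
        let (l , o , k , h) = live gap (down z) (subst Big (inst-cur z) b) in
        suc-Le l , new-edge z , on-wk (subst (λ I → On I _ _) (sym (inst-cur z)) o) , coloured-wk (inst z) (org e (down z)) (subst (λ I → Coloured I (org e (down z))) (sym (inst-cur z)) k) , zone h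
        where
        zone : (∀ ℓ c → Split (cur e (down z)) ℓ c → ℓ ≼ lev (org e (down z)) ⊎ f ≼ ℓ) →
          ∀ ℓ c → Split⁺ (wk (inst z)) ℓ c → suc (lev (org e (down z))) ≼⁺ ℓ → suc (lev (org e (down z))) ≢ ℓ → zero ≼⁺ ℓ
        zone h zero c s l n = ≼⁺-refl
        zone h (suc ℓ) c s l n with _ , q′ , s′ ← split-old s with refl ← wk-inj q′ with h ℓ c (subst (λ I → Split I ℓ c) (inst-cur z) s′)
        ... | inj₁ k = ⊥-elim (n (cong suc (≼-antisym (suc-≼⁻ l) k)))
        ... | inj₂ k = new-≼ k
      attached⁺ {suc t} {z} q with I , o , p , x , r , refl , refl ← item-old q =
        let (l , k , on , col , h) = attached r in suc-Le l , suc-Le k , on-wk on , coloured-wk I o col , zone r on col h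
        where
        zone : ∀ {I o p x} → item t z ≡ just (I , o , p , x) → On I (lev o) (idx o) → Coloured I o →
          (∀ ℓ c → Split I ℓ c → lev o ≼ ℓ → lev o ≢ ℓ → t ≼ ℓ) →
          ∀ ℓ c → Split⁺ (wk I) ℓ c → suc (lev o) ≼⁺ ℓ → suc (lev o) ≢ ℓ → suc t ≼⁺ ℓ
        zone r on col h (suc ℓ) c s l n with _ , q′ , s′ ← split-old s with refl ← wk-inj q′ = suc-≼ (h ℓ c s′ (suc-≼⁻ l) (n ∘ cong suc))
        zone {I} {o} r on col h zero c s l n with z′ , q′ , b , _ ← split-new s
          with refl ← trans (wk-inj q′) (inst-cur z′)
          with lev o Fin.≟ lev (org e (down z′)) | live gap (down z′) (subst Big (inst-cur z′) b)
        ... | yes same | _ = ≼-new (proj₁ (below-live gap (down z′) (subst Big (inst-cur z′) b) r same))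
        ... | no differ | (le , on′ , inj₁ (st , _) , zn) = ⊥-elim (differ (≼-antisym (o≼ col) (start-below st on)))
          where
          o≼ : Coloured (cur e (down z′)) o → lev o ≼ lev (org e (down z′))
          o≼ (inj₁ (st′ , _)) = start-below st′ on′
          o≼ (inj₂ sp) = [ id , (λ k → ⊥-elim (f⋠e (≼-trans k (≼-new⁻ l)))) ]′ (zn _ _ sp)
        ... | no differ | (le , on′ , inj₂ sp′ , zn) = ≼-new (≼-trans (h _ _ sp′ (o≼ col) differ) (Le⇒≼ le))
          where
          o≼ : Coloured (cur e (down z′)) o → lev o ≼ lev (org e (down z′))
          o≼ (inj₁ (st′ , _)) = start-below st′ on′
          o≼ (inj₂ sp) = [ id , (λ k → ⊥-elim (f⋠e (≼-trans k (≼-new⁻ l)))) ]′ (zn _ _ sp)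

      below-live⁺ : ∀ {a b} → Side a b → ∀ x → Big⁺ (cur⁺ a x) → ∀ {t z o p v} → item⁺ t z ≡ just (cur⁺ a x , o , p , v) →
        lev o ≡ lev (org⁺ a x) → t ≼⁺ a × (idx o ≡ idx (org⁺ a x) → Le⁺ t z a x)
      below-live⁺ near x b it h with cur-near x | org-near x
      ... | inj₁ (fr , q) | inj₂ (n , _) = ⊥-elim (n fr)
      ... | inj₂ (n , q) | inj₁ (fr , _) = ⊥-elim (n fr)
      ... | inj₁ (fr , q) | inj₁ (_ , r) rewrite q = ⊥-elim (no-item new-wk it)
      below-live⁺ near x b {zero} {z} it h | inj₂ (n , q) | inj₂ (_ , r) rewrite q with bz , fr , q′ , _ ← item-new it =
        ⊥-elim (n (fresh-const bz (trans (sym (wk-inj q′)) (trans (cong (cur e) (sym (inverseˡ μ))) (sym (inst-cur (μ ⟨$⟩ʳ x))))) fr))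
      below-live⁺ near x b {suc t} {z} it h | inj₂ (n , q) | inj₂ (_ , r) rewrite q | r with I , o , p , v , i , q′ , refl ← item-old it with refl ← wk-inj q′ =
        let (u , k) = below-live gap x (big-wk b) i (Fin.suc-injective h) in suc-≼ u , suc-Le ∘ k
      below-live⁺ far z b it h with cur-far z | org-far z
      ... | inj₁ (fr , q) | inj₂ (inj₁ (n , _)) = ⊥-elim (n fr)
      ... | inj₁ (fr , q) | inj₂ (inj₂ (n , _)) = ⊥-elim (n fr)
      ... | inj₂ (n , q) | inj₁ (fr , _) = ⊥-elim (n fr)
      ... | inj₁ (fr , q) | inj₁ (_ , r) rewrite q = ⊥-elim (no-item newᵒ-wk it)
      below-live⁺ far z b {zero} it h | inj₂ (n , q) | inj₂ (inj₂ (_ , n′ , r)) rewrite r with _ , _ , _ , refl ← item-new it = case h of λ ()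
      below-live⁺ far z b {suc t} it h | inj₂ (n , q) | inj₂ (inj₂ (_ , n′ , r)) rewrite r with _ , _ , _ , _ , _ , _ , refl ← item-old it = case h of λ ()
      below-live⁺ far z b {zero} {z′} it h | inj₂ (n , q) | inj₂ (inj₁ (_ , fr , r)) rewrite q | r with bz , fr′ , q′ , refl ← item-new it with same ← wk-inj q′ =
        ≼⁺-refl , λ i → subst (λ v → Le⁺ zero z′ zero v)
          (trans (sym (inverseʳ μ)) (trans (cong (μ ⟨$⟩ʳ_) (injective gap (subst Big (inst-cur z′) bz) (trans (sym (inst-cur z′)) (trans (sym same) (inst-cur z))) i)) (inverseʳ μ))) Le⁺-refl
      below-live⁺ far z b {suc t} it h | inj₂ (n , q) | inj₂ (inj₁ (_ , fr , r)) rewrite q | r with I , o , p , v , i , q′ , refl ← item-old it with refl ← wk-inj q′ =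
        let (u , k) = below-live gap (down z) (subst Big (inst-cur z) (big-wk b)) (subst (λ J → item t _ ≡ just (J , o , p , v)) (inst-cur z) i) (Fin.suc-injective h) in
        ≼-new u , λ j → Le⁺-trans (suc-Le (k j)) (new-edge z)
      below-live⁺ (other {a} n g) x b {zero} {z} it h rewrite cur-other x n | org-other x n with bz , fr , q′ , refl ← item-new it with same ← wk-inj q′ =
        ⊥-elim (clash (≼-total a e))
        where
        eq : cur e (down z) ≡ cur a x
        eq = trans (sym (inst-cur z)) (sym same)
        clash : a ≼ e ⊎ e ≼ a → ⊥
        clash (inj₁ l) = proj₁ (proj₂ g) (≼-antisym (proj₁ g) (≼-trans (subst (_ ≼_) (Fin.suc-injective h)
          (disjoint g gap (big-wk b) (sym eq) n l)) (Le⇒≼ (proj₁ (live g x (big-wk b))))))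
        clash (inj₂ l) = f⋠e (≼-trans (subst (f ≼_) (sym (Fin.suc-injective h)) (disjoint gap g (subst Big (inst-cur z) bz) eq (n ∘ sym) l))
          (Le⇒≼ (proj₁ (live gap (down z) (subst Big (inst-cur z) bz)))))
      below-live⁺ (other {a} n g) x b {suc t} it h rewrite cur-other x n | org-other x n with I , o , p , v , i , q′ , refl ← item-old it with refl ← wk-inj q′ =
        let (u , k) = below-live g x (big-wk b) i (Fin.suc-injective h) in suc-≼ u , suc-Le ∘ k

      near-view : ∀ x → (cur⁺ (suc e) x ≡ new x × org⁺ (suc e) x ≡ origin (suc e) x 0)
        ⊎ (¬ Fresh (μ ⟨$⟩ʳ x) × cur⁺ (suc e) x ≡ wk (cur e x) × org⁺ (suc e) x ≡ lift-origin (org e x))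
      near-view x with cur-near x | org-near x
      ... | inj₁ (fr , q) | inj₂ (n , _) = ⊥-elim (n fr)
      ... | inj₂ (n , q) | inj₁ (fr , _) = ⊥-elim (n fr)
      ... | inj₁ (_ , q) | inj₁ (_ , r) = inj₁ (q , r)
      ... | inj₂ (n , q) | inj₂ (_ , r) = inj₂ (n , q , r)

      far-view : ∀ z → (cur⁺ zero z ≡ newᵒ z × org⁺ zero z ≡ origin zero z 0)
        ⊎ (cur⁺ zero z ≡ wk (inst z) × ((Fresh z × org⁺ zero z ≡ lift-origin (org e (down z))) ⊎ (¬ Fresh z × org⁺ zero z ≡ origin zero z (c z))))
      far-view z with cur-far z | org-far z
      ... | inj₁ (fr , q) | inj₂ (inj₁ (n , _)) = ⊥-elim (n fr)
      ... | inj₁ (fr , q) | inj₂ (inj₂ (n , _)) = ⊥-elim (n fr)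
      ... | inj₂ (n , q) | inj₁ (fr , _) = ⊥-elim (n fr)
      ... | inj₁ (_ , q) | inj₁ (_ , r) = inj₁ (q , r)
      ... | inj₂ (_ , q) | inj₂ (inj₁ (_ , fr , r)) = inj₂ (q , inj₁ (fr , r))
      ... | inj₂ (_ , q) | inj₂ (inj₂ (_ , n , r)) = inj₂ (q , inj₂ (n , r))

      fresh-of-cur : ∀ {x z} → Big (cur e x) → cur e x ≡ inst z → Fresh z → Fresh (μ ⟨$⟩ʳ x)
      fresh-of-cur {x} b q = fresh-const (subst Big q b) (trans (sym q) (trans (cong (cur e) (sym (inverseˡ μ))) (sym (inst-cur (μ ⟨$⟩ʳ x)))))

      old-inst : ∀ {a x z} → wk (cur a x) ≡ wk (inst z) → cur a x ≡ cur e (down z)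
      old-inst q = trans (wk-inj q) (inst-cur _)

      disjoint⁺ : ∀ {a b a′ b′} → Side a b → Side a′ b′ → ∀ {x x′} → Big⁺ (cur⁺ a x) → cur⁺ a x ≡ cur⁺ a′ x′ → a ≢ a′ → a ≼⁺ a′ →
        b ≼⁺ lev (org⁺ a′ x′)
      disjoint⁺ near near b q n l = ⊥-elim (n refl)
      disjoint⁺ far far b q n l = ⊥-elim (n refl)
      disjoint⁺ far near b q n l = ⊥-elim (f⋠e (new-≼⁻ l))
      disjoint⁺ near far {x} {z} b q n l with near-view x | far-view z
      ... | inj₁ (u , _) | inj₁ (v , _) = ⊥-elim (new-newᵒ (trans (sym u) (trans q v)))
      ... | inj₁ (u , _) | inj₂ (v , _) = ⊥-elim (new-wk (trans (sym u) (trans q v)))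
      ... | inj₂ (_ , u , _) | inj₁ (v , _) = ⊥-elim (newᵒ-wk (trans (sym v) (trans (sym q) u)))
      ... | inj₂ (nf , u , _) | inj₂ (v , inj₁ (fr , _)) =
        ⊥-elim (nf (fresh-of-cur (big-wk (subst Big⁺ u b)) (wk-inj (trans (sym u) (trans q v))) fr))
      ... | inj₂ (nf , u , _) | inj₂ (v , inj₂ (_ , r)) rewrite r = ≼⁺-refl
      disjoint⁺ near (other n′ g) {x} {x′} b q n l with near-view x
      ... | inj₁ (u , _) = ⊥-elim (new-wk (trans (sym u) (trans q (cur-other x′ n′))))
      ... | inj₂ (_ , u , _) rewrite org-other x′ n′ =
        new-≼ (disjoint gap g (big-wk (subst Big⁺ u b)) (wk-inj (trans (sym u) (trans q (cur-other x′ n′)))) (n′ ∘ sym) (suc-≼⁻ l))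
      disjoint⁺ (other n′ g) near {x} {x′} b q n l with near-view x′
      ... | inj₁ (u , _) = ⊥-elim (new-wk (trans (sym u) (trans (sym q) (cur-other x n′))))
      ... | inj₂ (_ , u , r) rewrite r =
        suc-≼ (disjoint g gap (big-wk (subst Big⁺ (cur-other x n′) b)) (wk-inj (trans (sym (cur-other x n′)) (trans q u))) n′ (suc-≼⁻ l))
      disjoint⁺ far (other n′ g) {z} {x′} b q n l with far-view z
      ... | inj₁ (u , _) = ⊥-elim (newᵒ-wk (trans (sym u) (trans q (cur-other x′ n′))))
      ... | inj₂ (u , _) rewrite org-other x′ n′ =
        let q′ = trans (sym u) (trans q (cur-other x′ n′)) in
        suc-≼ (disjoint gap g (subst Big (inst-cur z) (big-wk (subst Big⁺ u b))) (sym (old-inst (sym q′))) (n′ ∘ sym) (≼-trans (proj₁ gap) (new-≼⁻ l)))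
      disjoint⁺ (other {a} n′ g) far {x} {z} b q n l with far-view z
      ... | inj₁ (u , _) = ⊥-elim (newᵒ-wk (trans (sym u) (trans (sym q) (cur-other x n′))))
      ... | inj₂ (u , inj₁ (_ , r)) rewrite r =
        let q′ = trans (sym (cur-other x n′)) (trans q u) in
        suc-≼ (disjoint g gap (big-wk (subst Big⁺ (cur-other x n′) b)) (old-inst q′) n′ (≼-new⁻ l))
      ... | inj₂ (u , inj₂ (_ , r)) rewrite r with proj₂ (proj₂ g) e
      ...   | inj₁ k = ⊥-elim (n′ (≼-antisym (≼-new⁻ l) k))
      ...   | inj₂ k = ≼-new k
      disjoint⁺ (other n₁ g₁) (other n₂ g₂) {x} {x′} b q n l rewrite org-other x′ n₂ =
        suc-≼ (disjoint g₁ g₂ (big-wk (subst Big⁺ (cur-other x n₁) b)) (wk-inj (trans (sym (cur-other x n₁)) (trans q (cur-other x′ n₂)))) (n ∘ cong suc) (suc-≼⁻ l))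

      injective⁺ : ∀ {a b} → Side a b → ∀ {x x′} → Big⁺ (cur⁺ a x) → cur⁺ a x ≡ cur⁺ a x′ → idx (org⁺ a x) ≡ idx (org⁺ a x′) → x ≡ x′
      injective⁺ near {x} {x′} b q i with near-view x | near-view x′
      ... | inj₁ (_ , r) | inj₁ (_ , r′) rewrite r | r′ = i
      ... | inj₁ (u , _) | inj₂ (_ , u′ , _) = ⊥-elim (new-wk (trans (sym u) (trans q u′)))
      ... | inj₂ (_ , u , _) | inj₁ (u′ , _) = ⊥-elim (new-wk (trans (sym u′) (trans (sym q) u)))
      ... | inj₂ (_ , u , r) | inj₂ (_ , u′ , r′) rewrite r | r′ = injective gap (big-wk (subst Big⁺ u b)) (wk-inj (trans (sym u) (trans q u′))) i
      injective⁺ far {z} {z′} b q i with far-view z | far-view z′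
      ... | inj₁ (_ , r) | inj₁ (_ , r′) rewrite r | r′ = i
      ... | inj₁ (u , _) | inj₂ (u′ , _) = ⊥-elim (newᵒ-wk (trans (sym u) (trans q u′)))
      ... | inj₂ (u , _) | inj₁ (u′ , _) = ⊥-elim (newᵒ-wk (trans (sym u′) (trans (sym q) u)))
      ... | inj₂ (_ , inj₂ (_ , r)) | inj₂ (_ , inj₂ (_ , r′)) rewrite r | r′ = i
      ... | inj₂ (u , inj₁ (fr , _)) | inj₂ (u′ , inj₂ (n , _)) = ⊥-elim (n (fresh-const (big-wk (subst Big⁺ u b)) (wk-inj (trans (sym u) (trans q u′))) fr))
      ... | inj₂ (u , inj₂ (n , _)) | inj₂ (u′ , inj₁ (fr , _)) =
        ⊥-elim (n (fresh-const (big-wk (subst Big⁺ (trans q u′) b)) (wk-inj (trans (sym u′) (trans (sym q) u))) fr))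
      ... | inj₂ (u , inj₁ (_ , r)) | inj₂ (u′ , inj₁ (_ , r′)) rewrite r | r′ = perm-injective (flip μ)
        (injective gap (subst Big (inst-cur z) (big-wk (subst Big⁺ u b))) (trans (sym (inst-cur z)) (trans (wk-inj (trans (sym u) (trans q u′))) (inst-cur z′))) i)
      injective⁺ (other n g) {x} {x′} b q i rewrite org-other x n | org-other x′ n =
        injective g (big-wk (subst Big⁺ (cur-other x n) b)) (wk-inj (trans (sym (cur-other x n)) (trans q (cur-other x′ n)))) i

      chained⁺ : ∀ t z t′ z′ {I o o′ p x p′ x′} → item⁺ t z ≡ just (I , o , p , x) → item⁺ t′ z′ ≡ just (I , o′ , p′ , x′) →
        lev o ≡ lev o′ → idx o ≡ idx o′ → (t ≡ t′ × z ≡ z′) ⊎ Le⁺ t z p′ x′ ⊎ Le⁺ t′ z′ p x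
      chained⁺ zero z zero z′ i i′ h k with b , _ , q , refl ← item-new i | _ , _ , q′ , refl ← item-new i′ =
        inj₁ (refl , perm-injective (flip μ) (injective gap (subst Big (inst-cur z) b)
          (trans (sym (inst-cur z)) (trans (wk-inj (trans (sym q) q′)) (inst-cur z′))) k))
      chained⁺ (suc t) z zero z′ i i′ h k with I , o , p , x , j , refl , refl ← item-old i | b , _ , q , refl ← item-new i′
        with refl ← trans (wk-inj q) (inst-cur z′) =
        inj₂ (inj₁ (suc-Le (proj₂ (below-live gap (down z′) (subst Big (inst-cur z′) b) j (Fin.suc-injective h)) k)))
      chained⁺ zero z (suc t′) z′ i i′ h k with I , o , p , x , j , refl , refl ← item-old i′ | b , _ , q , refl ← item-new i
        with refl ← trans (wk-inj q) (inst-cur z) =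
        inj₂ (inj₂ (suc-Le (proj₂ (below-live gap (down z) (subst Big (inst-cur z) b) j (Fin.suc-injective (sym h))) (sym k))))
      chained⁺ (suc t) z (suc t′) z′ i i′ h k with I , o , p , x , j , refl , refl ← item-old i | I′ , o′ , p′ , x′ , j′ , q , refl ← item-old i′
        with refl ← wk-inj q with chained j j′ (Fin.suc-injective h) k
      ... | inj₁ (u , v) = inj₁ (cong suc u , v)
      ... | inj₂ (inj₁ l) = inj₂ (inj₁ (suc-Le l))
      ... | inj₂ (inj₂ l) = inj₂ (inj₂ (suc-Le l))

    zones⁺ : Zones LS⁺ Z⁺
    zones⁺ = record
      { start-below = start-below⁺ ; live = λ g → live⁺ (side g) ; attached = attached⁺ ; below-live = λ g → below-live⁺ (side g)
      ; disjoint = λ g g′ → disjoint⁺ (side g) (side g′) ; injective = λ g → injective⁺ (side g) ; chained = λ {t} {z} {t′} {z′} → chained⁺ t z t′ z′ }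

-- The skeleton of the large instances: thread origins, items and splitting levels

private
  mex-from : ℕ → ℕ → List ℕ → ℕ
  mex-from zero n xs = n
  mex-from (suc k) n xs with Any.any? (n ℕ.≟_) xs
  ... | yes _ = mex-from k (suc n) xs
  ... | no _ = n

-- The least number not in a list.
mex : List ℕ → ℕ
mex xs = mex-from (suc (length xs)) 0 xs

mex-below : ∀ xs {c} → c < mex xs → c ∈ xs
mex-below xs = go (suc (length xs)) 0 (λ ())
  where
  go : ∀ k n → (∀ {c} → c < n → c ∈ xs) → ∀ {c} → c < mex-from k n xs → c ∈ xs
  go zero n h l = h l
  go (suc k) n h l with Any.any? (n ℕ.≟_) xs
  ... | no _ = h l
  ... | yes n∈ = go k (suc n) (λ { {c} (s≤s c≤n) → case ℕ.m≤n⇒m<n∨m≡n c≤n of λ { (inj₁ c<n) → h c<n ; (inj₂ refl) → n∈ } }) l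

mex-∉ : ∀ xs → mex xs ∉ xs
mex-∉ xs m = go (suc (length xs)) 0 (λ ()) (ℕ.≤-reflexive (sym (ℕ.+-identityʳ _))) m
  where
  go : ∀ k n → (∀ {c} → c < n → c ∈ xs) → suc (length xs) ≤ k + n → mex-from k n xs ∉ xs
  go zero n h l _ = ℕ.<-irrefl refl (ℕ.≤-trans l (subst (_≤ length xs) (length-tabulate toℕ)
    (inj-length id {xs = tabulate {n = n} toℕ} xs (Unique.tabulate⁺ Fin.toℕ-injective) (λ _ _ → id)
      λ m → case ∈-tabulate⁻ m of λ { (i , refl) → h (Fin.toℕ<n i) })))
  go (suc k) n h l with Any.any? (n ℕ.≟_) xs
  ... | no n∉ = n∉
  ... | yes n∈ = go k (suc n) (λ { {c} (s≤s c≤n) → case ℕ.m≤n⇒m<n∨m≡n c≤n of λ { (inj₁ c<n) → h c<n ; (inj₂ refl) → n∈ } })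
    (subst (suc (length xs) ≤_) (sym (ℕ.+-suc k n)) l)

currentʰ : ∀ {w′ m} (r : ℕ) (S : Sys (suc w′) m) → Fin m → Fin (suc w′) → Name S
currentʰ r base _ _ = name (suc zero) zero zero (tt , λ ())
currentʰ r (ins S p s p≼s p≢s adj L U ref pt) = hi
  where
  open Step r S p s p≼s p≢s adj L U ref pt (current r S)
  hi : Fin _ → Fin _ → Name S⁺
  hi zero z = curˡ (down z)
  hi (suc b) y with b Fin.≟ s
  ... | yes _ = curʰ (main U ⟨$⟩ˡ y)
  ... | no _ = wk (currentʰ r S b y)

Item : ∀ {w m} → Sys w m → Set
Item {w} {m} S = Name S × Origin w m × Fin m × Fin w

record Skeleton {w m : ℕ} (S : Sys w m) : Set where
  field
    orgˡ orgʰ : Fin m → Fin w → Origin w m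
    itemˡ itemʰ : Fin m → Fin w → Maybe (Item S)
    splits : List (Name S × Fin m × ℕ)

  Split : Name S → Fin m → ℕ → Set
  Split I ℓ c = (I , ℓ , c) ∈ splits

  SplitLevel : Name S → Fin m → Set
  SplitLevel I ℓ = ∃[ c ] Split I ℓ c

  private
    At : Name S → Fin m → Name S × Fin m × ℕ → Set
    At I ℓ (J , k , c) = I ≡ J × ℓ ≡ k

    At⇒Split : ∀ {I ℓ} → Any (At I ℓ) splits → SplitLevel I ℓ
    At⇒Split h with (J , k , c) , m , refl , refl ← find h = c , m

  SplitLevel? : ∀ I ℓ → Dec (SplitLevel I ℓ)
  SplitLevel? I ℓ = map′ At⇒Split (λ (c , m) → lose m (refl , refl))
    (Any.any? (λ (J , k , c) → (I ≟ᴺᵃ J) ×-dec (ℓ Fin.≟ k)) splits)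

module SkeletonStep {w m : ℕ} {N : Set} (e : Fin m) (μ : Permutation′ w) {Fresh Freshᵒ : Fin w → Set}
  (Fresh? : ∀ z → Dec (Fresh z)) (Freshᵒ? : ∀ z → Dec (Freshᵒ z)) (c : Fin w → ℕ) (org : Fin m → Fin w → Origin w m) where

  org⁺ : Fin (suc m) → Fin w → Origin w (suc m)
  org⁺ zero z with Freshᵒ? z | Fresh? z
  ... | yes _ | _ = origin zero z 0
  ... | no _ | yes _ = lift-origin (org e (μ ⟨$⟩ˡ z))
  ... | no _ | no _ = origin zero z (c z)
  org⁺ (suc a) x with a Fin.≟ e | Fresh? (μ ⟨$⟩ʳ x)
  ... | yes _ | yes _ = origin (suc e) x 0
  ... | yes _ | no _ = lift-origin (org e x)
  ... | no _ | _ = lift-origin (org a x)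

  org-near : ∀ x → (Fresh (μ ⟨$⟩ʳ x) × org⁺ (suc e) x ≡ origin (suc e) x 0) ⊎ (¬ Fresh (μ ⟨$⟩ʳ x) × org⁺ (suc e) x ≡ lift-origin (org e x))
  org-near x with e Fin.≟ e | Fresh? (μ ⟨$⟩ʳ x)
  ... | yes _ | yes f = inj₁ (f , refl)
  ... | yes _ | no n = inj₂ (n , refl)
  ... | no n | _ = ⊥-elim (n refl)

  org-far : ∀ z → (Freshᵒ z × org⁺ zero z ≡ origin zero z 0)
    ⊎ (¬ Freshᵒ z × Fresh z × org⁺ zero z ≡ lift-origin (org e (μ ⟨$⟩ˡ z)))
    ⊎ (¬ Freshᵒ z × ¬ Fresh z × org⁺ zero z ≡ origin zero z (c z))
  org-far z with Freshᵒ? z | Fresh? z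
  ... | yes f | _ = inj₁ (f , refl)
  ... | no n | yes f = inj₂ (inj₁ (n , f , refl))
  ... | no n | no n′ = inj₂ (inj₂ (n , n′ , refl))

  org-other : ∀ {a} x → a ≢ e → org⁺ (suc a) x ≡ lift-origin (org a x)
  org-other {a} x n with a Fin.≟ e | Fresh? (μ ⟨$⟩ʳ x)
  ... | yes q | _ = ⊥-elim (n q)
  ... | no _ | _ = refl

  module Items {N⁺ : Set} (wk : N → N⁺) {Big : N → Set} (big? : ∀ I → Dec (Big I)) (inst : Fin w → N)
    (item : Fin m → Fin w → Maybe (N × Origin w m × Fin m × Fin w)) where

    lift-item : N × Origin w m × Fin m × Fin w → N⁺ × Origin w (suc m) × Fin (suc m) × Fin w
    lift-item (I , o , p , x) = wk I , lift-origin o , suc p , x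

    item⁺ : Fin (suc m) → Fin w → Maybe (N⁺ × Origin w (suc m) × Fin (suc m) × Fin w)
    item⁺ zero z with big? (inst z) | Fresh? z
    ... | yes _ | yes _ = just (wk (inst z) , lift-origin (org e (μ ⟨$⟩ˡ z)) , suc e , (μ ⟨$⟩ˡ z))
    ... | _ | _ = nothing
    item⁺ (suc t) z with item t z
    ... | just i = just (lift-item i)
    ... | nothing = nothing

    item-old : ∀ {t z J j} → item⁺ (suc t) z ≡ just (J , j) →
      ∃[ I ] ∃[ o ] ∃[ p ] ∃[ x ] item t z ≡ just (I , o , p , x) × J ≡ wk I × j ≡ (lift-origin o , suc p , x)
    item-old {t} {z} h with item t z
    item-old refl | just (I , o , p , x) = I , o , p , x , refl , refl , refl

    item-new : ∀ {z J j} → item⁺ zero z ≡ just (J , j) →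
      Big (inst z) × Fresh z × J ≡ wk (inst z) × j ≡ (lift-origin (org e (μ ⟨$⟩ˡ z)) , suc e , (μ ⟨$⟩ˡ z))
    item-new {z} h with big? (inst z) | Fresh? z
    item-new refl | yes b | yes f = b , f , refl , refl

    item-here : ∀ {z} → Big (inst z) → Fresh z → item⁺ zero z ≡ just (wk (inst z) , lift-origin (org e (μ ⟨$⟩ˡ z)) , suc e , (μ ⟨$⟩ˡ z))
    item-here {z} b f with big? (inst z) | Fresh? z
    ... | yes _ | yes _ = refl
    ... | no n | _ = ⊥-elim (n b)
    ... | yes _ | no n = ⊥-elim (n f)

    item-kept : ∀ {t z I o p x} → item t z ≡ just (I , o , p , x) → item⁺ (suc t) z ≡ just (wk I , lift-origin o , suc p , x)
    item-kept h rewrite h = refl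

module SplitColour {w m : ℕ} (S : Sys w m) (sk : Skeleton S) (p s : Fin m) where
  open Names S
  open Skeleton sk

  -- Splitting levels of I strictly between the gap (p , s) and ℓ.
  Between : Name S → Fin m → Fin m → Set
  Between I ℓ ℓ′ = SplitLevel I ℓ′ × ℓ ≢ ℓ′ × ((s ≼ ℓ′ × ℓ′ ≼ ℓ) ⊎ (ℓ ≼ ℓ′ × ℓ′ ≼ p))

  Between? : ∀ I ℓ ℓ′ → Dec (Between I ℓ ℓ′)
  Between? I ℓ ℓ′ = SplitLevel? I ℓ′ ×-dec ¬? (ℓ Fin.≟ ℓ′) ×-dec (((s ≼? ℓ′) ×-dec (ℓ′ ≼? ℓ)) ⊎-dec ((ℓ ≼? ℓ′) ×-dec (ℓ′ ≼? p)))

  between : Name S → Fin m → List (Fin m)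
  between I ℓ = filter (Between? I ℓ) (allFin m)

  Close : Name S → Name S × Fin m × ℕ → Set
  Close I (J , ℓ , c) = I ≡ J × length (between I ℓ) ≤ w * w

  Close? : ∀ I e → Dec (Close I e)
  Close? I (J , ℓ , c) = (I ≟ᴺᵃ J) ×-dec (length (between I ℓ) ℕ.≤? w * w)

  used : Name S → List ℕ
  used I = 0 ∷ map (proj₂ ∘ proj₂) (filter (Close? I) splits)

  used⁻ : ∀ {I c} → suc c ∈ used I → ∃[ ℓ ] Split I ℓ (suc c) × length (between I ℓ) ≤ w * w
  used⁻ {I} (there h) with (J , ℓ , c) , m , refl ← ∈-map⁻ (proj₂ ∘ proj₂) h with m′ , refl , l ← ∈-filter⁻ (Close? I) {xs = splits} m = ℓ , m′ , l

  opaque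
    fresh-colour : Name S → ℕ
    fresh-colour I = mex (used I)

    fresh-colour-≢0 : ∀ {I} → fresh-colour I ≢ 0
    fresh-colour-≢0 {I} e = mex-∉ (used I) (subst (_∈ used I) (sym e) (here refl))

    fresh-colour-far : ∀ {I ℓ} → Split I ℓ (fresh-colour I) → w * w < length (between I ℓ)
    fresh-colour-far {I} {ℓ} h = ℕ.≰⇒> λ l → mex-∉ (used I) (there (∈-map⁺ (proj₂ ∘ proj₂) (∈-filter⁺ (Close? I) h (refl , l))))

    fresh-colour-used : ∀ {I c} → c < fresh-colour I → c ∈ used I
    fresh-colour-used {I} = mex-below (used I)

  module _ (adj : ∀ c → c ≼ p ⊎ s ≼ c) (functional : ∀ {I ℓ c c′} → Split I ℓ c → Split I ℓ c′ → c ≡ c′) (I : Name S) where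

    private
      few : (_⊑_ : Fin m → Fin m → Set) (_⊑?_ : ∀ a b → Dec (a ⊑ b)) → (∀ {a} → a ⊑ a) → (∀ {a b c} → a ⊑ b → b ⊑ c → a ⊑ c) →
        (∀ a b → a ⊑ b ⊎ b ⊑ a) → ∀ xs → Unique xs → (∀ {ℓ} → ℓ ∈ xs → length (between I ℓ) ≤ w * w) →
        (∀ {a b} → a ∈ xs → b ∈ xs → a ≢ b → a ⊑ b → Between I a b) → length xs ≤ suc (w * w)
      few _⊑_ _⊑?_ rf tr tot [] u close h = z≤n
      few _⊑_ _⊑?_ rf tr tot (x ∷ xs) u close h with t , t∈ , t≤ ← least _⊑_ _⊑?_ rf tr tot x xs =
        ℕ.≤-trans (inj-length id (t ∷ between I t) u (λ _ _ → id) cover) (s≤s (close t∈))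
        where
        cover : ∀ {y} → y ∈ x ∷ xs → y ∈ t ∷ between I t
        cover {y} y∈ with t Fin.≟ y
        ... | yes refl = here refl
        ... | no n = there (∈-filter⁺ (Between? I t) (∈-allFin y) (h t∈ y∈ n (All.lookup t≤ y∈)))

    fresh-colour-small : fresh-colour I ≤ suc (suc (w * w) + suc (w * w))
    fresh-colour-small with fresh-colour I | fresh-colour-used {I}
    ... | zero | _ = z≤n
    ... | suc k | use = s≤s (subst (_≤ suc (w * w) + suc (w * w)) (trans (sym (filter-split above? levels)) (length-tabulate lv))
        (ℕ.+-mono-≤ (few (λ a b → b ≼ a) (λ a b → b ≼? a) ≼-refl (λ u v → ≼-trans v u) (λ a b → ≼-total b a) (filter above? levels)
            (Unique.filter⁺ above? levels-unique) (λ h → proj₂ (split (proj₁ (∈-filter⁻ above? {xs = levels} h))))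
            (λ {a} {b} a∈ b∈ n l → let (a′ , _) = ∈-filter⁻ above? {xs = levels} a∈ ; (b′ , q) = ∈-filter⁻ above? {xs = levels} b∈ in
              proj₁ (split b′) , n , inj₁ (q , l)))
          (few _≼_ _≼?_ ≼-refl ≼-trans ≼-total (filter (λ ℓ → ¬? (above? ℓ)) levels)
            (Unique.filter⁺ (λ ℓ → ¬? (above? ℓ)) levels-unique) (λ h → proj₂ (split (proj₁ (∈-filter⁻ (λ ℓ → ¬? (above? ℓ)) {xs = levels} h))))
            (λ {a} {b} a∈ b∈ n l → let (b′ , q) = ∈-filter⁻ (λ ℓ → ¬? (above? ℓ)) {xs = levels} b∈ in
              proj₁ (split b′) , n , inj₂ (l , [ id , (λ r → ⊥-elim (q r)) ]′ (adj b))))))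
      where
      above? = λ ℓ → s ≼? ℓ
      found : (i : Fin k) → ∃[ ℓ ] Split I ℓ (suc (toℕ i)) × length (between I ℓ) ≤ w * w
      found i = used⁻ (use (s≤s (Fin.toℕ<n i)))
      lv : Fin k → Fin m
      lv i = proj₁ (found i)
      levels = tabulate lv
      levels-unique : Unique levels
      levels-unique = Unique.tabulate⁺ λ {i} {j} e → Fin.toℕ-injective (ℕ.suc-injective
        (functional (proj₁ (proj₂ (found i))) (subst (λ ℓ → Split I ℓ (suc (toℕ j))) (sym e) (proj₁ (proj₂ (found j))))))
      split : ∀ {ℓ} → ℓ ∈ levels → SplitLevel I ℓ × length (between I ℓ) ≤ w * w
      split h with i , refl ← ∈-tabulate⁻ h = (_ , proj₁ (proj₂ (found i))) , proj₂ (proj₂ (found i))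

module SkeletonIns {w′ m : ℕ} (r : ℕ) (S : Sys (suc w′) m) (p s : Fin m) (p≼s : below S p s) (p≢s : p ≢ s)
  (adj : ∀ c → below S c p ⊎ below S s c) (L U : Link (suc w′))
  (refines : ∀ {x z y} → Edge L x z → Edge U z y → Below S p x s y) (pt : Fin (suc w′)) (sk : Skeleton S) where
  private
    w : ℕ
    w = suc w′

  open Step r S p s p≼s p≢s adj L U refines pt (current r S) public
  open Skeleton sk
  open SplitColour S sk p s using (fresh-colour) public

  parent : Fin w → Name S
  parent z = current r S p (down z)

  big? : ∀ I → Dec (Big I)
  big? I = r ℕ.<? _

  Freshᵈ? : ∀ z → Dec (Freshˡ (down z))
  Freshᵈ? z = Freshˡ? (down z)

  module Sˡ = SkeletonStep {N = Name S} p (main L) Freshᵈ? Freshʰ? (fresh-colour ∘ parent) orgˡ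
  module Sʰ = SkeletonStep {N = Name S} s (flip (main U)) Freshʰ? Freshᵈ? (fresh-colour ∘ parent) orgʰ
  module Iˡ = Sˡ.Items wk big? parent itemˡ
  module Iʰ = Sʰ.Items wk big? parent itemʰ

  SplitHere : Fin w → Set
  SplitHere z = Big (parent z) × ¬ Freshˡ (down z) × ¬ Freshʰ z

  SplitHere? : ∀ z → Dec (SplitHere z)
  SplitHere? z = big? (parent z) ×-dec ¬? (Freshᵈ? z) ×-dec ¬? (Freshʰ? z)

  new-splits old-splits : List (Name S⁺ × Fin (suc m) × ℕ)
  new-splits = map (λ z → wk (parent z) , zero , fresh-colour (parent z)) (filter SplitHere? (allFin w))
  old-splits = map (λ (I , ℓ , c) → wk I , suc ℓ , c) splits

  skeleton⁺ : Skeleton S⁺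
  skeleton⁺ = record { orgˡ = Sˡ.org⁺ ; orgʰ = Sʰ.org⁺ ; itemˡ = Iˡ.item⁺ ; itemʰ = Iʰ.item⁺ ; splits = new-splits ++ old-splits }

skeleton : ∀ {w′ m} (r : ℕ) (S : Sys (suc w′) m) → Skeleton S
skeleton r base = record
  { orgˡ = λ a x → origin a x 0 ; orgʰ = λ a x → origin a x 0 ; itemˡ = λ _ _ → nothing ; itemʰ = λ _ _ → nothing ; splits = [] }
skeleton r (ins S p s p≼s p≢s adj L U ref pt) = SkeletonIns.skeleton⁺ r S p s p≼s p≢s adj L U ref pt (skeleton r S)

module _ {w′ m : ℕ} (r : ℕ) (S : Sys (suc w′) m) {cur : Fin m → Fin (suc w′) → Name S} {In : Name S → Set}
  (inv : ForestInvariant r S cur In) where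
  private
    w : ℕ
    w = suc w′

  open Names S
  open ForestInvariant inv

  conn-trace : ∀ {a b} → Adjacent a b → ∀ {x x′} → Conn S a b x x′ → Trace (cur a x) a x′
  conn-trace {a} {b} g {x} f = Components.conn-elim S a b {P = Trace N a} (λ v → Fin.any? λ u → Conn? S (Name.lo N) (Name.hi N) (Name.root N) u ×-dec Below? S (Name.lo N) u a v)
      (λ l l′ t → trace-down N lo≼ ≼hi l′ (trace-up N l t)) f tr
    where
    N = cur a x
    lo≼ = proj₁ (cur-contains g x)
    ≼hi = proj₁ (proj₂ (cur-contains g x))
    tr = proj₂ (proj₂ (cur-contains g x))

  -- A large instance fills the whole component of each of its current gaps.
  trace-conn : ∀ {a b} → Adjacent a b → ∀ {x x′} → r < size (cur a x) → Trace (cur a x) a x′ → Conn S a b x x′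
  trace-conn {a} {b} g {x} {x′} big tr with Conn? S a b x x′
  ... | yes f = f
  ... | no n = ⊥-elim (ℕ.<-irrefl (cur-big g x big) (inj-length push (L.members (Name.root N)) uniq (λ _ _ → push-inj) cover))
    where
    N = cur a x
    module C = Components S a b
    module L = Components S (Name.lo N) (Name.hi N)
    push : Fin w → Fin w
    push v = thread (Name.lo N) ⟨$⟩ʳ (thread a ⟨$⟩ˡ v)
    push-inj : ∀ {u v} → push u ≡ push v → u ≡ v
    push-inj e = perm-injective (flip (thread a)) (perm-injective (thread (Name.lo N)) e)
    uniq : Unique (x′ ∷ C.members x)
    uniq = All.tabulate (λ { m refl → n (C.members-∈ m) }) ∷ C.members-unique x
    bottom : ∀ {v} → Trace N a v → push v ∈ L.members (Name.root N)
    bottom {v} t with u , Xu , l ← trace-down N ≼-refl (≼-trans (proj₁ g) (proj₁ (proj₂ (cur-contains g x)))) (thread-down (proj₁ (cur-contains g x)) v) t =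
      L.∈-members (subst (Bottom N) (Le-eq l) Xu)
    cover : ∀ {v} → v ∈ x′ ∷ C.members x → push v ∈ L.members (Name.root N)
    cover (here refl) = bottom tr
    cover (there m) = bottom (conn-trace g (C.members-∈ m))

neighbourˡ neighbourʰ : ∀ {w m} → Sys w m → Fin m → Fin m
neighbourˡ base _ = suc zero
neighbourˡ (ins S p _ _ _ _ _ _ _ _) zero = suc p
neighbourˡ (ins S _ _ _ _ _ _ _ _ _) (suc a) = suc (neighbourˡ S a)
neighbourʰ base _ = zero
neighbourʰ (ins S _ s _ _ _ _ _ _ _) zero = suc s
neighbourʰ (ins S _ _ _ _ _ _ _ _ _) (suc a) = suc (neighbourʰ S a)

neighbours : ∀ {w m} (S : Sys w m) a b → below S a b → a ≢ b → below S a (neighbourˡ S b) ⊎ below S (neighbourʰ S a) b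
neighbours base zero zero l n = ⊥-elim (n refl)
neighbours base zero (suc zero) ()
neighbours base (suc zero) b l n = inj₁ tt
neighbours (ins _ _ _ _ _ _ _ _ _ _) zero zero l n = ⊥-elim (n refl)
neighbours (ins _ _ _ _ _ _ _ _ _ _) zero (suc b) l n = inj₂ l
neighbours (ins _ _ _ _ _ _ _ _ _ _) (suc a) zero l n = inj₁ l
neighbours (ins S _ _ _ _ _ _ _ _ _) (suc a) (suc b) l n = neighbours S a b l (n ∘ cong suc)

module _ {w m : ℕ} (S : Sys w m) where
  open Names S

  Within : Name S → Fin m → Fin w → Set
  Within I a x = Name.lo I ≼ a × a ≼ Name.hi I × Trace I a x

  ConnectedOn : Name S → Fin m → Fin m → Set
  ConnectedOn I a b = ∀ {x x′} → Trace I a x → Trace I a x′ → Conn S a b x x′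

  record Frame (I : Name S) (ℓ : Fin m) : Set where
    field
      lo≼ : Name.lo I ≼ neighbourˡ S ℓ
      ≼ℓ : neighbourˡ S ℓ ≼ ℓ
      ℓ≼ : ℓ ≼ neighbourʰ S ℓ
      ≼hi : neighbourʰ S ℓ ≼ Name.hi I
      ≢ℓ : neighbourˡ S ℓ ≢ ℓ
      ℓ≢ : ℓ ≢ neighbourʰ S ℓ
      connˡ : ConnectedOn I (neighbourˡ S ℓ) ℓ
      connʰ : ConnectedOn I ℓ (neighbourʰ S ℓ)

module _ {w m : ℕ} (r : ℕ) (S : Sys w m) (sk : Skeleton S) (cur : Fin m → Fin w → Name S) where
  open Names S
  open Skeleton sk

  zoneˡ zoneʰ : ZoneData w m (Name S)
  zoneˡ = record { cur = cur ; Big = λ I → r < size I ; org = orgˡ ; item = itemˡ ; Split = Split ; On = Within S ; Start = λ I o → o ≡ Name.lo I }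
  zoneʰ = record { cur = cur ; Big = λ I → r < size I ; org = orgʰ ; item = itemʰ ; Split = Split ; On = Within S ; Start = λ I o → o ≡ Name.hi I }

record SkeletonInvariant {w m : ℕ} (r : ℕ) (S : Sys w m) (curˡ curʰ : Fin m → Fin w → Name S) (sk : Skeleton S) : Set₁ where
  open Names S
  open Skeleton sk
  field
    consistent : ∀ {p s} → Adjacent p s → ∀ {x y} → Below S p x s y → curˡ p x ≡ curʰ s y
    functional : ∀ {I ℓ c c′} → Split I ℓ c → Split I ℓ c′ → c ≡ c′
    nonzero : ∀ {I ℓ} → ¬ Split I ℓ 0
    small : ∀ {I ℓ c} → Split I ℓ c → c ≤ suc (suc (w * w) + suc (w * w))
    apart : ∀ {I ℓ ℓ′ c} → Split I ℓ c → Split I ℓ′ c → ℓ ≼ ℓ′ → ℓ ≢ ℓ′ →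
      ∃[ ks ] Unique ks × w * w < length ks × (∀ {k} → k ∈ ks → SplitLevel I k × ℓ ≼ k × k ≼ ℓ′ × ℓ ≢ k × k ≢ ℓ′)
    frame : ∀ {I ℓ c} → Split I ℓ c → Frame S I ℓ
    zonesˡ : Zones (levelSystem S) (zoneˡ r S sk curˡ)
    zonesʰ : Zones (opposite (levelSystem S)) (zoneʰ r S sk curʰ)

module SkeletonInsProof {w′ m : ℕ} (r : ℕ) (S : Sys (suc w′) m) (p s : Fin m) (p≼s : below S p s) (p≢s : p ≢ s)
  (adj : ∀ c → below S c p ⊎ below S s c) (L U : Link (suc w′))
  (refines : ∀ {x z y} → Edge L x z → Edge U z y → Below S p x s y) (pt : Fin (suc w′))
  (inv : SkeletonInvariant r S (current r S) (currentʰ r S) (skeleton r S)) where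
  private
    w : ℕ
    w = suc w′

  open SkeletonIns r S p s p≼s p≢s adj L U refines pt (skeleton r S)
  open StepProof r S p s p≼s p≢s adj L U refines pt (current r S) (InForest r S) (forest-invariant r S)
    using (gap; up-edge; down-edge; side; Side; lower; upper; other; fresh-lower-cong; fresh-upper-cong; size-wk; csize-old; wk-upper; lower-contains; upper-contains;
           size-lowerName; size-upperName; conn-lower; conn-upper; step-invariant)
  open SkeletonInvariant inv
  private
    module O = Names S
    module N = Names S⁺
    module Fo = ForestInvariant (forest-invariant r S)
    module F⁺ = ForestInvariant step-invariant
    module K = Skeleton (skeleton r S)
    module K⁺ = Skeleton skeleton⁺

  up : Fin w → Fin w
  up z = main U ⟨$⟩ʳ z

  thr-edge : ∀ z → Below S p (down z) s (up z)
  thr-edge z = refines (down-edge z) (up-edge z)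

  gapˡ : N.Adjacent (suc p) zero
  gapˡ = O.≼-refl , (λ ()) , λ { zero → inj₂ tt ; (suc c) → adj c }

  gapʰ : N.Adjacent zero (suc s)
  gapʰ = O.≼-refl , (λ ()) , λ { zero → inj₁ tt ; (suc c) → adj c }

  wk-injective : ∀ {I J} → wk I ≡ wk J → I ≡ J
  wk-injective {name _ _ _ _} {name _ _ _ _} refl = refl

  current-near : ∀ x → (Freshˡ x × current r S⁺ (suc p) x ≡ lowerName x) ⊎ (¬ Freshˡ x × current r S⁺ (suc p) x ≡ wk (current r S p x))
  current-near x with p Fin.≟ p
  ... | no n = ⊥-elim (n refl)
  ... | yes _ with Freshˡ? x
  ...   | yes f = inj₁ (f , refl)
  ...   | no f = inj₂ (f , refl)

  current-far : ∀ z → (Freshʰ z × current r S⁺ zero z ≡ upperName z) ⊎ (¬ Freshʰ z × current r S⁺ zero z ≡ wk (parent z))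
  current-far z with Freshʰ? z
  ... | yes f = inj₁ (f , refl)
  ... | no f = inj₂ (f , refl)

  current-other : ∀ {a} x → a ≢ p → current r S⁺ (suc a) x ≡ wk (current r S a x)
  current-other {a} x n with a Fin.≟ p
  ... | yes e = ⊥-elim (n e)
  ... | no _ = refl

  curˡ-eq : ∀ x → current r S⁺ (suc p) x ≡ curˡ x
  curˡ-eq x with p Fin.≟ p
  ... | yes _ = refl
  ... | no n = ⊥-elim (n refl)

  currentʰ-near : ∀ y → currentʰ r S⁺ (suc s) y ≡ curʰ (main U ⟨$⟩ˡ y)
  currentʰ-near y with s Fin.≟ s
  ... | yes _ = refl
  ... | no n = ⊥-elim (n refl)

  currentʰ-other : ∀ {a} x → a ≢ s → currentʰ r S⁺ (suc a) x ≡ wk (currentʰ r S a x)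
  currentʰ-other {a} x n with a Fin.≟ s
  ... | yes e = ⊥-elim (n e)
  ... | no _ = refl

  -- Whether the new level splits off part of a large instance does not depend on the element.
  freshˡ-const : ∀ {z z′} → Big (parent z) → parent z ≡ parent z′ → Freshˡ (down z) → Freshˡ (down z′)
  freshˡ-const {z} {z′} b e f with current-near (down z′)
  ... | inj₁ (f′ , _) = f′
  ... | inj₂ (n , q) = fresh-lower-cong (Components.conn-sym S⁺ (suc p) zero
      (trace-conn r S⁺ step-invariant gapˡ {x = down z′} {x′ = down z}
        (subst (λ N → r < N.size N) (sym q) (subst (r <_) (sym (size-wk (parent z′))) (subst Big e b)))
        (subst (λ N → N.Trace N (suc p) (down z)) (sym q)
          (subst (λ I → N.Trace (wk I) (suc p) (down z)) e (trace (parent z) (proj₂ (proj₂ (Fo.cur-contains gap (down z))))))))) f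
    where
    trace : ∀ I {x} → O.Trace I p x → N.Trace (wk I) (suc p) x
    trace (name _ _ _ _) t = t

  freshʰ-const : ∀ {z z′} → Big (parent z) → parent z ≡ parent z′ → Freshʰ z → Freshʰ z′
  freshʰ-const {z} {z′} b e f with current-far z′
  ... | inj₁ (f′ , _) = f′
  ... | inj₂ (n , q) = fresh-upper-cong (Components.conn-sym S⁺ zero (suc s)
      (trace-conn r S⁺ step-invariant gapʰ {x = z′} {x′ = z}
        (subst (λ N → r < N.size N) (sym q) (subst (r <_) (sym (size-wk (parent z′))) (subst Big e b)))
        (subst (λ N → N.Trace N zero z) (sym q)
          (subst (λ I → N.Trace (wk I) zero z) e (trace (parent z) (proj₂ (proj₂ (Fo.cur-contains gap (down z))))))))) f
    where
    trace : ∀ I → O.Trace I p (down z) → N.Trace (wk I) zero z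
    trace (name _ _ _ _) (x , Xx , l) = x , Xx , (_ , l , down-edge z)

  On-wk : ∀ {I a x} → Within S I a x → Within S⁺ (wk I) (suc a) x
  On-wk {name _ _ _ _} o = o

  On-new : ∀ z → Within S⁺ (wk (parent z)) zero z
  On-new z = go (parent z) (Fo.cur-contains gap (down z))
    where
    go : ∀ I → O.Contains I p s (down z) → Within S⁺ (wk I) zero z
    go (name _ _ _ _) (l , h , (x , Xx , k)) = l , h , (x , Xx , (_ , k , down-edge z))

  On-lowerName : ∀ x → Within S⁺ (lowerName x) (suc p) x
  On-lowerName x = let (_ , _ , t) = lower-contains x in O.≼-refl , O.≼-refl , t

  On-lowerName-top : ∀ z → Within S⁺ (lowerName (down z)) zero z
  On-lowerName-top z = O.≼-refl , tt , N.trace-up (lowerName (down z)) {a = suc p} {b = zero} (_ , Below-refl S p (down z) , down-edge z) (proj₂ (proj₂ (lower-contains (down z))))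

  On-upperName : ∀ z → Within S⁺ (upperName z) zero z
  On-upperName z = tt , O.≼-refl , proj₂ (proj₂ (upper-contains z))

  On-upperName-top : ∀ y → Within S⁺ (upperName (main U ⟨$⟩ˡ y)) (suc s) y
  On-upperName-top y = O.≼-refl , O.≼-refl , N.trace-up (upperName z) {a = zero} {b = suc s}
      (_ , up-edge z , subst (Below S s (up z) s) (inverseʳ (main U)) (Below-refl S s (up z))) (proj₂ (proj₂ (upper-contains z)))
    where z = main U ⟨$⟩ˡ y

  consistent⁺ : ∀ {a b} → N.Adjacent a b → ∀ {x y} → Below S⁺ a x b y → current r S⁺ a x ≡ currentʰ r S⁺ b y
  consistent⁺ g = go (side g)
    where
    go : ∀ {a b} → Side a b → ∀ {x y} → Below S⁺ a x b y → current r S⁺ a x ≡ currentʰ r S⁺ b y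
    go lower {x} {z} l = trans (F⁺.cur-cong gapˡ (Components.conn-step S⁺ (suc p) zero {y = z} l (_ , Below-refl S p (down z) , down-edge z)))
      (curˡ-eq (down z))
    go upper {z} {y} l = trans (F⁺.cur-cong gapʰ {x = z} {x′ = main U ⟨$⟩ˡ y} (Components.conn-step S⁺ zero (suc s) {y = y} l
      (_ , up-edge (main U ⟨$⟩ˡ y) , subst (Below S s (up (main U ⟨$⟩ˡ y)) s) (inverseʳ (main U)) (Below-refl S s _)))) (sym (currentʰ-near y))
    go (other {a} {b} n g) {x} {y} l = trans (current-other x n) (trans (cong wk (consistent g l)) (sym (currentʰ-other y not-s)))
      where
      not-s : b ≢ s
      not-s refl with proj₂ (proj₂ g) p | adj a
      ... | inj₂ k | _ = s⋠p S p≼s p≢s k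
      ... | inj₁ k | inj₁ k′ = n (O.≼-antisym k′ k)
      ... | inj₁ k | inj₂ k′ = proj₁ (proj₂ g) (O.≼-antisym (proj₁ g) k′)

  split⁻ : ∀ {J ℓ c} → K⁺.Split J ℓ c →
    (∃[ z ] SplitHere z × J ≡ wk (parent z) × ℓ ≡ zero × c ≡ fresh-colour (parent z)) ⊎ (∃[ I ] ∃[ k ] K.Split I k c × J ≡ wk I × ℓ ≡ suc k)
  split⁻ h with ∈-++⁻ new-splits h
  ... | inj₁ m with z , z∈ , refl ← ∈-map⁻ _ m = inj₁ (z , proj₂ (∈-filter⁻ SplitHere? {xs = allFin w} z∈) , refl , refl , refl)
  ... | inj₂ m with (I , k , c) , i∈ , refl ← ∈-map⁻ _ m = inj₂ (I , k , i∈ , refl , refl)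

  split-wk : ∀ {I ℓ c} → K.Split I ℓ c → K⁺.Split (wk I) (suc ℓ) c
  split-wk h = ∈-++⁺ʳ new-splits (∈-map⁺ (λ (I , ℓ , c) → wk I , suc ℓ , c) h)

  split-here : ∀ {z} → SplitHere z → K⁺.Split (wk (parent z)) zero (fresh-colour (parent z))
  split-here {z} h = ∈-++⁺ˡ (∈-map⁺ (λ z → wk (parent z) , zero , fresh-colour (parent z)) (∈-filter⁺ SplitHere? (∈-allFin z) h))

  split-old : ∀ {J ℓ c} → K⁺.Split J (suc ℓ) c → ∃[ I ] J ≡ wk I × K.Split I ℓ c
  split-old h with split⁻ h
  ... | inj₁ (_ , _ , _ , () , _)
  ... | inj₂ (I , k , i , e , refl) = I , e , i

  split-new : ∀ {J c} → K⁺.Split J zero c → ∃[ z ] SplitHere z × J ≡ wk (parent z) × c ≡ fresh-colour (parent z)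
  split-new h with split⁻ h
  ... | inj₁ (z , sh , e , _ , e′) = z , sh , e , e′
  ... | inj₂ (_ , _ , _ , _ , ())

  wk-old : ∀ {I J ℓ c} → K⁺.Split J (suc ℓ) c → J ≡ wk I → K.Split I ℓ c
  wk-old {I} h e with I′ , e′ , i ← split-old h with refl ← wk-injective {I} {I′} (trans (sym e) e′) = i

  functional⁺ : ∀ {J ℓ c c′} → K⁺.Split J ℓ c → K⁺.Split J ℓ c′ → c ≡ c′
  functional⁺ {ℓ = zero} h h′ with z , _ , e , q ← split-new h | z′ , _ , e′ , q′ ← split-new h′ =
    trans q (trans (cong fresh-colour (wk-injective (trans (sym e) e′))) (sym q′))
  functional⁺ {ℓ = suc ℓ} h h′ with I , e , i ← split-old h = functional i (wk-old h′ e)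

  open SplitColour S (skeleton r S) p s using (fresh-colour-≢0; fresh-colour-far; fresh-colour-small; between; Between; Between?)

  nonzero⁺ : ∀ {J ℓ} → ¬ K⁺.Split J ℓ 0
  nonzero⁺ {ℓ = zero} h with z , _ , _ , q ← split-new h = fresh-colour-≢0 (sym q)
  nonzero⁺ {ℓ = suc ℓ} h with I , _ , i ← split-old h = nonzero i

  small⁺ : ∀ {J ℓ c} → K⁺.Split J ℓ c → c ≤ suc (suc (w * w) + suc (w * w))
  small⁺ {ℓ = zero} h with z , _ , _ , refl ← split-new h = fresh-colour-small adj functional (parent z)
  small⁺ {ℓ = suc ℓ} h with I , _ , i ← split-old h = small i

  Apart : Name S⁺ → Fin (suc m) → Fin (suc m) → Set
  Apart J ℓ ℓ′ = ∃[ ks ] Unique ks × w * w < length ks ×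
    (∀ {k} → k ∈ ks → K⁺.SplitLevel J k × ℓ N.≼ k × k N.≼ ℓ′ × ℓ ≢ k × k ≢ ℓ′)

  apart⁺ : ∀ {J ℓ ℓ′ c} → K⁺.Split J ℓ c → K⁺.Split J ℓ′ c → ℓ N.≼ ℓ′ → ℓ ≢ ℓ′ → Apart J ℓ ℓ′
  apart⁺ {ℓ = zero} {zero} h h′ l n = ⊥-elim (n refl)
  apart⁺ {J} {zero} {suc ℓ′} h h′ l n with z , _ , refl , refl ← split-new h =
    map suc (between (parent z) ℓ′) , Unique.map⁺ Fin.suc-injective (Unique.filter⁺ (Between? (parent z) ℓ′) (Unique-allFin m)) ,
    subst (w * w <_) (sym (length-map suc (between (parent z) ℓ′))) (fresh-colour-far (wk-old h′ refl)) , λ i → go i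
    where
    go : ∀ {k} → k ∈ map suc (between (parent z) ℓ′) → K⁺.SplitLevel (wk (parent z)) k × zero N.≼ k × k N.≼ suc ℓ′ × zero ≢ k × k ≢ suc ℓ′
    go i with k , k∈ , refl ← ∈-map⁻ suc i with (c , sp) , ne , d ← proj₂ (∈-filter⁻ (Between? (parent z) ℓ′) {xs = allFin m} k∈) with d
    ... | inj₁ (a , b) = (c , split-wk sp) , a , b , (λ ()) , λ e → ne (sym (Fin.suc-injective e))
    ... | inj₂ (a , b) = ⊥-elim (s⋠p S p≼s p≢s (O.≼-trans l (O.≼-trans a b)))
  apart⁺ {J} {suc ℓ} {zero} h h′ l n with z , _ , refl , refl ← split-new h′ =
    map suc (between (parent z) ℓ) , Unique.map⁺ Fin.suc-injective (Unique.filter⁺ (Between? (parent z) ℓ) (Unique-allFin m)) ,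
    subst (w * w <_) (sym (length-map suc (between (parent z) ℓ))) (fresh-colour-far (wk-old h refl)) , λ i → go i
    where
    go : ∀ {k} → k ∈ map suc (between (parent z) ℓ) → K⁺.SplitLevel (wk (parent z)) k × suc ℓ N.≼ k × k N.≼ zero × suc ℓ ≢ k × k ≢ zero
    go i with k , k∈ , refl ← ∈-map⁻ suc i with (c , sp) , ne , d ← proj₂ (∈-filter⁻ (Between? (parent z) ℓ) {xs = allFin m} k∈) with d
    ... | inj₂ (a , b) = (c , split-wk sp) , a , b , (λ e → ne (Fin.suc-injective e)) , λ ()
    ... | inj₁ (a , b) = ⊥-elim (s⋠p S p≼s p≢s (O.≼-trans a (O.≼-trans b l)))
  apart⁺ {J} {suc ℓ} {suc ℓ′} h h′ l n with I , refl , i ← split-old h with ks , u , len , ok ← apart i (wk-old h′ refl) l (n ∘ cong suc) =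
    map suc ks , Unique.map⁺ Fin.suc-injective u , subst (w * w <_) (sym (length-map suc ks)) len , λ i → go i
    where
    go : ∀ {k} → k ∈ map suc ks → K⁺.SplitLevel (wk I) k × suc ℓ N.≼ k × k N.≼ suc ℓ′ × suc ℓ ≢ k × k ≢ suc ℓ′
    go i with k , k∈ , refl ← ∈-map⁻ suc i with (c , sp) , a , b , n₁ , n₂ ← ok k∈ =
      (c , split-wk sp) , a , b , n₁ ∘ Fin.suc-injective , n₂ ∘ Fin.suc-injective

  frame⁺ : ∀ {J ℓ c} → K⁺.Split J ℓ c → Frame S⁺ J ℓ
  frame⁺ {J} {suc ℓ} h with I , refl , i ← split-old h = go I (frame i)
    where
    go : ∀ I → Frame S I ℓ → Frame S⁺ (wk I) (suc ℓ)
    go (name _ _ _ _) f = record { lo≼ = lo≼ ; ≼ℓ = ≼ℓ ; ℓ≼ = ℓ≼ ; ≼hi = ≼hi ; ≢ℓ = ≢ℓ ∘ Fin.suc-injective ; ℓ≢ = ℓ≢ ∘ Fin.suc-injective ; connˡ = connˡ ; connʰ = connʰ }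
      where open Frame f
  frame⁺ {J} {zero} h with z , (b , nˡ , nʰ) , refl , _ ← split-new h = record
    { lo≼ = proj₁ (cl (parent z) c₁) ; ≼ℓ = O.≼-refl ; ℓ≼ = O.≼-refl ; ≼hi = proj₂ (cl (parent z) c₁) ; ≢ℓ = λ () ; ℓ≢ = λ ()
    ; connˡ = λ {x} {x′} t t′ → Components.conn-trans S⁺ (suc p) zero (Components.conn-sym S⁺ (suc p) zero (tcˡ t)) (tcˡ t′)
    ; connʰ = λ {x} {x′} t t′ → Components.conn-trans S⁺ zero (suc s) (Components.conn-sym S⁺ zero (suc s) (tcʰ t)) (tcʰ t′) }
    where
    c₁ = Fo.cur-contains gap (down z)
    cl : ∀ I → O.Contains I p s (down z) → Name.lo (wk I) N.≼ suc p × suc s N.≼ Name.hi (wk I)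
    cl (name _ _ _ _) (a , b , _) = a , b
    big⁺ : r < N.size (wk (parent z))
    big⁺ = subst (r <_) (sym (size-wk (parent z))) b
    eqˡ : current r S⁺ (suc p) (down z) ≡ wk (parent z)
    eqˡ = [ (λ (f , _) → ⊥-elim (nˡ f)) , proj₂ ]′ (current-near (down z))
    eqʰ : current r S⁺ zero z ≡ wk (parent z)
    eqʰ = [ (λ (f , _) → ⊥-elim (nʰ f)) , proj₂ ]′ (current-far z)
    tcˡ : ∀ {x} → N.Trace (wk (parent z)) (suc p) x → Conn S⁺ (suc p) zero (down z) x
    tcˡ t = trace-conn r S⁺ step-invariant gapˡ {x = down z} (subst (λ N → r < N.size N) (sym eqˡ) big⁺) (subst (λ N → N.Trace N (suc p) _) (sym eqˡ) t)
    tcʰ : ∀ {x} → N.Trace (wk (parent z)) zero x → Conn S⁺ zero (suc s) z x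
    tcʰ t = trace-conn r S⁺ step-invariant gapʰ {x = z} (subst (λ N → r < N.size N) (sym eqʰ) big⁺) (subst (λ N → N.Trace N zero _) (sym eqʰ) t)

  start-wkˡ : ∀ {I : Name S} {a} → a ≡ Name.lo I → suc a ≡ Name.lo (wk I)
  start-wkˡ {name _ _ _ _} refl = refl

  start-wkʰ : ∀ {I : Name S} {a} → a ≡ Name.hi I → suc a ≡ Name.hi (wk I)
  start-wkʰ {name _ _ _ _} refl = refl

  lower≢wk : ∀ {x I} → lowerName x ≢ wk I
  lower≢wk {I = name _ _ _ _} ()

  upper≢wk : ∀ {x I} → upperName x ≢ wk I
  upper≢wk {I = name _ _ _ _} ()

  lower≢upper : ∀ {x z} → lowerName x ≢ upperName z
  lower≢upper ()

  big-wk : ∀ {I} → r < N.size (wk I) → r < O.size I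
  big-wk {I} = subst (r <_) (size-wk I)

  zonesˡ⁺ : Zones (levelSystem S⁺) (zoneˡ r S⁺ skeleton⁺ (current r S⁺))
  zonesˡ⁺ = ZoneStep.zones⁺ (levelSystem S) (levelSystem S⁺) (zoneˡ r S (skeleton r S) (current r S)) (zoneˡ r S⁺ skeleton⁺ (current r S⁺)) p s (p≼s , p≢s , adj)
    id id id id id id id (main L) (λ z → _ , Below-refl S p (down z) , down-edge z) wk (λ {I} {J} → wk-injective {I} {J})
    (Freshˡ ∘ down) Freshʰ Freshᵈ? Freshʰ? big? parent (λ _ → refl) freshˡ-const
    lowerName upperName (λ {x} {I} → lower≢wk {x} {I}) (λ {x} {I} → upper≢wk {x} {I}) lower≢upper
    near (current-far) current-other (λ {I} → big-wk {I}) (fresh-colour ∘ parent)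
    Sˡ.org-near Sˡ.org-far Sˡ.org-other Iˡ.item-old Iˡ.item-new split-wk split-old
    (λ h → let (z , (b , n , n′) , e , _) = split-new h in z , e , b , n , n′) (λ b n n′ → split-here (b , n , n′))
    (λ {I} {a} {x} → On-wk {I} {a} {x}) (λ {x} _ → On-lowerName x) (λ {z} _ → On-upperName z) (λ {z} → On-new z)
    (λ {I} {a} → start-wkˡ {I} {a}) refl refl (λ { refl o → proj₁ o }) zonesˡ
    where
    near : ∀ x → (Freshˡ (down (main L ⟨$⟩ʳ x)) × current r S⁺ (suc p) x ≡ lowerName x)
      ⊎ (¬ Freshˡ (down (main L ⟨$⟩ʳ x)) × current r S⁺ (suc p) x ≡ wk (current r S p x))
    near x = subst (λ v → (Freshˡ v × current r S⁺ (suc p) x ≡ lowerName x) ⊎ (¬ Freshˡ v × current r S⁺ (suc p) x ≡ wk (current r S p x)))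
      (sym (inverseˡ (main L))) (current-near x)

  zonesʰ⁺ : Zones (opposite (levelSystem S⁺)) (zoneʰ r S⁺ skeleton⁺ (currentʰ r S⁺))
  zonesʰ⁺ = ZoneStep.zones⁺ (opposite (levelSystem S)) (opposite (levelSystem S⁺)) (zoneʰ r S (skeleton r S) (currentʰ r S)) (zoneʰ r S⁺ skeleton⁺ (currentʰ r S⁺)) s p
    (p≼s , p≢s ∘ sym , λ c → [ inj₂ , inj₁ ]′ (adj c))
    id id id id id id id (flip (main U)) (λ z → up z , up-edge z , Below-refl S s (up z)) wk (λ {I} {J} → wk-injective {I} {J})
    Freshʰ (Freshˡ ∘ down) Freshʰ? Freshᵈ? big? parent parent-up freshʰ-const
    (λ y → upperName (main U ⟨$⟩ˡ y)) (λ z → lowerName (down z)) (λ {x} {I} → upper≢wk {_} {I}) (λ {x} {I} → lower≢wk {_} {I}) (λ e → lower≢upper (sym e))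
    near far currentʰ-other (λ {I} → big-wk {I}) (fresh-colour ∘ parent)
    Sʰ.org-near Sʰ.org-far Sʰ.org-other Iʰ.item-old Iʰ.item-new split-wk split-old
    (λ h → let (z , (b , n , n′) , e , _) = split-new h in z , e , b , n′ , n) (λ b n n′ → split-here (b , n′ , n))
    (λ {I} {a} {x} → On-wk {I} {a} {x}) (λ {y} _ → On-upperName-top y) (λ {z} _ → On-lowerName-top z) (λ {z} → On-new z)
    (λ {I} {a} → start-wkʰ {I} {a}) refl refl (λ { refl (_ , l , _) → l }) zonesʰ
    where
    parent-up : ∀ z → parent z ≡ currentʰ r S s (up z)
    parent-up z = consistent gap (thr-edge z)
    near : ∀ y → (Freshʰ (main U ⟨$⟩ˡ y) × currentʰ r S⁺ (suc s) y ≡ upperName (main U ⟨$⟩ˡ y))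
      ⊎ (¬ Freshʰ (main U ⟨$⟩ˡ y) × currentʰ r S⁺ (suc s) y ≡ wk (currentʰ r S s y))
    near y rewrite currentʰ-near y with Freshʰ? (main U ⟨$⟩ˡ y)
    ... | yes f = inj₁ (f , refl)
    ... | no n = inj₂ (n , cong wk (trans (parent-up (main U ⟨$⟩ˡ y)) (cong (currentʰ r S s) (inverseʳ (main U)))))
    far : ∀ z → (Freshˡ (down z) × currentʰ r S⁺ zero z ≡ lowerName (down z)) ⊎ (¬ Freshˡ (down z) × currentʰ r S⁺ zero z ≡ wk (parent z))
    far z with Freshˡ? (down z)
    ... | yes f = inj₁ (f , refl)
    ... | no n = inj₂ (n , refl)

  skeleton-invariant⁺ : SkeletonInvariant r S⁺ (current r S⁺) (currentʰ r S⁺) skeleton⁺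
  skeleton-invariant⁺ = record
    { consistent = consistent⁺ ; functional = functional⁺ ; nonzero = nonzero⁺ ; small = small⁺ ; apart = apart⁺ ; frame = frame⁺
    ; zonesˡ = zonesˡ⁺ ; zonesʰ = zonesʰ⁺ }

skeleton-invariant : ∀ {w′ m} (r : ℕ) (S : Sys (suc w′) m) → SkeletonInvariant r S (current r S) (currentʰ r S) (skeleton r S)
skeleton-invariant r base = record
  { consistent = λ _ _ → refl ; functional = λ () ; nonzero = λ () ; small = λ () ; apart = λ () ; frame = λ ()
  ; zonesˡ = record
    { start-below = λ { refl (l , _) → l } ; live = λ {a} g x _ → Below-refl base a x , here′ g x , inj₁ (start g , refl) , λ _ _ ()
    ; attached = λ () ; below-live = λ _ _ _ () ; disjoint = λ g g′ _ _ n l → ⊥-elim (n (only g g′)) ; injective = λ _ _ _ e → e ; chained = λ () }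
  ; zonesʰ = record
    { start-below = λ { refl (_ , l , _) → l } ; live = λ {a} g x _ → Below-refl base a x , hereʰ g x , inj₁ (startʰ g , refl) , λ _ _ ()
    ; attached = λ () ; below-live = λ _ _ _ () ; disjoint = λ g g′ _ _ n l → ⊥-elim (n (onlyʰ g g′)) ; injective = λ _ _ _ e → e ; chained = λ () } }
  where
  N₀ : Name base
  N₀ = name (suc zero) zero zero (tt , λ ())
  start : ∀ {a b} → Adj (levelSystem base) a b → a ≡ suc zero
  start {zero} {zero} (_ , n , _) = ⊥-elim (n refl)
  start {zero} {suc zero} (() , _)
  start {suc zero} _ = refl
  startʰ : ∀ {a b} → Adj (opposite (levelSystem base)) a b → a ≡ zero
  startʰ {zero} _ = refl
  startʰ {suc zero} {zero} (() , _)
  startʰ {suc zero} {suc zero} (_ , n , _) = ⊥-elim (n refl)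
  only : ∀ {a b a′ b′} → Adj (levelSystem base) a b → Adj (levelSystem base) a′ b′ → a ≡ a′
  only g g′ = trans (start g) (sym (start g′))
  onlyʰ : ∀ {a b a′ b′} → Adj (opposite (levelSystem base)) a b → Adj (opposite (levelSystem base)) a′ b′ → a ≡ a′
  onlyʰ g g′ = trans (startʰ g) (sym (startʰ g′))
  all-conn : ∀ x y → Conn base (suc zero) zero x y
  all-conn x y = Components.conn-step base (suc zero) zero {y = x} tt tt
  here′ : ∀ {a b} → Adj (levelSystem base) a b → ∀ x → Within base N₀ a x
  here′ {zero} g x = case start g of λ ()
  here′ {suc zero} g x = tt , tt , x , all-conn zero x , refl
  hereʰ : ∀ {a b} → Adj (opposite (levelSystem base)) a b → ∀ x → Within base N₀ a x
  hereʰ {zero} g x = tt , tt , x , all-conn zero x , tt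
  hereʰ {suc zero} g x = case startʰ g of λ ()
skeleton-invariant r (ins S p s p≼s p≢s adj L U ref pt) =
  SkeletonInsProof.skeleton-invariant⁺ r S p s p≼s p≢s adj L U ref pt (skeleton-invariant r S)

-- Elements of an instance separated by many splitting levels are comparable

module _ {w′ m : ℕ} (S : Sys (suc w′) m) (I : Name S) where
  private
    w : ℕ
    w = suc w′

  open Names S

  -- An element not below (v , z′) gives, at every splitting level, a thread that leaves the down-set of (v , z′) just below
  -- and one that leaves it just above; no pair of threads can serve two levels.
  full : ∀ {u z v z′} → Within S I u z → Within S I v z′ → (ks : List (Fin m)) → Unique ks → w * w < length ks →
    (∀ {k} → k ∈ ks → Frame S I k × u ≼ k × k ≼ v) → Below S u z v z′
  full {u} {z} {v} {z′} (lo≼u , u≼hi , tz) (lo≼v , v≼hi , tz′) ks uks len ok with Below? S u z v z′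
  ... | yes l = l
  ... | no n = ⊥-elim (ℕ.<-irrefl refl (ℕ.<-≤-trans len (inj-Fin pick uks inj)))
    where
    θ : Fin m → Fin w → Fin w
    θ = at (levelSystem S)
    D : Fin m → Fin w → Set
    D b y = Below S b y v z′
    D? : ∀ b y → Dec (D b y)
    D? b y = Below? S b y v z′
    down : ∀ {a x b y} → Below S a x b y → D b y → D a x
    down = Le-trans
    Leaves : Fin m → Fin m → Fin w → Set
    Leaves a b i = D a (θ a i) × ¬ D b (θ b i)
    Leaves? : ∀ a b i → Dec (Leaves a b i)
    Leaves? a b i = D? a _ ×-dec ¬? (D? b _)

    module At {k} (k∈ : k ∈ ks) where
      F = proj₁ (ok k∈)
      u≼k = proj₁ (proj₂ (ok k∈))
      k≼v = proj₂ (proj₂ (ok k∈))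
      open Frame F
      lo≼k : Name.lo I ≼ k
      lo≼k = ≼-trans lo≼ ≼ℓ
      k≼hi : k ≼ Name.hi I
      k≼hi = ≼-trans ℓ≼ ≼hi
      inner outer : Fin w
      inner = θ k (thread v ⟨$⟩ˡ z′)
      outer = θ k (thread u ⟨$⟩ˡ z)
      inner-D : D k inner
      inner-D = thread-down k≼v z′
      outer-¬D : ¬ D k outer
      outer-¬D d = n (Le-trans (thread-up u≼k z) d)
      inner-trace : Trace I k inner
      inner-trace = trace-down I lo≼k v≼hi (thread-down k≼v z′) tz′
      outer-trace : Trace I k outer
      outer-trace = trace-up I (thread-up u≼k z) tz

      a b : Fin m
      a = neighbourˡ S k
      b = neighbourʰ S k
      base-point : Fin w
      base-point = θ a (thread k ⟨$⟩ˡ inner)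
      base-trace : Trace I a base-point
      base-trace = trace-down I lo≼ k≼hi (thread-down ≼ℓ inner) inner-trace
      Nˡ Nʰ : Name S
      Nˡ = name a k base-point (≼ℓ , ≢ℓ)
      Nʰ = name k b inner (ℓ≼ , ℓ≢)
      topˡ : ∀ {y} → Trace I k y → Top Nˡ y
      topˡ {y} t = _ , connˡ base-trace (trace-down I lo≼ k≼hi (thread-down ≼ℓ y) t) , thread-down ≼ℓ y
      leavesˡ : ∃ (Leaves a k)
      leavesˡ = let (i , _ , d , d′) = Switching.switch-hi (levelSystem S) D D? down (node Nˡ) (topˡ inner-trace) (topˡ outer-trace) inner-D outer-¬D in i , d , d′
      leavesʰ : ∃ (Leaves k b)
      leavesʰ = let (i , _ , d , d′) = Switching.switch-lo (levelSystem S) D D? down (node Nʰ) (connʰ inner-trace inner-trace) (connʰ inner-trace outer-trace) inner-D outer-¬D in i , d , d′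

    choose : ∀ a b → Fin w
    choose a b with Fin.any? (Leaves? a b)
    ... | yes (i , _) = i
    ... | no _ = zero
    chosen : ∀ {a b} → ∃ (Leaves a b) → Leaves a b (choose a b)
    chosen {a} {b} e with Fin.any? (Leaves? a b)
    ... | yes (_ , l) = l
    ... | no n = ⊥-elim (n e)
    pick : Fin m → Fin (w * w)
    pick k = Fin.combine (choose (neighbourˡ S k) k) (choose k (neighbourʰ S k))
    distinct : ∀ {k k′} → k ∈ ks → k′ ∈ ks → pick k ≡ pick k′ → k ≢ k′ → k ≼ k′ → ⊥
    distinct {k} {k′} k∈ k∈′ e ne l with Fin.combine-injective (choose (neighbourˡ S k) k) (choose k (neighbourʰ S k)) (choose (neighbourˡ S k′) k′) (choose k′ (neighbourʰ S k′)) e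
      | neighbours S k k′ l ne
    ... | e₁ , _ | inj₁ q = proj₂ (chosen (At.leavesˡ k∈))
      (down (thread-Le q _) (subst (λ i → D (neighbourˡ S k′) (θ _ i)) (sym e₁) (proj₁ (chosen (At.leavesˡ k∈′)))))
    ... | _ , e₂ | inj₂ q = proj₂ (chosen (At.leavesʰ k∈))
      (down (thread-Le q _) (subst (λ i → D k′ (θ k′ i)) (sym e₂) (proj₁ (chosen (At.leavesʰ k∈′)))))
    inj : InjOn pick ks
    inj {k} {k′} k∈ k∈′ e with k Fin.≟ k′ | ≼-total k k′
    ... | yes q | _ = q
    ... | no q | inj₁ l = ⊥-elim (distinct k∈ k∈′ e q l)
    ... | no q | inj₂ l = ⊥-elim (distinct k∈′ k∈ (sym e) (q ∘ sym) l)

module ZoneChain {w m : ℕ} (LS : LevelSystem w m) {N : Set} (Z : ZoneData w m N) where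
  open LevelSystem LS
  open ZoneData Z

  module _ (zones : Zones LS Z)
    (start-unique : ∀ {I a b} → Start I a → Start I b → a ≡ b)
    (nonzero : ∀ {I ℓ} → ¬ Split I ℓ 0)
    (on-up : ∀ {I a x b y} → On I a x → Le a x b y → ∀ {k c} → Split I k c → b ≼ k → On I b y)
    (far : ∀ {I o o′ c t z x} → Split I o c → Split I o′ c → o ≼ o′ → o ≢ o′ → (∀ k c → Split I k c → o ≼ k → o ≢ k → t ≼ k) →
      On I t z → On I o′ x → Le t z o′ x) where
    open Zones zones

    items-comparable : ∀ {t z t′ z′ I o o′ p x p′ x′} → item t z ≡ just (I , o , p , x) → item t′ z′ ≡ just (I , o′ , p′ , x′) →
      col o ≡ col o′ → idx o ≡ idx o′ → (t ≡ t′ × z ≡ z′) ⊎ Le t z p′ x′ ⊎ Le t′ z′ p x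
    items-comparable {t} {z} {t′} {z′} {I} {o} {o′} {p} {x} {p′} {x′} i i′ ec ei with lev o Fin.≟ lev o′
    ... | yes e = chained i i′ e ei
    ... | no ne with attached i | attached i′
    ... | l₁ , l₂ , on , inj₁ (s , _) , zn | l₁′ , l₂′ , on′ , inj₁ (s′ , _) , zn′ = ⊥-elim (ne (start-unique s s′))
    ... | l₁ , l₂ , on , inj₁ (_ , e) , zn | l₁′ , l₂′ , on′ , inj₂ s′ , zn′ = ⊥-elim (nonzero (subst (Split I (lev o′)) (trans (sym ec) e) s′))
    ... | l₁ , l₂ , on , inj₂ s , zn | l₁′ , l₂′ , on′ , inj₁ (_ , e) , zn′ = ⊥-elim (nonzero (subst (Split I (lev o)) (trans ec e) s))
    ... | l₁ , l₂ , on , inj₂ s , zn | l₁′ , l₂′ , on′ , inj₂ s′ , zn′ with ≼-total (lev o) (lev o′)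
    ... | inj₁ l = inj₂ (inj₁ (Le-trans (far s (subst (Split I (lev o′)) (sym ec) s′) l ne zn (on-up on (Le-trans l₁ l₂) s′ (zn _ _ s′ l ne)) on′) l₁′))
    ... | inj₂ l = inj₂ (inj₂ (Le-trans (far s′ (subst (Split I (lev o)) ec s) l (ne ∘ sym) zn′ (on-up on′ (Le-trans l₁′ l₂′) s (zn′ _ _ s l (ne ∘ sym))) on) l₁))

module _ {w′ m : ℕ} (r : ℕ) (S : Sys (suc w′) m) where
  open Names S
  open Skeleton (skeleton r S)
  open SkeletonInvariant (skeleton-invariant r S)

  On-mid : ∀ {I a x b y} → Within S I a x → Below S a x b y → b ≼ Name.hi I → Within S I b y
  On-mid {I} (l , _ , t) k h = ≼-trans l (Le⇒≼ k) , h , trace-up I k t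

  On-midʰ : ∀ {I a x b y} → Within S I b y → Below S a x b y → Name.lo I ≼ a → Within S I a x
  On-midʰ {I} (_ , h , t) k l = l , ≼-trans (Le⇒≼ k) h , trace-down I l h k t

  split-bounds : ∀ {I k c} → Split I k c → Name.lo I ≼ k × k ≼ Name.hi I
  split-bounds s = let open Frame (frame s) in ≼-trans lo≼ ≼ℓ , ≼-trans ℓ≼ ≼hi

  splits-comparable : ∀ {I ℓ ℓ′ c x y} → Split I ℓ c → Split I ℓ′ c → ℓ ≼ ℓ′ → ℓ ≢ ℓ′ → Within S I ℓ x → Within S I ℓ′ y → Below S ℓ x ℓ′ y
  splits-comparable {I} s s′ l ne on on′ with ks , u , len , ok ← apart s s′ l ne =
    full S I on on′ ks u len λ k∈ → let ((_ , sp) , a , b , _ , _) = ok k∈ in frame sp , a , b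

  itemsˡ-comparable : ∀ {t z t′ z′ I o o′ p x p′ x′} → itemˡ t z ≡ just (I , o , p , x) → itemˡ t′ z′ ≡ just (I , o′ , p′ , x′) →
    col o ≡ col o′ → idx o ≡ idx o′ → (t ≡ t′ × z ≡ z′) ⊎ Below S t z p′ x′ ⊎ Below S t′ z′ p x
  itemsˡ-comparable = ZoneChain.items-comparable (levelSystem S) (zoneˡ r S (skeleton r S) (current r S)) zonesˡ
    (λ { refl refl → refl }) nonzero (λ {I} on l s b → On-mid {I} on l (≼-trans b (proj₂ (split-bounds s))))
    λ {I} s s′ l ne zn on on′ → let (ks , u , len , ok) = apart s s′ l ne in
      full S I on on′ ks u len λ k∈ → let ((_ , sp) , a , b , n , _) = ok k∈ in frame sp , zn _ _ sp a n , b

  itemsʰ-comparable : ∀ {t z t′ z′ I o o′ p x p′ x′} → itemʰ t z ≡ just (I , o , p , x) → itemʰ t′ z′ ≡ just (I , o′ , p′ , x′) →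
    col o ≡ col o′ → idx o ≡ idx o′ → (t ≡ t′ × z ≡ z′) ⊎ Below S p′ x′ t z ⊎ Below S p x t′ z′
  itemsʰ-comparable = ZoneChain.items-comparable (opposite (levelSystem S)) (zoneʰ r S (skeleton r S) (currentʰ r S)) zonesʰ
    (λ { refl refl → refl }) nonzero (λ {I} on l s b → On-midʰ {I} on l (≼-trans (proj₁ (split-bounds s)) b))
    λ {I} s s′ l ne zn on on′ → let (ks , u , len , ok) = apart s′ s l (ne ∘ sym) in
      full S I on′ on ks u len λ k∈ → let ((_ , sp) , a , b , _ , n) = ok k∈ in frame sp , a , zn _ _ sp b (n ∘ sym)

-- Labels of instances: three first-fit colours and the colour of a black-box algorithm

module NameRelations {w m : ℕ} (S : Sys w m) where
  open Names S
  open Name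

  Reach Under Over Complete : Name S → Name S → Set
  Reach M N = ∃[ y ] ∃[ x ] Top M y × Bottom N x × Below S (hi M) y (lo N) x
  Under M N = ∀ y → Top M y → ∃[ x ] Bottom N x × Below S (hi M) y (lo N) x
  Over M N = ∀ x → Bottom N x → ∃[ y ] Top M y × Below S (hi M) y (lo N) x
  Complete M N = hi M ≼ lo N × (∀ y x → Top M y → Bottom N x → Below S (hi M) y (lo N) x)

  Reachᵒ : Name S → Name S → Set
  Reachᵒ N M = ∃[ x ] ∃[ y ] Bottom N x × Top M y × Below S (hi M) y (lo N) x

  Clash₁ Clash₂ Clash₃ : Name S → Name S → Set
  Clash₁ M N = Reach M N × ¬ Under M N
  Clash₂ N M = Reachᵒ N M × ¬ Over M N
  Clash₃ M N = Under M N × Over M N × ¬ Complete M N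

  Conflict : (Name S → Name S → Set) → Name S → Name S → Set
  Conflict C M N = size M ≡ size N × (C M N ⊎ C N M)

  private
    Bottom? : ∀ N x → Dec (Bottom N x)
    Bottom? N x = Conn? S (lo N) (hi N) (root N) x
    Top? : ∀ N y → Dec (Top N y)
    Top? N y = Fin.any? λ x → Bottom? N x ×-dec Below? S (lo N) x (hi N) y

    under? : ∀ M N → Dec (Under M N)
    under? M N = Fin.all? λ y → Top? M y →-dec Fin.any? λ x → Bottom? N x ×-dec Below? S (hi M) y (lo N) x
    over? : ∀ M N → Dec (Over M N)
    over? M N = Fin.all? λ x → Bottom? N x →-dec Fin.any? λ y → Top? M y ×-dec Below? S (hi M) y (lo N) x
    complete? : ∀ M N → Dec (Complete M N)
    complete? M N = (hi M ≼? lo N) ×-dec (Fin.all? λ y → Fin.all? λ x → Top? M y →-dec Bottom? N x →-dec Below? S (hi M) y (lo N) x)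
    conflict? : ∀ {C} → (∀ M N → Dec (C M N)) → ∀ M N → Dec (Conflict C M N)
    conflict? C? M N = (size M ℕ.≟ size N) ×-dec (C? M N ⊎-dec C? N M)

  opaque
    Complete? : ∀ M N → Dec (Complete M N)
    Complete? = complete?

    Under? : ∀ M N → Dec (Under M N)
    Under? = under?

    Over? : ∀ M N → Dec (Over M N)
    Over? = over?

    Conflict₁? : ∀ M N → Dec (Conflict Clash₁ M N)
    Conflict₁? = conflict? λ M N → (Fin.any? λ y → Fin.any? λ x → Top? M y ×-dec Bottom? N x ×-dec Below? S (hi M) y (lo N) x) ×-dec ¬? (under? M N)

    Conflict₂? : ∀ M N → Dec (Conflict Clash₂ M N)
    Conflict₂? = conflict? λ N M → (Fin.any? λ x → Fin.any? λ y → Bottom? N x ×-dec Top? M y ×-dec Below? S (hi M) y (lo N) x) ×-dec ¬? (over? M N)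

    Conflict₃? : ∀ M N → Dec (Conflict Clash₃ M N)
    Conflict₃? = conflict? λ M N → under? M N ×-dec over? M N ×-dec ¬? (complete? M N)

  complete-irrefl : ∀ N → ¬ Complete N N
  complete-irrefl N (l , _) = lo≢hi N (≼-antisym (lo-hi N) l)

  bottom-up : ∀ N {x} → Bottom N x → ∃[ y ] Top N y × Below S (lo N) x (hi N) y
  bottom-up N {x} b = _ , (x , b , thread-up (lo-hi N) x) , thread-up (lo-hi N) x

  complete-trans : ∀ {L M N} → Complete L M → Complete M N → Complete L N
  complete-trans {L} {M} {N} (l , f) (l′ , g) = ≼-trans l (≼-trans (lo-hi M) l′) , λ y x ty bx →
    let b = Components.conn-refl S (lo M) (hi M) {root M} ; (v , tv , k) = bottom-up M b in
    Le-trans (f y (root M) ty b) (Le-trans k (g v x tv bx))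

  complete-elements : ∀ {M N a x b y} → Complete M N → Within S M a x → Within S N b y → Below S a x b y
  complete-elements {M} {N} {a} {x} {b} {y} (l , f) (lo≼ , ≼hi , t) (lo≼′ , ≼hi′ , (v , bv , k)) =
    Le-trans (thread-up ≼hi x) (Le-trans (f _ v (trace-up M (thread-up ≼hi x) t) bv) k)

record Label : Set where
  constructor label
  field
    size φ₁ φ₂ φ₃ chain : ℕ
    parentCode : Vec ℕ 8
open Label public

Key : Set
Key = ℕ × ℕ × ℕ × ℕ

key : Label → Key
key l = size l , φ₁ l , φ₂ l , φ₃ l

_≟ᴷ_ : DecidableEquality Key
_≟ᴷ_ = ≡-dec ℕ._≟_ (≡-dec ℕ._≟_ (≡-dec ℕ._≟_ ℕ._≟_))

module Labels {k₀ k : ℕ} (alg : Algorithm k₀ k) {w m : ℕ} (S : Sys w m) where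
  open NameRelations S

  Entry : Set
  Entry = Name S × Label

  completeᵇ : Name S → Name S → Bool
  completeᵇ M N = does (Complete? M N)

  module Chains = Keyed alg {E = Entry} _≟ᴷ_ (key ∘ proj₂) proj₁ (chain ∘ proj₂) completeᵇ

  firstFit : {C : Name S → Name S → Set} → (∀ M N → Dec (Conflict C M N)) → (Label → ℕ) → Name S → List Entry → ℕ
  firstFit C? φ N ls = mex (map (φ ∘ proj₂) (filter (λ e → C? N (proj₁ e)) ls))

  mkLabel : Name S → Vec ℕ 8 → List Entry → Label
  mkLabel N par ls = label (Names.size S N) a b c (Chains.nextColour (Names.size S N , a , b , c) N ls) par
    where
    a = firstFit Conflict₁? φ₁ N ls
    b = firstFit Conflict₂? φ₂ N ls
    c = firstFit Conflict₃? φ₃ N ls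

  WellLabelled : List Entry → Set
  WellLabelled [] = ⊤
  WellLabelled ((N , l) ∷ ls) = l ≡ mkLabel N (parentCode l) ls × WellLabelled ls

  size-correct : ∀ ls → WellLabelled ls → ∀ {N l} → (N , l) ∈ ls → size l ≡ Names.size S N
  size-correct (_ ∷ ls) (e , ok) (here refl) = cong size e
  size-correct (_ ∷ ls) (e , ok) (there h) = size-correct ls ok h

  chains-consistent : ∀ ls → WellLabelled ls → Chains.Consistent ls
  chains-consistent [] _ = tt
  chains-consistent ((N , l) ∷ ls) (e , ok) = go l e , chains-consistent ls ok
    where
    go : ∀ l → l ≡ mkLabel N (parentCode l) ls → chain l ≡ Chains.nextColour (key l) N ls
    go _ refl = refl

  find-label : List Entry → Name S → Label
  find-label [] N = label 0 0 0 0 0 (Vec.replicate 8 0)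
  find-label ((M , l) ∷ es) N with M ≟ᴺᵃ N
  ... | yes _ = l
  ... | no _ = find-label es N

  find-label-∈ : ∀ {es N l} → Unique (map proj₁ es) → (N , l) ∈ es → find-label es N ≡ l
  find-label-∈ {(M , _) ∷ es} {N} u (here refl) with N ≟ᴺᵃ N
  ... | yes _ = refl
  ... | no n = ⊥-elim (n refl)
  find-label-∈ {(M , _) ∷ es} {N} (p ∷ u) (there h) with M ≟ᴺᵃ N
  ... | yes refl = ⊥-elim (All.lookup p (∈-map⁺ proj₁ h) refl)
  ... | no _ = find-label-∈ u h

  -- The i-th colour of every entry is the first fit against the later entries of the list.
  module FirstFitFacts {C : Name S → Name S → Set} (C? : ∀ M N → Dec (Conflict C M N)) (φ : Label → ℕ)
    (φ-eq : ∀ N par ls → φ (mkLabel N par ls) ≡ firstFit C? φ N ls) where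

    ff-grundy : ∀ ls → WellLabelled ls → ∀ {N l} → (N , l) ∈ ls → ∀ {c} → c < φ l →
      ∃[ M ] ∃[ l′ ] (M , l′) ∈ ls × Conflict C N M × φ l′ ≡ c
    ff-grundy ((N , l) ∷ ls) (e , ok) (here refl) {c} h
      with (M , l′) , m , refl ← ∈-map⁻ (φ ∘ proj₂) (mex-below _ (subst (c <_) (trans (cong φ e) (φ-eq N (parentCode l) ls)) h))
      with m∈ , cf ← ∈-filter⁻ (λ e → C? N (proj₁ e)) {xs = ls} m = M , l′ , there m∈ , cf , refl
    ff-grundy (_ ∷ ls) (e , ok) (there i) h = let (M , l′ , m , cf , q) = ff-grundy ls ok i h in M , l′ , there m , cf , q

    private
      head-proper : ∀ {N l ls} → l ≡ mkLabel N (parentCode l) ls → ∀ {M l′} → (M , l′) ∈ ls → Conflict C N M → φ l ≢ φ l′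
      head-proper {N} {l} {ls} e {M} {l′} i cf q = mex-∉ (map (φ ∘ proj₂) (filter (λ e → C? N (proj₁ e)) ls))
        (subst (_∈ map (φ ∘ proj₂) (filter (λ e → C? N (proj₁ e)) ls)) (trans (sym q) (trans (cong φ e) (φ-eq N (parentCode l) ls)))
        (∈-map⁺ (φ ∘ proj₂) (∈-filter⁺ (λ e → C? N (proj₁ e)) i cf)))

    ff-proper : ∀ ls → WellLabelled ls → ∀ {N l M l′} → (N , l) ∈ ls → (M , l′) ∈ ls → N ≢ M → Conflict C N M → φ l ≢ φ l′
    ff-proper (_ ∷ ls) (e , ok) (here refl) (here refl) n = ⊥-elim (n refl)
    ff-proper (_ ∷ ls) (e , ok) (here refl) (there j) n cf = head-proper e j cf
    ff-proper (_ ∷ ls) (e , ok) (there i) (here refl) n (q , cf) = head-proper e i (sym q , [ inj₂ , inj₁ ]′ cf) ∘ sym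
    ff-proper (_ ∷ ls) (e , ok) (there i) (there j) n cf = ff-proper ls ok i j n cf

  module FF₁ = FirstFitFacts Conflict₁? φ₁ (λ _ _ _ → refl)
  module FF₂ = FirstFitFacts Conflict₂? φ₂ (λ _ _ _ → refl)
  module FF₃ = FirstFitFacts Conflict₃? φ₃ (λ _ _ _ → refl)

  -- Within a class of equal size and first-fit colours, reachability is completeness.
  same-class : ∀ {ls} → WellLabelled ls → ∀ {M N l l′} → (M , l) ∈ ls → (N , l′) ∈ ls → key l ≡ key l′ → M ≢ N → Reach M N → Complete M N
  same-class {ls} ok {M} {N} {l} {l′} i j e n rc@(y , x , ty , bx , k) = decidable-stable (Complete? M N) λ nc →
    FF₃.ff-proper ls ok i j n (sz , inj₁ (un , ov , nc)) (cong (proj₂ ∘ proj₂ ∘ proj₂) e)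
    where
    sz : Names.size S M ≡ Names.size S N
    sz = trans (sym (size-correct ls ok i)) (trans (cong proj₁ e) (size-correct ls ok j))
    un : Under M N
    un = decidable-stable (Under? M N) λ nu → FF₁.ff-proper ls ok i j n (sz , inj₁ (rc , nu)) (cong (proj₁ ∘ proj₂) e)
    ov : Over M N
    ov = decidable-stable (Over? M N) λ no → FF₂.ff-proper ls ok i j n (sz , inj₂ ((x , y , bx , ty , k) , no)) (cong (proj₁ ∘ proj₂ ∘ proj₂) e)

module FewCuts {w m} {L : LevelSystem w m} {Nd} (F : NodeFamily L Nd) where
  open LevelSystem L
  open Relations F

  module _
    {n : ℕ} (M : Fin n → Nd) (M-injective : ∀ {c d} → M c ≡ M d → c ≡ d) (M∈ : ∀ c → M c ∈ nodes)
    (D : Fin w → Fin m → Fin w → Set) (D? : ∀ x a z → Dec (D x a z))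
    (down : ∀ {x a z b y} → Le a z b y → D x b y → D x a z) where

    private
      Cut : Fin n → Fin w → Set
      Cut c x = ∃[ y ] ∃[ y′ ] Y (M c) y × Y (M c) y′ × D x (hi (M c)) y × ¬ D x (hi (M c)) y′

      cut? : ∀ c x → Dec (Cut c x)
      cut? c x = Fin.any? λ y → Fin.any? λ y′ → Y? (M c) y ×-dec Y? (M c) y′ ×-dec D? x (hi (M c)) y ×-dec ¬? (D? x (hi (M c)) y′)

    few-cuts : ∀ cs → Unique cs → (∀ {c} → c ∈ cs → ∃[ x ] Cut c x) → length cs ≤ suc w * suc w
    few-cuts [] u h = z≤n
    few-cuts cs@(c₀ ∷ _) u h with length cs ℕ.≤? suc w * suc w
    ... | yes q = q
    ... | no q = let (y , big) = large-fiber pick w cs (ℕ.<⇒≤ (ℕ.≰⇒> q)) in ⊥-elim (ℕ.<-irrefl refl (ℕ.≤-trans big (few y)))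
      where
      pick : Fin n → Fin w
      pick c with Fin.any? (cut? c)
      ... | yes (x , _) = x
      ... | no _ = proj₁ (h (here refl))
      pick-cut : ∀ {c} → c ∈ cs → Cut c (pick c)
      pick-cut {c} c∈ with Fin.any? (cut? c)
      ... | yes (_ , q) = q
      ... | no nq = ⊥-elim (nq (h c∈))
      few : ∀ x → length (fiber pick x cs) ≤ w
      few x = subst (_≤ w) (length-map M ys) (few-cut (D x) (D? x) down (map M ys)
        (Unique-map (λ _ _ → M-injective) (Unique.filter⁺ (λ c → pick c Fin.≟ x) u)) λ M∈′ → case ∈-map⁻ M M∈′ of λ
          { (c , c∈ , refl) → let (a , e) = ∈-filter⁻ (λ c → pick c Fin.≟ x) {xs = cs} c∈ in M∈ c , subst (Cut c) e (pick-cut a) })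
        where ys = fiber pick x cs

module LabelBounds {k₀ k : ℕ} (alg : Algorithm k₀ k) {w′ m : ℕ} (r : ℕ) (S : Sys (suc w′) m)
  (ls : List (Labels.Entry alg S)) (ok : Labels.WellLabelled alg S ls) (unique-names : Unique (map proj₁ ls))
  (in-forest : ∀ {N l} → (N , l) ∈ ls → InForest r S N) where
  open Labels alg S
  open NameRelations S
  open Names S
  open Name
  private
    w W : ℕ
    w = suc w′
    W = suc w

  entry-of : ∀ {N} → N ∈ map proj₁ ls → (N , find-label ls N) ∈ ls
  entry-of h with (N , l) , i , refl ← ∈-map⁻ proj₁ h = subst (λ l′ → (N , l′) ∈ ls) (sym (find-label-∈ unique-names i)) i

  of-size : ℕ → List (Name S)
  of-size v = filter (λ N → Names.size S N ℕ.≟ v) (map proj₁ ls)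

  of-size⁻ : ∀ {v N} → N ∈ of-size v → N ∈ map proj₁ ls × Names.size S N ≡ v
  of-size⁻ {v} = ∈-filter⁻ (λ N → Names.size S N ℕ.≟ v) {xs = map proj₁ ls}

  family : ℕ → NodeFamily (levelSystem S) (Name S)
  family v = record { _≟ᴺ_ = _≟ᴺᵃ_ ; node = node ; nodes = of-size v ; separated = λ M∈ N∈ i p q →
    let (a , e) = of-size⁻ M∈ ; (b , e′) = of-size⁻ N∈ in
    instances-separated r S (in-forest (entry-of a)) (in-forest (entry-of b)) (trans e (sym e′)) i p q }

  private
    grundy : {C : Name S → Name S → Set} (φ : Label → ℕ) →
      (∀ {N l} → (N , l) ∈ ls → ∀ {c} → c < φ l → ∃[ M ] ∃[ l′ ] (M , l′) ∈ ls × Conflict C N M × φ l′ ≡ c) →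
      ∀ v {N} → N ∈ of-size v → ∀ c → c < φ (find-label ls N) →
      ∃[ M ] M ∈ of-size v × (C N M ⊎ C M N) × φ (find-label ls M) ≡ c
    grundy φ g v {N} N∈ c h with a , e ← of-size⁻ N∈ with M , l′ , i , (q , cf) , e′ ← g (entry-of a) h =
      M , ∈-filter⁺ (λ N → Names.size S N ℕ.≟ v) (∈-map⁺ proj₁ i) (trans (sym q) e) , cf , trans (cong φ (find-label-∈ unique-names i)) e′

    own-size : ∀ {N l} → (N , l) ∈ ls → N ∈ of-size (Names.size S N)
    own-size {N} i = ∈-filter⁺ (λ M → Names.size S M ℕ.≟ Names.size S N) (∈-map⁺ proj₁ i) refl

  φ₁-bound : ∀ {N l} → (N , l) ∈ ls → φ₁ l < φ-limit w
  φ₁-bound {N} {l} i = subst (λ l → φ₁ l < φ-limit w) (find-label-∈ unique-names i)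
    (FirstFitBound.colour-limit (family v) (s≤s z≤n) (φ₁ ∘ find-label ls) (grundy φ₁ (FF₁.ff-grundy ls ok) v) (own-size i))
    where v = Names.size S N

  φ₂-bound : ∀ {N l} → (N , l) ∈ ls → φ₂ l < φ-limit w
  φ₂-bound {N} {l} i = subst (λ l → φ₂ l < φ-limit w) (find-label-∈ unique-names i)
    (FirstFitBound.colour-limit (oppositeFamily (family v)) (s≤s z≤n) (φ₂ ∘ find-label ls) (grundy φ₂ (FF₂.ff-grundy ls ok) v) (own-size i))
    where v = Names.size S N

  private
    Missing : Name S → Name S → Fin w → Fin w → Set
    Missing A B y x = Top A y × Bottom B x × ¬ Below S (hi A) y (lo B) x

    missing? : ∀ A B → Dec (∃[ y ] ∃[ x ] Missing A B y x)
    missing? A B = Fin.any? λ y → Fin.any? λ x → Node.Y? (node A) y ×-dec Node.X? (node B) x ×-dec ¬? (Below? S (hi A) y (lo B) x)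

    under-≼ : ∀ {A B} → Under A B → hi A ≼ lo B
    under-≼ {A} {B} u = let (y , t , _) = bottom-up A (Components.conn-refl S (lo A) (hi A) {root A}) ; (x , _ , k) = u y t in Le⇒≼ {hi A} {y} {lo B} {x} k

    missing : ∀ {A B} → Under A B → ¬ Complete A B → ∃[ y ] ∃[ x ] Missing A B y x
    missing {A} {B} u nc = decidable-stable (missing? A B) λ q →
      nc (under-≼ {A} {B} u , λ y x t b → decidable-stable (Below? S _ _ _ _) λ n → q (y , x , t , b , n))

    φ₃-index : ∀ {N l} → (N , l) ∈ ls → (c : Fin (φ₃ l)) → ∃[ M ] ∃[ l′ ] (M , l′) ∈ ls × Conflict Clash₃ N M × φ₃ l′ ≡ toℕ c
    φ₃-index i c = FF₃.ff-grundy ls ok i (Fin.toℕ<n c)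

    φ₃-injective : ∀ {N l} (i : (N , l) ∈ ls) {c d} → proj₁ (φ₃-index i c) ≡ proj₁ (φ₃-index i d) → c ≡ d
    φ₃-injective i {c} {d} e = Fin.toℕ-injective (trans (sym (colour-of c)) (trans (cong (φ₃ ∘ find-label ls) e) (colour-of d)))
      where
      colour-of : ∀ c → φ₃ (find-label ls (proj₁ (φ₃-index i c))) ≡ toℕ c
      colour-of c = let (_ , _ , j , _ , q) = φ₃-index i c in trans (cong φ₃ (find-label-∈ unique-names j)) q

    module Clashes {N l} (i : (N , l) ∈ ls) where
      M : Fin (φ₃ l) → Name S
      M c = proj₁ (φ₃-index i c)

      M∈ : ∀ c → M c ∈ of-size (Names.size S N)
      M∈ c = let (_ , _ , j , (e , _) , _) = φ₃-index i c in ∈-filter⁺ (λ M → Names.size S M ℕ.≟ Names.size S N) (∈-map⁺ proj₁ j) (sym e)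

      Above : Fin (φ₃ l) → Set
      Above c = Clash₃ N (M c)

      above? : ∀ c → Dec (Above c)
      above? c = Under? N (M c) ×-dec Over? N (M c) ×-dec ¬? (Complete? N (M c))

      above-below : ∀ c → ¬ Above c → Clash₃ (M c) N
      above-below c n = let (_ , _ , _ , (_ , cl) , _) = φ₃-index i c in [ (λ a → ⊥-elim (n a)) , id ]′ cl

      cut-above : ∀ {c} → Above c → ∃[ y ] ∃[ x ] ∃[ x′ ] Bottom (M c) x × Bottom (M c) x′ × Below S (hi N) y (lo (M c)) x × ¬ Below S (hi N) y (lo (M c)) x′
      cut-above {c} (un , _ , nc) = let (y , x , t , b , n) = missing {N} {M c} un nc ; (x₀ , b₀ , k₀) = un y t in y , x₀ , x , b₀ , b , k₀ , n

      cut-below : ∀ {c} → Clash₃ (M c) N → ∃[ x ] ∃[ y ] ∃[ y′ ] Top (M c) y × Top (M c) y′ × Below S (hi (M c)) y (lo N) x × ¬ Below S (hi (M c)) y′ (lo N) x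
      cut-below {c} (un , ov , nc) = let (y , x , t , b , n) = missing {M c} {N} un nc ; (y₀ , t₀ , k₀) = ov x b in x , y₀ , y , t₀ , t , k₀ , n

      private
        cs = allFin (φ₃ l)
        unique = Unique-allFin (φ₃ l)

      few-above : length (filter above? cs) ≤ W * W
      few-above = FewCuts.few-cuts (oppositeFamily (family (Names.size S N))) M (φ₃-injective i) M∈
        (λ y a z → Below S (hi N) y a z) (λ y a z → Below? S (hi N) y a z) (λ k l → Le-trans l k) (filter above? cs) (Unique.filter⁺ above? unique)
        λ {c} h → cut-above {c} (proj₂ (∈-filter⁻ above? {xs = cs} h))

      few-below : length (filter (λ c → ¬? (above? c)) cs) ≤ W * W
      few-below = FewCuts.few-cuts (family (Names.size S N)) M (φ₃-injective i) M∈
        (λ x a z → Below S a z (lo N) x) (λ x a z → Below? S a z (lo N) x) (λ k l → Le-trans k l) (filter (λ c → ¬? (above? c)) cs) (Unique.filter⁺ (λ c → ¬? (above? c)) unique)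
        λ {c} h → cut-below {c} (above-below c (proj₂ (∈-filter⁻ (λ c → ¬? (above? c)) {xs = cs} h)))

  -- Both kinds of Clash₃ neighbours are cut by the up-set or the down-set of one of w elements.
  φ₃-bound : ∀ {N l} → (N , l) ∈ ls → φ₃ l ≤ W * W + W * W
  φ₃-bound {l = l} i = subst (_≤ W * W + W * W) (trans (sym (filter-split above? (allFin (φ₃ l)))) (length-tabulate id))
      (ℕ.+-mono-≤ few-above few-below)
    where open Clashes i

  private
    select-∈ : ∀ {κ N} → N ∈ Chains.select κ ls → ∃[ l ] (N , l) ∈ ls × key l ≡ κ
    select-∈ h with (_ , l) , i , e , refl ← Chains.∈-select h = l , i , e

    select-unique : ∀ κ → Unique (Chains.select κ ls)
    select-unique κ = Unique-map (λ {(N , l)} {(M , l′)} a b q → pairs-eq (proj₁ (∈-filter⁻ P? {xs = ls} a)) (proj₁ (∈-filter⁻ P? {xs = ls} b)) q)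
      (Unique.filter⁺ P? (entries-unique ls unique-names))
      where
      P? = λ (e : Entry) → key (proj₂ e) ≟ᴷ κ
      entries-unique : ∀ es → Unique (map proj₁ es) → Unique es
      entries-unique [] [] = []
      entries-unique (e ∷ es) (p ∷ u) = All.tabulate (λ h q → All.lookup p (∈-map⁺ proj₁ h) (cong proj₁ q)) ∷ entries-unique es u
      pairs-eq : ∀ {N M : Name S} {l l′} → (N , l) ∈ ls → (M , l′) ∈ ls → N ≡ M → (N , l) ≡ (M , l′)
      pairs-eq a b refl = cong (_ ,_) (trans (sym (find-label-∈ unique-names a)) (find-label-∈ unique-names b))

  chains-transitive : ∀ κ → Transitive (present completeᵇ (Chains.select κ ls))
  chains-transitive κ = present-transitive completeᵇ (Chains.select κ ls)
    (λ {x} {y} {z} _ _ _ p q → does⁺ (Complete? x z) (complete-trans {x} {y} {z} (does⁻ (Complete? x y) p) (does⁻ (Complete? y z) q)))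
    (λ {x} _ p → complete-irrefl x (does⁻ (Complete? x x) p))

  module _ (r<k₀ : w < suc r * suc k₀) where

    -- Pairwise unreachable instances of equal size use disjoint sets of threads.
    chains-width : ∀ κ → r < proj₁ κ → WidthAtMost k₀ (present completeᵇ (Chains.select κ ls))
    chains-width κ big = present-width completeᵇ k₀ (Chains.select κ ls) (select-unique κ) λ ys u sub apart →
      ℕ.≤-pred (ℕ.≰⇒> λ long → ℕ.<-irrefl refl (ℕ.<-≤-trans r<k₀ (ℕ.≤-trans (ℕ.*-mono-≤ big long) (threads-disjoint ys u sub apart))))
      where
      v = proj₁ κ
      size-eq : ∀ {N} → N ∈ Chains.select κ ls → Names.size S N ≡ v
      size-eq h = let (l , i , e) = select-∈ h in trans (sym (size-correct ls ok i)) (cong proj₁ e)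
      module _ (ys : List (Name S)) (u : Unique ys) (sub : ∀ {y} → y ∈ ys → y ∈ Chains.select κ ls)
        (apart : ∀ {x y} → x ∈ ys → y ∈ ys → x ≢ y → ¬ T (completeᵇ x y)) where
        θ : Name S → Fin w → Fin w
        θ N x = thread (lo N) ⟨$⟩ˡ x
        pairs : List (Name S) → List (Name S × Fin w)
        pairs [] = []
        pairs (N ∷ ns) = map (N ,_) (Components.members S (lo N) (hi N) (root N)) ++ pairs ns
        pairs⁻ : ∀ ns {N x} → (N , x) ∈ pairs ns → N ∈ ns × Bottom N x
        pairs⁻ (M ∷ ns) h with ∈-++⁻ (map (M ,_) (Components.members S (lo M) (hi M) (root M))) h
        ... | inj₁ a with _ , b , refl ← ∈-map⁻ (M ,_) a = here refl , Components.members-∈ S (lo M) (hi M) b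
        ... | inj₂ a = let (b , c) = pairs⁻ ns a in there b , c
        pairs-unique : ∀ ns → Unique ns → Unique (pairs ns)
        pairs-unique [] _ = []
        pairs-unique (N ∷ ns) (p ∷ q) = Unique.++⁺ (Unique.map⁺ (cong proj₂) (Components.members-unique S (lo N) (hi N) (root N))) (pairs-unique ns q)
          λ (a , b) → case ∈-map⁻ (N ,_) a of λ { (_ , _ , refl) → All.lookup p (proj₁ (pairs⁻ ns b)) refl }
        pairs-length : ∀ ns → (∀ {N} → N ∈ ns → Names.size S N ≡ v) → length (pairs ns) ≡ length ns * v
        pairs-length [] _ = refl
        pairs-length (N ∷ ns) h = trans (length-++ (map (N ,_) (Components.members S (lo N) (hi N) (root N))))
          (cong₂ _+_ (trans (length-map (N ,_) (Components.members S (lo N) (hi N) (root N))) (h (here refl))) (pairs-length ns (h ∘ there)))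
        inj : InjOn (λ (N , x) → θ N x) (pairs ys)
        inj {N , x} {M , y} a b e with pairs⁻ ys a | pairs⁻ ys b
        ... | N∈ , bx | M∈ , by with N ≟ᴺᵃ M
        ...   | yes refl = cong (N ,_) (perm-injective (flip (thread (lo N))) e)
        ...   | no ne = ⊥-elim (related (instances-separated r S (in-forest i) (in-forest j) (trans (size-eq (sub N∈)) (sym (size-eq (sub M∈)))) (θ N x) bN bM))
          where
          i = proj₁ (proj₂ (select-∈ (sub N∈)))
          j = proj₁ (proj₂ (select-∈ (sub M∈)))
          bN : Bottom N (at (levelSystem S) (lo N) (θ N x))
          bN = subst (Bottom N) (sym (inverseʳ (thread (lo N)))) bx
          bM : Bottom M (at (levelSystem S) (lo M) (θ N x))
          bM = subst (Bottom M) (sym (trans (cong (at (levelSystem S) (lo M)) e) (inverseʳ (thread (lo M))))) by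
          keys : key (proj₁ (select-∈ (sub N∈))) ≡ key (proj₁ (select-∈ (sub M∈)))
          keys = trans (proj₂ (proj₂ (select-∈ (sub N∈)))) (sym (proj₂ (proj₂ (select-∈ (sub M∈)))))
          reach : ∀ {A B} → Bottom A (at (levelSystem S) (lo A) (θ N x)) → Bottom B (at (levelSystem S) (lo B) (θ N x)) → hi A ≼ lo B → Reach A B
          reach {A} {B} p q l = _ , _ , Node.thread-closedʳ (node A) p , q , thread-Le l (θ N x)
          related : N ≡ M ⊎ hi N ≼ lo M ⊎ hi M ≼ lo N → ⊥
          related (inj₁ q) = ne q
          related (inj₂ (inj₁ l)) = apart N∈ M∈ ne (does⁺ (Complete? N M) (same-class ok i j keys ne (reach {N} {M} bN bM l)))
          related (inj₂ (inj₂ l)) = apart M∈ N∈ (ne ∘ sym) (does⁺ (Complete? M N) (same-class ok j i (sym keys) (ne ∘ sym) (reach {M} {N} bM bN l)))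
        threads-disjoint : v * length ys ≤ w
        threads-disjoint = subst (_≤ w) (trans (pairs-length ys (size-eq ∘ sub)) (ℕ.*-comm (length ys) v)) (inj-Fin (λ (N , x) → θ N x) (pairs-unique ys u) inj)

    chain-bound : ∀ {N l} → (N , l) ∈ ls → r < Names.size S N → chain l < k
    chain-bound {N} {l} i b = Chains.keyed-bounded ls (chains-consistent ls ok) (key l) (chains-transitive (key l))
      (chains-width (key l) (subst (r <_) (sym (size-correct ls ok i)) b)) i refl

    chain-complete : ∀ {M N l l′} → (M , l) ∈ ls → (N , l′) ∈ ls → r < Names.size S M → key l ≡ key l′ → chain l ≡ chain l′ →
      M ≡ N ⊎ Complete M N ⊎ Complete N M
    chain-complete {M} {N} {l} {l′} i j b e e′ = finish (Chains.keyed-proper ls (chains-consistent ls ok) (key l) (chains-transitive (key l))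
      (chains-width (key l) (subst (r <_) (sym (size-correct ls ok i)) b)) {M , l} {N , l′} i j refl (sym e) e′)
      where
      finish : M ≡ N ⊎ T (completeᵇ M N) ⊎ T (completeᵇ N M) → M ≡ N ⊎ Complete M N ⊎ Complete N M
      finish (inj₁ q) = inj₁ q
      finish (inj₂ (inj₁ q)) = inj₂ (inj₁ (does⁻ (Complete? M N) q))
      finish (inj₂ (inj₂ q)) = inj₂ (inj₂ (does⁻ (Complete? N M) q))

-- The labelled forest

does-cong : {P Q : Set} → (P → Q) → (Q → P) → (p : Dec P) (q : Dec Q) → does p ≡ does q
does-cong f g (yes _) (yes _) = refl
does-cong f g (no _) (no _) = refl
does-cong f g (yes p) (no n) = ⊥-elim (n (f p))
does-cong f g (no n) (yes q) = ⊥-elim (n (g q))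

filter-map : {A B : Set} {P : B → Set} {Q : A → Set} (P? : ∀ b → Dec (P b)) (Q? : ∀ a → Dec (Q a)) (g : A → B) (φ : B → ℕ) (ψ : A → ℕ) →
  (∀ a → φ (g a) ≡ ψ a) → (∀ a → P (g a) → Q a) → (∀ a → Q a → P (g a)) →
  ∀ xs → map φ (filter P? (map g xs)) ≡ map ψ (filter Q? xs)
filter-map P? Q? g φ ψ e h k [] = refl
filter-map P? Q? g φ ψ e h k (x ∷ xs) with P? (g x) | Q? x
... | yes _ | yes _ = cong₂ _∷_ (e x) (filter-map P? Q? g φ ψ e h k xs)
... | no _ | no _ = filter-map P? Q? g φ ψ e h k xs
... | yes p | no n = ⊥-elim (n (h x p))
... | no n | yes q = ⊥-elim (n (k x q))

code : ∀ {w m} → Label → ℕ → Origin w m → Vec ℕ 8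
code l side o = size l ∷ φ₁ l ∷ φ₂ l ∷ φ₃ l ∷ chain l ∷ side ∷ col o ∷ toℕ (idx o) ∷ []

module _ {w m : ℕ} (S : Sys w m) where
  open Names S

  Inside : Name S → Name S → Set
  Inside J I = Name.lo I ≼ Name.lo J × Name.hi J ≼ Name.hi I × (∀ x → Bottom J x → Trace I (Name.lo J) x)

  within-inside : ∀ {J I a x} → Inside J I → Within S J a x → Within S I a x
  within-inside {J} {I} (l , h , t) (l′ , h′ , (v , b , k)) = ≼-trans l l′ , ≼-trans h′ h , trace-up I k (t v b)

module _ {w′ m : ℕ} (r : ℕ) (S : Sys (suc w′) m) (ls : List (Name S × Label)) where
  open Names S
  open Skeleton (skeleton r S)

  Attached : Name S → Vec ℕ 8 → Set
  Attached J v = ∃[ I ] ∃[ l ] (I , l) ∈ ls × r < Names.size S I × Inside S J I × ∃[ o ]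
    ((∃[ z ] ∃[ x ] Top J z × Bottom J x × itemˡ (Name.hi J) z ≡ just (I , o , Name.lo J , x) × v ≡ code l 0 o)
    ⊎ (∃[ z ] ∃[ y ] Bottom J z × Top J y × itemʰ (Name.lo J) z ≡ just (I , o , Name.hi J , y) × v ≡ code l 1 o))

module Extend {k₀ k : ℕ} (alg : Algorithm k₀ k) {w m : ℕ} (S : Sys w m) where
  open Labels alg S

  extend-with : List (Name S × Vec ℕ 8) → List Entry → List Entry
  extend-with [] ls = ls
  extend-with ((N , v) ∷ cs) ls = (N , mkLabel N v (extend-with cs ls)) ∷ extend-with cs ls

  extend-names : ∀ cs ls → map proj₁ (extend-with cs ls) ≡ map proj₁ cs ++ map proj₁ ls
  extend-names [] ls = refl
  extend-names (_ ∷ cs) ls = cong (_ ∷_) (extend-names cs ls)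

  extend-well : ∀ cs {ls} → WellLabelled ls → WellLabelled (extend-with cs ls)
  extend-well [] ok = ok
  extend-well (_ ∷ cs) ok = refl , extend-well cs ok

  extend-⊇ : ∀ cs {ls e} → e ∈ ls → e ∈ extend-with cs ls
  extend-⊇ [] h = h
  extend-⊇ (_ ∷ cs) h = there (extend-⊇ cs h)

  extend-∈ : ∀ cs {ls N l} → (N , l) ∈ extend-with cs ls → (N , l) ∈ ls ⊎ (N , parentCode l) ∈ cs
  extend-∈ [] h = inj₁ h
  extend-∈ (_ ∷ cs) (here refl) = inj₂ (here refl)
  extend-∈ (_ ∷ cs) (there h) = [ inj₁ , inj₂ ∘ there ]′ (extend-∈ cs h)

module LabelIns {k₀ k : ℕ} (alg : Algorithm k₀ k) {w′ m : ℕ} (r : ℕ) (S : Sys (suc w′) m) (p s : Fin m) (p≼s : below S p s) (p≢s : p ≢ s)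
  (adj : ∀ c → below S c p ⊎ below S s c) (L U : Link (suc w′))
  (refines : ∀ {x z y} → Edge L x z → Edge U z y → Below S p x s y) (pt : Fin (suc w′)) (ls : List (Labels.Entry alg S)) where
  private
    w : ℕ
    w = suc w′

  open SkeletonIns r S p s p≼s p≢s adj L U refines pt (skeleton r S)
  open Extend alg S⁺
  private
    module O = Labels alg S
    module N = Labels alg S⁺

  up : Fin w → Fin w
  up z = main U ⟨$⟩ʳ z

  NewLower NewUpper : Fin w → Set
  NewLower z = Freshˡ (down z) × rep S⁺ (suc p) zero (down z) ≡ down z
  NewUpper z = Freshʰ z × rep S⁺ zero (suc s) z ≡ z

  NewLower? : ∀ z → Dec (NewLower z)
  NewLower? z = Freshᵈ? z ×-dec (_ Fin.≟ _)

  NewUpper? : ∀ z → Dec (NewUpper z)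
  NewUpper? z = Freshʰ? z ×-dec (_ Fin.≟ _)

  lower-candidate upper-candidate : Fin w → Name S⁺ × Vec ℕ 8
  lower-candidate z = lowerName (down z) , code (O.find-label ls (parent z)) 0 (Skeleton.orgˡ (skeleton r S) p (down z))
  upper-candidate z = upperName z , code (O.find-label ls (parent z)) 1 (Skeleton.orgʰ (skeleton r S) s (up z))

  opaque
    new-lower new-upper : List (Fin w)
    new-lower = filter NewLower? (allFin w)
    new-upper = filter NewUpper? (allFin w)

    new-lower⁺ : ∀ {z} → NewLower z → z ∈ new-lower
    new-lower⁺ h = ∈-filter⁺ NewLower? (∈-allFin _) h

    new-lower⁻ : ∀ {z} → z ∈ new-lower → NewLower z
    new-lower⁻ h = proj₂ (∈-filter⁻ NewLower? {xs = allFin w} h)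

    new-upper⁺ : ∀ {z} → NewUpper z → z ∈ new-upper
    new-upper⁺ h = ∈-filter⁺ NewUpper? (∈-allFin _) h

    new-upper⁻ : ∀ {z} → z ∈ new-upper → NewUpper z
    new-upper⁻ h = proj₂ (∈-filter⁻ NewUpper? {xs = allFin w} h)

    new-lower-unique : Unique new-lower
    new-lower-unique = Unique.filter⁺ NewLower? (Unique-allFin w)

    new-upper-unique : Unique new-upper
    new-upper-unique = Unique.filter⁺ NewUpper? (Unique-allFin w)

  candidates : List (Name S⁺ × Vec ℕ 8)
  candidates = map lower-candidate new-lower ++ map upper-candidate new-upper

  wk-entry : O.Entry → N.Entry
  wk-entry (N , l) = wk N , l

  labels⁺ : List N.Entry
  labels⁺ = extend-with candidates (map wk-entry ls)

labelled : ∀ {k₀ k} (alg : Algorithm k₀ k) {w′ m} (r : ℕ) (S : Sys (suc w′) m) → List (Labels.Entry alg S)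
labelled alg {w′} r base = (name (suc zero) zero zero (tt , λ ()) , Labels.mkLabel alg {suc w′} base (name (suc zero) zero zero (tt , λ ())) (Vec.replicate 8 0) []) ∷ []
labelled alg r (ins S p s p≼s p≢s adj L U ref pt) = LabelIns.labels⁺ alg r S p s p≼s p≢s adj L U ref pt (labelled alg r S)

record LabelledInvariant {k₀ k : ℕ} (alg : Algorithm k₀ k) {w′ m : ℕ} (r : ℕ) (S : Sys (suc w′) m) (ls : List (Labels.Entry alg S)) : Set where
  field
    names-unique : Unique (map proj₁ ls)
    names-sound : ∀ {N l} → (N , l) ∈ ls → InForest r S N
    names-complete : ∀ {N} → InForest r S N → N ∈ map proj₁ ls
    well-labelled : Labels.WellLabelled alg S ls
    small-attached : ∀ {N l} → (N , l) ∈ ls → r < Names.size S N ⊎ Attached r S ls N (parentCode l)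

module LabelInsProof {k₀ k : ℕ} (alg : Algorithm k₀ k) {w′ m : ℕ} (r : ℕ) (S : Sys (suc w′) m) (p s : Fin m) (p≼s : below S p s) (p≢s : p ≢ s)
  (adj : ∀ c → below S c p ⊎ below S s c) (L U : Link (suc w′))
  (refines : ∀ {x z y} → Edge L x z → Edge U z y → Below S p x s y) (pt : Fin (suc w′)) (ls : List (Labels.Entry alg S))
  (inv : LabelledInvariant alg r S ls) where
  private
    w : ℕ
    w = suc w′

  open SkeletonIns r S p s p≼s p≢s adj L U refines pt (skeleton r S)
  open SkeletonInsProof r S p s p≼s p≢s adj L U refines pt (skeleton-invariant r S)
    using (wk-injective; lower≢wk; upper≢wk; lower≢upper; On-new)
  open StepProof r S p s p≼s p≢s adj L U refines pt (current r S) (InForest r S) (forest-invariant r S)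
    using (gap; up-edge; down-edge; size-wk; conn-lower; conn-upper; fresh-lower-cong; fresh-upper-cong; lower-eq; upper-eq; wk-lower⁻¹)
  open LabelIns alg r S p s p≼s p≢s adj L U refines pt ls
  open Extend alg S⁺
  open LabelledInvariant inv
  private
    module O = Labels alg S
    module N = Labels alg S⁺
    module Fo = ForestInvariant (forest-invariant r S)
    module Cˡ = Components S⁺ (suc p) zero
    module Cʰ = Components S⁺ zero (suc s)
    module R = NameRelations S
    module R⁺ = NameRelations S⁺

  private
    sizes : ∀ {M N} → Names.size S⁺ (wk M) ≡ Names.size S⁺ (wk N) → Names.size S M ≡ Names.size S N
    sizes {M} {N} e = trans (sym (size-wk M)) (trans e (size-wk N))

    sizes⁺ : ∀ {M N} → Names.size S M ≡ Names.size S N → Names.size S⁺ (wk M) ≡ Names.size S⁺ (wk N)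
    sizes⁺ {M} {N} e = trans (size-wk M) (trans e (sym (size-wk N)))

    complete-wk : ∀ M N → N.completeᵇ (wk M) (wk N) ≡ O.completeᵇ M N
    complete-wk M@(name _ _ _ _) N@(name _ _ _ _) = does-cong (λ h → h) (λ h → h) (R⁺.Complete? (wk M) (wk N)) (R.Complete? M N)

    first-fit-wk : ∀ {C⁺ : Name S⁺ → Name S⁺ → Set} {C : Name S → Name S → Set}
      (C⁺? : ∀ M N → Dec (R⁺.Conflict C⁺ M N)) (C? : ∀ M N → Dec (R.Conflict C M N)) →
      (∀ M N → C⁺ (wk M) (wk N) → C M N) → (∀ M N → C M N → C⁺ (wk M) (wk N)) →
      ∀ φ N es → N.firstFit C⁺? φ (wk N) (map wk-entry es) ≡ O.firstFit C? φ N es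
    first-fit-wk C⁺? C? f g φ N es = cong mex (filter-map (λ e → C⁺? (wk N) (proj₁ e)) (λ e → C? N (proj₁ e)) wk-entry (φ ∘ proj₂) (φ ∘ proj₂)
      (λ _ → refl)
      (λ (M , _) (e , c) → sizes {N} {M} e , [ inj₁ ∘ f N M , inj₂ ∘ f M N ]′ c)
      (λ (M , _) (e , c) → sizes⁺ {N} {M} e , [ inj₁ ∘ g N M , inj₂ ∘ g M N ]′ c) es)

    clash₁ : ∀ M N → R⁺.Clash₁ (wk M) (wk N) → R.Clash₁ M N
    clash₁ (name _ _ _ _) (name _ _ _ _) h = h
    clash₁⁺ : ∀ M N → R.Clash₁ M N → R⁺.Clash₁ (wk M) (wk N)
    clash₁⁺ (name _ _ _ _) (name _ _ _ _) h = h
    clash₂ : ∀ M N → R⁺.Clash₂ (wk M) (wk N) → R.Clash₂ M N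
    clash₂ (name _ _ _ _) (name _ _ _ _) h = h
    clash₂⁺ : ∀ M N → R.Clash₂ M N → R⁺.Clash₂ (wk M) (wk N)
    clash₂⁺ (name _ _ _ _) (name _ _ _ _) h = h
    clash₃ : ∀ M N → R⁺.Clash₃ (wk M) (wk N) → R.Clash₃ M N
    clash₃ (name _ _ _ _) (name _ _ _ _) h = h
    clash₃⁺ : ∀ M N → R.Clash₃ M N → R⁺.Clash₃ (wk M) (wk N)
    clash₃⁺ (name _ _ _ _) (name _ _ _ _) h = h

  mkLabel-wk : ∀ N v es → N.mkLabel (wk N) v (map wk-entry es) ≡ O.mkLabel N v es
  mkLabel-wk N v es = assemble (size-wk N) (first-fit-wk R⁺.Conflict₁? R.Conflict₁? clash₁ clash₁⁺ φ₁ N es)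
    (first-fit-wk R⁺.Conflict₂? R.Conflict₂? clash₂ clash₂⁺ φ₂ N es) (first-fit-wk R⁺.Conflict₃? R.Conflict₃? clash₃ clash₃⁺ φ₃ N es)
    where
    module KM = KeyedMap alg _≟ᴷ_ _≟ᴷ_ (key ∘ proj₂) proj₁ (chain ∘ proj₂) O.completeᵇ (key ∘ proj₂) proj₁ (chain ∘ proj₂) N.completeᵇ
      wk-entry (λ κ → κ) wk (λ e → e) (λ _ → refl) (λ _ → refl) (λ _ → refl) complete-wk
    assemble : ∀ {z z′ a a′ b b′ c c′} → z ≡ z′ → a ≡ a′ → b ≡ b′ → c ≡ c′ →
      label z a b c (N.Chains.nextColour (z , a , b , c) (wk N) (map wk-entry es)) v ≡ label z′ a′ b′ c′ (O.Chains.nextColour (z′ , a′ , b′ , c′) N es) v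
    assemble {z} {_} {a} {_} {b} {_} {c} refl refl refl refl = cong (λ q → label z a b c q v) (KM.nextColour-map (z , a , b , c) N es)

  well-wk : ∀ es → O.WellLabelled es → N.WellLabelled (map wk-entry es)
  well-wk [] _ = tt
  well-wk ((N , l) ∷ es) (e , ok) = trans e (sym (mkLabel-wk N (parentCode l) es)) , well-wk es ok

  names⁺ : map proj₁ labels⁺ ≡ (map (lowerName ∘ down) new-lower ++ map upperName new-upper) ++ map wk (map proj₁ ls)
  names⁺ = trans (extend-names candidates (map wk-entry ls)) (cong₂ _++_ (trans (List-map-++ proj₁ (map lower-candidate new-lower) (map upper-candidate new-upper))
      (cong₂ _++_ (sym (map-∘ new-lower)) (sym (map-∘ new-upper)))) (trans (sym (map-∘ ls)) (map-∘ ls)))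
    where
    List-map-++ : ∀ {A B : Set} (f : A → B) xs ys → map f (xs ++ ys) ≡ map f xs ++ map f ys
    List-map-++ f [] ys = refl
    List-map-++ f (x ∷ xs) ys = cong (f x ∷_) (List-map-++ f xs ys)

  unique⁺ : Unique (map proj₁ labels⁺)
  unique⁺ = subst Unique (sym names⁺) (Unique.++⁺ (Unique.++⁺
      (Unique-map (λ a b e → perm-injective (flip (main L)) (trans (sym (proj₂ (new-lower⁻ a))) (trans (cong Name.root e) (proj₂ (new-lower⁻ b))))) new-lower-unique)
      (Unique-map (λ a b e → trans (sym (proj₂ (new-upper⁻ a))) (trans (cong Name.root e) (proj₂ (new-upper⁻ b)))) new-upper-unique)
      λ (a , b) → case (∈-map⁻ (lowerName ∘ down) a , ∈-map⁻ upperName b) of λ { ((x , _ , refl) , (z , _ , e)) → lower≢upper {down x} {z} e })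
    (Unique.map⁺ wk-injective names-unique)
    λ (a , b) → case ∈-++⁻ (map (lowerName ∘ down) new-lower) a of λ
      { (inj₁ h) → case (∈-map⁻ (lowerName ∘ down) h , ∈-map⁻ wk b) of λ { ((x , _ , refl) , (I , _ , e)) → lower≢wk {down x} {I} e }
      ; (inj₂ h) → case (∈-map⁻ upperName h , ∈-map⁻ wk b) of λ { ((x , _ , refl) , (I , _ , e)) → upper≢wk {x} {I} e } })

  entry-of : ∀ {I} → InForest r S I → (I , O.find-label ls I) ∈ ls
  entry-of i with (N , l) , j , refl ← ∈-map⁻ proj₁ (names-complete i) = subst (λ l′ → (N , l′) ∈ ls) (sym (O.find-label-∈ names-unique j)) j

  candidates⁻ : ∀ {c} → c ∈ candidates → (∃[ z ] NewLower z × c ≡ lower-candidate z) ⊎ (∃[ z ] NewUpper z × c ≡ upper-candidate z)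
  candidates⁻ h with ∈-++⁻ (map lower-candidate new-lower) h
  ... | inj₁ a = let (z , b , e) = ∈-map⁻ lower-candidate a in inj₁ (z , new-lower⁻ b , e)
  ... | inj₂ a = let (z , b , e) = ∈-map⁻ upper-candidate a in inj₂ (z , new-upper⁻ b , e)

  labels⁺-∈ : ∀ {N l} → (N , l) ∈ labels⁺ →
    (∃[ M ] (M , l) ∈ ls × N ≡ wk M) ⊎ (∃[ z ] NewLower z × (N , parentCode l) ≡ lower-candidate z) ⊎ (∃[ z ] NewUpper z × (N , parentCode l) ≡ upper-candidate z)
  labels⁺-∈ h with extend-∈ candidates h
  ... | inj₁ a = case ∈-map⁻ wk-entry a of λ { ((M , _) , b , refl) → inj₁ (M , b , refl) }
  ... | inj₂ a = inj₂ (candidates⁻ a)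

  wk-∈ : ∀ {N l} → (N , l) ∈ ls → (wk N , l) ∈ labels⁺
  wk-∈ h = extend-⊇ candidates (∈-map⁺ wk-entry h)

  sound⁺ : ∀ {N l} → (N , l) ∈ labels⁺ → InForest r S⁺ N
  sound⁺ h with labels⁺-∈ h
  ... | inj₁ (M , i , e) = inj₁ (M , names-sound i , e)
  ... | inj₂ (inj₁ (z , (f , _) , e)) = inj₂ (inj₁ (down z , f , cong proj₁ e))
  ... | inj₂ (inj₂ (z , (f , _) , e)) = inj₂ (inj₂ (z , f , cong proj₁ e))

  complete⁺ : ∀ {N} → InForest r S⁺ N → N ∈ map proj₁ labels⁺
  complete⁺ (inj₁ (M , i , refl)) = subst (wk M ∈_) (sym names⁺) (∈-++⁺ʳ (map (lowerName ∘ down) new-lower ++ map upperName new-upper) (∈-map⁺ wk (names-complete i)))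
  complete⁺ (inj₂ (inj₁ (x , f , refl))) = subst (lowerName x ∈_) (sym names⁺) (∈-++⁺ˡ (∈-++⁺ˡ
      (subst (_∈ map (lowerName ∘ down) new-lower) (trans (cong lowerName down-z) (sym (lower-eq c))) (∈-map⁺ (lowerName ∘ down) (new-lower⁺ {z}
        (subst (λ v → Freshˡ v × rep S⁺ (suc p) zero v ≡ v) (sym down-z) (fresh-lower-cong c f , sym (Cˡ.rep-cong c))))))))
    where
    c = Cˡ.rep-conn x
    z = main L ⟨$⟩ʳ rep S⁺ (suc p) zero x
    down-z : down z ≡ rep S⁺ (suc p) zero x
    down-z = inverseˡ (main L)
  complete⁺ (inj₂ (inj₂ (z , f , refl))) = subst (upperName z ∈_) (sym names⁺) (∈-++⁺ˡ (∈-++⁺ʳ (map (lowerName ∘ down) new-lower)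
      (subst (_∈ map upperName new-upper) (sym (upper-eq c)) (∈-map⁺ upperName (new-upper⁺ (fresh-upper-cong c f , sym (Cʰ.rep-cong c)))))))
    where c = Cʰ.rep-conn z

  attached-wk : ∀ {J v} → Attached r S ls J v → Attached r S⁺ labels⁺ (wk J) v
  attached-wk {J@(name _ _ _ _)} (I@(name _ _ _ _) , l , i , b , sub , o , inj₁ (z , x , tz , bx , q , e)) =
    wk I , l , wk-∈ i , subst (r <_) (sym (size-wk I)) b , sub , lift-origin o , inj₁ (z , x , tz , bx , Iˡ.item-kept q , e)
  attached-wk {J@(name _ _ _ _)} (I@(name _ _ _ _) , l , i , b , sub , o , inj₂ (z , y , bz , ty , q , e)) =
    wk I , l , wk-∈ i , subst (r <_) (sym (size-wk I)) b , sub , lift-origin o , inj₂ (z , y , bz , ty , Iʰ.item-kept q , e)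

  big-wk⁺ : ∀ I → Big I → r < Names.size S⁺ (wk I)
  big-wk⁺ I = subst (r <_) (sym (size-wk I))

  inside-lower : ∀ x → Inside S⁺ (lowerName x) (wk (current r S p x))
  inside-lower x = proj₁ bs , proj₂ bs , λ v b → subst (λ I → Names.Trace S⁺ (wk I) (suc p) v)
      (sym (Fo.cur-cong gap (conn-lower (Cˡ.conn-trans (Cˡ.rep-conn x) b)))) (proj₂ (proj₂ (wk-lower⁻¹ (current r S p v) v (Fo.cur-contains gap v))))
    where
    bounds : ∀ I → Names.Contains S I p s x → below S⁺ (Name.lo (wk I)) (suc p) × below S⁺ zero (Name.hi (wk I))
    bounds (name _ _ _ _) (a , b , _) = a , b
    bs = bounds (current r S p x) (Fo.cur-contains gap x)

  inside-upper : ∀ z → Inside S⁺ (upperName z) (wk (parent z))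
  inside-upper z = proj₁ bs , proj₂ bs , λ v b → subst (λ I → Names.Trace S⁺ (wk I) zero v)
      (sym (Fo.cur-cong gap (conn-upper (Cʰ.conn-trans (Cʰ.rep-conn z) b)))) (proj₂ (proj₂ (On-new v)))
    where
    bounds : ∀ I → Names.Contains S I p s (down z) → below S⁺ (Name.lo (wk I)) zero × below S⁺ (suc s) (Name.hi (wk I))
    bounds (name _ _ _ _) (a , b , _) = a , b
    bs = bounds (parent z) (Fo.cur-contains gap (down z))

  attached-lower : ∀ z → Freshˡ (down z) → Attached r S⁺ labels⁺ (lowerName (down z)) (proj₂ (lower-candidate z))
  attached-lower z f@(b , _) = wk (parent z) , O.find-label ls (parent z) , wk-∈ (entry-of (Fo.cur-in gap (down z))) , big-wk⁺ (parent z) b , inside-lower (down z) ,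
    lift-origin (Skeleton.orgˡ (skeleton r S) p (down z)) , inj₁ (z , down z , (down z , bottom , (down z , Below-refl S p (down z) , down-edge z)) , bottom , Iˡ.item-here b f , refl)
    where bottom = Cˡ.conn-sym (Cˡ.rep-conn (down z))

  attached-upper : ∀ z → Freshʰ z → Attached r S⁺ labels⁺ (upperName z) (proj₂ (upper-candidate z))
  attached-upper z f@(b , _) = wk (parent z) , O.find-label ls (parent z) , wk-∈ (entry-of (Fo.cur-in gap (down z))) , big-wk⁺ (parent z) b , inside-upper z ,
    lift-origin (Skeleton.orgʰ (skeleton r S) s (up z)) , inj₂ (z , up z , bottom , (z , bottom , (up z , up-edge z , Below-refl S s (up z))) , Iʰ.item-here b f , refl)
    where bottom = Cʰ.conn-sym (Cʰ.rep-conn z)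

  attached⁺ : ∀ {N l} → (N , l) ∈ labels⁺ → r < Names.size S⁺ N ⊎ Attached r S⁺ labels⁺ N (parentCode l)
  attached⁺ h with labels⁺-∈ h
  ... | inj₁ (M , i , refl) = [ inj₁ ∘ big-wk⁺ M , inj₂ ∘ attached-wk {M} ]′ (small-attached i)
  ... | inj₂ (inj₁ (z , (f , _) , e)) = inj₂ (subst (λ (N , v) → Attached r S⁺ labels⁺ N v) (sym e) (attached-lower z f))
  ... | inj₂ (inj₂ (z , (f , _) , e)) = inj₂ (subst (λ (N , v) → Attached r S⁺ labels⁺ N v) (sym e) (attached-upper z f))

  labelled-invariant⁺ : LabelledInvariant alg r S⁺ labels⁺
  labelled-invariant⁺ = record
    { names-unique = unique⁺ ; names-sound = sound⁺ ; names-complete = complete⁺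
    ; well-labelled = extend-well candidates (well-wk ls well-labelled) ; small-attached = attached⁺ }

labelled-invariant : ∀ {k₀ k} (alg : Algorithm k₀ k) {w′ m} (r : ℕ) → r < suc w′ → (S : Sys (suc w′) m) → LabelledInvariant alg r S (labelled alg r S)
labelled-invariant alg {w′} r r<w base = record
  { names-unique = [] ∷ [] ; names-sound = λ { (here refl) → refl } ; names-complete = λ { refl → here refl }
  ; well-labelled = refl , tt ; small-attached = λ { (here refl) → inj₁ (ℕ.≤-trans r<w root-size) } }
  where
  module C = Components {suc w′} base (suc zero) zero
  root-size : suc w′ ≤ C.csize zero
  root-size = subst (_≤ C.csize zero) (length-tabulate id) (inj-length id (C.members zero) (Unique-allFin (suc w′)) (λ _ _ → id)
    λ {x} _ → C.∈-members (C.conn-step {y = x} tt tt))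
labelled-invariant alg r r<w (ins S p s p≼s p≢s adj L U ref pt) =
  LabelInsProof.labelled-invariant⁺ alg r S p s p≼s p≢s adj L U ref pt (labelled alg r S) (labelled-invariant alg r r<w S)

-- Colouring the inserted elements

Point : ∀ {w m} → Sys w m → Set
Point {w} {m} S = Fin m × Fin w

Strict : ∀ {w m} (S : Sys w m) → Point S → Point S → Set
Strict S (a , x) (b , y) = a ≢ b × Below S a x b y

opaque
  Strict? : ∀ {w m} (S : Sys w m) u v → Dec (Strict S u v)
  Strict? S (a , x) (b , y) = ¬? (a Fin.≟ b) ×-dec Below? S a x b y

strictᵇ : ∀ {w m} (S : Sys w m) → Point S → Point S → Bool
strictᵇ S u v = does (Strict? S u v)

Inserted : ∀ {w m} (S : Sys w m) → Fin m → Fin w → Set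
Inserted base t x = ⊥
Inserted (ins S p s _ _ _ L U _ pt) zero x = x ≡ pt
Inserted (ins S p s _ _ _ L U _ pt) (suc t) x = Inserted S t x

inserted-unique : ∀ {w m} (S : Sys w m) t {x y} → Inserted S t x → Inserted S t y → x ≡ y
inserted-unique (ins S p s _ _ _ L U _ pt) zero e e′ = trans e (sym e′)
inserted-unique (ins S p s _ _ _ L U _ pt) (suc t) h h′ = inserted-unique S t h h′

module Smalls {k₀ k : ℕ} (alg : Algorithm k₀ k) {w m : ℕ} (S : Sys w m) where
  Small : Set
  Small = Name S × Point S × ℕ

  module Vals = Keyed alg {E = Small} _≟ᴺᵃ_ proj₁ (proj₁ ∘ proj₂) (proj₂ ∘ proj₂) (strictᵇ S)

Colour : Set
Colour = Vec ℕ 14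

big-colour : Label → ℕ → ℕ → ℕ → Colour
big-colour l type a b = 0 ∷ size l ∷ φ₁ l ∷ φ₂ l ∷ φ₃ l ∷ chain l ∷ type ∷ a ∷ b ∷ Vec.replicate 5 0

small-colour : Label → ℕ → Colour
small-colour l v = 1 ∷ size l ∷ φ₁ l ∷ φ₂ l ∷ φ₃ l ∷ v ∷ parentCode l

record PointState {k₀ k : ℕ} (alg : Algorithm k₀ k) {w m : ℕ} (S : Sys w m) : Set where
  constructor state
  field
    smalls : List (Smalls.Small alg S)
    colour : Fin m → Colour

module PointIns {k₀ k : ℕ} (alg : Algorithm k₀ k) {w′ m : ℕ} (r : ℕ) (S : Sys (suc w′) m) (p s : Fin m) (p≼s : below S p s) (p≢s : p ≢ s)
  (adj : ∀ c → below S c p ⊎ below S s c) (L U : Link (suc w′))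
  (refines : ∀ {x z y} → Edge L x z → Edge U z y → Below S p x s y) (pt : Fin (suc w′)) (st : PointState alg S) where
  private
    w : ℕ
    w = suc w′

  open SkeletonIns r S p s p≼s p≢s adj L U refines pt (skeleton r S)
  open PointState st

  own : Label
  own = Labels.find-label alg S (labelled alg r S) (parent pt)

  wk-small : Smalls.Small alg S → Smalls.Small alg S⁺
  wk-small (J , (t , x) , v) = wk J , (suc t , x) , v

  val : ℕ
  val = Smalls.Vals.nextColour alg S⁺ (wk (parent pt)) (zero , pt) (map wk-small smalls)

  new-smalls : Dec (Big (parent pt)) → List (Smalls.Small alg S⁺)
  new-smalls (yes _) = map wk-small smalls
  new-smalls (no _) = (wk (parent pt) , (zero , pt) , val) ∷ map wk-small smalls

  new-colour : Dec (Big (parent pt)) → Dec (Freshˡ (down pt)) → Dec (Freshʰ pt) → Colour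
  new-colour (no _) _ _ = small-colour own val
  new-colour (yes _) (yes _) _ = let o = Skeleton.orgˡ (skeleton r S) p (down pt) in big-colour own 1 (col o) (toℕ (idx o))
  new-colour (yes _) (no _) (yes _) = let o = Skeleton.orgʰ (skeleton r S) s (main U ⟨$⟩ʳ pt) in big-colour own 2 (col o) (toℕ (idx o))
  new-colour (yes _) (no _) (no _) = big-colour own 0 (fresh-colour (parent pt)) 0

  colour⁺ : Fin (suc m) → Colour
  colour⁺ zero = new-colour (big? (parent pt)) (Freshᵈ? pt) (Freshʰ? pt)
  colour⁺ (suc t) = colour t

  state⁺ : PointState alg S⁺
  state⁺ = state (new-smalls (big? (parent pt))) colour⁺

points : ∀ {k₀ k} (alg : Algorithm k₀ k) {w′ m} (r : ℕ) (S : Sys (suc w′) m) → PointState alg S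
points alg r base = state [] λ _ → Vec.replicate 14 0
points alg r (ins S p s p≼s p≢s adj L U ref pt) = PointIns.state⁺ alg r S p s p≼s p≢s adj L U ref pt (points alg r S)

module Describe {k₀ k : ℕ} (alg : Algorithm k₀ k) {w′ m : ℕ} (r : ℕ) (S : Sys (suc w′) m) (st : PointState alg S) where
  open Names S hiding (size)
  open Skeleton (skeleton r S)
  open PointState st

  ls : List (Labels.Entry alg S)
  ls = labelled alg r S

  Kind : Name S → Fin m → Fin (suc w′) → ℕ → ℕ → ℕ → Set
  Kind I t x type a b = (type ≡ 0 × b ≡ 0 × Split I t a)
    ⊎ (type ≡ 1 × ∃[ o ] ∃[ p ] ∃[ v ] itemˡ t x ≡ just (I , o , p , v) × a ≡ col o × b ≡ toℕ (idx o))
    ⊎ (type ≡ 2 × ∃[ o ] ∃[ p ] ∃[ v ] itemʰ t x ≡ just (I , o , p , v) × a ≡ col o × b ≡ toℕ (idx o))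

  BigPoint SmallPoint : Fin m → Fin (suc w′) → Colour → Set
  BigPoint t x c = ∃[ I ] ∃[ l ] (I , l) ∈ ls × r < Names.size S I × Within S I t x ×
    ∃[ type ] ∃[ a ] ∃[ b ] c ≡ big-colour l type a b × Kind I t x type a b
  SmallPoint t x c = ∃[ J ] ∃[ l ] ∃[ v ] (J , l) ∈ ls × (J , (t , x) , v) ∈ smalls × c ≡ small-colour l v

  record PointInvariant : Set where
    field
      described : ∀ t x → Inserted S t x → BigPoint t x (colour t) ⊎ SmallPoint t x (colour t)
      small-within : ∀ {J t x v} → (J , (t , x) , v) ∈ smalls → Within S J t x × Names.size S J ≤ r
      small-unique : Unique (map (proj₁ ∘ proj₂) smalls)
      consistent : Smalls.Vals.Consistent alg S smalls

module PointInsProof {k₀ k : ℕ} (alg : Algorithm k₀ k) {w′ m : ℕ} (r : ℕ) (r<w : r < suc w′) (S : Sys (suc w′) m) (p s : Fin m) (p≼s : below S p s) (p≢s : p ≢ s)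
  (adj : ∀ c → below S c p ⊎ below S s c) (L U : Link (suc w′))
  (refines : ∀ {x z y} → Edge L x z → Edge U z y → Below S p x s y) (pt : Fin (suc w′)) (st : PointState alg S)
  (inv : Describe.PointInvariant alg r S st) where
  private
    w : ℕ
    w = suc w′

  open SkeletonIns r S p s p≼s p≢s adj L U refines pt (skeleton r S)
  open SkeletonInsProof r S p s p≼s p≢s adj L U refines pt (skeleton-invariant r S)
    using (wk-injective; On-new; On-wk; split-here; split-wk)
  open StepProof r S p s p≼s p≢s adj L U refines pt (current r S) (InForest r S) (forest-invariant r S)
    using (gap; size-wk)
  open PointIns alg r S p s p≼s p≢s adj L U refines pt st
  open PointState st
  open Describe.PointInvariant inv
  open LabelInsProof alg r S p s p≼s p≢s adj L U refines pt (labelled alg r S) (labelled-invariant alg r r<w S)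
    using (wk-∈; entry-of; big-wk⁺)
  private
    module D = Describe alg r S st
    module D⁺ = Describe alg r S⁺ state⁺

  private
    own-∈ : (wk (parent pt) , own) ∈ labelled alg r S⁺
    own-∈ = wk-∈ (entry-of (ForestInvariant.cur-in (forest-invariant r S) gap (down pt)))

    old-small : ∀ d {e} → e ∈ smalls → wk-small e ∈ new-smalls d
    old-small (yes _) h = ∈-map⁺ wk-small h
    old-small (no _) h = there (∈-map⁺ wk-small h)

    kind-wk : ∀ {I t x type a b} → D.Kind I t x type a b → D⁺.Kind (wk I) (suc t) x type a b
    kind-wk (inj₁ (e , e′ , sp)) = inj₁ (e , e′ , split-wk sp)
    kind-wk (inj₂ (inj₁ (e , o , q , v , i , c , d))) = inj₂ (inj₁ (e , lift-origin o , suc q , v , Iˡ.item-kept i , c , d))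
    kind-wk (inj₂ (inj₂ (e , o , q , v , i , c , d))) = inj₂ (inj₂ (e , lift-origin o , suc q , v , Iʰ.item-kept i , c , d))

    new : (b? : Dec (Big (parent pt))) (l? : Dec (Freshˡ (down pt))) (h? : Dec (Freshʰ pt)) →
      D⁺.BigPoint zero pt (new-colour b? l? h?) ⊎
        (∃[ J ] ∃[ l ] ∃[ v ] (J , l) ∈ labelled alg r S⁺ × (J , (zero , pt) , v) ∈ new-smalls b? × new-colour b? l? h? ≡ small-colour l v)
    new (no _) _ _ = inj₂ (wk (parent pt) , own , val , own-∈ , here refl , refl)
    new (yes b) (yes f) _ = inj₁ (wk (parent pt) , own , own-∈ , big-wk⁺ (parent pt) b , On-new pt , 1 , _ , _ , refl ,
      inj₂ (inj₁ (refl , lift-origin (Skeleton.orgˡ (skeleton r S) p (down pt)) , _ , _ , Iˡ.item-here b f , refl , refl)))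
    new (yes b) (no _) (yes f) = inj₁ (wk (parent pt) , own , own-∈ , big-wk⁺ (parent pt) b , On-new pt , 2 , _ , _ , refl ,
      inj₂ (inj₂ (refl , lift-origin (Skeleton.orgʰ (skeleton r S) s (main U ⟨$⟩ʳ pt)) , _ , _ , Iʰ.item-here b f , refl , refl)))
    new (yes b) (no f) (no f′) = inj₁ (wk (parent pt) , own , own-∈ , big-wk⁺ (parent pt) b , On-new pt , 0 , _ , _ , refl ,
      inj₁ (refl , refl , split-here (b , f , f′)))

    described⁺ : ∀ t x → Inserted S⁺ t x → D⁺.BigPoint t x (colour⁺ t) ⊎ D⁺.SmallPoint t x (colour⁺ t)
    described⁺ zero x refl = new (big? (parent pt)) (Freshᵈ? pt) (Freshʰ? pt)
    described⁺ (suc t) x h with described t x h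
    ... | inj₁ (I , l , i , b , on , type , a , c , e , kd) = inj₁ (wk I , l , wk-∈ i , big-wk⁺ I b , On-wk {I} on , type , a , c , e , kind-wk kd)
    ... | inj₂ (J , l , v , i , j , e) = inj₂ (wk J , l , v , wk-∈ i , old-small (big? (parent pt)) j , e)

    old-within : ∀ {e} → e ∈ map wk-small smalls → let (J , (t , x) , v) = e in Within S⁺ J t x × Names.size S⁺ J ≤ r
    old-within h with (J , (t , x) , v) , i , refl ← ∈-map⁻ wk-small h =
      On-wk {J} (proj₁ (small-within i)) , subst (_≤ r) (sym (size-wk J)) (proj₂ (small-within i))

    within⁺ : ∀ d {e} → e ∈ new-smalls d → let (J , (t , x) , v) = e in Within S⁺ J t x × Names.size S⁺ J ≤ r
    within⁺ (yes _) h = old-within h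
    within⁺ (no n) (here refl) = On-new pt , ℕ.≮⇒≥ (λ b → n (subst (r <_) (size-wk (parent pt)) b))
    within⁺ (no n) (there h) = old-within h

    shift : Point S → Point S⁺
    shift (t , x) = suc t , x

    old-points : map (proj₁ ∘ proj₂) (map wk-small smalls) ≡ map shift (map (proj₁ ∘ proj₂) smalls)
    old-points = trans (sym (map-∘ smalls)) (map-∘ smalls)

    old-unique : Unique (map (proj₁ ∘ proj₂) (map wk-small smalls))
    old-unique = subst Unique (sym old-points) (Unique.map⁺ (λ { refl → refl }) small-unique)

    unique⁺ : ∀ d → Unique (map (proj₁ ∘ proj₂) (new-smalls d))
    unique⁺ (yes _) = old-unique
    unique⁺ (no _) = All.tabulate (λ h e → case ∈-map⁻ shift (subst (_ ∈_) old-points h) of λ { (_ , _ , q) → case cong proj₁ (trans e q) of λ () }) ∷ old-unique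

    strict-wk : ∀ u v → strictᵇ S⁺ (shift u) (shift v) ≡ strictᵇ S u v
    strict-wk u v = does-cong (λ (n , l) → n ∘ cong suc , l) (λ (n , l) → n ∘ Fin.suc-injective , l) (Strict? S⁺ (shift u) (shift v)) (Strict? S u v)

    module KM = KeyedMap alg _≟ᴺᵃ_ _≟ᴺᵃ_ proj₁ (proj₁ ∘ proj₂) (proj₂ ∘ proj₂) (strictᵇ S) proj₁ (proj₁ ∘ proj₂) (proj₂ ∘ proj₂) (strictᵇ S⁺)
      wk-small wk shift wk-injective (λ _ → refl) (λ _ → refl) (λ _ → refl) strict-wk

    consistent⁺ : ∀ d → Smalls.Vals.Consistent alg S⁺ (new-smalls d)
    consistent⁺ (yes _) = KM.consistent-map smalls consistent
    consistent⁺ (no _) = refl , KM.consistent-map smalls consistent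

  point-invariant⁺ : Describe.PointInvariant alg r S⁺ state⁺
  point-invariant⁺ = record { described = described⁺ ; small-within = within⁺ (big? (parent pt)) ; small-unique = unique⁺ (big? (parent pt))
    ; consistent = consistent⁺ (big? (parent pt)) }

point-invariant : ∀ {k₀ k} (alg : Algorithm k₀ k) {w′ m} (r : ℕ) → r < suc w′ → (S : Sys (suc w′) m) → Describe.PointInvariant alg r S (points alg r S)
point-invariant alg r r<w base = record { described = λ _ _ () ; small-within = λ () ; small-unique = [] ; consistent = tt }
point-invariant alg r r<w (ins S p s p≼s p≢s adj L U ref pt) =
  PointInsProof.point-invariant⁺ alg r r<w S p s p≼s p≢s adj L U ref pt (points alg r S) (point-invariant alg r r<w S)

unique-filter : {A B : Set} {P : A → Set} (f : A → B) (P? : ∀ x → Dec (P x)) (xs : List A) → Unique (map f xs) → Unique (map f (filter P? xs))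
unique-filter f P? xs u = AllPairs.map⁺ (AllPairs.filter⁺ P? (AllPairs.map⁻ u))

module Comparable {r k : ℕ} (alg : Algorithm r k) {w′ m : ℕ} (r<w : r < suc w′) (w<r² : suc w′ < suc r * suc r) (S : Sys (suc w′) m) where
  private
    w : ℕ
    w = suc w′
  open Names S hiding (size)
  open NameRelations S using (Reach; Complete; complete-elements)
  open Skeleton (skeleton r S)
  open SkeletonInvariant (skeleton-invariant r S)
  open LabelledInvariant (labelled-invariant alg r r<w S)
  open PointState (points alg r S)
  open Describe alg r S (points alg r S) using (ls; Kind; BigPoint; SmallPoint)
  open Describe.PointInvariant (point-invariant alg r r<w S) renaming (consistent to vals-consistent)
  open Smalls alg S using (module Vals)
  open Labels alg S using (same-class; size-correct)
  module LB = LabelBounds alg r S ls well-labelled names-unique names-sound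

  Comp : Fin m → Fin w → Fin m → Fin w → Set
  Comp t x t′ x′ = Below S t x t′ x′ ⊎ Below S t′ x′ t x

  private
    complete-comp : ∀ {M N t x t′ x′} → Within S M t x → Within S N t′ x′ → Complete M N ⊎ Complete N M → Comp t x t′ x′
    complete-comp {M} {N} a b (inj₁ c) = inj₁ (complete-elements {M} {N} c a b)
    complete-comp {M} {N} a b (inj₂ c) = inj₂ (complete-elements {N} {M} c b a)

    kind-comp : ∀ {I t x t′ x′ type a b} → Within S I t x → Within S I t′ x′ → Inserted S t x → Inserted S t′ x′ →
      Kind I t x type a b → Kind I t′ x′ type a b → Comp t x t′ x′
    kind-comp {I} {t} {x} {t′} {x′} on on′ h h′ (inj₁ (_ , _ , sp)) (inj₁ (_ , _ , sp′)) with t Fin.≟ t′ | ≼-total t t′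
    ... | yes refl | _ = inj₁ (subst (Below S t x t) (inserted-unique S t h h′) Le-refl)
    ... | no n | inj₁ l = inj₁ (splits-comparable r S {I} sp sp′ l n on on′)
    ... | no n | inj₂ l = inj₂ (splits-comparable r S {I} sp′ sp l (n ∘ sym) on′ on)
    kind-comp _ _ _ _ (inj₂ (inj₁ (refl , o , p , v , i , ea , eb))) (inj₂ (inj₁ (_ , o′ , p′ , v′ , i′ , ea′ , eb′)))
      with itemsˡ-comparable r S i i′ (trans (sym ea) ea′) (Fin.toℕ-injective (trans (sym eb) eb′))
    ... | inj₁ (refl , refl) = inj₁ Le-refl
    ... | inj₂ (inj₁ l) = inj₁ (Le-trans l (proj₁ (proj₂ (Zones.attached zonesˡ i′))))
    ... | inj₂ (inj₂ l) = inj₂ (Le-trans l (proj₁ (proj₂ (Zones.attached zonesˡ i))))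
    kind-comp _ _ _ _ (inj₂ (inj₂ (refl , o , p , v , i , ea , eb))) (inj₂ (inj₂ (_ , o′ , p′ , v′ , i′ , ea′ , eb′)))
      with itemsʰ-comparable r S i i′ (trans (sym ea) ea′) (Fin.toℕ-injective (trans (sym eb) eb′))
    ... | inj₁ (refl , refl) = inj₁ Le-refl
    ... | inj₂ (inj₁ l) = inj₂ (Le-trans (proj₁ (proj₂ (Zones.attached zonesʰ i′))) l)
    ... | inj₂ (inj₂ l) = inj₁ (Le-trans (proj₁ (proj₂ (Zones.attached zonesʰ i))) l)
    kind-comp _ _ _ _ (inj₁ (refl , _)) (inj₂ (inj₁ (() , _)))
    kind-comp _ _ _ _ (inj₁ (refl , _)) (inj₂ (inj₂ (() , _)))
    kind-comp _ _ _ _ (inj₂ (inj₁ (refl , _))) (inj₁ (() , _))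
    kind-comp _ _ _ _ (inj₂ (inj₁ (refl , _))) (inj₂ (inj₂ (() , _)))
    kind-comp _ _ _ _ (inj₂ (inj₂ (refl , _))) (inj₁ (() , _))
    kind-comp _ _ _ _ (inj₂ (inj₂ (refl , _))) (inj₂ (inj₁ (() , _)))

    label-key : Colour → Key
    label-key (_ ∷ a ∷ b ∷ c ∷ d ∷ _) = a , b , c , d

    fifth : Colour → ℕ
    fifth (_ ∷ _ ∷ _ ∷ _ ∷ _ ∷ v ∷ _) = v

    kind-part : Colour → ℕ × ℕ × ℕ
    kind-part (_ ∷ _ ∷ _ ∷ _ ∷ _ ∷ _ ∷ a ∷ b ∷ c ∷ _) = a , b , c

    parent-part : Colour → Vec ℕ 8
    parent-part (_ ∷ _ ∷ _ ∷ _ ∷ _ ∷ _ ∷ v) = v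

    big-big : ∀ {t x t′ x′ c} → Inserted S t x → Inserted S t′ x′ → BigPoint t x c → BigPoint t′ x′ c → Comp t x t′ x′
    big-big {t} {x} {t′} {x′} h h′ (I , l , i , b , on , type , a , d , refl , kd) (I′ , l′ , i′ , b′ , on′ , type′ , a′ , d′ , e , kd′) =
      go (LB.chain-complete w<r² i i′ b (cong label-key e) (cong fifth e)) kd′
      where
      go : I ≡ I′ ⊎ Complete I I′ ⊎ Complete I′ I → Kind I′ t′ x′ type′ a′ d′ → Comp t x t′ x′
      go (inj₁ refl) kd′ = kind-comp on on′ h h′ kd (subst (λ (u , v , z) → Kind I t′ x′ u v z) (sym (cong kind-part e)) kd′)
      go (inj₂ q) _ = complete-comp {I} {I′} on on′ q

    strict-trans : ∀ {u v z} → Strict S u v → Strict S v z → Strict S u z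
    strict-trans {a , _} {b , _} {c , _} (n , l) (n′ , l′) = (λ { refl → n (≼-antisym (Le⇒≼ l) (Le⇒≼ l′)) }) , Le-trans l l′

    strict : ∀ {u v} → T (strictᵇ S u v) → Strict S u v
    strict {u} {v} = does⁻ (Strict? S u v)

    vals-transitive : ∀ J → Transitive (present (strictᵇ S) (Vals.select J smalls))
    vals-transitive J = present-transitive (strictᵇ S) (Vals.select J smalls)
      (λ {x} {y} {z} _ _ _ p q → does⁺ (Strict? S x z) (strict-trans {x} {y} {z} (strict {x} {y} p) (strict {y} {z} q)))
      (λ {x} _ p → proj₁ (strict {x} {x} p) refl)

    -- Incomparable elements of an instance lie on different threads.
    vals-width : ∀ J → Names.size S J ≤ r → WidthAtMost r (present (strictᵇ S) (Vals.select J smalls))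
    vals-width J small = present-width (strictᵇ S) r (Vals.select J smalls) (unique-filter (proj₁ ∘ proj₂) (λ e → proj₁ e ≟ᴺᵃ J) smalls small-unique)
      λ ys u sub apart → ℕ.≤-trans (inj-length onto (Components.members S (Name.lo J) (Name.hi J) (Name.root J)) u (injective ys sub apart)
        (λ y∈ → Components.∈-members S (Name.lo J) (Name.hi J) (bottom (inside-J (sub y∈))))) small
      where
      onto : Point S → Fin w
      onto (t , x) = thread (Name.lo J) ⟨$⟩ʳ (thread t ⟨$⟩ˡ x)
      inside-J : ∀ {u} → u ∈ Vals.select J smalls → Within S J (proj₁ u) (proj₂ u)
      inside-J h with (_ , _ , v) , i , refl , refl ← Vals.∈-select h = proj₁ (small-within i)
      bottom : ∀ {u} → Within S J (proj₁ u) (proj₂ u) → Bottom J (onto u)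
      bottom {t , x} (l , h , tr) with v , b , k ← trace-down J ≼-refl h (thread-down l x) tr = subst (Bottom J) (Le-eq k) b
      injective : ∀ ys → (∀ {y} → y ∈ ys → y ∈ Vals.select J smalls) → (∀ {x y} → x ∈ ys → y ∈ ys → x ≢ y → ¬ T (strictᵇ S x y)) → InjOn onto ys
      injective ys sub apart {t , x} {t′ , x′} a b e with ≼-total t t′ | t Fin.≟ t′
      ... | _ | yes refl = cong (t ,_) (perm-injective (flip (thread t)) (perm-injective (thread (Name.lo J)) e))
      ... | inj₁ l | no n = ⊥-elim (apart a b (n ∘ cong proj₁) (does⁺ (Strict? S (t , x) (t′ , x′)) (n ,
        subst (Below S t x t′) (trans (cong (thread t′ ⟨$⟩ʳ_) (perm-injective (thread (Name.lo J)) e)) (inverseʳ (thread t′))) (thread-up l x))))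
      ... | inj₂ l | no n = ⊥-elim (apart b a (n ∘ sym ∘ cong proj₁) (does⁺ (Strict? S (t′ , x′) (t , x)) (n ∘ sym ,
        subst (Below S t′ x′ t) (trans (cong (thread t ⟨$⟩ʳ_) (sym (perm-injective (thread (Name.lo J)) e))) (inverseʳ (thread t))) (thread-up l x′))))

    val-proper : ∀ {J t x v t′ x′} → (J , (t , x) , v) ∈ smalls → (J , (t′ , x′) , v) ∈ smalls → Comp t x t′ x′
    val-proper {J} {t} {x} {v} {t′} {x′} i j = finish (Vals.keyed-proper smalls vals-consistent J (vals-transitive J) (vals-width J (proj₂ (small-within i)))
        {J , (t , x) , v} {J , (t′ , x′) , v} i j refl refl refl)
      where
      finish : (t , x) ≡ (t′ , x′) ⊎ T (strictᵇ S (t , x) (t′ , x′)) ⊎ T (strictᵇ S (t′ , x′) (t , x)) → Comp t x t′ x′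
      finish (inj₁ refl) = inj₁ Le-refl
      finish (inj₂ (inj₁ q)) = inj₁ (proj₂ (strict {t , x} {t′ , x′} q))
      finish (inj₂ (inj₂ q)) = inj₂ (proj₂ (strict {t′ , x′} {t , x} q))

    small-attachment : ∀ {J t x v l} → (J , (t , x) , v) ∈ smalls → (J , l) ∈ ls → Attached r S ls J (parentCode l)
    small-attachment i j with small-attached j
    ... | inj₁ b = ⊥-elim (ℕ.<-irrefl refl (ℕ.<-≤-trans b (proj₂ (small-within i))))
    ... | inj₂ a = a

    code-key : Vec ℕ 8 → Key
    code-key (a ∷ b ∷ c ∷ d ∷ _) = a , b , c , d

    code-rest : Vec ℕ 8 → ℕ × ℕ × ℕ × ℕ
    code-rest (_ ∷ _ ∷ _ ∷ _ ∷ e ∷ f ∷ g ∷ h ∷ []) = e , f , g , h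

    module _ {J J′ l l′} (i : (J , l) ∈ ls) (i′ : (J′ , l′) ∈ ls) (keys : key l ≡ key l′) (ne : J ≢ J′) where

      sizes : Names.size S J ≡ Names.size S J′
      sizes = trans (sym (size-correct ls well-labelled i)) (trans (cong proj₁ keys) (size-correct ls well-labelled i′))

      separated : ∀ θ → Bottom J (thread (Name.lo J) ⟨$⟩ʳ θ) → Bottom J′ (thread (Name.lo J′) ⟨$⟩ʳ θ) → ¬ (Name.lo J ≡ Name.lo J′ ⊎ Name.hi J ≡ Name.hi J′)
      separated θ b b′ e with instances-separated r S (names-sound i) (names-sound i′) sizes θ b b′ | e
      ... | inj₁ q | _ = ne q
      ... | inj₂ (inj₁ q) | inj₁ refl = lo≢hi J (≼-antisym (lo-hi J) q)
      ... | inj₂ (inj₂ q) | inj₁ refl = lo≢hi J′ (≼-antisym (lo-hi J′) q)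
      ... | inj₂ (inj₁ q) | inj₂ refl = lo≢hi J′ (≼-antisym (lo-hi J′) q)
      ... | inj₂ (inj₂ q) | inj₂ refl = lo≢hi J (≼-antisym (lo-hi J) q)

      top-distinct : ∀ {z z′} → Top J z → Top J′ z′ → ¬ (Name.hi J ≡ Name.hi J′ × z ≡ z′)
      top-distinct {z} tz tz′ (e , refl) = separated (thread (Name.hi J) ⟨$⟩ˡ z)
        (Node.thread-closedˡ (node J) (subst (Top J) (sym (inverseʳ (thread (Name.hi J)))) tz))
        (Node.thread-closedˡ (node J′) (subst (λ h → Top J′ (thread (Name.hi J′) ⟨$⟩ʳ (thread h ⟨$⟩ˡ z))) (sym e)
          (subst (Top J′) (sym (inverseʳ (thread (Name.hi J′)))) tz′))) (inj₂ e)

      bottom-distinct : ∀ {z z′} → Bottom J z → Bottom J′ z′ → ¬ (Name.lo J ≡ Name.lo J′ × z ≡ z′)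
      bottom-distinct {z} bz bz′ (e , refl) = separated (thread (Name.lo J) ⟨$⟩ˡ z)
        (subst (Bottom J) (sym (inverseʳ (thread (Name.lo J)))) bz)
        (subst (λ h → Bottom J′ (thread (Name.lo J′) ⟨$⟩ʳ (thread h ⟨$⟩ˡ z))) (sym e)
          (subst (Bottom J′) (sym (inverseʳ (thread (Name.lo J′)))) bz′)) (inj₁ e)

      siblings : Attached r S ls J (parentCode l) → Attached r S ls J′ (parentCode l′) → parentCode l ≡ parentCode l′ →
        ∀ {t x t′ x′} → Within S J t x → Within S J′ t′ x′ → Comp t x t′ x′
      siblings (I , a , g , b , sub , o , at′) (I′ , a′ , g′ , b′ , sub′ , o′ , at″) e {t} {x} {t′} {x′} on on′ =
        go (LB.chain-complete w<r² g g′ b (trans (sym (own-key {J} {I} {a} {o} at′)) (trans (cong code-key e) (own-key {J′} {I′} {a′} {o′} at″))) (trans (sym (own-chain {J} {I} {a} {o} at′)) (trans (cong (proj₁ ∘ code-rest) e) (own-chain {J′} {I′} {a′} {o′} at″)))) at′ at″ e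
        where
        Side : Name S → Name S → Label → Origin w m → Vec ℕ 8 → Set
        Side J I a o v = (∃[ z ] ∃[ x ] Top J z × Bottom J x × itemˡ (Name.hi J) z ≡ just (I , o , Name.lo J , x) × v ≡ code a 0 o)
          ⊎ (∃[ z ] ∃[ y ] Bottom J z × Top J y × itemʰ (Name.lo J) z ≡ just (I , o , Name.hi J , y) × v ≡ code a 1 o)
        own-key : ∀ {J I a o v} → Side J I a o v → code-key v ≡ key a
        own-key (inj₁ (_ , _ , _ , _ , _ , refl)) = refl
        own-key (inj₂ (_ , _ , _ , _ , _ , refl)) = refl
        own-chain : ∀ {J I a o v} → Side J I a o v → proj₁ (code-rest v) ≡ chain a
        own-chain (inj₁ (_ , _ , _ , _ , _ , refl)) = refl
        own-chain (inj₂ (_ , _ , _ , _ , _ , refl)) = refl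
        related : Reach J J′ ⊎ Reach J′ J → Comp t x t′ x′
        related (inj₁ q) = complete-comp {J} {J′} on on′ (inj₁ (same-class well-labelled i i′ keys ne q))
        related (inj₂ q) = complete-comp {J} {J′} on on′ (inj₂ (same-class well-labelled i′ i (sym keys) (ne ∘ sym) q))
        same-origin : ∀ {v v′ d d′} → v ≡ code a d o → v′ ≡ code a′ d′ o′ → v ≡ v′ → d ≡ d′ × col o ≡ col o′ × idx o ≡ idx o′
        same-origin refl refl q = let q′ = cong code-rest q in cong (proj₁ ∘ proj₂) q′ , cong (proj₁ ∘ proj₂ ∘ proj₂) q′ , Fin.toℕ-injective (cong (proj₂ ∘ proj₂ ∘ proj₂) q′)
        go : I ≡ I′ ⊎ Complete I I′ ⊎ Complete I′ I → Side J I a o (parentCode l) → Side J′ I′ a′ o′ (parentCode l′) → parentCode l ≡ parentCode l′ → Comp t x t′ x′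
        go (inj₂ c) _ _ _ = complete-comp {I} {I′} (within-inside S {J} {I} sub on) (within-inside S {J′} {I′} sub′ on′) c
        go (inj₁ refl) (inj₁ (z , v , tz , bv , it , q)) (inj₁ (z′ , v′ , tz′ , bv′ , it′ , q′)) e =
          let (_ , ec , ei) = same-origin q q′ e in related (case itemsˡ-comparable r S it it′ ec ei of λ
            { (inj₁ h) → ⊥-elim (top-distinct tz tz′ h)
            ; (inj₂ (inj₁ k)) → inj₁ (z , v′ , tz , bv′ , k)
            ; (inj₂ (inj₂ k)) → inj₂ (z′ , v , tz′ , bv , k) })
        go (inj₁ refl) (inj₂ (z , v , bz , tv , it , q)) (inj₂ (z′ , v′ , bz′ , tv′ , it′ , q′)) e =
          let (_ , ec , ei) = same-origin q q′ e in related (case itemsʰ-comparable r S it it′ ec ei of λ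
            { (inj₁ h) → ⊥-elim (bottom-distinct bz bz′ h)
            ; (inj₂ (inj₁ k)) → inj₂ (v′ , z , tv′ , bz , k)
            ; (inj₂ (inj₂ k)) → inj₁ (v , z′ , tv , bz′ , k) })
        go (inj₁ refl) (inj₁ (_ , _ , _ , _ , _ , q)) (inj₂ (_ , _ , _ , _ , _ , q′)) e = case proj₁ (same-origin q q′ e) of λ ()
        go (inj₁ refl) (inj₂ (_ , _ , _ , _ , _ , q)) (inj₁ (_ , _ , _ , _ , _ , q′)) e = case proj₁ (same-origin q q′ e) of λ ()

    small-small : ∀ {t x t′ x′ c} → SmallPoint t x c → SmallPoint t′ x′ c → Comp t x t′ x′
    small-small {t} {x} {t′} {x′} (J , l , v , i , j , refl) (J′ , l′ , v′ , i′ , j′ , e) with J ≟ᴺᵃ J′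
    ... | yes refl = val-proper j (subst (λ v → (J , (t′ , x′) , v) ∈ smalls) (sym (cong fifth e)) j′)
    ... | no n = siblings i i′ (cong label-key e) n (small-attachment j i) (small-attachment j′ i′) (cong parent-part e)
      (proj₁ (small-within j)) (proj₁ (small-within j′))

  comparable : ∀ {t x t′ x′} → Inserted S t x → Inserted S t′ x′ → colour t ≡ colour t′ → Comp t x t′ x′
  comparable {t} {x} {t′} {x′} h h′ e with described t x h | described t′ x′ h′
  ... | inj₁ a | inj₁ b = big-big h h′ a (subst (BigPoint t′ x′) (sym e) b)
  ... | inj₂ a | inj₂ b = small-small a (subst (SmallPoint t′ x′) (sym e) b)
  ... | inj₁ (_ , _ , _ , _ , _ , _ , _ , _ , q , _) | inj₂ (_ , _ , _ , _ , _ , q′) = case cong Vec.head (trans (sym q) (trans e q′)) of λ ()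
  ... | inj₂ (_ , _ , _ , _ , _ , q′) | inj₁ (_ , _ , _ , _ , _ , _ , _ , _ , q , _) = case cong Vec.head (trans (sym q) (trans (sym e) q′)) of λ ()

  P : ℕ
  P = φ-limit w + 4 * (suc w * suc w)

  limits : Vec ℕ 14
  limits = P ∷ P ∷ P ∷ P ∷ P ∷ k ∷ P ∷ P ∷ P ∷ P ∷ k ∷ P ∷ P ∷ P ∷ []

  private
    below-P : ∀ {n} → n < 4 * (suc w * suc w) → n < P
    below-P h = ℕ.<-≤-trans h (ℕ.m≤n+m _ (φ-limit w))

    small-P : ∀ {n} → n < 4 → n < P
    small-P h = below-P (ℕ.<-≤-trans h (ℕ.m≤m*n 4 (suc w * suc w)))

    w≤square : w ≤ suc w * suc w
    w≤square = ℕ.≤-trans (ℕ.n≤1+n w) (ℕ.m≤m*n (suc w) (suc w))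

    square<four : ∀ {n} → n ≤ suc w * suc w → n < 4 * (suc w * suc w)
    square<four h = ℕ.≤-<-trans h (ℕ.m<m+n (suc w * suc w) (ℕ.≤-trans (s≤s z≤n) (ℕ.m≤m+n (suc w * suc w) _)))

    double<four : ∀ {n} → n ≤ suc w * suc w + suc w * suc w → n < 4 * (suc w * suc w)
    double<four {n} h = ℕ.≤-<-trans h (subst (suc w * suc w + suc w * suc w <_) (ℕ.+-assoc (suc w * suc w) (suc w * suc w) _)
      (ℕ.m<m+n (suc w * suc w + suc w * suc w) (ℕ.≤-trans (s≤s z≤n) (ℕ.m≤m+n (suc w * suc w) _))))

    col-P : ∀ {n} → n ≤ suc (suc (w * w) + suc (w * w)) → n < P
    col-P h = below-P (double<four (ℕ.≤-trans h (ℕ.+-mono-≤ step (ℕ.<⇒≤ step))))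
      where
      step : suc (w * w) < suc w * suc w
      step = s≤s (s≤s (ℕ.≤-trans (ℕ.*-monoʳ-≤ w (ℕ.n≤1+n w)) (ℕ.m≤n+m (w * suc w) _)))

    idx-P : (x : Fin w) → toℕ x < P
    idx-P x = below-P (square<four (ℕ.≤-trans (ℕ.<⇒≤ (Fin.toℕ<n x)) w≤square))

    size-P : ∀ {N l} → (N , l) ∈ ls → size l < P
    size-P {N} i = below-P (square<four (ℕ.≤-trans (ℕ.≤-reflexive (size-correct ls well-labelled i))
      (ℕ.≤-trans (inj-Fin id (Components.members-unique S (Name.lo N) (Name.hi N) (Name.root N)) (λ _ _ → id)) w≤square)))

    φ₁-P : ∀ {N l} → (N , l) ∈ ls → φ₁ l < P
    φ₁-P i = ℕ.<-≤-trans (LB.φ₁-bound i) (ℕ.m≤m+n _ _)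

    φ₂-P : ∀ {N l} → (N , l) ∈ ls → φ₂ l < P
    φ₂-P i = ℕ.<-≤-trans (LB.φ₂-bound i) (ℕ.m≤m+n _ _)

    φ₃-P : ∀ {N l} → (N , l) ∈ ls → φ₃ l < P
    φ₃-P i = below-P (double<four (LB.φ₃-bound i))

    coloured-P : ∀ {Start : Set} {I c} {ℓ : Fin m} → (Start × c ≡ 0) ⊎ Split I ℓ c → c < P
    coloured-P (inj₁ (_ , refl)) = small-P (s≤s z≤n)
    coloured-P (inj₂ sp) = col-P (small sp)

    itemˡ-P : ∀ {t z I o p x} → itemˡ t z ≡ just (I , o , p , x) → col o < P
    itemˡ-P i = coloured-P (proj₁ (proj₂ (proj₂ (proj₂ (Zones.attached zonesˡ i)))))

    itemʰ-P : ∀ {t z I o p x} → itemʰ t z ≡ just (I , o , p , x) → col o < P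
    itemʰ-P i = coloured-P (proj₁ (proj₂ (proj₂ (proj₂ (Zones.attached zonesʰ i)))))

    kind-P : ∀ {I t x type a b} → Kind I t x type a b → type < P × a < P × b < P
    kind-P (inj₁ (refl , refl , sp)) = small-P (s≤s z≤n) , col-P (small sp) , small-P (s≤s z≤n)
    kind-P (inj₂ (inj₁ (refl , o , _ , _ , i , refl , refl))) = small-P (s≤s (s≤s z≤n)) , itemˡ-P i , idx-P (idx o)
    kind-P (inj₂ (inj₂ (refl , o , _ , _ , i , refl , refl))) = small-P (s≤s (s≤s (s≤s z≤n))) , itemʰ-P i , idx-P (idx o)

    zero-P : 0 < P
    zero-P = small-P (s≤s z≤n)

    big-limits : ∀ {t x c} → BigPoint t x c → Pointwise _<_ c limits
    big-limits (I , l , i , b , _ , type , a , d , refl , kd) = let (p , q , s) = kind-P kd ; ch = LB.chain-bound w<r² i b in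
      zero-P ∷ size-P i ∷ φ₁-P i ∷ φ₂-P i ∷ φ₃-P i ∷ ch ∷ p ∷ q ∷ s ∷ zero-P ∷ ℕ.≤-trans (s≤s z≤n) ch ∷ zero-P ∷ zero-P ∷ zero-P ∷ []

    code-limits : ∀ {I a side} {o : Origin w m} → (I , a) ∈ ls → r < Names.size S I → side < 4 → col o < P →
      Pointwise _<_ (code a side o) (P ∷ P ∷ P ∷ P ∷ k ∷ P ∷ P ∷ P ∷ [])
    code-limits {o = o} g b h c = size-P g ∷ φ₁-P g ∷ φ₂-P g ∷ φ₃-P g ∷ LB.chain-bound w<r² g b ∷ small-P h ∷ c ∷ idx-P (idx o) ∷ []

    parent-limits : ∀ {J v} → Attached r S ls J v → Pointwise _<_ v (P ∷ P ∷ P ∷ P ∷ k ∷ P ∷ P ∷ P ∷ [])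
    parent-limits (I , a , g , b , _ , o , inj₁ (_ , _ , _ , _ , it , refl)) = code-limits {I} {a} {0} {o} g b (s≤s z≤n) (itemˡ-P it)
    parent-limits (I , a , g , b , _ , o , inj₂ (_ , _ , _ , _ , it , refl)) = code-limits {I} {a} {1} {o} g b (s≤s (s≤s z≤n)) (itemʰ-P it)

    small-limits : ∀ {t x c} → SmallPoint t x c → Pointwise _<_ c limits
    small-limits (J , l , v , i , j , refl) = small-P (s≤s (s≤s z≤n)) ∷ size-P i ∷ φ₁-P i ∷ φ₂-P i ∷ φ₃-P i
      ∷ Vals.keyed-bounded smalls vals-consistent J (vals-transitive J) (vals-width J (proj₂ (small-within j))) j refl ∷ parent-limits {J} (small-attachment j i)

  colour-limits : ∀ {t x} → Inserted S t x → Pointwise _<_ (colour t) limits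
  colour-limits {t} {x} h = [ big-limits , small-limits ]′ (described t x h)

-- Matchings between antichains of maximum size

card-∪-∩ : ∀ {n} (p q : Subset n) → ∣ p Sub.∪ q ∣ + ∣ p Sub.∩ q ∣ ≡ ∣ p ∣ + ∣ q ∣
card-∪-∩ [] [] = refl
card-∪-∩ (true ∷ p) (true ∷ q) = trans (cong suc (ℕ.+-suc _ _)) (trans (cong (λ k → suc (suc k)) (card-∪-∩ p q)) (cong suc (sym (ℕ.+-suc _ _))))
card-∪-∩ (true ∷ p) (false ∷ q) = cong suc (card-∪-∩ p q)
card-∪-∩ (false ∷ p) (true ∷ q) = trans (cong suc (card-∪-∩ p q)) (sym (ℕ.+-suc _ _))
card-∪-∩ (false ∷ p) (false ∷ q) = card-∪-∩ p q

without : ∀ {n} → Subset n → Fin n → Subset n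
without (_ ∷ p) zero = outside ∷ p
without (b ∷ p) (suc i) = b ∷ without p i

card-without : ∀ {n} (p : Subset n) i → ∣ p ∣ ≤ suc ∣ without p i ∣
card-without (true ∷ p) zero = ℕ.≤-refl
card-without (false ∷ p) zero = ℕ.n≤1+n _
card-without (true ∷ p) (suc i) = s≤s (card-without p i)
card-without (false ∷ p) (suc i) = card-without p i

∈-without⁻ : ∀ {n} (p : Subset n) i {x} → x Sub.∈ without p i → x Sub.∈ p × x ≢ i
∈-without⁻ (_ ∷ p) zero (Vec.there h) = Vec.there h , λ ()
∈-without⁻ (_ ∷ p) (suc i) Vec.here = Vec.here , λ ()
∈-without⁻ (_ ∷ p) (suc i) (Vec.there h) = let (a , b) = ∈-without⁻ p i h in Vec.there a , b ∘ Fin.suc-injective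

elements : ∀ {n} → Subset n → List (Fin n)
elements [] = []
elements (true ∷ p) = zero ∷ map suc (elements p)
elements (false ∷ p) = map suc (elements p)

length-elements : ∀ {n} (p : Subset n) → length (elements p) ≡ ∣ p ∣
length-elements [] = refl
length-elements (true ∷ p) = cong suc (trans (length-map suc (elements p)) (length-elements p))
length-elements (false ∷ p) = trans (length-map suc (elements p)) (length-elements p)

elements-∈ : ∀ {n} (p : Subset n) {x} → x ∈ elements p → x Sub.∈ p
elements-∈ (true ∷ p) (here refl) = Vec.here
elements-∈ (true ∷ p) (there h) with y , i , refl ← ∈-map⁻ suc h = Vec.there (elements-∈ p i)
elements-∈ (false ∷ p) h with y , i , refl ← ∈-map⁻ suc h = Vec.there (elements-∈ p i)

elements-unique : ∀ {n} (p : Subset n) → Unique (elements p)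
elements-unique [] = []
elements-unique (true ∷ p) = All.tabulate (λ h e → case ∈-map⁻ suc h of λ { (_ , _ , q) → case trans e q of λ () }) ∷ Unique.map⁺ Fin.suc-injective (elements-unique p)
elements-unique (false ∷ p) = Unique.map⁺ Fin.suc-injective (elements-unique p)

Saturated Deficient : ∀ {n m} → (Fin n → Fin m → Set) → Subset m → Set
Saturated {n} {m} R cols = Σ[ f ∈ (Fin n → Fin m) ] (∀ {i j} → f i ≡ f j → i ≡ j) × (∀ i → R i (f i) × f i Sub.∈ cols)
Deficient {n} {m} R cols = Σ[ X ∈ Subset n ] Σ[ Y ∈ Subset m ] Y Sub.⊆ cols × (∀ {x y} → x Sub.∈ X → y Sub.∈ Y → ¬ R x y) × ∣ cols ∣ < ∣ X ∣ + ∣ Y ∣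

-- If row zero can be matched to none of its columns y, the deficient pairs found without y combine, by submodularity.
hall : ∀ n {m} {R : Fin n → Fin m → Set} → (∀ i j → Dec (R i j)) → (cols : Subset m) → Saturated R cols ⊎ Deficient R cols
hall zero R? cols = inj₁ ((λ ()) , (λ { {()} }) , λ ())
hall (suc n) {m} {R} R? cols = loop (filter candidate? (allFin m)) (λ h → proj₂ (∈-filter⁻ candidate? {xs = allFin m} h)) Sub.⊥ cols id
    (λ h → ⊥-elim (Sub.∉⊥ h)) (ℕ.m≤n+m _ _) λ {y} r y∈ _ → ∈-filter⁺ candidate? (∈-allFin y) (r , y∈)
  where
  candidate? : ∀ y → Dec (R zero y × y Sub.∈ cols)
  candidate? y = R? zero y ×-dec (y Sub.∈? cols)
  balance : ∀ {c x y x₂ y₂ xu xi yu yi} → xu + xi ≡ x + x₂ → yu + yi ≡ y + y₂ → c ≤ x + y → c ≤ x₂ + y₂ → ¬ c < xi + yu → c ≤ xu + yi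
  balance {c} {x} {y} {x₂} {y₂} {xu} {xi} {yu} {yi} e e′ h h₂ n with c ℕ.≤? xu + yi
  ... | yes q = q
  ... | no q = ⊥-elim (ℕ.<-irrefl refl (begin-strict
      c + c ≤⟨ ℕ.+-mono-≤ h h₂ ⟩
      (x + y) + (x₂ + y₂) ≡⟨ shuffle x y x₂ y₂ ⟩
      (x + x₂) + (y + y₂) ≡⟨ cong₂ _+_ e e′ ⟨
      (xu + xi) + (yu + yi) ≡⟨ shuffle′ xu xi yu yi ⟩
      (xu + yi) + (xi + yu) <⟨ ℕ.+-mono-<-≤ (ℕ.≰⇒> q) (ℕ.≮⇒≥ n) ⟩
      c + c ∎))
    where
    open ℕ.≤-Reasoning
    shuffle : ∀ a b c d → (a + b) + (c + d) ≡ (a + c) + (b + d)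
    shuffle = solve-∀
    shuffle′ : ∀ a b c d → (a + b) + (c + d) ≡ (a + d) + (b + c)
    shuffle′ = solve-∀
  loop : ∀ ys → (∀ {y} → y ∈ ys → R zero y × y Sub.∈ cols) → ∀ X Y → Y Sub.⊆ cols → (∀ {x y} → x Sub.∈ X → y Sub.∈ Y → ¬ R (suc x) y) →
    ∣ cols ∣ ≤ ∣ X ∣ + ∣ Y ∣ → (∀ {y} → R zero y → y Sub.∈ cols → y Sub.∈ Y → y ∈ ys) → Saturated R cols ⊎ Deficient R cols
  loop [] cand X Y sub indep le cov = inj₂ (inside ∷ X , Y , sub ,
    (λ { {zero} _ y∈ q → case cov q (sub y∈) y∈ of λ () ; {suc x} (Vec.there x∈) y∈ → indep x∈ y∈ }) , s≤s le)
  loop (y ∷ ys) cand X Y sub indep le cov with hall n (λ i → R? (suc i)) (without cols y)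
  ... | inj₁ (f , inj , ok) = inj₁ (g , g-inj , λ { zero → cand (here refl) ; (suc i) → proj₁ (ok i) , proj₁ (∈-without⁻ cols y (proj₂ (ok i))) })
    where
    g : Fin (suc n) → Fin m
    g zero = y
    g (suc i) = f i
    g-inj : ∀ {i j} → g i ≡ g j → i ≡ j
    g-inj {zero} {zero} e = refl
    g-inj {zero} {suc j} e = ⊥-elim (proj₂ (∈-without⁻ cols y (proj₂ (ok j))) (sym e))
    g-inj {suc i} {zero} e = ⊥-elim (proj₂ (∈-without⁻ cols y (proj₂ (ok i))) e)
    g-inj {suc i} {suc j} e = cong suc (inj e)
  ... | inj₂ (X₂ , Y₂ , sub₂ , indep₂ , lt) with ∣ cols ∣ ℕ.<? ∣ X Sub.∩ X₂ ∣ + ∣ Y Sub.∪ Y₂ ∣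
  ...   | yes big = inj₂ (outside ∷ (X Sub.∩ X₂) , Y Sub.∪ Y₂ ,
      (λ h → [ sub , (λ h₂ → proj₁ (∈-without⁻ cols y (sub₂ h₂))) ]′ (Sub.x∈p∪q⁻ Y Y₂ h)) ,
      (λ { {suc x} (Vec.there x∈) y∈ → let (a , b) = Sub.x∈p∩q⁻ X X₂ x∈ in [ indep a , indep₂ b ]′ (Sub.x∈p∪q⁻ Y Y₂ y∈) }) , big)
  ...   | no small = loop ys (cand ∘ there) (X Sub.∪ X₂) (Y Sub.∩ Y₂) (λ h → sub (proj₁ (Sub.x∈p∩q⁻ Y Y₂ h)))
      (λ x∈ y∈ → let (a , b) = Sub.x∈p∩q⁻ Y Y₂ y∈ in [ (λ h → indep h a) , (λ h → indep₂ h b) ]′ (Sub.x∈p∪q⁻ X X₂ x∈))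
      (balance {x = ∣ X ∣} {y = ∣ Y ∣} {xu = ∣ X Sub.∪ X₂ ∣} (card-∪-∩ X X₂) (card-∪-∩ Y Y₂) le (ℕ.≤-trans (card-without cols y) lt) small)
      λ q c∈ y∈ → let (a , b) = Sub.x∈p∩q⁻ Y Y₂ y∈ in case cov q c∈ a of λ
        { (here refl) → ⊥-elim (proj₂ (∈-without⁻ cols y (sub₂ b)) refl) ; (there h) → h }

module Antichains {E : Set} (_⊑_ : E → E → Set) (_⊑?_ : ∀ a b → Dec (a ⊑ b)) (⊑-refl : ∀ {a} → a ⊑ a) (⊑-trans : ∀ {a b c} → a ⊑ b → b ⊑ c → a ⊑ c)
  (⊑-antisym : ∀ {a b} → a ⊑ b → b ⊑ a → a ≡ b) (w : ℕ)
  (width : ∀ es → AllPairs (λ a b → ¬ a ⊑ b × ¬ b ⊑ a) es → length es ≤ w) where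

  Antichain : (Fin w → E) → Set
  Antichain a = ∀ {i j} → a i ⊑ a j → i ≡ j

  Injective : (Fin w → Fin w) → Set
  Injective f = ∀ {i j} → f i ≡ f j → i ≡ j

  comparability-matching : ∀ {a b} → Antichain a → Antichain b → ∃[ f ] Injective f × (∀ i → a i ⊑ b (f i) ⊎ b (f i) ⊑ a i)
  comparability-matching {a} {b} anti-a anti-b with hall w (λ i j → (a i ⊑? b j) ⊎-dec (b j ⊑? a i)) Sub.⊤
  ... | inj₁ (f , inj , ok) = f , inj , proj₁ ∘ ok
  ... | inj₂ (X , Y , _ , indep , lt) = ⊥-elim (ℕ.<-irrefl refl (ℕ.<-≤-trans (subst (_< ∣ X ∣ + ∣ Y ∣) (Sub.∣⊤∣≡n w) lt)
      (subst (_≤ w) total (width (map a (elements X) ++ map b (elements Y)) (AllPairs.++⁺ (pairs anti-a X) (pairs anti-b Y)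
        (All.map⁺ (All.tabulate λ x∈ → All.map⁺ (All.tabulate λ y∈ → (λ l → indep (elements-∈ X x∈) (elements-∈ Y y∈) (inj₁ l)) ,
          (λ l → indep (elements-∈ X x∈) (elements-∈ Y y∈) (inj₂ l))))))))))
    where
    total : length (map a (elements X) ++ map b (elements Y)) ≡ ∣ X ∣ + ∣ Y ∣
    total = trans (length-++ (map a (elements X))) (cong₂ _+_ (trans (length-map a (elements X)) (length-elements X)) (trans (length-map b (elements Y)) (length-elements Y)))
    pairs : ∀ {a} → Antichain a → ∀ X → AllPairs (λ a b → ¬ a ⊑ b × ¬ b ⊑ a) (map a (elements X))
    pairs anti X = AllPairs.map⁺ (AllPairs.map (λ n → n ∘ anti , n ∘ sym ∘ anti) (elements-unique X))

  directed-matching : ∀ {a b} → Antichain a → Antichain b → (∀ i → ∃[ j ] a j ⊑ b i) → ∃[ f ] Injective f × (∀ i → a i ⊑ b (f i))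
  directed-matching {a} {b} anti-a anti-b above = let (f , inj , c) = comparability-matching anti-a anti-b in f , inj , λ i → direct i (f i) (c i)
    where
    direct : ∀ i k → a i ⊑ b k ⊎ b k ⊑ a i → a i ⊑ b k
    direct i k (inj₁ l) = l
    direct i k (inj₂ l) with j , h ← above k with refl ← anti-a (⊑-trans h l) = h

  directed-matchingᵘ : ∀ {a b} → Antichain a → Antichain b → (∀ i → ∃[ j ] a i ⊑ b j) → ∃[ f ] Injective f × (∀ i → a i ⊑ b (f i))
  directed-matchingᵘ {a} {b} anti-a anti-b above = let (f , inj , c) = comparability-matching anti-a anti-b in f , inj , λ i → direct i (f i) (c i)
    where
    direct : ∀ i k → a i ⊑ b k ⊎ b k ⊑ a i → a i ⊑ b k
    direct i k (inj₁ l) = l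
    direct i k (inj₂ l) with j , h ← above i with refl ← anti-b (⊑-trans l h) = h

  join : ∀ {a b} → Antichain a → Antichain b →
    ∃[ c ] Antichain c × (∀ i → ∃[ j ] b j ⊑ c i) × (∀ i → c i ≡ a i ⊎ ∃[ j ] c i ≡ b j × a i ⊑ b j)
  join {a} {b} anti-a anti-b with f , inj , cmp ← comparability-matching anti-a anti-b =
    (λ i → pick i (cmp i)) , (λ {i} {j} → anti (cmp i) (cmp j)) , (λ i → f i , above i (cmp i)) , λ i → origin-of i (cmp i)
    where
    pick : ∀ i → a i ⊑ b (f i) ⊎ b (f i) ⊑ a i → E
    pick i (inj₁ _) = b (f i)
    pick i (inj₂ _) = a i
    anti : ∀ {i j} (p : a i ⊑ b (f i) ⊎ b (f i) ⊑ a i) (q : a j ⊑ b (f j) ⊎ b (f j) ⊑ a j) → pick i p ⊑ pick j q → i ≡ j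
    anti (inj₁ _) (inj₁ _) l = inj (anti-b l)
    anti (inj₁ h) (inj₂ _) l = anti-a (⊑-trans h l)
    anti (inj₂ h) (inj₁ _) l = inj (anti-b (⊑-trans h l))
    anti (inj₂ _) (inj₂ _) l = anti-a l
    above : ∀ i p → b (f i) ⊑ pick i p
    above i (inj₁ _) = ⊑-refl
    above i (inj₂ h) = h
    origin-of : ∀ i p → pick i p ≡ a i ⊎ ∃[ j ] pick i p ≡ b j × a i ⊑ b j
    origin-of i (inj₁ h) = inj₂ (f i , refl , h)
    origin-of i (inj₂ _) = inj₁ refl

  join-keeps : ∀ {a b c : Fin w → E} {i j} → Antichain b → c i ≡ a i ⊎ ∃[ k ] c i ≡ b k × a i ⊑ b k → b j ⊑ a i → c i ≡ a i
  join-keeps anti-b (inj₁ e) h = e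
  join-keeps {c = c} anti-b (inj₂ (k , e , l)) h with refl ← anti-b (⊑-trans h l) = trans e (⊑-antisym h l)

any-Vec? : ∀ {w} n {P : Vec (Fin w) n → Set} → (∀ v → Dec (P v)) → Dec (∃ P)
any-Vec? zero P? = map′ (λ p → [] , p) (λ { ([] , p) → p }) (P? [])
any-Vec? (suc n) P? = map′ (λ (x , v , p) → x ∷ v , p) (λ { (x ∷ v , p) → x , v , p }) (Fin.any? λ x → any-Vec? n λ v → P? (x ∷ v))

injective⇒permutation : ∀ {n} (f : Fin n → Fin n) → (∀ {i j} → f i ≡ f j → i ≡ j) → ∃[ π ] ∀ i → π ⟨$⟩ʳ i ≡ f i
injective⇒permutation {n} f inj = permutation f (proj₁ ∘ onto) (proj₂ ∘ onto) (λ i → inj (proj₂ (onto (f i)))) , λ _ → refl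
  where
  onto : ∀ y → ∃[ x ] f x ≡ y
  onto y with Fin.any? (λ x → f x Fin.≟ y)
  ... | yes q = q
  ... | no q with zs , e , h ← remove-∈ (∈-allFin y) = ⊥-elim (ℕ.<-irrefl refl (ℕ.≤-trans (ℕ.≤-reflexive (sym e))
    (inj-length f {allFin n} zs (Unique-allFin n) (λ _ _ → inj) λ {x} _ → h (λ r → q (x , r)) (∈-allFin (f x)))))

-- Reducing width w to width w ∸ 1 and a growing system of maximum antichains

volume : ∀ {n} → Vec ℕ n → ℕ
volume [] = 1
volume (b ∷ bs) = b * volume bs

encode : ∀ {n} → Vec ℕ n → Vec ℕ n → ℕ
encode [] [] = 0
encode (x ∷ xs) (b ∷ bs) = x + b * encode xs bs

private
  digit-< : ∀ {x b e f} → x < b → e < f → x + b * e < b * f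
  digit-< {x} {b} {e} {f} h l = ℕ.<-≤-trans (ℕ.+-monoˡ-< (b * e) h) (ℕ.≤-trans (ℕ.≤-reflexive (sym (ℕ.*-suc b e))) (ℕ.*-monoʳ-≤ b l))

encode-< : ∀ {n} {xs bs : Vec ℕ n} → Pointwise _<_ xs bs → encode xs bs < volume bs
encode-< [] = s≤s z≤n
encode-< (h ∷ hs) = digit-< h (encode-< hs)

encode-injective : ∀ {n} {xs ys bs : Vec ℕ n} → Pointwise _<_ xs bs → Pointwise _<_ ys bs → encode xs bs ≡ encode ys bs → xs ≡ ys
encode-injective [] [] _ = refl
encode-injective {xs = x ∷ xs} {y ∷ ys} {b ∷ bs} (h ∷ hs) (k ∷ ks) e = finish (encode-injective hs ks tails)
  where
  apart : ∀ {x y e f} → x < b → e < f → x + b * e ≢ y + b * f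
  apart {y = y} h l q = ℕ.<-irrefl q (ℕ.<-≤-trans (digit-< h l) (ℕ.m≤n+m _ y))
  tails : encode xs bs ≡ encode ys bs
  tails with ℕ.<-cmp (encode xs bs) (encode ys bs)
  ... | tri< l _ _ = ⊥-elim (apart h l e)
  ... | tri≈ _ q _ = q
  ... | tri> _ _ l = ⊥-elim (apart k l (sym e))
  finish : xs ≡ ys → x ∷ xs ≡ y ∷ ys
  finish refl = cong (_∷ xs) (ℕ.+-cancelʳ-≡ (b * encode xs bs) x y e)

Incomparable-sym : ∀ D {i j} → Incomparable D i j → Incomparable D j i
Incomparable-sym D (n , a , b) = n ∘ sym , b , a

Incomparable? : ∀ D i j → Dec (Incomparable D i j)
Incomparable? D i j = ¬? (i Fin.≟ j) ×-dec ¬? (T? (less D i j)) ×-dec ¬? (T? (less D j i))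

pairs-at : {A : Set} {R : A → A → Set} → (∀ {x y} → R x y → R y x) → ∀ {xs} → AllPairs R xs → ∀ {i j} → i ≢ j → R (List.lookup xs i) (List.lookup xs j)
pairs-at s (p ∷ ps) {zero} {zero} n = ⊥-elim (n refl)
pairs-at s (p ∷ ps) {zero} {suc j} n = All.lookup p (∈-lookup j)
pairs-at s (p ∷ ps) {suc i} {zero} n = s (All.lookup p (∈-lookup i))
pairs-at s (p ∷ ps) {suc i} {suc j} n = pairs-at s ps (n ∘ cong suc)

module _ (D : Presentation) (Q : Fin (length D) → Set) where

  Extends : ℕ → List (Fin (length D)) → Set
  Extends zero ys = ⊤
  Extends (suc k) ys = ∃[ x ] Q x × All (Incomparable D x) ys × Extends k (x ∷ ys)

  extends? : (∀ x → Dec (Q x)) → ∀ k ys → Dec (Extends k ys)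
  extends? Q? zero ys = yes tt
  extends? Q? (suc k) ys = Fin.any? λ x → Q? x ×-dec All.all? (Incomparable? D x) ys ×-dec extends? Q? k (x ∷ ys)

  extends⇒list : ∀ k {ys} → Extends k ys → AllPairs (Incomparable D) ys →
    ∃[ xs ] length xs ≡ k + length ys × AllPairs (Incomparable D) xs × (∀ {y} → y ∈ ys → y ∈ xs)
  extends⇒list zero _ ps = _ , refl , ps , id
  extends⇒list (suc k) (x , _ , a , e) ps with xs , l , qs , sub ← extends⇒list k e (a ∷ ps) = xs , trans l (ℕ.+-suc k _) , qs , sub ∘ there

  list⇒extends : ∀ zs → (∀ {z} → z ∈ zs → Q z) → AllPairs (Incomparable D) zs → ∀ ys → (∀ {z} → z ∈ zs → All (Incomparable D z) ys) →
    ∀ k → k ≤ length zs → Extends k ys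
  list⇒extends zs q ps ys h zero l = tt
  list⇒extends (z ∷ zs) q (p ∷ ps) ys h (suc k) (s≤s l) = z , q (here refl) , h (here refl) ,
    list⇒extends zs (q ∘ there) ps (z ∷ ys) (λ i → Incomparable-sym D (All.lookup p i) ∷ h (there i)) k l

Valid : ℕ → Presentation → Set
Valid w D = Transitive D × WidthAtMost w D

opaque
  Valid? : ∀ w D → Dec (Valid w D)
  Valid? w D = (Fin.all? λ i → Fin.all? λ j → Fin.all? λ k → T? (less D i j) →-dec T? (less D j k) →-dec T? (less D i k))
    ×-dec map′ (λ n xs ps → ℕ.≮⇒≥ λ l → n (list⇒extends D (λ _ → ⊤) xs (λ _ → tt) ps [] (λ _ → []) (suc w) l))
      (λ h e → let (xs , l , ps , _) = extends⇒list D (λ _ → ⊤) (suc w) e [] in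
        ℕ.<-irrefl refl (subst (_≤ w) (trans l (ℕ.+-identityʳ (suc w))) (h xs ps)))
      (¬? (extends? D (λ _ → ⊤) (λ _ → yes tt) (suc w) []))

valid-tail : ∀ {w ρ D} → Valid w (ρ ∷ D) → Valid w D
valid-tail {w} {ρ} {D} (t , h) = (λ i j k → t (suc i) (suc j) (suc k)) , λ xs ps → subst (_≤ w) (length-map suc xs)
  (h (map suc xs) (AllPairs.map⁺ (AllPairs.map (λ (n , a , b) → n ∘ Fin.suc-injective , a , b) ps)))

-- A presented order with w new minimal and w new maximal elements.
data Element (w n : ℕ) : Set where
  bot top : Fin w → Element w n
  el : Fin n → Element w n

module ElementOrder (w : ℕ) (D : Presentation) where

  infix 4 _⊑_
  _⊑_ : Element w (length D) → Element w (length D) → Set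
  bot i ⊑ bot j = i ≡ j
  bot _ ⊑ _ = ⊤
  el x ⊑ bot _ = ⊥
  el x ⊑ el y = x ≡ y ⊎ Less D x y
  el x ⊑ top _ = ⊤
  top i ⊑ top j = i ≡ j
  top _ ⊑ _ = ⊥

  _⊑?_ : ∀ a b → Dec (a ⊑ b)
  bot i ⊑? bot j = i Fin.≟ j
  bot _ ⊑? el _ = yes tt
  bot _ ⊑? top _ = yes tt
  el x ⊑? bot _ = no id
  el x ⊑? el y = (x Fin.≟ y) ⊎-dec T? (less D x y)
  el x ⊑? top _ = yes tt
  top i ⊑? top j = i Fin.≟ j
  top _ ⊑? bot _ = no id
  top _ ⊑? el _ = no id

  ⊑-refl : ∀ {a} → a ⊑ a
  ⊑-refl {bot _} = refl
  ⊑-refl {top _} = refl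
  ⊑-refl {el _} = inj₁ refl

  module _ (tr : Transitive D) where

    ⊑-trans : ∀ {a b c} → a ⊑ b → b ⊑ c → a ⊑ c
    ⊑-trans {bot _} {bot _} refl q = q
    ⊑-trans {bot _} {el _} {el _} p q = tt
    ⊑-trans {bot _} {el _} {top _} p q = tt
    ⊑-trans {bot _} {top _} {top _} p q = tt
    ⊑-trans {el _} {el _} {el _} (inj₁ refl) q = q
    ⊑-trans {el _} {el _} {el _} (inj₂ p) (inj₁ refl) = inj₂ p
    ⊑-trans {el _} {el _} {el _} (inj₂ p) (inj₂ q) = inj₂ (tr _ _ _ p q)
    ⊑-trans {el _} {el _} {top _} p q = tt
    ⊑-trans {el _} {top _} {top _} p q = tt
    ⊑-trans {top _} {top _} {top _} refl q = q

    ⊑-antisym : ∀ {a b} → a ⊑ b → b ⊑ a → a ≡ b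
    ⊑-antisym {bot _} {bot _} refl q = refl
    ⊑-antisym {top _} {top _} refl q = refl
    ⊑-antisym {el _} {el _} (inj₁ refl) q = refl
    ⊑-antisym {el _} {el _} (inj₂ p) (inj₁ refl) = refl
    ⊑-antisym {el _} {el _} (inj₂ p) (inj₂ q) = ⊥-elim (less-irrefl D _ (tr _ _ _ p q))

  Apart : Element w (length D) → Element w (length D) → Set
  Apart a b = ¬ a ⊑ b × ¬ b ⊑ a

  private
    all-bot : ∀ {i es} → All (Apart (bot i)) es → ∃[ is ] es ≡ map bot is
    all-bot [] = [] , refl
    all-bot {es = bot j ∷ _} (_ ∷ ps) with is , refl ← all-bot ps = j ∷ is , refl
    all-bot {es = top j ∷ _} ((n , _) ∷ ps) = ⊥-elim (n tt)
    all-bot {es = el j ∷ _} ((n , _) ∷ ps) = ⊥-elim (n tt)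

    all-top : ∀ {i es} → All (Apart (top i)) es → ∃[ is ] es ≡ map top is
    all-top [] = [] , refl
    all-top {es = top j ∷ _} (_ ∷ ps) with is , refl ← all-top ps = j ∷ is , refl
    all-top {es = bot j ∷ _} ((_ , n) ∷ ps) = ⊥-elim (n tt)
    all-top {es = el j ∷ _} ((_ , n) ∷ ps) = ⊥-elim (n tt)

    all-el : ∀ {x es} → All (Apart (el x)) es → ∃[ xs ] es ≡ map el xs
    all-el [] = [] , refl
    all-el {es = el y ∷ _} (_ ∷ ps) with xs , refl ← all-el ps = y ∷ xs , refl
    all-el {es = bot j ∷ _} ((_ , n) ∷ ps) = ⊥-elim (n tt)
    all-el {es = top j ∷ _} ((n , _) ∷ ps) = ⊥-elim (n tt)

    few : ∀ (f : Fin w → Element w (length D)) is → AllPairs Apart (map f is) → length (map f is) ≤ w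
    few f is ps = subst (_≤ w) (sym (length-map f is)) (inj-Fin id (AllPairs.map (λ { (n , _) refl → n ⊑-refl }) (AllPairs.map⁻ ps)) (λ _ _ → id))

  element-width : WidthAtMost w D → ∀ es → AllPairs Apart es → length es ≤ w
  element-width h [] _ = z≤n
  element-width h (bot i ∷ es) (p ∷ ps) with is , refl ← all-bot p = few bot (i ∷ is) (p ∷ ps)
  element-width h (top i ∷ es) (p ∷ ps) with is , refl ← all-top p = few top (i ∷ is) (p ∷ ps)
  element-width h (el x ∷ es) (p ∷ ps) with xs , refl ← all-el p = subst (_≤ w) (sym (length-map el (x ∷ xs)))
    (h (x ∷ xs) (AllPairs.map (λ (a , b) → a ∘ inj₁ , a ∘ inj₂ , b ∘ inj₂) (AllPairs.map⁻ (p ∷ ps))))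

-- The core between two antichains: the union of all perfect matchings upwards.
module Core {E : Set} (_⊑_ : E → E → Set) (_⊑?_ : ∀ a b → Dec (a ⊑ b)) {w : ℕ} (a b : Fin w → E) where

  Core : Fin w → Fin w → Set
  Core x z = ∃[ v ] (∀ i j → Vec.lookup v i ≡ Vec.lookup v j → i ≡ j) × (∀ i → a i ⊑ b (Vec.lookup v i)) × Vec.lookup v x ≡ z

  opaque
    core? : ∀ x z → Dec (Core x z)
    core? x z = any-Vec? w λ v → (Fin.all? λ i → Fin.all? λ j → (Vec.lookup v i Fin.≟ Vec.lookup v j) →-dec (i Fin.≟ j))
      ×-dec (Fin.all? λ i → a i ⊑? b (Vec.lookup v i)) ×-dec (Vec.lookup v x Fin.≟ z)

  core : (f : Fin w → Fin w) → (∀ {i j} → f i ≡ f j → i ≡ j) → (∀ i → a i ⊑ b (f i)) → ∀ x → Core x (f x)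
  core f inj ok x = Vec.tabulate f , (λ i j e → inj (trans (sym (Vec.lookup∘tabulate f i)) (trans e (Vec.lookup∘tabulate f j)))) ,
    (λ i → subst (λ j → a i ⊑ b j) (sym (Vec.lookup∘tabulate f i)) (ok i)) , Vec.lookup∘tabulate f x

  core-⊑ : ∀ {x z} → Core x z → a x ⊑ b z
  core-⊑ (v , _ , ok , refl) = ok _

  core-link : (f : Fin w → Fin w) → (∀ {i j} → f i ≡ f j → i ≡ j) → (∀ i → a i ⊑ b (f i)) → Link w
  core-link f inj ok = record
    { edge? = λ x z → does (core? x z) ; main = proj₁ π
    ; main-edge = λ x → does⁺ (core? x _) (subst (Core x) (sym (proj₂ π x)) (core f inj ok x))
    ; extend = λ {x} {z} e → extension (does⁻ (core? x z) e) }
    where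
    π = injective⇒permutation f inj
    extension : ∀ {x z} → Core x z → ∃[ π ] (∀ v → T (does (core? v (π ⟨$⟩ʳ v)))) × π ⟨$⟩ʳ x ≡ z
    extension {x} (v , inj , ok , e) = let (π , h) = injective⇒permutation (Vec.lookup v) (λ {i} {j} → inj i j) in
      π , (λ u → does⁺ (core? u _) (v , inj , ok , sym (h u))) , trans (h x) e

raise : ∀ {w n} → Element w n → Element w (suc n)
raise (bot i) = bot i
raise (top i) = top i
raise (el x) = el (suc x)

module _ (w : ℕ) (ρ : Row) (D : Presentation) where
  private
    module O = ElementOrder w D
    module N = ElementOrder w (ρ ∷ D)

  raise⁺ : ∀ {a b} → a O.⊑ b → raise a N.⊑ raise b
  raise⁺ {bot _} {bot _} h = h
  raise⁺ {bot _} {el _} h = tt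
  raise⁺ {bot _} {top _} h = tt
  raise⁺ {el _} {el _} (inj₁ e) = inj₁ (cong suc e)
  raise⁺ {el _} {el _} (inj₂ h) = inj₂ h
  raise⁺ {el _} {top _} h = tt
  raise⁺ {top _} {top _} h = h

  raise⁻ : ∀ {a b} → raise a N.⊑ raise b → a O.⊑ b
  raise⁻ {bot _} {bot _} h = h
  raise⁻ {bot _} {el _} h = tt
  raise⁻ {bot _} {top _} h = tt
  raise⁻ {el _} {el _} (inj₁ e) = inj₁ (Fin.suc-injective e)
  raise⁻ {el _} {el _} (inj₂ h) = inj₂ h
  raise⁻ {el _} {top _} h = tt
  raise⁻ {top _} {top _} h = h

module Layer {w′ V r k : ℕ} (algB : Algorithm w′ V) (algR : Algorithm r k) (r<w : r < suc w′) (w<r² : suc w′ < suc r * suc r) where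
  private
    w : ℕ
    w = suc w′

  module Colours (D : Presentation) = Keyed algB {E = Fin (length D) × ℕ} {K = ⊤} (λ _ _ → yes refl) (λ _ → tt) proj₁ proj₂ (less D)

  -- `low` holds the elements passed on to the algorithm for width w′; every other element is placed on a level.
  record Placement (D : Presentation) : Set where
    open ElementOrder w D
    field
      {m} : ℕ
      S : Sys w m
      level : Fin m → Fin w → Element w (length D)
      antichain : ∀ t {i j} → level t i ⊑ level t j → i ≡ j
      sound : ∀ a x b y → Below S a x b y → level a x ⊑ level b y
      matched : ∀ {p s} → Adj (levelSystem S) p s → ∀ (f : Fin w → Fin w) → (∀ {i j} → f i ≡ f j → i ≡ j) → (∀ i → level p i ⊑ level s (f i)) → ∀ x → Below S p x s (f x)
      topmost lowest : Fin m
      ≼topmost : ∀ t → below S t topmost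
      level-topmost : ∀ i → level topmost i ≡ top i
      level-lowest : ∀ i → level lowest i ≡ bot i
      low : List (Fin (length D) × ℕ)
      low-consistent : Colours.Consistent D low
      low-unique : Unique (map proj₁ low)
      low-width : ∀ xs → AllPairs (Incomparable D) xs → (∀ {x} → x ∈ xs → x ∈ map proj₁ low) → length xs ≤ w′

  data Home {D : Presentation} (P : Placement D) (x : Fin (length D)) : Set where
    lowered : ∀ c → (x , c) ∈ Placement.low P → Home P x
    placed : ∀ t z → Inserted (Placement.S P) t z → Placement.level P t z ≡ el x → Home P x

  module C {m} (S : Sys w m) = Comparable algR r<w w<r² S

  limits : Vec ℕ 14
  limits = C.limits {2} base

  level-colour : ∀ {m} (S : Sys w m) → Fin m → ℕ
  level-colour S t = V + encode (PointState.colour (points algR r S) t) limits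

  home-colour : ∀ {D} {P : Placement D} {x} → Home P x → ℕ
  home-colour (lowered c _) = c
  home-colour {P = P} (placed t _ _ _) = level-colour (Placement.S P) t

  initial : Placement []
  initial = record
    { S = base ; level = level ; antichain = λ { zero e → e ; (suc zero) e → e } ; sound = sound ; matched = matched
    ; topmost = zero ; lowest = suc zero ; ≼topmost = λ { zero → tt ; (suc zero) → tt } ; level-topmost = λ _ → refl ; level-lowest = λ _ → refl
    ; low = [] ; low-consistent = tt ; low-unique = [] ; low-width = λ { [] _ _ → z≤n ; (() ∷ _) _ _ } }
    where
    open ElementOrder w []
    level : Fin 2 → Fin w → Element w 0
    level zero i = top i
    level (suc zero) i = bot i
    sound : ∀ a x b y → Below base a x b y → level a x ⊑ level b y
    sound zero x zero y e = e
    sound zero x (suc zero) y ()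
    sound (suc zero) x zero y _ = tt
    sound (suc zero) x (suc zero) y e = e
    matched : ∀ {p s} → Adj (levelSystem base) p s → ∀ (f : Fin w → Fin w) → (∀ {i j} → f i ≡ f j → i ≡ j) → (∀ i → level p i ⊑ level s (f i)) → ∀ x → Below base p x s (f x)
    matched {zero} {zero} (_ , n , _) = ⊥-elim (n refl)
    matched {zero} {suc zero} (() , _)
    matched {suc zero} {zero} _ f _ _ x = tt
    matched {suc zero} {suc zero} (_ , n , _) = ⊥-elim (n refl)

  module Weaken (ρ : Row) (D : Presentation) (P : Placement D) where
    open Placement P

    lift-entry : Fin (length D) × ℕ → Fin (length (ρ ∷ D)) × ℕ
    lift-entry (x , c) = suc x , c

    module KM = KeyedMap algB {E = Fin (length D) × ℕ} {K = ⊤} {E′ = Fin (length (ρ ∷ D)) × ℕ} {K′ = ⊤} (λ _ _ → yes refl) (λ _ _ → yes refl)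
      (λ _ → tt) proj₁ proj₂ (less D) (λ _ → tt) proj₁ proj₂ (less (ρ ∷ D)) lift-entry id suc id (λ _ → refl) (λ _ → refl) (λ _ → refl) (λ _ _ → refl)

    names : map proj₁ (map lift-entry low) ≡ map suc (map proj₁ low)
    names = trans (sym (map-∘ low)) (map-∘ low)

    private
      preimages : ∀ xs → (∀ {x} → x ∈ xs → x ∈ map proj₁ (map lift-entry low)) → ∃[ ys ] xs ≡ map suc ys × (∀ {y} → y ∈ ys → y ∈ map proj₁ low)
      preimages [] h = [] , refl , λ ()
      preimages (x ∷ xs) h with ∈-map⁻ suc (subst (x ∈_) names (h (here refl))) | preimages xs (h ∘ there)
      ... | y , y∈ , refl | ys , refl , k = y ∷ ys , refl , λ { (here refl) → y∈ ; (there i) → k i }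

    weakened : Placement (ρ ∷ D)
    weakened = record
      { S = S ; level = λ t i → raise (level t i) ; antichain = λ t l → antichain t (raise⁻ w ρ D {level t _} {level t _} l)
      ; sound = λ a x b y l → raise⁺ w ρ D {level a x} {level b y} (sound a x b y l)
      ; matched = λ {p} {s} g f inj ok x → matched g f inj (λ i → raise⁻ w ρ D {level p i} {level s (f i)} (ok i)) x
      ; topmost = topmost ; lowest = lowest ; ≼topmost = ≼topmost
      ; level-topmost = λ i → cong raise (level-topmost i) ; level-lowest = λ i → cong raise (level-lowest i)
      ; low = map lift-entry low ; low-consistent = KM.consistent-map low low-consistent
      ; low-unique = subst Unique (sym names) (Unique.map⁺ Fin.suc-injective low-unique)
      ; low-width = λ xs ps sub → case preimages xs sub of λ { (ys , refl , h) → subst (_≤ w′) (sym (length-map suc ys))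
          (low-width ys (AllPairs.map (λ (n , a , b) → n ∘ cong suc , a , b) (AllPairs.map⁻ ps)) h) } }

    weaken-home : ∀ {x} → Home P x → Home weakened (suc x)
    weaken-home (lowered c i) = lowered c (∈-map⁺ lift-entry i)
    weaken-home (placed t z h e) = placed t z h (cong raise e)

    weaken-colour : ∀ {x} (h : Home P x) → home-colour (weaken-home h) ≡ home-colour h
    weaken-colour (lowered _ _) = refl
    weaken-colour (placed _ _ _ _) = refl

    fresh-low : zero ∉ map proj₁ (map lift-entry low)
    fresh-low h = case ∈-map⁻ suc (subst (zero ∈_) names h) of λ { (_ , _ , ()) }

  IsLow : ∀ {D} → Placement D → Fin (length D) → Set
  IsLow P x = x ∈ map proj₁ (Placement.low P)

  isLow? : ∀ {D} (P : Placement D) x → Dec (IsLow P x)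
  isLow? P x = Any.any? (x Fin.≟_) (map proj₁ (Placement.low P))

  module Lower (D : Presentation) (P : Placement D) (x : Fin (length D)) (x∉ : ¬ IsLow P x) (narrow : ¬ Extends D (IsLow P) w′ (x ∷ [])) where
    open Placement P

    colour : ℕ
    colour = Colours.nextColour D tt x low

    private
      width⁺ : ∀ xs → AllPairs (Incomparable D) xs → (∀ {y} → y ∈ xs → y ∈ x ∷ map proj₁ low) → length xs ≤ w′
      width⁺ xs ps sub with Any.any? (x Fin.≟_) xs
      ... | no n = low-width xs ps λ y∈ → case sub y∈ of λ { (here refl) → ⊥-elim (n y∈) ; (there h) → h }
      ... | yes x∈ = subst (_≤ w′) (sym (filter-split (x Fin.≟_) xs)) (ℕ.≤-trans (ℕ.+-monoˡ-≤ (length zs) one) (ℕ.≰⇒> λ long →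
          narrow (list⇒extends D (IsLow P) zs (λ z∈ → keep z∈) (AllPairs.filter⁺ other? ps) (x ∷ []) (λ z∈ → away z∈ ∷ []) w′ long)))
        where
        other? = λ y → ¬? (x Fin.≟ y)
        zs = filter other? xs
        keep : ∀ {z} → z ∈ zs → IsLow P z
        keep z∈ = let (a , n) = ∈-filter⁻ other? {xs = xs} z∈ in case sub a of λ { (here refl) → ⊥-elim (n refl) ; (there h) → h }
        away : ∀ {z} → z ∈ zs → Incomparable D z x
        away z∈ = let (a , n) = ∈-filter⁻ other? {xs = xs} z∈ in case AllPairs-lookup ps a x∈ of λ
          { (inj₁ e) → ⊥-elim (n (sym e)) ; (inj₂ (inj₁ q)) → q ; (inj₂ (inj₂ q)) → Incomparable-sym D q }
        one : length (filter (x Fin.≟_) xs) ≤ 1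
        one = unique-constant _ (Unique.filter⁺ (x Fin.≟_) (AllPairs⇒Unique (λ (n , _) → n refl) ps)) (All.tabulate (proj₂ ∘ ∈-filter⁻ (x Fin.≟_) {xs = xs}))

    lowering : Placement D
    lowering = record
      { S = S ; level = level ; antichain = antichain ; sound = sound ; matched = matched ; topmost = topmost ; lowest = lowest
      ; ≼topmost = ≼topmost ; level-topmost = level-topmost ; level-lowest = level-lowest ; low = (x , colour) ∷ low
      ; low-consistent = refl , low-consistent ; low-unique = All.tabulate (λ { h refl → x∉ h }) ∷ low-unique ; low-width = width⁺ }

    lower-home : ∀ {y} → Home P y → Home lowering y
    lower-home (lowered c i) = lowered c (there i)
    lower-home (placed t z h e) = placed t z h e

    lower-colour : ∀ {y} (h : Home P y) → home-colour (lower-home h) ≡ home-colour h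
    lower-colour (lowered _ _) = refl
    lower-colour (placed _ _ _ _) = refl

  record Cut {D : Presentation} (P : Placement D) (x : Fin (length D)) : Set where
    open Placement P
    open Names S
    open ElementOrder w D
    field
      p s : Fin m
      gap : Adjacent p s
      d : Fin w → Element w (length D)
      d-antichain : ∀ {i j} → d i ⊑ d j → i ≡ j
      i₀ : Fin w
      d-x : d i₀ ≡ el x
      lower-matching : Σ[ f ∈ (Fin w → Fin w) ] (∀ {i j} → f i ≡ f j → i ≡ j) × (∀ i → level p i ⊑ d (f i))
      upper-matching : Σ[ f ∈ (Fin w → Fin w) ] (∀ {i j} → f i ≡ f j → i ≡ j) × (∀ i → d i ⊑ level s (f i))

  -- Between the highest antichain A with x in its up-set and the next one B lies (X ∨ A) ∧ B, where X is an antichain through x.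
  module FindCut (D : Presentation) (valid : Valid w D) (P : Placement D) (x : Fin (length D))
    (X : Fin w → Element w (length D)) (X-antichain : ∀ {i j} → ElementOrder._⊑_ w D (X i) (X j) → i ≡ j) (i₀ : Fin w) (X-x : X i₀ ≡ el x) where
    open Placement P
    open Names S
    open ElementOrder w D
    private
      tr = proj₁ valid
      le-trans : ∀ {a b c} → a ⊑ b → b ⊑ c → a ⊑ c
      le-trans {a} {b} {c} = ⊑-trans tr {a} {b} {c}
      module A = Antichains _⊑_ _⊑?_ (λ {a} → ⊑-refl {a}) (λ {a} {b} {c} → le-trans {a} {b} {c}) (λ {a} {b} → ⊑-antisym tr {a} {b}) w (element-width (proj₂ valid))
      module Aᵒ = Antichains (λ a b → b ⊑ a) (λ a b → b ⊑? a) (λ {a} → ⊑-refl {a}) (λ {a} {b} {c} p q → le-trans {c} {b} {a} q p)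
        (λ {a} {b} p q → ⊑-antisym tr {a} {b} q p) w (λ es ps → element-width (proj₂ valid) es (AllPairs.map (λ (p , q) → q , p) ps))

      Up : Fin m → Set
      Up t = ∃[ i ] level t i ⊑ el x

      Up? : ∀ t → Dec (Up t)
      Up? t = Fin.any? λ i → level t i ⊑? el x

      below-x : ∀ a i → a ≡ lowest → level a i ⊑ el x
      below-x _ i refl = subst (_⊑ el x) (sym (level-lowest i)) tt

      ups : List (Fin m)
      ups = filter Up? (allFin m)

      highest : ∃[ p ] Up p × (∀ {c} → Up c → c ≼ p)
      highest = go ups (∈-filter⁺ Up? (∈-allFin lowest) (zero , below-x lowest zero refl)) (λ h → proj₂ (∈-filter⁻ Up? {xs = allFin m} h)) (∈-filter⁺ Up? (∈-allFin _))
        where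
        go : ∀ ts → lowest ∈ ts → (∀ {t} → t ∈ ts → Up t) → (∀ {t} → Up t → t ∈ ts) → ∃[ p ] Up p × (∀ {c} → Up c → c ≼ p)
        go (t ∷ ts) _ h k with p , p∈ , q ← least (λ a b → b ≼ a) (λ a b → b ≼? a) ≼-refl (λ u v → ≼-trans v u) (λ a b → ≼-total b a) t ts =
          p , h p∈ , λ u → All.lookup q (k u)

      p = proj₁ highest
      p-up = proj₁ (proj₂ highest)

      p≢topmost : p ≢ topmost
      p≢topmost e = not-top (subst Up e p-up)
        where
        not-top : ¬ Up topmost
        not-top (i , l) = subst (_⊑ el x) (level-topmost i) l

      next : ∃[ s ] Adjacent p s
      next = successor p topmost (≼topmost p) p≢topmost

      s = proj₁ next

      gap : Adjacent p s
      gap = proj₂ next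

      s-not-up : ¬ Up s
      s-not-up u = proj₁ (proj₂ gap) (≼-antisym (proj₁ gap) (proj₂ (proj₂ highest) u))

      joined = A.join {X} {level p} X-antichain (antichain p)
      c = proj₁ joined
      c-antichain : A.Antichain c
      c-antichain = proj₁ (proj₂ joined)
      c-above : ∀ i → ∃[ j ] level p j ⊑ c i
      c-above = proj₁ (proj₂ (proj₂ joined))

      c-x : c i₀ ≡ el x
      c-x = trans (A.join-keeps {X} {level p} {c} (antichain p) (proj₂ (proj₂ (proj₂ joined)) i₀) (subst (level p (proj₁ p-up) ⊑_) (sym X-x) (proj₂ p-up))) X-x

      met = Aᵒ.join {c} {level s} (sym ∘ c-antichain) (sym ∘ antichain s)
      d = proj₁ met
      d-antichain : A.Antichain d
      d-antichain l = sym (proj₁ (proj₂ met) l)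
      d-below : ∀ i → ∃[ j ] d i ⊑ level s j
      d-below = proj₁ (proj₂ (proj₂ met))

      x-below-s : ∃[ j ] c i₀ ⊑ level s j
      x-below-s = let (f , _ , cmp) = A.comparability-matching {c} {level s} c-antichain (antichain s) in f i₀ , decide (f i₀) (cmp i₀)
        where
        decide : ∀ j → c i₀ ⊑ level s j ⊎ level s j ⊑ c i₀ → c i₀ ⊑ level s j
        decide j (inj₁ l) = l
        decide j (inj₂ l) = ⊥-elim (s-not-up (j , subst (level s j ⊑_) c-x l))

      d-x : d i₀ ≡ el x
      d-x = trans (Aᵒ.join-keeps {c} {level s} {d} (sym ∘ antichain s) (proj₂ (proj₂ (proj₂ met)) i₀) (proj₂ x-below-s)) c-x

      d-above : ∀ i → ∃[ j ] level p j ⊑ d i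
      d-above i = from (proj₂ (proj₂ (proj₂ met)) i)
        where
        from : d i ≡ c i ⊎ ∃[ j ] d i ≡ level s j × level s j ⊑ c i → ∃[ j ] level p j ⊑ d i
        from (inj₁ e) = let (j , l) = c-above i in j , subst (level p j ⊑_) (sym e) l
        from (inj₂ (j , e , _)) = let u = thread p ⟨$⟩ʳ (thread s ⟨$⟩ˡ j) in u , subst (level p u ⊑_) (sym e) (sound p u s j (thread-down (proj₁ gap) j))

      lower-matching = A.directed-matching {level p} {d} (antichain p) d-antichain d-above
      upper-matching = A.directed-matchingᵘ {d} {level s} d-antichain (antichain s) d-below

    opaque
      cut : Cut P x
      cut = record { p = p ; s = s ; gap = gap ; d = d ; d-antichain = d-antichain ; i₀ = i₀ ; d-x = d-x ; lower-matching = lower-matching ; upper-matching = upper-matching }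

  module Insert (D : Presentation) (valid : Valid w D) (P : Placement D) (x : Fin (length D)) (cut : Cut P x) where
    open Placement P
    open Names S
    open ElementOrder w D
    open Cut cut
    private
      le-trans : ∀ {a b c} → a ⊑ b → b ⊑ c → a ⊑ c
      le-trans {a} {b} {c} = ⊑-trans (proj₁ valid) {a} {b} {c}

      module Coreˡ = Core _⊑_ _⊑?_ (level p) d
      module Coreʰ = Core _⊑_ _⊑?_ d (level s)

      L U : Link w
      L = Coreˡ.core-link (proj₁ lower-matching) (proj₁ (proj₂ lower-matching)) (proj₂ (proj₂ lower-matching))
      U = Coreʰ.core-link (proj₁ upper-matching) (proj₁ (proj₂ upper-matching)) (proj₂ (proj₂ upper-matching))

      edgeˡ : ∀ {y z} → Edge L y z → Coreˡ.Core y z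
      edgeˡ {y} {z} = does⁻ (Coreˡ.core? y z)

      edgeʰ : ∀ {y z} → Edge U y z → Coreʰ.Core y z
      edgeʰ {y} {z} = does⁻ (Coreʰ.core? y z)

      refines : ∀ {u z y} → Edge L u z → Edge U z y → Below S p u s y
      refines {u} {z} {y} e e′ = compose (edgeˡ e) (edgeʰ e′)
        where
        compose : ∀ {u z y} → Coreˡ.Core u z → Coreʰ.Core z y → Below S p u s y
        compose {u} (v , inj , ok , refl) (v′ , inj′ , ok′ , refl) =
          matched gap (Vec.lookup v′ ∘ Vec.lookup v) (λ e → inj _ _ (inj′ _ _ e)) (λ i → le-trans {level p i} {d (Vec.lookup v i)} (ok i) (ok′ _)) u

      S⁺ : Sys w (suc m)
      S⁺ = ins S p s (proj₁ gap) (proj₁ (proj₂ gap)) (proj₂ (proj₂ gap)) L U refines i₀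

      level⁺ : Fin (suc m) → Fin w → Element w (length D)
      level⁺ zero = d
      level⁺ (suc t) = level t

      sound⁺ : ∀ a u b y → Below S⁺ a u b y → level⁺ a u ⊑ level⁺ b y
      sound⁺ zero u zero y refl = ⊑-refl {d u}
      sound⁺ zero u (suc b) y (v , e , l) = le-trans {d u} {level s v} (Coreʰ.core-⊑ (edgeʰ e)) (sound s v b y l)
      sound⁺ (suc a) u zero y (v , l , e) = le-trans {level a u} {level p v} (sound a u p v l) (Coreˡ.core-⊑ (edgeˡ e))
      sound⁺ (suc a) u (suc b) y l = sound a u b y l

      open StepProof 0 S p s (proj₁ gap) (proj₁ (proj₂ gap)) (proj₂ (proj₂ gap)) L U refines i₀ (current 0 S) (InForest 0 S) (forest-invariant 0 S)
        using (side; Side; lower; upper; other)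

      matched-side : ∀ {a b} → Side a b → ∀ (f : Fin w → Fin w) → (∀ {i j} → f i ≡ f j → i ≡ j) → (∀ i → level⁺ a i ⊑ level⁺ b (f i)) → ∀ u → Below S⁺ a u b (f u)
      matched-side lower f inj ok u = u , Below-refl S p u , does⁺ (Coreˡ.core? u (f u)) (Coreˡ.core f inj ok u)
      matched-side upper f inj ok u = f u , does⁺ (Coreʰ.core? u (f u)) (Coreʰ.core f inj ok u) , Below-refl S s (f u)
      matched-side (other _ g) f inj ok u = matched g f inj ok u

    inserted : Placement D
    inserted = record
      { S = S⁺ ; level = level⁺ ; antichain = λ { zero l → d-antichain l ; (suc t) l → antichain t l } ; sound = sound⁺
      ; matched = λ {a} {b} g → matched-side (side g) ; topmost = suc topmost ; lowest = suc lowest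
      ; ≼topmost = λ { zero → ≼topmost s ; (suc t) → ≼topmost t } ; level-topmost = level-topmost ; level-lowest = level-lowest
      ; low = low ; low-consistent = low-consistent ; low-unique = low-unique ; low-width = low-width }

    insert-home : ∀ {y} → Home P y → Home inserted y
    insert-home (lowered c i) = lowered c i
    insert-home (placed t z h e) = placed (suc t) z h e

    insert-colour : ∀ {y} (h : Home P y) → home-colour (insert-home h) ≡ home-colour h
    insert-colour (lowered _ _) = refl
    insert-colour (placed _ _ _ _) = refl

    new-home : Home inserted x
    new-home = placed zero i₀ refl d-x

indexed : ∀ {D n x} (xs : List (Fin (length D))) → length xs ≡ n → AllPairs (Incomparable D) xs → x ∈ xs →
  Σ[ X ∈ (Fin n → Fin (length D)) ] (∀ {i j} → i ≢ j → Incomparable D (X i) (X j)) × ∃[ i ] X i ≡ x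
indexed {D} xs refl ps x∈ = List.lookup xs , pairs-at (Incomparable-sym D) ps , Any.index x∈ , sym (Any.lookup-index x∈)

module Online {w′ V r k : ℕ} (algB : Algorithm w′ V) (algR : Algorithm r k) (r<w : r < suc w′) (w<r² : suc w′ < suc r * suc r) where
  open Layer algB algR r<w w<r²
  private
    w : ℕ
    w = suc w′

  record Run (D : Presentation) : Set where
    constructor run-of
    field
      placement : Placement D
      home : ∀ x → Home placement x

    colour : Fin (length D) → ℕ
    colour x = home-colour (home x)

  module Step′ (ρ : Row) (D : Presentation) (valid : Valid w (ρ ∷ D)) (R : Run D) where
    open Run R
    open Weaken ρ D placement

    wide? : Dec (Extends (ρ ∷ D) (IsLow weakened) w′ (zero ∷ []))
    wide? = extends? (ρ ∷ D) (IsLow weakened) (isLow? weakened) w′ (zero ∷ [])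

    module OnLevel (e : Extends (ρ ∷ D) (IsLow weakened) w′ (zero ∷ [])) where
      found : ∃[ xs ] length xs ≡ w′ + 1 × AllPairs (Incomparable (ρ ∷ D)) xs × (∀ {y} → y ∈ zero ∷ [] → y ∈ xs)
      found = extends⇒list (ρ ∷ D) (IsLow weakened) w′ e ([] ∷ [])
      line : Σ[ X ∈ (Fin w → Fin (length (ρ ∷ D))) ] (∀ {i j} → i ≢ j → Incomparable (ρ ∷ D) (X i) (X j)) × ∃[ i ] X i ≡ zero
      line = indexed (proj₁ found) (trans (proj₁ (proj₂ found)) (ℕ.+-comm w′ 1)) (proj₁ (proj₂ (proj₂ found))) (proj₂ (proj₂ (proj₂ found)) (here refl))
      X : Fin w → Fin (length (ρ ∷ D))
      X = proj₁ line
      separate : ∀ {i j} → ElementOrder._⊑_ w (ρ ∷ D) (el (X i)) (el (X j)) → i ≡ j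
      separate {i} {j} l with i Fin.≟ j
      ... | yes e = e
      ... | no n = let (a , b , _) = proj₁ (proj₂ line) n in ⊥-elim ([ a , b ]′ l)
      cut : Cut weakened zero
      cut = FindCut.cut (ρ ∷ D) valid weakened zero (el ∘ X) separate (proj₁ (proj₂ (proj₂ line))) (cong el (proj₂ (proj₂ (proj₂ line))))
      open Insert (ρ ∷ D) valid weakened zero cut public

    next-run : Dec (Extends (ρ ∷ D) (IsLow weakened) w′ (zero ∷ [])) → Run (ρ ∷ D)
    next-run (no n) = run-of lowering λ { zero → lowered _ (here refl) ; (suc x) → lower-home (weaken-home (home x)) }
      where open Lower (ρ ∷ D) weakened zero fresh-low n
    next-run (yes e) = run-of inserted λ { zero → new-home ; (suc x) → insert-home (weaken-home (home x)) }
      where open OnLevel e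

    next-colour : ∀ d x → Run.colour (next-run d) (suc x) ≡ colour x
    next-colour (no n) x = trans (Lower.lower-colour (ρ ∷ D) weakened zero fresh-low n (weaken-home (home x))) (weaken-colour (home x))
    next-colour (yes e) x = trans (OnLevel.insert-colour e (weaken-home (home x))) (weaken-colour (home x))

  advance : ∀ ρ D → Valid w (ρ ∷ D) → Run D → Run (ρ ∷ D)
  advance ρ D v R = Step′.next-run ρ D v R (Step′.wide? ρ D v R)

  combine : ∀ ρ D → Dec (Valid w (ρ ∷ D)) → Maybe (Run D) → Maybe (Run (ρ ∷ D))
  combine ρ D (yes v) (just R) = just (advance ρ D v R)
  combine ρ D (yes _) nothing = nothing
  combine ρ D (no _) _ = nothing

  runs : ∀ D → Maybe (Run D)
  runs [] = just (run-of initial λ ())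
  runs (ρ ∷ D) = combine ρ D (Valid? w (ρ ∷ D)) (runs D)

  newest : ∀ {ρ D} → Maybe (Run (ρ ∷ D)) → ℕ
  newest (just R) = Run.colour R zero
  newest nothing = 0

  online-colour : Row → Presentation → ℕ
  online-colour ρ D = newest (runs (ρ ∷ D))

  runs-valid : ∀ D → Valid w D → ∃[ R ] runs D ≡ just R × (∀ i → colours online-colour D i ≡ Run.colour R i)
  runs-valid [] v = _ , refl , λ ()
  runs-valid (ρ ∷ D) v with R , e , h ← runs-valid D (valid-tail v) = let (v′ , q) = defined (Valid? w (ρ ∷ D)) (runs D) e in
      advance ρ D v′ R , q , λ { zero → cong newest q ; (suc i) → trans (h i) (sym (Step′.next-colour ρ D v′ R (Step′.wide? ρ D v′ R) i)) }
    where
    defined : ∀ d s → s ≡ just R → ∃[ v′ ] combine ρ D d s ≡ just (advance ρ D v′ R)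
    defined (yes v′) _ refl = v′ , refl
    defined (no n) _ _ = ⊥-elim (n v)

  module Correct (D : Presentation) (valid : Valid w D) (R : Run D) where
    open Run R
    open Placement placement
    private
      selected = Colours.select D tt low

      low-transitive : Transitive (present (less D) selected)
      low-transitive = present-transitive (less D) selected (λ {x} {y} {z} _ _ _ → proj₁ valid x y z) (λ {x} _ → less-irrefl D x)

      low-width′ : WidthAtMost w′ (present (less D) selected)
      low-width′ = present-width (less D) w′ selected (unique-filter proj₁ (λ _ → yes refl) low low-unique) λ ys u sub apart →
        low-width ys (tabulate-AllPairs ys u λ a b n → n , apart a b n , apart b a (n ∘ sym)) λ y∈ → case Colours.∈-select D (sub y∈) of λ
          { (e , e∈ , _ , refl) → ∈-map⁺ proj₁ e∈ }

      low-bounded : ∀ {x c} → (x , c) ∈ low → c < V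
      low-bounded i = Colours.keyed-bounded D low low-consistent tt low-transitive low-width′ i refl

    bounded : ∀ {x} (h : Home placement x) → home-colour h < V + volume limits
    bounded (lowered c i) = ℕ.<-≤-trans (low-bounded i) (ℕ.m≤m+n V _)
    bounded (placed t z h _) = ℕ.+-monoʳ-< V (encode-< (C.colour-limits S h))

    proper : ∀ {x y} (h : Home placement x) (h′ : Home placement y) → home-colour h ≡ home-colour h′ → x ≡ y ⊎ Less D x y ⊎ Less D y x
    proper {x} {y} (lowered c i) (lowered _ j) refl = Colours.keyed-proper D low low-consistent tt low-transitive low-width′ {x , c} {y , c} i j refl refl refl
    proper (lowered c i) (placed t z _ _) e = ⊥-elim (ℕ.<-irrefl e (ℕ.<-≤-trans (low-bounded i) (ℕ.m≤m+n V _)))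
    proper (placed t z _ _) (lowered c i) e = ⊥-elim (ℕ.<-irrefl (sym e) (ℕ.<-≤-trans (low-bounded i) (ℕ.m≤m+n V _)))
    proper {x} {y} (placed t z h q) (placed t′ z′ h′ q′) e = [ inj₁′ ∘ subst₂ _⊑_ q q′ ∘ sound t z t′ z′ , inj₂′ ∘ subst₂ _⊑_ q′ q ∘ sound t′ z′ t z ]′
        (C.comparable S h h′ (encode-injective (C.colour-limits S h) (C.colour-limits S h′) (ℕ.+-cancelˡ-≡ V _ _ e)))
      where
      open ElementOrder w D
      inj₁′ : el x ⊑ el y → x ≡ y ⊎ Less D x y ⊎ Less D y x
      inj₁′ (inj₁ e) = inj₁ e
      inj₁′ (inj₂ l) = inj₂ (inj₁ l)
      inj₂′ : el y ⊑ el x → x ≡ y ⊎ Less D x y ⊎ Less D y x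
      inj₂′ (inj₁ e) = inj₁ (sym e)
      inj₂′ (inj₂ l) = inj₂ (inj₂ l)

  online : Algorithm w (V + volume limits)
  online = record
    { col = online-colour
    ; bounded = λ D t h i → let (R , _ , e) = runs-valid D (t , h) in subst (_< V + volume limits) (sym (e i)) (Correct.bounded D (t , h) R (Run.home R i))
    ; proper = λ D t h i j q → let (R , _ , e) = runs-valid D (t , h) in
        Correct.proper D (t , h) R (Run.home R i) (Run.home R j) (trans (sym (e i)) (trans q (e j))) }

-- Iterating the reduction: from width √w to width w the number of chains is squared, up to a polynomial factor

weaken-bound : ∀ {w k k′} → k ≤ k′ → Algorithm w k → Algorithm w k′
weaken-bound l alg = record { col = Algorithm.col alg ; bounded = λ D t h i → ℕ.<-≤-trans (bounded D t h i) l ; proper = proper }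
  where open Algorithm alg using (bounded; proper)

narrow : ∀ {w w′ k} → w′ ≤ w → Algorithm w k → Algorithm w′ k
narrow l alg = record { col = Algorithm.col alg ; bounded = λ D t h → bounded D t (λ xs ps → ℕ.≤-trans (h xs ps) l)
  ; proper = λ D t h → proper D t (λ xs ps → ℕ.≤-trans (h xs ps) l) }
  where open Algorithm alg using (bounded; proper)

one-chain : Algorithm 1 1
one-chain = record { col = λ _ _ → 0 ; bounded = λ D _ _ i → ℕ.≤-reflexive (cong suc (zeros D i)) ; proper = λ D _ h i j _ → related D h i j }
  where
  zeros : ∀ D i → colours (λ _ _ → 0) D i ≡ 0
  zeros (ρ ∷ D) zero = refl
  zeros (ρ ∷ D) (suc i) = zeros D i
  related : ∀ D → WidthAtMost 1 D → ∀ i j → i ≡ j ⊎ Less D i j ⊎ Less D j i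
  related D h i j with i Fin.≟ j | T? (less D i j) | T? (less D j i)
  ... | yes e | _ | _ = inj₁ e
  ... | no _ | yes l | _ = inj₂ (inj₁ l)
  ... | no _ | no _ | yes l = inj₂ (inj₂ l)
  ... | no n | no a | no b = case h (i ∷ j ∷ []) (((n , a , b) ∷ []) ∷ [] ∷ []) of λ { (s≤s ()) }

module _ {N : ℕ} (4≤N : 4 ≤ N) where
  private
    instance
      N≢0 : NonZero N
      N≢0 = >-nonZero (ℕ.≤-trans (s≤s z≤n) 4≤N)

    2≤N : 2 ≤ N
    2≤N = ℕ.≤-trans (s≤s (s≤s z≤n)) 4≤N

  polynomial-≤ : ∀ {W} → W ≤ N → W ^ 5 * W ^ 12 + 4 * (W * W) ≤ N ^ 18
  polynomial-≤ {W} h = begin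
    W ^ 5 * W ^ 12 + 4 * (W * W) ≤⟨ ℕ.+-mono-≤ (ℕ.*-mono-≤ (ℕ.^-monoˡ-≤ 5 h) (ℕ.^-monoˡ-≤ 12 h)) (ℕ.*-mono-≤ 4≤N (ℕ.*-mono-≤ h h)) ⟩
    N ^ 5 * N ^ 12 + N * (N * N) ≤⟨ ℕ.+-mono-≤ (ℕ.≤-reflexive (sym (ℕ.^-distribˡ-+-* N 5 12))) cube ⟩
    N ^ 17 + N ^ 17 ≡⟨ cong (N ^ 17 +_) (sym (ℕ.+-identityʳ (N ^ 17))) ⟩
    2 * N ^ 17 ≤⟨ ℕ.*-monoˡ-≤ (N ^ 17) 2≤N ⟩
    N ^ 18 ∎
    where
    open ℕ.≤-Reasoning
    cube : N * (N * N) ≤ N ^ 17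
    cube = ℕ.≤-trans (ℕ.≤-reflexive (cong (λ n → N * (N * n)) (sym (ℕ.*-identityʳ N)))) (ℕ.^-monoʳ-≤ N {3} {17} (s≤s (s≤s (s≤s z≤n))))

  total-≤ : ∀ {k q} → 1 ≤ k → 1 ≤ q → k + N * (q * (k * k)) ≤ N * N * q * (k * k)
  total-≤ {k} {q} 1≤k 1≤q = begin
    k + N * (q * (k * k)) ≤⟨ ℕ.+-monoˡ-≤ (N * (q * (k * k))) (ℕ.≤-trans (ℕ.m≤m*n k k {{>-nonZero 1≤k}}) (ℕ.≤-trans (ℕ.m≤n*m (k * k) q {{>-nonZero 1≤q}}) (ℕ.m≤n*m (q * (k * k)) N))) ⟩
    N * (q * (k * k)) + N * (q * (k * k)) ≡⟨ cong (N * (q * (k * k)) +_) (sym (ℕ.+-identityʳ _)) ⟩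
    2 * (N * (q * (k * k))) ≤⟨ ℕ.*-monoˡ-≤ (N * (q * (k * k))) 2≤N ⟩
    N * (N * (q * (k * k))) ≡⟨ regroup N q (k * k) ⟩
    N * N * q * (k * k) ∎
    where
    open ℕ.≤-Reasoning
    regroup : ∀ a b c → a * (a * (b * c)) ≡ a * a * b * c
    regroup = solve-∀

volume-≤ : ∀ {k P Q} → P ≤ Q → volume (P ∷ P ∷ P ∷ P ∷ P ∷ k ∷ P ∷ P ∷ P ∷ P ∷ k ∷ P ∷ P ∷ P ∷ []) ≤ Q ^ 12 * (k * k)
volume-≤ {k} {P} h = ℕ.≤-trans (ℕ.≤-reflexive (rearrange P k)) (ℕ.*-monoˡ-≤ (k * k) (ℕ.^-monoˡ-≤ 12 h))
  where
  rearrange : ∀ P k → P * (P * (P * (P * (P * (k * (P * (P * (P * (P * (k * (P * (P * (P * 1))))))))))))) ≡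
    (P * (P * (P * (P * (P * (P * (P * (P * (P * (P * (P * (P * 1)))))))))))) * (k * k)
  rearrange = solve-∀

-- One copy of the algorithm for width r is used at every width from suc r up to suc r squared.
module Climb {r k N : ℕ} (algR : Algorithm r k) (4≤N : 4 ≤ N) (r² : suc r * suc r ≡ N) where

  opaque
    step : ℕ
    step = (N ^ 18) ^ 12 * (k * k)

    volume-step : ∀ {P} → P ≤ N ^ 18 → volume (P ∷ P ∷ P ∷ P ∷ P ∷ k ∷ P ∷ P ∷ P ∷ P ∷ k ∷ P ∷ P ∷ P ∷ []) ≤ step
    volume-step = volume-≤ {k}

    total : 1 ≤ k → k + N * step ≤ N ^ 218 * (k * k)
    total 1≤k = ℕ.≤-trans (total-≤ 4≤N 1≤k (ℕ.m^n>0 (N ^ 18) {{>-nonZero (ℕ.m^n>0 N {{>-nonZero (ℕ.≤-trans (s≤s z≤n) 4≤N)}} 18)}} 12))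
      (ℕ.≤-reflexive (cong (_* (k * k)) (trans (cong₂ _*_ (cong (N *_) (sym (ℕ.*-identityʳ N))) (ℕ.^-*-assoc N 18 12)) (sym (ℕ.^-distribˡ-+-* N 2 216)))))

  limit-≤ : ∀ v → suc v ≤ N → φ-limit v + 4 * (suc v * suc v) ≤ N ^ 18
  limit-≤ v h = subst (λ n → n + 4 * (suc v * suc v) ≤ N ^ 18) (sym (φ-limit-def v)) (polynomial-≤ 4≤N {suc v} h)

  climb : ∀ d → r + d < N → Algorithm (r + d) (k + d * step)
  climb zero h = weaken-bound (ℕ.m≤m+n k 0) (narrow (ℕ.≤-reflexive (ℕ.+-identityʳ r)) algR)
  climb (suc d) h = weaken-bound bound (narrow (ℕ.≤-reflexive (ℕ.+-suc r d))
      (Online.online (climb d (ℕ.<-trans (ℕ.n<1+n _) h′)) algR (s≤s (ℕ.m≤m+n r d)) (subst (suc (r + d) <_) (sym r²) h′)))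
    where
    v : ℕ
    v = suc (r + d)
    h′ : v < N
    h′ = subst (_< N) (ℕ.+-suc r d) h
    bound : k + d * step + volume (let P = φ-limit v + 4 * (suc v * suc v) in P ∷ P ∷ P ∷ P ∷ P ∷ k ∷ P ∷ P ∷ P ∷ P ∷ k ∷ P ∷ P ∷ P ∷ []) ≤ k + suc d * step
    bound = ℕ.≤-trans (ℕ.+-monoʳ-≤ (k + d * step) (volume-step (limit-≤ v h′)))
      (ℕ.≤-reflexive (trans (ℕ.+-assoc k (d * step) step) (cong (k +_) (ℕ.+-comm (d * step) step))))

  square : ∀ v → v < N → Algorithm v (k + N * step)
  square v h with v ℕ.≤? r
  ... | yes l = weaken-bound (ℕ.m≤m+n k _) (narrow l algR)
  ... | no n = weaken-bound (ℕ.+-monoʳ-≤ k (ℕ.*-monoˡ-≤ step (ℕ.≤-trans (ℕ.m∸n≤m v r) (ℕ.<⇒≤ h)))) (narrow (ℕ.≤-reflexive (sym e)) (climb (v ∸ r) (subst (_< N) (sym e) h)))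
    where
    e : r + (v ∸ r) ≡ v
    e = ℕ.m+[n∸m]≡n (ℕ.<⇒≤ (ℕ.≰⇒> n))

opaque
  exponent : ℕ
  exponent = 218

  exponent-def : exponent ≡ 218
  exponent-def = refl

tower : ℕ → ℕ
tower j = 2 ^ (2 ^ j)

tower-suc : ∀ j → tower (suc j) ≡ tower j * tower j
tower-suc j = trans (cong (2 ^_) (cong (2 ^ j +_) (ℕ.+-identityʳ (2 ^ j)))) (ℕ.^-distribˡ-+-* 2 (2 ^ j) (2 ^ j))

algorithms : ∀ j w → w < tower j → Algorithm w (tower j ^ (exponent * j))
algorithms zero w h = weaken-bound (ℕ.m^n>0 2 (exponent * 0)) (narrow (ℕ.≤-pred h) one-chain)
algorithms (suc j) w h = weaken-bound bound (Climb.square algR 4≤N r² w h)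
  where
  c M r : ℕ
  c = exponent
  M = tower j
  r = pred M
  1≤M : 1 ≤ M
  1≤M = ℕ.m^n>0 2 (2 ^ j)
  e : suc r ≡ M
  e = ℕ.suc-pred M {{>-nonZero 1≤M}}
  r² : suc r * suc r ≡ tower (suc j)
  r² = trans (cong₂ _*_ e e) (sym (tower-suc j))
  2≤M : 2 ≤ M
  2≤M = ℕ.^-monoʳ-≤ 2 {1} {2 ^ j} (ℕ.m^n>0 2 j)
  4≤N : 4 ≤ tower (suc j)
  4≤N = subst (4 ≤_) (sym (tower-suc j)) (ℕ.*-mono-≤ 2≤M 2≤M)
  algR : Algorithm r (M ^ (c * j))
  algR = algorithms j r (ℕ.≤-reflexive e)
  square-power : ∀ b n → b ^ n * b ^ n ≡ (b * b) ^ n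
  square-power b zero = refl
  square-power b (suc n) = trans (interchange b (b ^ n)) (cong (b * b *_) (square-power b n))
    where
    interchange : ∀ a b → a * b * (a * b) ≡ a * a * (b * b)
    interchange = solve-∀
  bound : M ^ (c * j) + tower (suc j) * Climb.step algR 4≤N r² ≤ tower (suc j) ^ (c * suc j)
  bound = ℕ.≤-trans (Climb.total algR 4≤N r² (ℕ.m^n>0 M {{>-nonZero 1≤M}} (c * j))) (ℕ.≤-reflexive (trans
    (cong₂ _*_ (cong (tower (suc j) ^_) (sym exponent-def)) (trans (square-power M (c * j)) (cong (_^ (c * j)) (sym (tower-suc j)))))
    (trans (sym (ℕ.^-distribˡ-+-* (tower (suc j)) c (c * j))) (cong (tower (suc j) ^_) (sym (ℕ.*-suc c j))))))

log-upper : ∀ L n → n < 2 ^ suc L → ⌊log₂ n ⌋ ≤ L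
log-upper zero zero _ = z≤n
log-upper zero (suc zero) _ = z≤n
log-upper zero (suc (suc n)) (s≤s (s≤s ()))
log-upper (suc L) n h = ℕ.≤-trans (ℕ.m≤n+m∸n ⌊log₂ n ⌋ 1) (s≤s (subst (_≤ L) (⌊log₂⌊n/2⌋⌋≡⌊log₂n⌋∸1 n) (log-upper L ⌊ n /2⌋ (ℕ.≰⇒> λ l → ℕ.<-irrefl refl
  (ℕ.<-≤-trans h (ℕ.≤-trans (ℕ.≤-reflexive (cong (2 ^ suc L +_) (ℕ.+-identityʳ _))) (ℕ.≤-trans (ℕ.+-mono-≤ l (ℕ.≤-trans l (ℕ.⌊n/2⌋≤⌈n/2⌉ n))) (ℕ.≤-reflexive (ℕ.⌊n/2⌋+⌈n/2⌉≡n n)))))))))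

2^log≤ : ∀ n → 1 ≤ n → 2 ^ ⌊log₂ n ⌋ ≤ n
2^log≤ n 1≤n = ℕ.≮⇒≥ λ h → below-power ⌊log₂ n ⌋ refl h
  where
  below-power : ∀ L → L ≡ ⌊log₂ n ⌋ → ¬ n < 2 ^ L
  below-power zero _ h = ℕ.<-irrefl refl (ℕ.<-≤-trans h 1≤n)
  below-power (suc L) e h = ℕ.<-irrefl refl (subst (_≤ L) (sym e) (log-upper L n h))

<2^suc-log : ∀ n → n < 2 ^ suc ⌊log₂ n ⌋
<2^suc-log n = ℕ.≰⇒> λ h → ℕ.<-irrefl refl (subst (_≤ ⌊log₂ n ⌋) (⌊log₂[2^n]⌋≡n (suc ⌊log₂ n ⌋)) (⌊log₂⌋-mono-≤ h))

subquasipolynomial : ∀ w → 4 ≤ w → Algorithm w (w ^ (4 * exponent * ⌊log₂ ⌊log₂ w ⌋ ⌋))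
subquasipolynomial w 4≤w = weaken-bound bound (algorithms (suc j) w w<)
  where
  ℓ j c : ℕ
  ℓ = ⌊log₂ w ⌋
  j = ⌊log₂ ℓ ⌋
  c = exponent
  1≤w : 1 ≤ w
  1≤w = ℕ.≤-trans (s≤s z≤n) 4≤w
  2≤ℓ : 2 ≤ ℓ
  2≤ℓ = ⌊log₂⌋-mono-≤ 4≤w
  1≤j : 1 ≤ j
  1≤j = ⌊log₂⌋-mono-≤ 2≤ℓ
  w< : w < tower (suc j)
  w< = ℕ.<-≤-trans (<2^suc-log w) (ℕ.^-monoʳ-≤ 2 (<2^suc-log ℓ))
  tower≤ : tower j ≤ w
  tower≤ = ℕ.≤-trans (ℕ.^-monoʳ-≤ 2 (2^log≤ ℓ (ℕ.≤-trans (s≤s z≤n) 2≤ℓ))) (2^log≤ w 1≤w)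
  exponents : 2 * (c * suc j) ≤ 4 * c * j
  exponents = ℕ.≤-trans (ℕ.*-monoʳ-≤ 2 (ℕ.*-monoʳ-≤ c (ℕ.+-monoˡ-≤ j 1≤j))) (ℕ.≤-reflexive (double c j))
    where
    double : ∀ c j → 2 * (c * (j + j)) ≡ 4 * c * j
    double = solve-∀
  bound : tower (suc j) ^ (c * suc j) ≤ w ^ (4 * c * j)
  bound = begin
    tower (suc j) ^ (c * suc j) ≡⟨ cong (_^ (c * suc j)) (tower-suc j) ⟩
    (tower j * tower j) ^ (c * suc j) ≤⟨ ℕ.^-monoˡ-≤ (c * suc j) (ℕ.*-mono-≤ tower≤ (ℕ.≤-trans tower≤ (ℕ.≤-reflexive (sym (ℕ.*-identityʳ w))))) ⟩
    (w ^ 2) ^ (c * suc j) ≡⟨ ℕ.^-*-assoc w 2 (c * suc j) ⟩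
    w ^ (2 * (c * suc j)) ≤⟨ ℕ.^-monoʳ-≤ w {{>-nonZero 1≤w}} exponents ⟩
    w ^ (4 * c * j) ∎
    where open ℕ.≤-Reasoning

-- From presented orders to posets

presentation : ∀ {n} → FinPoset n → Presentation
newest-row : ∀ {n} → FinPoset (suc n) → Row
presentation {zero} P = []
presentation {suc n} P = newest-row P ∷ presentation (earlier P)
newest-row P = tabulate λ j → FinPoset.leq P zero (suc j) , FinPoset.leq P (suc j) zero

pos : ∀ {n} (P : FinPoset n) → Fin (length (presentation P)) → Fin n
pos {suc n} P zero = zero
pos {suc n} P (suc i) = suc (pos (earlier P) i)

elt : ∀ {n} (P : FinPoset n) → Fin n → Fin (length (presentation P))
elt P zero = zero
elt P (suc i) = suc (elt (earlier P) i)

pos-elt : ∀ {n} (P : FinPoset n) i → pos P (elt P i) ≡ i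
pos-elt P zero = refl
pos-elt P (suc i) = cong suc (pos-elt (earlier P) i)

pos-injective : ∀ {n} (P : FinPoset n) {i j} → pos P i ≡ pos P j → i ≡ j
pos-injective {suc n} P {zero} {zero} e = refl
pos-injective {suc n} P {suc i} {suc j} e = cong suc (pos-injective (earlier P) (Fin.suc-injective e))

private
  entry-pos : ∀ {n} (P : FinPoset n) (f : Fin n → Bool × Bool) i → entry (tabulate f) (toℕ i) ≡ f (pos P i)
  entry-pos {suc n} P f zero = refl
  entry-pos {suc n} P f (suc i) = entry-pos (earlier P) (f ∘ suc) i

less-leq : ∀ {n} (P : FinPoset n) i j → i ≢ j → less (presentation P) i j ≡ FinPoset.leq P (pos P i) (pos P j)
less-leq {suc n} P zero zero ne = ⊥-elim (ne refl)
less-leq {suc n} P zero (suc j) ne = cong proj₁ (entry-pos (earlier P) (λ j → FinPoset.leq P zero (suc j) , FinPoset.leq P (suc j) zero) j)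
less-leq {suc n} P (suc i) zero ne = cong proj₂ (entry-pos (earlier P) (λ j → FinPoset.leq P zero (suc j) , FinPoset.leq P (suc j) zero) i)
less-leq {suc n} P (suc i) (suc j) ne = less-leq (earlier P) i j (ne ∘ cong suc)

module _ {n} (P : FinPoset n) where
  open FinPoset P
  private module O = IsPartialOrder isPartialOrder

  less⇒⊑ : ∀ {i j} → Less (presentation P) i j → i ≢ j × pos P i ⊑ pos P j
  less⇒⊑ {i} {j} l = ne , subst T (less-leq P i j ne) l
    where
    ne : i ≢ j
    ne refl = less-irrefl (presentation P) i l

  ⊑⇒less : ∀ {i j} → i ≢ j → pos P i ⊑ pos P j → Less (presentation P) i j
  ⊑⇒less {i} {j} ne = subst T (sym (less-leq P i j ne))

  presentation-valid : ∀ {w} → HasWidth P w → Valid w (presentation P)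
  presentation-valid {w} (_ , h) = transitive , width
    where
    transitive : Transitive (presentation P)
    transitive i j k l l′ = let (n , a) = less⇒⊑ l ; (_ , b) = less⇒⊑ l′ in
      ⊑⇒less (λ { refl → n (pos-injective P (O.antisym a b)) }) (O.trans a b)
    width : WidthAtMost w (presentation P)
    width xs ps = ℕ.≤-trans (subst (_≤ length (elements S)) (length-map (pos P) xs) (inj-length id (elements S) unique (λ _ _ → id) (∈-elements S ∘ S⁺)))
      (subst (_≤ w) (sym (length-elements S)) (h S antichain))
      where
      ys = map (pos P) xs
      member? : ∀ y → Dec (y ∈ ys)
      member? y = Any.any? (y Fin.≟_) ys
      S : Subset n
      S = Vec.tabulate (λ y → does (member? y))
      S⁺ : ∀ {y} → y ∈ ys → y Sub.∈ S
      S⁺ {y} y∈ = Vec.lookup⇒[]= y S (trans (Vec.lookup∘tabulate _ y) (T⇒≡ (does⁺ (member? y) y∈)))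
        where
        T⇒≡ : ∀ {b} → T b → b ≡ true
        T⇒≡ {true} _ = refl
      S⁻ : ∀ {y} → y Sub.∈ S → y ∈ ys
      S⁻ {y} y∈ = does⁻ (member? y) (subst T (trans (sym (Vec.[]=⇒lookup y∈)) (Vec.lookup∘tabulate _ y)) tt)
      ∈-elements : ∀ {n} (S : Subset n) {y} → y Sub.∈ S → y ∈ elements S
      ∈-elements (true ∷ S) Vec.here = here refl
      ∈-elements (true ∷ S) (Vec.there h) = there (∈-map⁺ suc (∈-elements S h))
      ∈-elements (false ∷ S) (Vec.there h) = ∈-map⁺ suc (∈-elements S h)
      unique : Unique ys
      unique = Unique.map⁺ (pos-injective P) (AllPairs⇒Unique (λ (n , _) → n refl) ps)
      antichain : IsAntichain P S
      antichain x y x∈ y∈ l with ∈-map⁻ (pos P) (S⁻ x∈) | ∈-map⁻ (pos P) (S⁻ y∈)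
      ... | i , i∈ , refl | j , j∈ , refl with AllPairs-lookup ps i∈ j∈
      ...   | inj₁ refl = refl
      ...   | inj₂ (inj₁ (n , a , _)) = ⊥-elim (a (⊑⇒less n l))
      ...   | inj₂ (inj₂ (n , _ , b)) = ⊥-elim (b (⊑⇒less (n ∘ sym) l))

-- A proposed class that would not be a chain is replaced by a new one; this never happens when the width is respected.
module Partition {w k : ℕ} (alg : Algorithm w k) where
  open Algorithm alg renaming (col to assign)

  Fits : ∀ {n} → FinPoset (suc n) → Vec ℕ n → ℕ → Set
  Fits P cs c = ∀ j → Vec.lookup cs j ≡ c → T (FinPoset.leq P zero (suc j)) ⊎ T (FinPoset.leq P (suc j) zero)

  fits? : ∀ {n} (P : FinPoset (suc n)) cs c → Dec (Fits P cs c)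
  fits? P cs c = Fin.all? λ j → (Vec.lookup cs j ℕ.≟ c) →-dec (T? _ ⊎-dec T? _)

  proposed : ∀ {n} → FinPoset (suc n) → ℕ
  proposed P = assign (newest-row P) (presentation (earlier P))

  choose : ∀ {n} (P : FinPoset (suc n)) cs → Dec (Fits P cs (proposed P)) → ℕ
  choose P cs (yes _) = proposed P
  choose P cs (no _) = mex (Vec.toList cs)

  rule : OnlineRule
  rule P cs = choose P cs (fits? P cs (proposed P))

  lookup-∈ : ∀ {n} (cs : Vec ℕ n) j → Vec.lookup cs j ∈ Vec.toList cs
  lookup-∈ (_ ∷ cs) zero = here refl
  lookup-∈ (_ ∷ cs) (suc j) = there (lookup-∈ cs j)

  choose-fits : ∀ {n} (P : FinPoset (suc n)) cs (d : Dec (Fits P cs (proposed P))) → Fits P cs (choose P cs d)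
  choose-fits P cs (yes f) = f
  choose-fits P cs (no _) j e = ⊥-elim (mex-∉ (Vec.toList cs) (subst (_∈ Vec.toList cs) e (lookup-∈ cs j)))

  run-chains : ∀ {n} (P : FinPoset n) (a : ℕ) → IsChain P (λ x → Vec.lookup (run rule P) x ≡ a)
  run-chains {suc n} P a zero zero _ _ = inj₁ (IsPartialOrder.reflexive (FinPoset.isPartialOrder P) refl)
  run-chains {suc n} P a zero (suc y) e e′ = choose-fits P (run rule (earlier P)) (fits? P (run rule (earlier P)) (proposed P)) y (trans e′ (sym e))
  run-chains {suc n} P a (suc x) zero e e′ = [ inj₂ , inj₁ ]′ (choose-fits P (run rule (earlier P)) (fits? P (run rule (earlier P)) (proposed P)) x (trans e (sym e′)))
  run-chains {suc n} P a (suc x) (suc y) e e′ = run-chains (earlier P) a x y e e′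

  partitioning : OnlineChainPartitioning
  partitioning = record { rule = rule ; chains = run-chains }

  run-colours : ∀ {n} (P : FinPoset n) → Valid w (presentation P) → ∀ i → Vec.lookup (run rule P) (pos P i) ≡ colours assign (presentation P) i
  run-colours {suc n} P v (suc i) = run-colours (earlier P) (valid-tail v) i
  run-colours {suc n} P v zero = accepted (fits? P (run rule (earlier P)) (proposed P))
    where
    fits : Fits P (run rule (earlier P)) (proposed P)
    fits j e = case proper (presentation P) (proj₁ v) (proj₂ v) zero (suc (elt (earlier P) j)) (sym (trans (sym (run-colours (earlier P) (valid-tail v) (elt (earlier P) j)))
        (trans (cong (Vec.lookup (run rule (earlier P))) (pos-elt (earlier P) j)) e))) of λ
      { (inj₂ (inj₁ l)) → inj₁ (subst (λ j → T (FinPoset.leq P zero (suc j))) (pos-elt (earlier P) j) (proj₂ (less⇒⊑ P {zero} {suc (elt (earlier P) j)} l)))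
      ; (inj₂ (inj₂ l)) → inj₂ (subst (λ j → T (FinPoset.leq P (suc j) zero)) (pos-elt (earlier P) j) (proj₂ (less⇒⊑ P {suc (elt (earlier P) j)} {zero} l))) }
    accepted : (d : Dec (Fits P (run rule (earlier P)) (proposed P))) → choose P (run rule (earlier P)) d ≡ proposed P
    accepted (yes _) = refl
    accepted (no n) = ⊥-elim (n fits)

  toList-∈ : ∀ {n} (cs : Vec ℕ n) {c} → c ∈ Vec.toList cs → ∃[ i ] Vec.lookup cs i ≡ c
  toList-∈ (_ ∷ cs) (here refl) = zero , refl
  toList-∈ (_ ∷ cs) (there h) = let (i , e) = toList-∈ cs h in suc i , e

  partitions : PartitionsInto w k partitioning
  partitions P hw = subst (length classes ≤_) (length-tabulate toℕ) (inj-length id (tabulate {n = k} toℕ) (deduplicate-! (Vec.toList (run rule P))) (λ _ _ → id) small)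
    where
    valid = presentation-valid P hw
    classes : List ℕ
    classes = deduplicate ℕ._≟_ (Vec.toList (run rule P))
    small : ∀ {c} → c ∈ classes → c ∈ tabulate {n = k} toℕ
    small h with i , refl ← toList-∈ (run rule P) (∈-deduplicate⁻ ℕ._≟_ (Vec.toList (run rule P)) h) =
      subst (_∈ tabulate {n = k} toℕ) (Fin.toℕ-fromℕ< bound) (∈-tabulate⁺ (fromℕ< bound))
      where
      bound : Vec.lookup (run rule P) i < k
      bound = subst (_< k) (trans (sym (run-colours P valid (elt P i))) (cong (Vec.lookup (run rule P)) (pos-elt P i)))
        (bounded (presentation P) (proj₁ valid) (proj₂ valid) (elt P i))

¬¬-least : {Q : ℕ → Set} → ∀ n → Q n → ¬ ¬ (∃[ k ] ((Q k × (∀ j → Q j → k ≤ j)) × k ≤ n))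
¬¬-least {Q} n q = descend (suc n) n ℕ.≤-refl q
  where
  descend : ∀ b n → n < b → Q n → ¬ ¬ (∃[ k ] ((Q k × (∀ j → Q j → k ≤ j)) × k ≤ n))
  descend (suc b) n (s≤s n≤b) q none = none (n , (q , λ j qj → ℕ.≮⇒≥ λ j<n →
    descend b j (ℕ.<-≤-trans j<n n≤b) qj λ (k , m , l) → none (k , m , ℕ.≤-trans l (ℕ.<⇒≤ j<n))) , ℕ.≤-refl)

theorem4 : ∃[ C ] ∃[ w₀ ] ∀ (w : ℕ) → w ≥ w₀ →
    (∃[ A ] PartitionsInto w (w ^ (C * ⌊log₂ ⌊log₂ w ⌋ ⌋)) A)
    × ¬ ¬ (∃[ k ] (IsVal w k × k ≤ w ^ (C * ⌊log₂ ⌊log₂ w ⌋ ⌋)))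
theorem4 = 4 * exponent , 4 , λ w 4≤w → solution w 4≤w , ¬¬-least (bound w) (solution w 4≤w)
  where
  bound : ℕ → ℕ
  bound w = w ^ (4 * exponent * ⌊log₂ ⌊log₂ w ⌋ ⌋)
  solution : ∀ w → w ≥ 4 → ∃[ A ] PartitionsInto w (bound w) A
  solution w h = Partition.partitioning (subquasipolynomial w h) , Partition.partitions (subquasipolynomial w h)
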